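{- There exists an absolute constant $\tau>2$ with the following property. Let $U\subseteq\mathbb{R}$ be an open interval and let $f:U\to\mathbb{R}$ be real-analytic. Suppose that $f$ is not the restriction to $U$ of a rational function in $\mathbb{R}(x)$ without poles on $U$. Then every nonempty open subinterval $V\subseteq U$ contains a Liouville number $\xi$ such that $$\mu(f(\xi))\le\tau.$$ In fact, $\xi\in V\cap\mathscr{L}$ may be chosen so that $$\left|f(\xi)-\frac ab\right|>b^{ -\tau}$$ for every $a\in\mathbb{Z}$ and every sufficiently large integer $b$. One may take $\tau=100$.
   Context: A real number $\xi$ is a Liouville number if for every integer $N\ge 1$ there exist infinitely many pairs $(p,q)\in\mathbb{Z}\times\mathbb{Z}_{>0}$ with $q\ge 2$ such that $0<|\xi-p/q|<q^{ -N}$. The set of Liouville numbers is denoted $\mathscr{L}$. The irrationality exponent of $y\in\mathbb{R}$ is $$\mu(y):=\sup\{\lambda>0:\ 0<|y-a/b|<b^{ -\lambda}\text{ for infinitely many }(a,b)\in\mathbb{Z}\times\mathbb{Z}_{>0}\}.$$ -}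

module Defs where

open import Level using (0ℓ)
open import Algebra.Bundles.Raw using (RawSemiring)
import Algebra.Definitions.RawSemiring as RawSemiringDefinitions
open import Data.Fin.Base using (toℕ)
open import Data.Integer.Base as ℤ using (ℤ; +_; -[1+_])
open import Data.List.Membership.Propositional using () renaming (_∉_ to _∉ᴸ_)
open import Data.Nat.Base as ℕ using (ℕ; suc)
import Data.Nat.Properties as ℕₚ
open import Data.Product.Base using (∃; ∃-syntax; Σ-syntax; _×_; _,_; proj₁; proj₂)
open import Data.Rational.Base as ℚ using (ℚ; 0ℚ; 1ℚ; ½; ↥_; ↧ₙ_)
import Data.Rational.Properties as ℚₚ
open import Data.Rational.Solver using (module +-*-Solver)
open import Data.Sum.Base using (inj₁; inj₂)
open import Data.Vec.Functional using (Vector)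
open import Function.Bundles using (Func)
open import Relation.Binary.Bundles using (Setoid)
import Relation.Binary.Construct.Add.Extrema.NonStrict as NonStrict±
import Relation.Binary.Construct.Add.Extrema.Strict as Strict±
import Relation.Binary.Construct.On as On
open import Relation.Binary.PropositionalEquality
  using (_≡_; refl; sym; trans; cong; cong₂; subst)
open import Relation.Nullary.Construct.Add.Extrema using (_±; [_])
open import Relation.Nullary.Negation.Core using (¬_)
open import Relation.Unary using (Pred; _⊆_; Satisfiable)

-- A real is a Cauchy sequence of rationals; two reals are identified by _≈_
-- (the difference tends to 0), never by propositional equality.

Cauchy : (ℕ → ℚ) → Set
Cauchy u = ∀ ε → 0ℚ ℚ.< ε →
  ∃[ N ] ∀ m n → N ℕ.≤ m → N ℕ.≤ n → ℚ.∣ u m ℚ.- u n ∣ ℚ.< ε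

record ℝ : Set where
  constructor mkℝ
  field
    approx : ℕ → ℚ
    cauchy : Cauchy approx

open ℝ public

infix 4 _≈_ _<_ _≤_

record _≈_ (x y : ℝ) : Set where
  constructor mk≈
  field
    eventually-close : ∀ ε → 0ℚ ℚ.< ε →
      ∃[ N ] ∀ n → N ℕ.≤ n → ℚ.∣ approx x n ℚ.- approx y n ∣ ℚ.< ε

record _<_ (x y : ℝ) : Set where
  constructor mk<
  field
    gap          : ℚ
    gap-positive : 0ℚ ℚ.< gap
    eventually   : ∃[ N ] ∀ n → N ℕ.≤ n → approx x n ℚ.+ gap ℚ.< approx y n

record _≤_ (x y : ℝ) : Set where
  constructor mk≤
  field
    eventually-below : ∀ ε → 0ℚ ℚ.< ε →
      ∃[ N ] ∀ n → N ℕ.≤ n → approx x n ℚ.< approx y n ℚ.+ ε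

private
  open +-*-Solver

  ⊔ˡ : ∀ m n {o} → m ℕ.⊔ n ℕ.≤ o → m ℕ.≤ o
  ⊔ˡ m n = ℕₚ.m⊔n≤o⇒m≤o m n

  ⊔ʳ : ∀ m n {o} → m ℕ.⊔ n ℕ.≤ o → n ℕ.≤ o
  ⊔ʳ m n = ℕₚ.m⊔n≤o⇒n≤o m n

  halve : ∀ {ε} → 0ℚ ℚ.< ε → ∃[ δ ] 0ℚ ℚ.< δ × δ ℚ.+ δ ≡ ε
  halve {ε} 0<ε =
      ½ ℚ.* ε
    , ℚₚ.*-monoʳ-<-pos ½ 0<ε
    , trans (sym (ℚₚ.*-distribʳ-+ ε ½ ½)) (ℚₚ.*-identityˡ ε)

  divide : ∀ {K ε} → 0ℚ ℚ.< K → 0ℚ ℚ.< ε → ∃[ δ ] 0ℚ ℚ.< δ × K ℚ.* δ ≡ ε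
  divide {K} {ε} 0<K 0<ε =
      ℚ.1/ K ℚ.* ε
    , subst (ℚ._< ℚ.1/ K ℚ.* ε) (ℚₚ.*-zeroʳ (ℚ.1/ K))
        (ℚₚ.*-monoʳ-<-pos (ℚ.1/ K) {{ℚₚ.1/pos⇒pos K}} 0<ε)
    , trans (sym (ℚₚ.*-assoc K (ℚ.1/ K) ε))
        (trans (cong (ℚ._* ε) (ℚₚ.*-inverseʳ K)) (ℚₚ.*-identityˡ ε))
    where
    instance
      K-pos : ℚ.Positive K
      K-pos = ℚ.positive 0<K
      K-nonZero : ℚ.NonZero K
      K-nonZero = ℚₚ.pos⇒nonZero K

  dist-refl : ∀ p {ε} → 0ℚ ℚ.< ε → ℚ.∣ p ℚ.- p ∣ ℚ.< ε
  dist-refl p {ε} 0<ε =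
    subst (ℚ._< ε) (sym (cong ℚ.∣_∣ (ℚₚ.+-inverseʳ p))) 0<ε

  dist-sym : ∀ p q → ℚ.∣ p ℚ.- q ∣ ≡ ℚ.∣ q ℚ.- p ∣
  dist-sym p q = trans (sym (ℚₚ.∣-p∣≡∣p∣ (p ℚ.- q)))
    (cong ℚ.∣_∣ (solve 2 (λ p q → :- (p :- q) := q :- p) refl p q))

  dist-triangle : ∀ p q r → ℚ.∣ p ℚ.- r ∣ ℚ.≤ ℚ.∣ p ℚ.- q ∣ ℚ.+ ℚ.∣ q ℚ.- r ∣
  dist-triangle p q r = subst (ℚ._≤ ℚ.∣ p ℚ.- q ∣ ℚ.+ ℚ.∣ q ℚ.- r ∣)
    (cong ℚ.∣_∣ (solve 3 (λ p q r → (p :- q) :+ (q :- r) := p :- r) refl p q r))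
    (ℚₚ.∣p+q∣≤∣p∣+∣q∣ (p ℚ.- q) (q ℚ.- r))

  dist-+ : ∀ a b c d →
    ℚ.∣ (a ℚ.+ b) ℚ.- (c ℚ.+ d) ∣ ℚ.≤ ℚ.∣ a ℚ.- c ∣ ℚ.+ ℚ.∣ b ℚ.- d ∣
  dist-+ a b c d = subst (ℚ._≤ ℚ.∣ a ℚ.- c ∣ ℚ.+ ℚ.∣ b ℚ.- d ∣)
    (cong ℚ.∣_∣ (solve 4
      (λ a b c d → (a :- c) :+ (b :- d) := (a :+ b) :- (c :+ d)) refl a b c d))
    (ℚₚ.∣p+q∣≤∣p∣+∣q∣ (a ℚ.- c) (b ℚ.- d))

  dist-neg : ∀ a c → ℚ.∣ ℚ.- a ℚ.- ℚ.- c ∣ ≡ ℚ.∣ a ℚ.- c ∣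
  dist-neg a c = trans
    (cong ℚ.∣_∣ (solve 2 (λ a c → :- a :- :- c := :- (a :- c)) refl a c))
    (ℚₚ.∣-p∣≡∣p∣ (a ℚ.- c))

  dist-* : ∀ a b c d → ℚ.∣ a ℚ.* b ℚ.- c ℚ.* d ∣
    ℚ.≤ ℚ.∣ a ∣ ℚ.* ℚ.∣ b ℚ.- d ∣ ℚ.+ ℚ.∣ d ∣ ℚ.* ℚ.∣ a ℚ.- c ∣
  dist-* a b c d = subst
    (ℚ.∣ a ℚ.* b ℚ.- c ℚ.* d ∣ ℚ.≤_)
    (cong₂ ℚ._+_ (ℚₚ.∣p*q∣≡∣p∣*∣q∣ a (b ℚ.- d)) (ℚₚ.∣p*q∣≡∣p∣*∣q∣ d (a ℚ.- c)))
    (subst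
      (ℚ._≤ ℚ.∣ a ℚ.* (b ℚ.- d) ∣ ℚ.+ ℚ.∣ d ℚ.* (a ℚ.- c) ∣)
      (cong ℚ.∣_∣ (solve 4
        (λ a b c d → a :* (b :- d) :+ d :* (a :- c) := a :* b :- c :* d)
        refl a b c d))
      (ℚₚ.∣p+q∣≤∣p∣+∣q∣ (a ℚ.* (b ℚ.- d)) (d ℚ.* (a ℚ.- c))))

  ∣∣-≤-dist : ∀ a c → ℚ.∣ a ∣ ℚ.≤ ℚ.∣ a ℚ.- c ∣ ℚ.+ ℚ.∣ c ∣
  ∣∣-≤-dist a c = subst (ℚ._≤ ℚ.∣ a ℚ.- c ∣ ℚ.+ ℚ.∣ c ∣)
    (cong ℚ.∣_∣ (solve 2 (λ a c → (a :- c) :+ c := a) refl a c))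
    (ℚₚ.∣p+q∣≤∣p∣+∣q∣ (a ℚ.- c) c)

  ∣∣-sub-≤ : ∀ a c → ℚ.∣ a ∣ ℚ.- ℚ.∣ c ∣ ℚ.≤ ℚ.∣ a ℚ.- c ∣
  ∣∣-sub-≤ a c = subst (ℚ.∣ a ∣ ℚ.- ℚ.∣ c ∣ ℚ.≤_)
    (solve 2 (λ s t → (s :+ t) :- t := s) refl ℚ.∣ a ℚ.- c ∣ ℚ.∣ c ∣)
    (ℚₚ.+-monoˡ-≤ (ℚ.- ℚ.∣ c ∣) (∣∣-≤-dist a c))

  dist-∣∣ : ∀ a c → ℚ.∣ ℚ.∣ a ∣ ℚ.- ℚ.∣ c ∣ ∣ ℚ.≤ ℚ.∣ a ℚ.- c ∣
  dist-∣∣ a c with ℚₚ.∣p∣≡p∨∣p∣≡-p (ℚ.∣ a ∣ ℚ.- ℚ.∣ c ∣)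
  ... | inj₁ eq = subst (ℚ._≤ ℚ.∣ a ℚ.- c ∣) (sym eq) (∣∣-sub-≤ a c)
  ... | inj₂ eq = subst (ℚ._≤ ℚ.∣ a ℚ.- c ∣)
    (sym (trans eq
      (solve 2 (λ s t → :- (s :- t) := t :- s) refl ℚ.∣ a ∣ ℚ.∣ c ∣)))
    (subst (ℚ.∣ c ∣ ℚ.- ℚ.∣ a ∣ ℚ.≤_) (dist-sym c a) (∣∣-sub-≤ c a))

  bounded : ∀ {u} → Cauchy u →
    ∃[ K ] 0ℚ ℚ.< K × ∃[ N ] ∀ n → N ℕ.≤ n → ℚ.∣ u n ∣ ℚ.≤ K
  bounded {u} c with c 1ℚ (ℚ.*<* (ℤ.+<+ (ℕ.s≤s ℕ.z≤n)))
  ... | N , close =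
      1ℚ ℚ.+ ℚ.∣ u N ∣
    , ℚₚ.<-≤-trans (ℚ.*<* (ℤ.+<+ (ℕ.s≤s ℕ.z≤n)))
        (subst (ℚ._≤ 1ℚ ℚ.+ ℚ.∣ u N ∣) (ℚₚ.+-identityʳ 1ℚ)
          (ℚₚ.+-monoʳ-≤ 1ℚ (ℚₚ.0≤∣p∣ (u N))))
    , N
    , λ n N≤n → ℚₚ.≤-trans (∣∣-≤-dist (u n) (u N))
        (ℚₚ.+-monoˡ-≤ ℚ.∣ u N ∣ (ℚₚ.<⇒≤ (close n N N≤n ℕₚ.≤-refl)))

  *-bound : ∀ {k K e δ} → 0ℚ ℚ.< K → k ℚ.≤ K → 0ℚ ℚ.≤ e → e ℚ.< δ →
    k ℚ.* e ℚ.< K ℚ.* δ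
  *-bound {k} {K} {e} {δ} 0<K k≤K 0≤e e<δ = ℚₚ.≤-<-trans
    (ℚₚ.*-monoʳ-≤-nonNeg e {{ℚ.nonNegative 0≤e}} k≤K)
    (ℚₚ.*-monoʳ-<-pos K {{ℚ.positive 0<K}} e<δ)

  +-close : ∀ {a b c d δ ε} → δ ℚ.+ δ ≡ ε →
    ℚ.∣ a ℚ.- c ∣ ℚ.< δ → ℚ.∣ b ℚ.- d ∣ ℚ.< δ →
    ℚ.∣ (a ℚ.+ b) ℚ.- (c ℚ.+ d) ∣ ℚ.< ε
  +-close {a} {b} {c} {d} δ+δ≡ε a-c<δ b-d<δ = ℚₚ.≤-<-trans (dist-+ a b c d)
    (subst (_ ℚ.<_) δ+δ≡ε (ℚₚ.+-mono-< a-c<δ b-d<δ))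

  *-close : ∀ {a b c d K L γ δ η ε} →
    0ℚ ℚ.< K → 0ℚ ℚ.< L → K ℚ.* δ ≡ η → L ℚ.* γ ≡ η → η ℚ.+ η ≡ ε →
    ℚ.∣ a ∣ ℚ.≤ K → ℚ.∣ d ∣ ℚ.≤ L → ℚ.∣ a ℚ.- c ∣ ℚ.< γ → ℚ.∣ b ℚ.- d ∣ ℚ.< δ →
    ℚ.∣ a ℚ.* b ℚ.- c ℚ.* d ∣ ℚ.< ε
  *-close {a} {b} {c} {d} 0<K 0<L Kδ≡η Lγ≡η η+η≡ε a≤K d≤L a-c<γ b-d<δ =
    ℚₚ.≤-<-trans (dist-* a b c d)
      (subst (_ ℚ.<_) (trans (cong₂ ℚ._+_ Kδ≡η Lγ≡η) η+η≡ε) (ℚₚ.+-mono-<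
        (*-bound 0<K a≤K (ℚₚ.0≤∣p∣ (b ℚ.- d)) b-d<δ)
        (*-bound 0<L d≤L (ℚₚ.0≤∣p∣ (a ℚ.- c)) a-c<γ)))

  module _ {u v : ℕ → ℚ} {K L : ℚ} (0<K : 0ℚ ℚ.< K) (0<L : 0ℚ ℚ.< L) where

    *-cauchy-at : ∀ {γ δ η ε} A B M N →
      K ℚ.* δ ≡ η → L ℚ.* γ ≡ η → η ℚ.+ η ≡ ε →
      (∀ n → A ℕ.≤ n → ℚ.∣ u n ∣ ℚ.≤ K) → (∀ n → B ℕ.≤ n → ℚ.∣ v n ∣ ℚ.≤ L) →
      (∀ m n → M ℕ.≤ m → M ℕ.≤ n → ℚ.∣ u m ℚ.- u n ∣ ℚ.< γ) →
      (∀ m n → N ℕ.≤ m → N ℕ.≤ n → ℚ.∣ v m ℚ.- v n ∣ ℚ.< δ) →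
      ∀ m n → (A ℕ.⊔ B) ℕ.⊔ (M ℕ.⊔ N) ℕ.≤ m → (A ℕ.⊔ B) ℕ.⊔ (M ℕ.⊔ N) ℕ.≤ n →
      ℚ.∣ u m ℚ.* v m ℚ.- u n ℚ.* v n ∣ ℚ.< ε
    *-cauchy-at {γ} {δ} {η} {ε} A B M N Kδ≡η Lγ≡η η+η≡ε u≤K v≤L h k m n p q =
      *-close {u m} {v m} {u n} {v n} {K} {L} {γ} {δ} {η} {ε}
        0<K 0<L Kδ≡η Lγ≡η η+η≡ε
        (u≤K m (⊔ˡ A B (⊔ˡ (A ℕ.⊔ B) (M ℕ.⊔ N) p)))
        (v≤L n (⊔ʳ A B (⊔ˡ (A ℕ.⊔ B) (M ℕ.⊔ N) q)))
        (h m n (⊔ˡ M N (⊔ʳ (A ℕ.⊔ B) (M ℕ.⊔ N) p))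
               (⊔ˡ M N (⊔ʳ (A ℕ.⊔ B) (M ℕ.⊔ N) q)))
        (k m n (⊔ʳ M N (⊔ʳ (A ℕ.⊔ B) (M ℕ.⊔ N) p))
               (⊔ʳ M N (⊔ʳ (A ℕ.⊔ B) (M ℕ.⊔ N) q)))

  abstract
    neg-cauchy : ∀ {u} → Cauchy u → Cauchy (λ n → ℚ.- u n)
    neg-cauchy {u} cu ε 0<ε =
      let N , h = cu ε 0<ε in
      N , λ m n p q → subst (ℚ._< ε) (sym (dist-neg (u m) (u n))) (h m n p q)

    ∣∣-cauchy : ∀ {u} → Cauchy u → Cauchy (λ n → ℚ.∣ u n ∣)
    ∣∣-cauchy {u} cu ε 0<ε =
      let N , h = cu ε 0<ε in
      N , λ m n p q → ℚₚ.≤-<-trans (dist-∣∣ (u m) (u n)) (h m n p q)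

    +-cauchy : ∀ {u v} → Cauchy u → Cauchy v → Cauchy (λ n → u n ℚ.+ v n)
    +-cauchy {u} {v} cu cv ε 0<ε = step (halve 0<ε)
      where
      step : (∃[ δ ] 0ℚ ℚ.< δ × δ ℚ.+ δ ≡ ε) →
        ∃[ N ] ∀ m n → N ℕ.≤ m → N ℕ.≤ n →
          ℚ.∣ (u m ℚ.+ v m) ℚ.- (u n ℚ.+ v n) ∣ ℚ.< ε
      step (δ , 0<δ , δ+δ≡ε) =
        let M , h = cu δ 0<δ
            N , k = cv δ 0<δ
        in
        M ℕ.⊔ N , λ m n p q → +-close {u m} {v m} {u n} {v n} {δ} {ε} δ+δ≡ε
          (h m n (⊔ˡ M N p) (⊔ˡ M N q)) (k m n (⊔ʳ M N p) (⊔ʳ M N q))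

    *-cauchy : ∀ {u v} → Cauchy u → Cauchy v → Cauchy (λ n → u n ℚ.* v n)
    *-cauchy {u} {v} cu cv ε 0<ε = step (bounded cu) (bounded cv) (halve 0<ε)
      where
      step :
        (∃[ K ] 0ℚ ℚ.< K × ∃[ A ] ∀ n → A ℕ.≤ n → ℚ.∣ u n ∣ ℚ.≤ K) →
        (∃[ L ] 0ℚ ℚ.< L × ∃[ B ] ∀ n → B ℕ.≤ n → ℚ.∣ v n ∣ ℚ.≤ L) →
        (∃[ η ] 0ℚ ℚ.< η × η ℚ.+ η ≡ ε) →
        ∃[ N ] ∀ m n → N ℕ.≤ m → N ℕ.≤ n →
          ℚ.∣ u m ℚ.* v m ℚ.- u n ℚ.* v n ∣ ℚ.< ε
      step (K , 0<K , A , u≤K) (L , 0<L , B , v≤L) (η , 0<η , η+η≡ε) =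
        step′ (divide 0<K 0<η) (divide 0<L 0<η)
        where
        step′ :
          (∃[ δ ] 0ℚ ℚ.< δ × K ℚ.* δ ≡ η) →
          (∃[ γ ] 0ℚ ℚ.< γ × L ℚ.* γ ≡ η) →
          ∃[ N ] ∀ m n → N ℕ.≤ m → N ℕ.≤ n →
            ℚ.∣ u m ℚ.* v m ℚ.- u n ℚ.* v n ∣ ℚ.< ε
        step′ (δ , 0<δ , Kδ≡η) (γ , 0<γ , Lγ≡η) =
          let M , h = cu γ 0<γ
              N , k = cv δ 0<δ
          in _ , *-cauchy-at {u} {v} 0<K 0<L A B M N Kδ≡η Lγ≡η η+η≡ε u≤K v≤L h k

≈-setoid : Setoid 0ℓ 0ℓ
≈-setoid = record
  { Carrier       = ℝ
  ; _≈_           = _≈_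
  ; isEquivalence = record
    { refl  = λ {x} → mk≈ λ ε 0<ε → 0 , λ n _ → dist-refl (approx x n) 0<ε
    ; sym   = λ {x} {y} (mk≈ x≈y) → mk≈ λ ε 0<ε →
        let N , h = x≈y ε 0<ε in
        N , λ n N≤n → subst (ℚ._< ε) (dist-sym (approx x n) (approx y n)) (h n N≤n)
    ; trans = λ {x} {y} {z} (mk≈ x≈y) (mk≈ y≈z) → mk≈ λ ε 0<ε →
        let δ , 0<δ , δ+δ≡ε = halve 0<ε
            M , h = x≈y δ 0<δ
            N , k = y≈z δ 0<δ
        in
        M ℕ.⊔ N , λ n le → ℚₚ.≤-<-trans
          (dist-triangle (approx x n) (approx y n) (approx z n))
          (subst (_ ℚ.<_) δ+δ≡ε (ℚₚ.+-mono-<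
            (h n (⊔ˡ M N le)) (k n (⊔ʳ M N le))))
    }
  }

ι : ℚ → ℝ
ι q = mkℝ (λ _ → q) (λ ε 0<ε → 0 , λ _ _ _ _ → dist-refl q 0<ε)

0ℝ 1ℝ : ℝ
0ℝ = ι 0ℚ
1ℝ = ι 1ℚ

infix  8 -_
infixl 7 _*_
infixl 6 _+_ _-_

_+_ : ℝ → ℝ → ℝ
mkℝ u cu + mkℝ v cv = mkℝ (λ n → u n ℚ.+ v n) (+-cauchy {u} {v} cu cv)

-_ : ℝ → ℝ
- mkℝ u cu = mkℝ (λ n → ℚ.- u n) (neg-cauchy {u} cu)

_-_ : ℝ → ℝ → ℝ
x - y = x + - y

_*_ : ℝ → ℝ → ℝ
mkℝ u cu * mkℝ v cv = mkℝ (λ n → u n ℚ.* v n) (*-cauchy {u} {v} cu cv)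

∣_∣ : ℝ → ℝ
∣ mkℝ u cu ∣ = mkℝ (λ n → ℚ.∣ u n ∣) (∣∣-cauchy {u} cu)

ℝ-rawSemiring : RawSemiring 0ℓ 0ℓ
ℝ-rawSemiring = record
  { Carrier = ℝ ; _≈_ = _≈_ ; _+_ = _+_ ; _*_ = _*_ ; 0# = 0ℝ ; 1# = 1ℝ }

open RawSemiringDefinitions ℝ-rawSemiring public using (_^_; sum)

open Strict± _<_ public using (_<±_)
open NonStrict± _≤_ public using (_≤±_)

IsSup : Pred ℝ 0ℓ → ℝ ± → Set
IsSup P s =
  (∀ x → P x → [ x ] ≤± s) × (∀ u → (∀ x → P x → [ x ] ≤± u) → s ≤± u)

infixr 8 _^ᶻ_

_^ᶻ_ : (b : ℕ) .{{_ : ℕ.NonZero b}} → ℤ → ℚ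
b ^ᶻ (+ n)    = + (b ℕ.^ n) ℚ./ 1
b ^ᶻ -[1+ n ] = (+ 1 ℚ./ (b ℕ.^ suc n)) {{ℕₚ.m^n≢0 b (suc n)}}

-- z = b ^ t with t rational: the positive root of z ^ den t = b ^ num t.
IsRationalPower : (b : ℕ) .{{_ : ℕ.NonZero b}} → ℚ → ℝ → Set
IsRationalPower b t z = 0ℝ < z × z ^ (↧ₙ t) ≈ ι (b ^ᶻ (↥ t))

-- y = b ^ l with l real: the supremum of b ^ t over the rationals t ≤ l, which is
-- correct because the base satisfies b ≥ 1.
IsPower : (b : ℕ) .{{_ : ℕ.NonZero b}} → ℝ → ℝ → Set
IsPower b l y = IsSup (λ z → ∃[ t ] ι t ≤ l × IsRationalPower b t z) [ y ]

-- No finite list exhausts P.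
Infinitely : {A : Set} → Pred A 0ℓ → Set
Infinitely P = ∀ xs → ∃[ x ] x ∉ᴸ xs × P x

Liouville : Pred ℝ 0ℓ
Liouville ξ = ∀ N → 1 ℕ.≤ N → Infinitely {ℤ × ℕ} λ { (p , q) →
  Σ[ nz ∈ ℕ.NonZero q ] let instance _ = nz; d = ∣ ξ - ι (p ℚ./ q) ∣ in
    2 ℕ.≤ q × 0ℝ < d × d < ι (q ^ᶻ (ℤ.- + N)) }

-- The supremum is taken in the extended reals, so the exponent may be ⊤±.
IsIrrationalityExponent : ℝ → ℝ ± → Set
IsIrrationalityExponent y = IsSup λ l → 0ℝ < l × Infinitely {ℤ × ℕ} λ { (a , b) →
  Σ[ nz ∈ ℕ.NonZero b ] let instance _ = nz; d = ∣ y - ι (a ℚ./ b) ∣ in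
    0ℝ < d × ∃[ c ] IsPower b (- l) c × d < c }

EventuallyFarFromRationals : ℝ → ℝ → Set
EventuallyFarFromRationals τ y =
  ∃[ B ] ∀ (a : ℤ) (b : ℕ) .{{_ : ℕ.NonZero b}} → B ℕ.≤ b →
    ∃[ c ] IsPower b (- τ) c × c < ∣ y - ι (a ℚ./ b) ∣

-- Endpoints in the extended reals, so that rays and ℝ itself are included.
record OpenInterval : Set where
  constructor ⟨_,_⟩
  field
    lower upper : ℝ ±

Points : OpenInterval → Pred ℝ 0ℓ
Points ⟨ a , b ⟩ x = a <± [ x ] × [ x ] <± b

domain : OpenInterval → Setoid 0ℓ 0ℓ
domain U = On.setoid {B = ∃ (Points U)} ≈-setoid proj₁

RealFunction : OpenInterval → Set
RealFunction U = Func (domain U) ≈-setoid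

eval : ∀ {n} → Vector ℝ n → ℝ → ℝ
eval p x = sum λ i → p i * x ^ toℕ i

_converges-to_ : (ℕ → ℝ) → ℝ → Set
s converges-to y = ∀ ε → 0ℝ < ε → ∃[ N ] ∀ n → N ℕ.≤ n → ∣ s n - y ∣ < ε

module _ (U : OpenInterval) (f : RealFunction U) where
  open Func f

  RealAnalytic : Set
  RealAnalytic = ∀ c → Points U c →
    Σ[ a ∈ (ℕ → ℝ) ] Σ[ r ∈ ℝ ] 0ℝ < r ×
    (∀ x (x∈U : Points U x) → ∣ x - c ∣ < r →
      (λ n → eval {n} (λ i → a (toℕ i)) (x - c)) converges-to to (x , x∈U))

  -- f = P / Q on U, with Q nowhere zero on U.
  RationalWithoutPoles : Set
  RationalWithoutPoles =
    ∃[ m ] ∃[ n ] Σ[ P ∈ Vector ℝ m ] Σ[ Q ∈ Vector ℝ n ]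
      (∀ x (x∈U : Points U x) →
        ¬ (eval Q x ≈ 0ℝ) × to (x , x∈U) * eval Q x ≈ eval P x)

ApproximationProperty : ℝ → Set
ApproximationProperty τ =
  (U : OpenInterval) (f : RealFunction U) →
  RealAnalytic U f → ¬ RationalWithoutPoles U f →
  (V : OpenInterval) → Satisfiable (Points V) → (V⊆U : Points V ⊆ Points U) →
  Σ[ ξ ∈ ℝ ] Σ[ ξ∈V ∈ Points V ξ ] let y = Func.to f (ξ , V⊆U {ξ} ξ∈V) in
    Liouville ξ ×
    (∃[ m ] IsIrrationalityExponent y m × m ≤± [ τ ]) ×
    EventuallyFarFromRationals τ y

{-# OPTIONS --safe #-}

-- The number ξ is the limit of an increasing sequence of centres c. At each of them f c = (√2 + e)/T with
-- integers e and T, so that f c is badly approximable, and |b f(c) - a| b⁹⁸ ≥ 1 + μ for all integers a and b ≥ b₀;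
-- the margin μ is halved from one centre to the next. The next centre c + s is found as follows, with
-- F s = f (c + s), h = 1/t for a large t, and r = t^J.
--   If b² is at most of the order of t^(p+1), where p + 1 is the order of F - F 0 at 0, then the bound at c survives,
-- because F varies by O(h^(p+1)) on [0, 2h].
--   The other b ≤ r are controlled by a point s* in [h/2, h] with F s* = (√2 + e)/T₁ and T₁ of the order of t^(p+1).
--   Suppose r^(κ+1) ≤ b ≤ r^(κ+2) and κ ≤ N. The points s_k = (U + k)/r⁶ - c next to s*, with k bounded, are considered,
-- and s_k is bad if |b F(s_k) - a| b⁸⁹ < 1 for such a and b. If many of them are bad, the pigeonhole principle yields
-- integral polynomials A and B of small degrees, not both zero, with A + B F tiny at these points. Then A b + B a is an
-- integer of absolute value below 1, so it is 0, and A + B F is even smaller at the bad points. As f is not rational, the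
-- functions sⁱ and sʲ F are linearly independent, and this bounds A + B F from below: a contradiction. So some s_k is
-- good for all κ ≤ N.
--   Finally s is taken slightly above s_k, such that F s = (√2 + e)/T₂, which controls all b ≥ r^(N+2), and such that the
-- rational number c + s_k, whose denominator divides r⁶, approximates c + s to order N.
module Submission where

-- The middle range of denominators is the obstacle. For ξ to be a Liouville number, the last move
-- of s, away from s_k, must be a high negative power of r, here at most r^(-92(N+2)). A value (√2 +
-- e)/T₂ reached by so short a move has T₂ = r^(93(N+2)), and its Liouville inequality is strong
-- enough only for b beyond r^(N+2), while the value at s* helps only up to about r. In between, F
-- has to be estimated at rational points, where nothing is known about its values; hence a supply
-- of candidates s_k and an argument that most of them are good. There are finitely many classes κ ≤
-- N, and t is chosen after all constants that depend on F, c and N, so that only exponents of r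
-- have to be compared; they leave ample slack. The degrees of A and B grow with κ, because the
-- Taylor error on a net of mesh r⁻⁶ has to beat a power of r that grows with κ. Numbers built from
-- √2 serve because their distance to fractions has an explicit lower bound and because the numbers
-- (√2 + e)/T form a net of mesh 1/T, so the intermediate value theorem reaches one.

open import Axiom.ExcludedMiddle using (ExcludedMiddle)
open import Level using (0ℓ)
open import Algebra.Bundles using (CommutativeRing)
open import Algebra.Structures using (IsCommutativeRing)
open import Algebra.Definitions.RawMonoid using (_×′_)
open import Data.Nat.Base using (ℕ; zero; suc)
import Data.Nat.Base as ℕ
open import Data.Product.Base using (∃; _×_)
open import Data.Sum.Base using (_⊎_)
open import Relation.Nullary.Negation.Core using (¬_)

-- The order is given by the cone of nonnegative elements.
record OrderedField : Set₁ where
  infix 4 _≈_ _≤_ 0≤_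
  infixl 6 _+_ _-_
  infixl 7 _*_
  infix 8 -_
  field
    K : Set
    _≈_ : K → K → Set
    _+_ _*_ : K → K → K
    -_ : K → K
    0# 1# : K
    isCommutativeRing : IsCommutativeRing _≈_ _+_ _*_ -_ 0# 1#

  commutativeRing : CommutativeRing 0ℓ 0ℓ
  commutativeRing = record { isCommutativeRing = isCommutativeRing }

  _-_ : K → K → K
  x - y = x + - y

  fromℕ : ℕ → K
  fromℕ n = _×′_ (record { _≈_ = _≈_ ; _∙_ = _+_ ; ε = 0# }) n 1#

  field
    0≤_ : K → Set
    0≤-resp : ∀ {x y} → x ≈ y → 0≤ x → 0≤ y
    0≤-+ : ∀ {x y} → 0≤ x → 0≤ y → 0≤ x + y
    0≤-* : ∀ {x y} → 0≤ x → 0≤ y → 0≤ x * y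
    0≤-total : ∀ x → 0≤ x ⊎ 0≤ - x
    0≤-antisym : ∀ {x} → 0≤ x → 0≤ - x → x ≈ 0#
    0≰-1 : ¬ 0≤ - 1#
    inverse : ∀ x → ¬ x ≈ 0# → ∃ λ y → x * y ≈ 1#
    archimedean : ∀ x → ∃ λ n → 0≤ fromℕ n - x

  _≤_ : K → K → Set
  x ≤ y = 0≤ y - x

-- Completeness is stated for nested intervals whose lengths shrink like 2⁻ⁿ. Both uses, bisection
-- and the shrinking intervals around the centres, have this form, and the Cauchy reals satisfy it
-- by a diagonal argument.
record RealField : Set₁ where
  field
    ordered : OrderedField
  open OrderedField ordered
  field
    complete : (l u : ℕ → K) → (∀ n → l n ≤ l (suc n)) → (∀ n → u (suc n) ≤ u n) →
      (∀ n → l n ≤ u n) → (∀ n → fromℕ (2 ℕ.^ n) * (u n - l n) ≤ u 0 - l 0) →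
      ∃ λ x → ∀ n → l n ≤ x × x ≤ u n

-- Polynomial identities and certified inequalities in an ordered field

module Solver (𝕂 : OrderedField) where
  open import Data.Bool.Base using (Bool; true; false; T)
  open import Data.Integer.Base as ℤ using (ℤ; +_; -[1+_])
  import Data.Integer.Properties as ℤₚ
  open import Data.Maybe.Base using (nothing)
  open import Data.Nat.Base as ℕ using (ℕ; zero; suc)
  import Data.Nat.Properties as ℕₚ
  open import Data.Vec.Base as Vec using (Vec; allFin)
  open import Data.Vec.N-ary using (N-ary; _$ⁿ_)
  import Relation.Binary.PropositionalEquality as ≡
  open import Relation.Nullary.Negation.Core using (¬_)
  open import Tactic.RingSolver.Core.AlmostCommutativeRing
    using (fromCommutativeRing; _-Raw-AlmostCommutative⟶_)
  import Tactic.RingSolver.Core.Expression as Expression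
  open Expression using (Expr; Κ; Ι; _⊕_; _⊗_; _⊛_; ⊝_)
  open import Tactic.RingSolver.Core.Polynomial.Parameters

  open OrderedField 𝕂 public
  open CommutativeRing commutativeRing public
    using ( setoid; refl; sym; trans; reflexive; +-cong; *-cong; -‿cong; +-congˡ; +-congʳ
          ; *-congˡ; *-congʳ; +-comm; *-comm; +-identityˡ; +-identityʳ; *-identityˡ
          ; *-identityʳ; -‿inverseʳ; semiring; ring; rawRing; +-assoc; *-assoc; distribˡ; distribʳ; +-abelianGroup)
  open import Algebra.Properties.Semiring.Mult.TCOptimised semiring using (1+×; ×-homo-+; ×1-homo-*)
  open import Algebra.Properties.Ring ring using (-‿distribˡ-*; -‿distribʳ-*; -‿involutive)
  open import Algebra.Properties.AbelianGroup +-abelianGroup using (⁻¹-∙-comm)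
  open import Relation.Binary.Reasoning.Setoid setoid

  infix 9 #_
  infixr 8 _^_

  -- Numerals are opaque, so that unification never unfolds them.
  abstract
    #_ : ℕ → K
    # n = fromℕ n

    #≈fromℕ : ∀ n → # n ≈ fromℕ n
    #≈fromℕ n = refl

    #0 : # 0 ≈ 0#
    #0 = refl

    #1 : # 1 ≈ 1#
    #1 = refl

    #-suc : ∀ n → # (suc n) ≈ # 1 + # n
    #-suc n = 1+× n 1#

    #-+ : ∀ m n → # (m ℕ.+ n) ≈ # m + # n
    #-+ m n = ×-homo-+ 1# m n

    #-* : ∀ m n → # (m ℕ.* n) ≈ # m * # n
    #-* = ×1-homo-*

  _^_ : K → ℕ → K
  x ^ zero = # 1
  x ^ suc n = x * x ^ n

  E : ℕ → Set
  E = Expr ℤ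

  infix 4 0<_ _<_

  -- Positivity is a negation, so strict inequalities carry no data. The rational gap contained in
  -- the strict order of the Cauchy reals is recovered at the end by `positive-gap`.
  0<_ : K → Set
  0< x = ¬ 0≤ - x

  _<_ : K → K → Set
  x < y = 0< y - x

  private
    -0≈0 : - 0# ≈ 0#
    -0≈0 = trans (sym (+-identityˡ (- 0#))) (-‿inverseʳ 0#)

    fromℤ : ℤ → K
    fromℤ (+ n) = # n
    fromℤ -[1+ n ] = - # (suc n)

    fromℤ-⊖ : ∀ m n → fromℤ (m ℤ.⊖ n) ≈ # m - # n
    fromℤ-⊖ m zero = trans (reflexive (≡.cong fromℤ (ℤₚ.⊖-≥ {m} {0} ℕ.z≤n)))
      (sym (trans (+-congˡ (trans (-‿cong #0) -0≈0)) (+-identityʳ (# m))))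
    fromℤ-⊖ zero (suc n) = sym (trans (+-congʳ #0) (+-identityˡ _))
    fromℤ-⊖ (suc m) (suc n) = begin
      fromℤ (suc m ℤ.⊖ suc n)  ≡⟨ ≡.cong fromℤ (ℤₚ.[1+m]⊖[1+n]≡m⊖n m n) ⟩
      fromℤ (m ℤ.⊖ n)          ≈⟨ fromℤ-⊖ m n ⟩
      # m - # n                ≈⟨ +-congʳ (+-identityˡ (# m)) ⟨
      (0# + # m) - # n         ≈⟨ +-congʳ (+-congʳ (-‿inverseʳ (# 1))) ⟨
      ((# 1 - # 1) + # m) - # n  ≈⟨ +-congʳ (trans (+-assoc _ _ _) (trans (+-congˡ (+-comm _ _)) (sym (+-assoc _ _ _)))) ⟩
      ((# 1 + # m) - # 1) - # n  ≈⟨ +-assoc _ _ _ ⟩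
      (# 1 + # m) + (- # 1 - # n)  ≈⟨ +-congˡ (⁻¹-∙-comm (# 1) (# n)) ⟩
      (# 1 + # m) - (# 1 + # n)  ≈⟨ +-cong (#-suc m) (-‿cong (#-suc n)) ⟨
      # (suc m) - # (suc n)    ∎

    fromℤ-neg : ∀ i → fromℤ (ℤ.- i) ≈ - fromℤ i
    fromℤ-neg (+ zero) = trans #0 (sym (trans (-‿cong #0) -0≈0))
    fromℤ-neg (+ suc n) = refl
    fromℤ-neg -[1+ n ] = sym (-‿involutive _)

    fromℤ-+ : ∀ i j → fromℤ (i ℤ.+ j) ≈ fromℤ i + fromℤ j
    fromℤ-+ (+ m) (+ n) = #-+ m n
    fromℤ-+ (+ m) -[1+ n ] = fromℤ-⊖ m (suc n)
    fromℤ-+ -[1+ m ] (+ n) = trans (fromℤ-⊖ n (suc m)) (+-comm _ _)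
    fromℤ-+ -[1+ m ] -[1+ n ] = begin
      - # (suc (suc (m ℕ.+ n)))   ≡⟨ ≡.cong (λ k → - # (suc k)) (ℕₚ.+-suc m n) ⟨
      - # (suc m ℕ.+ suc n)       ≈⟨ -‿cong (#-+ (suc m) (suc n)) ⟩
      - (# (suc m) + # (suc n))   ≈⟨ ⁻¹-∙-comm _ _ ⟨
      - # (suc m) - # (suc n)     ∎

    fromℤ-* : ∀ i j → fromℤ (i ℤ.* j) ≈ fromℤ i * fromℤ j
    fromℤ-* (+ m) (+ n) = trans (reflexive (≡.cong fromℤ (≡.sym (ℤₚ.pos-* m n)))) (#-* m n)
    fromℤ-* (+ m) -[1+ n ] = begin
      fromℤ (+ m ℤ.* ℤ.- + suc n)    ≡⟨ ≡.cong fromℤ (ℤₚ.neg-distribʳ-* (+ m) (+ suc n)) ⟨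
      fromℤ (ℤ.- (+ m ℤ.* + suc n))  ≈⟨ fromℤ-neg (+ m ℤ.* + suc n) ⟩
      - fromℤ (+ m ℤ.* + suc n)      ≈⟨ -‿cong (fromℤ-* (+ m) (+ suc n)) ⟩
      - (# m * # (suc n))            ≈⟨ -‿distribʳ-* _ _ ⟩
      # m * - # (suc n)              ∎
    fromℤ-* -[1+ m ] (+ n) = begin
      fromℤ (ℤ.- + suc m ℤ.* + n)    ≡⟨ ≡.cong fromℤ (ℤₚ.neg-distribˡ-* (+ suc m) (+ n)) ⟨
      fromℤ (ℤ.- (+ suc m ℤ.* + n))  ≈⟨ fromℤ-neg (+ suc m ℤ.* + n) ⟩
      - fromℤ (+ suc m ℤ.* + n)      ≈⟨ -‿cong (fromℤ-* (+ suc m) (+ n)) ⟩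
      - (# (suc m) * # n)            ≈⟨ -‿distribˡ-* _ _ ⟩
      - # (suc m) * # n              ∎
    fromℤ-* -[1+ m ] -[1+ n ] = begin
      # (suc m ℕ.* suc n)            ≈⟨ #-* (suc m) (suc n) ⟩
      # (suc m) * # (suc n)          ≈⟨ -‿involutive _ ⟨
      - - (# (suc m) * # (suc n))    ≈⟨ -‿cong (-‿distribˡ-* _ _) ⟩
      - (- # (suc m) * # (suc n))    ≈⟨ -‿distribʳ-* _ _ ⟩
      - # (suc m) * - # (suc n)      ∎

    isZero : ℤ → Bool
    isZero (+ zero) = true
    isZero _ = false

    homomorphism : Homomorphism _ _ _ _
    homomorphism = record
      { from = record { rawRing = ℤ.+-*-rawRing ; isZero = isZero }
      ; to = fromCommutativeRing commutativeRing (λ _ → nothing)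
      ; morphism = record
        { ⟦_⟧ = fromℤ ; +-homo = fromℤ-+ ; *-homo = fromℤ-* ; -‿homo = fromℤ-neg
        ; 0-homo = #0 ; 1-homo = #1 }
      ; Zero-C⟶Zero-R = λ { (+ zero) _ → sym #0 }
      }

    open Expression.Eval rawRing fromℤ using (⟦_⟧)
    open import Tactic.RingSolver.Core.Polynomial.Base (Homomorphism.from homomorphism)
      renaming (Κ to Κₚ; ⅀ to ⅀ₚ)
    open import Tactic.RingSolver.Core.Polynomial.Semantics homomorphism renaming (⟦_⟧ to ⟦_⟧ₚ)
    open import Tactic.RingSolver.Core.Polynomial.Homomorphism homomorphism

    norm : ∀ {n} → E n → Poly n
    norm (Κ x) = κ x
    norm (Ι x) = ι x
    norm (x ⊕ y) = norm x ⊞ norm y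
    norm (x ⊗ y) = norm x ⊠ norm y
    norm (⊝ x) = ⊟ norm x
    norm (x ⊛ i) = norm x ⊡ i

    norm-correct : ∀ {n} (e : E n) ρ → ⟦ norm e ⟧ₚ ρ ≈ ⟦ e ⟧ ρ
    norm-correct (Κ x) ρ = κ-hom x ρ
    norm-correct (Ι x) ρ = ι-hom x ρ
    norm-correct (x ⊕ y) ρ = trans (⊞-hom (norm x) (norm y) ρ) (+-cong (norm-correct x ρ) (norm-correct y ρ))
    norm-correct (x ⊗ y) ρ = trans (⊠-hom (norm x) (norm y) ρ) (*-cong (norm-correct x ρ) (norm-correct y ρ))
    norm-correct (⊝ x) ρ = trans (⊟-hom (norm x) ρ) (-‿cong (norm-correct x ρ))
    norm-correct (x ⊛ i) ρ = trans (⊡-hom (norm x) i ρ) (^-cong′ i (norm-correct x ρ))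
      where
      open import Algebra.Properties.Semiring.Exp.TCOptimised semiring using (^-congˡ)
      ^-cong′ = λ i → ^-congˡ i

    -- Only the soundness of this test is proved. That it succeeds is seen at each use: the implicit
    -- argument of type `T (isZeroₚ ...)` computes to the unit type.
    isZeroₚ : ∀ {n} → Poly n → Bool
    isZeroₚ (Κₚ c ⊐ _) = isZero c
    isZeroₚ (⅀ₚ _ ⊐ _) = false

    isZeroₚ-correct : ∀ {n} (p : Poly n) → T (isZeroₚ p) → ∀ ρ → ⟦ p ⟧ₚ ρ ≈ 0#
    isZeroₚ-correct (Κₚ (+ zero) ⊐ _) _ ρ = #0

  infixl 6 _:+_ _:-_
  infixl 7 _:*_
  infix 8 :-_
  infixr 8 _:^_

  _:+_ _:*_ _:-_ : ∀ {n} → E n → E n → E n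
  _:+_ = _⊕_
  _:*_ = _⊗_
  x :- y = x ⊕ (⊝ y)

  :-_ : ∀ {n} → E n → E n
  :-_ = ⊝_

  κ# : ∀ {n} → ℕ → E n
  κ# n = Κ (+ n)

  _:^_ : ∀ {n} → E n → ℕ → E n
  e :^ zero = κ# 1
  e :^ suc n = e :* e :^ n

  infix 4 _:=_ _⊢_:≤_

  data Equation (n : ℕ) : Set where
    _:=_ : E n → E n → Equation n

  data Certificate (n : ℕ) : Set where
    _⊢_:≤_ : E n → E n → E n → Certificate n

  private
    vars : ∀ n → Vec (E n) n
    vars n = Vec.map Ι (allFin n)

    left right : ∀ {n} → Equation n → E n
    left (l := _) = l
    right (_ := r) = r

    cone lower upper : ∀ {n} → Certificate n → E n
    cone (c ⊢ _ :≤ _) = c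
    lower (_ ⊢ l :≤ _) = l
    upper (_ ⊢ _ :≤ u) = u

    difference≈0 : ∀ {x y} → x - y ≈ 0# → x ≈ y
    difference≈0 {x} {y} eq = begin
      x              ≈⟨ +-identityʳ x ⟨
      x + 0#         ≈⟨ +-congˡ (trans (+-comm _ _) (-‿inverseʳ y)) ⟨
      x + (- y + y)  ≈⟨ +-assoc _ _ _ ⟨
      (x - y) + y    ≈⟨ +-congʳ eq ⟩
      0# + y         ≈⟨ +-identityˡ y ⟩
      y              ∎

    equal : ∀ {n} (ρ : Vec K n) (l r : E n) → T (isZeroₚ (norm (l :- r))) → ⟦ l ⟧ ρ ≈ ⟦ r ⟧ ρ
    equal ρ l r t = difference≈0
      (trans (sym (norm-correct (l :- r) ρ)) (isZeroₚ-correct (norm (l :- r)) t ρ))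

  ring! : ∀ {n} (ρ : Vec K n) (f : N-ary n (E n) (Equation n)) →
    (let e = f $ⁿ vars n) → {_ : T (isZeroₚ (norm (left e :- right e)))} →
    ⟦ left e ⟧ ρ ≈ ⟦ right e ⟧ ρ
  ring! {n} ρ f {t} = equal ρ (left (f $ⁿ vars n)) (right (f $ⁿ vars n)) t

  -- A certificate is an expression for the difference of the two sides, arranged so that it is
  -- visibly a sum of products of nonnegative quantities. Normalisation checks the polynomial
  -- identity; the last argument supplies the nonnegativity.
  by : ∀ {n} (ρ : Vec K n) (f : N-ary n (E n) (Certificate n)) →
    (let e = f $ⁿ vars n) → {_ : T (isZeroₚ (norm (cone e :- (upper e :- lower e))))} →
    0≤ ⟦ cone e ⟧ ρ → ⟦ lower e ⟧ ρ ≤ ⟦ upper e ⟧ ρ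
  by {n} ρ f {t} = 0≤-resp (equal ρ (cone c) (upper c :- lower c) t)
    where c = f $ⁿ vars n

  by< : ∀ {n} (ρ : Vec K n) (f : N-ary n (E n) (Certificate n)) →
    (let e = f $ⁿ vars n) → {_ : T (isZeroₚ (norm (cone e :- (upper e :- lower e))))} →
    0< ⟦ cone e ⟧ ρ → ⟦ lower e ⟧ ρ < ⟦ upper e ⟧ ρ
  by< {n} ρ f {t} 0<c 0≤-d = 0<c (0≤-resp (-‿cong (sym (equal ρ (cone c) (upper c :- lower c) t))) 0≤-d)
    where c = f $ⁿ vars n

-- Order, absolute value, powers and integers in an ordered field

module Basics (𝕂 : OrderedField) (em : ExcludedMiddle 0ℓ) where
  open Solver 𝕂 public
  open import Data.Nat.Base as ℕ using (ℕ; zero; suc; z≤n; s≤s)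
  import Data.Nat.Properties as ℕₚ
  open import Data.Product.Base using (∃; ∃₂; _×_; _,_)
  open import Data.Sum.Base using (_⊎_; inj₁; inj₂; [_,_]′)
  open import Data.Vec.Base using (_∷_; [])
  open import Data.Empty using (⊥-elim)
  open import Relation.Binary.PropositionalEquality as ≡ using (_≡_)
  open import Relation.Nullary.Negation.Core using (¬_)
  open import Relation.Nullary.Decidable.Core using (yes; no)

  infixl 6 _⊹_
  infixl 7 _·_

  _⊹_ : ∀ {x y} → 0≤ x → 0≤ y → 0≤ x + y
  _⊹_ = 0≤-+

  _·_ : ∀ {x y} → 0≤ x → 0≤ y → 0≤ x * y
  _·_ = 0≤-*

  1*≈ : ∀ x → # 1 * x ≈ x
  1*≈ x = ring! (x ∷ []) λ x → κ# 1 :* x := x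

  *0≈ : ∀ x → x * # 0 ≈ # 0
  *0≈ x = ring! (x ∷ []) λ x → x :* κ# 0 := κ# 0

  *1≈ : ∀ x → x * # 1 ≈ x
  *1≈ x = ring! (x ∷ []) λ x → x :* κ# 1 := x

  0+≈ : ∀ x → # 0 + x ≈ x
  0+≈ x = ring! (x ∷ []) λ x → κ# 0 :+ x := x

  +0≈ : ∀ x → x + # 0 ≈ x
  +0≈ x = ring! (x ∷ []) λ x → x :+ κ# 0 := x

  ≤⇒0≤ : ∀ {x} → # 0 ≤ x → 0≤ x
  ≤⇒0≤ {x} = 0≤-resp (ring! (x ∷ []) λ x → x :- κ# 0 := x)

  0≤⇒≤ : ∀ {x} → 0≤ x → # 0 ≤ x
  0≤⇒≤ {x} = by (x ∷ []) λ x → x ⊢ κ# 0 :≤ x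

  0≤sq : ∀ x → 0≤ x * x
  0≤sq x with 0≤-total x
  ... | inj₁ p = p · p
  ... | inj₂ p = 0≤-resp (ring! (x ∷ []) λ x → (:- x) :* (:- x) := x :* x) (p · p)

  0≤1 : 0≤ # 1
  0≤1 = 0≤-resp (ring! [] (κ# 1 :* κ# 1 := κ# 1)) (0≤sq (# 1))

  0≤# : ∀ n → 0≤ # n
  0≤# zero = 0≤-resp (ring! [] (κ# 0 :* κ# 0 := κ# 0)) (0≤sq (# 0))
  0≤# (suc n) = 0≤-resp (sym (#-suc n)) (0≤1 ⊹ 0≤# n)

  0≤0 : 0≤ # 0
  0≤0 = 0≤# 0

  ≤-reflexive : ∀ {x y} → x ≈ y → x ≤ y
  ≤-reflexive {x} {y} eq = 0≤-resp (sym (trans (+-congˡ (-‿cong eq)) (ring! (y ∷ []) λ y → y :- y := κ# 0))) 0≤0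

  ≤-refl : ∀ {x} → x ≤ x
  ≤-refl = ≤-reflexive refl

  ≤-trans : ∀ {x y z} → x ≤ y → y ≤ z → x ≤ z
  ≤-trans {x} {y} {z} p q = by (x ∷ y ∷ z ∷ []) (λ x y z → (y :- x) :+ (z :- y) ⊢ x :≤ z) (p ⊹ q)

  ≈0 : ∀ {x} → 0≤ x → 0≤ - x → x ≈ # 0
  ≈0 p q = trans (0≤-antisym p q) (sym #0)

  ≤-antisym : ∀ {x y} → x ≤ y → y ≤ x → x ≈ y
  ≤-antisym {x} {y} p q = sym (trans (ring! (x ∷ y ∷ []) λ x y → y := (y :- x) :+ x)
    (trans (+-congʳ (≈0 p (0≤-resp (ring! (x ∷ y ∷ []) λ x y → x :- y := :- (y :- x)) q))) (0+≈ x)))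

  0<⇒0≤ : ∀ {x} → 0< x → 0≤ x
  0<⇒0≤ {x} p = [ (λ q → q) , (λ q → ⊥-elim (p q)) ]′ (0≤-total x)

  <⇒≤ : ∀ {x y} → x < y → x ≤ y
  <⇒≤ = 0<⇒0≤

  0<-resp : ∀ {x y} → x ≈ y → 0< x → 0< y
  0<-resp eq p q = p (0≤-resp (-‿cong (sym eq)) q)

  ≰⇒> : ∀ {x y} → ¬ x ≤ y → y < x
  ≰⇒> {x} {y} p q = p (0≤-resp (ring! (x ∷ y ∷ []) λ x y → :- (x :- y) := y :- x) q)

  <⇒≱ : ∀ {x y} → x < y → ¬ y ≤ x
  <⇒≱ {x} {y} p q = p (0≤-resp (ring! (x ∷ y ∷ []) λ x y → x :- y := :- (y :- x)) q)

  ≤-or-> : ∀ x y → x ≤ y ⊎ y < x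
  ≤-or-> x y with em {x ≤ y}
  ... | yes p = inj₁ p
  ... | no p = inj₂ (≰⇒> p)

  ≤-total : ∀ x y → x ≤ y ⊎ y ≤ x
  ≤-total x y with ≤-or-> x y
  ... | inj₁ p = inj₁ p
  ... | inj₂ p = inj₂ (<⇒≤ p)

  infixl 6 _<⊹_

  _<⊹_ : ∀ {x y} → 0< x → 0≤ y → 0< x + y
  _<⊹_ {x} {y} p q r = p (0≤-resp (ring! (x ∷ y ∷ []) λ x y → :- (x :+ y) :+ y := :- x) (r ⊹ q))

  0<⇒≉0 : ∀ {x} → 0< x → ¬ x ≈ # 0
  0<⇒≉0 p eq = p (0≤-resp (sym (trans (-‿cong eq) (ring! [] (:- κ# 0 := κ# 0)))) 0≤0)

  0≤∧≉0⇒0< : ∀ {x} → 0≤ x → ¬ x ≈ # 0 → 0< x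
  0≤∧≉0⇒0< p q r = q (≈0 p r)

  inv : ∀ {x} → ¬ x ≈ # 0 → ∃ λ y → x * y ≈ # 1
  inv {x} p = let y , eq = inverse x (λ q → p (trans q (sym #0))) in y , trans eq (sym #1)

  *-≉0 : ∀ {x y} → ¬ x ≈ # 0 → ¬ y ≈ # 0 → ¬ x * y ≈ # 0
  *-≉0 {x} {y} p q eq with inv p
  ... | z , xz≈1 = q (trans (sym (1*≈ y)) (trans (*-congʳ (sym xz≈1))
    (trans (ring! (x ∷ y ∷ z ∷ []) λ x y z → x :* z :* y := z :* (x :* y)) (trans (*-congˡ eq) (*0≈ z)))))

  infixl 7 _<·_

  _<·_ : ∀ {x y} → 0< x → 0< y → 0< x * y
  p <· q = 0≤∧≉0⇒0< (0<⇒0≤ p · 0<⇒0≤ q) (*-≉0 (0<⇒≉0 p) (0<⇒≉0 q))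

  0<1 : 0< # 1
  0<1 p = 0≰-1 (0≤-resp (-‿cong #1) p)

  0<# : ∀ n → 0< # (suc n)
  0<# n = 0<-resp (sym (#-suc n)) (0<1 <⊹ 0≤# n)

  0<-≤ : ∀ {x y} → 0< x → x ≤ y → 0< y
  0<-≤ {x} {y} p q = 0<-resp (ring! (x ∷ y ∷ []) λ x y → x :+ (y :- x) := y) (p <⊹ q)

  1≤⇒0< : ∀ {x} → # 1 ≤ x → 0< x
  1≤⇒0< = 0<-≤ 0<1

  1≤⇒0≤ : ∀ {x} → # 1 ≤ x → 0≤ x
  1≤⇒0≤ p = 0<⇒0≤ (1≤⇒0< p)

  <-≤-trans : ∀ {x y z} → x < y → y ≤ z → x < z
  <-≤-trans {x} {y} {z} p q = by< (x ∷ y ∷ z ∷ []) (λ x y z → (y :- x) :+ (z :- y) ⊢ x :≤ z) (p <⊹ q)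

  ≤-<-trans : ∀ {x y z} → x ≤ y → y < z → x < z
  ≤-<-trans {x} {y} {z} p q = by< (x ∷ y ∷ z ∷ []) (λ x y z → (z :- y) :+ (y :- x) ⊢ x :≤ z) (q <⊹ p)

  0≤-cancel : ∀ {c x} → 0< c → 0≤ c * x → 0≤ x
  0≤-cancel {c} {x} p q with em {0≤ x}
  ... | yes r = r
  ... | no r = ⊥-elim ((p <· 0<-x)
    (0≤-resp (ring! (c ∷ x ∷ []) λ c x → c :* x := :- (c :* (:- x))) q))
    where
    0<-x : 0< - x
    0<-x s = r (0≤-resp (ring! (x ∷ []) λ x → :- (:- x) := x) s)

  *-cancelˡ-≤ : ∀ {c x y} → 0< c → c * x ≤ c * y → x ≤ y
  *-cancelˡ-≤ {c} {x} {y} p q =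
    0≤-cancel p (0≤-resp (ring! (c ∷ x ∷ y ∷ []) λ c x y → c :* y :- c :* x := c :* (y :- x)) q)

  *-monoˡ-≤ : ∀ {c x y} → 0≤ c → x ≤ y → c * x ≤ c * y
  *-monoˡ-≤ {c} {x} {y} p q = by (c ∷ x ∷ y ∷ []) (λ c x y → c :* (y :- x) ⊢ c :* x :≤ c :* y) (p · q)

  *-monoʳ-≤ : ∀ {c x y} → 0≤ c → x ≤ y → x * c ≤ y * c
  *-monoʳ-≤ {c} {x} {y} p q = by (c ∷ x ∷ y ∷ []) (λ c x y → c :* (y :- x) ⊢ x :* c :≤ y :* c) (p · q)

  *-mono-≤ : ∀ {x y u v} → 0≤ u → 0≤ y → x ≤ y → u ≤ v → x * u ≤ y * v
  *-mono-≤ 0≤u 0≤y p q = ≤-trans (*-monoʳ-≤ 0≤u p) (*-monoˡ-≤ 0≤y q)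

  +-mono-≤ : ∀ {x y u v} → x ≤ y → u ≤ v → x + u ≤ y + v
  +-mono-≤ {x} {y} {u} {v} p q = by (x ∷ y ∷ u ∷ v ∷ []) (λ x y u v → (y :- x) :+ (v :- u) ⊢ x :+ u :≤ y :+ v) (p ⊹ q)

  +-monoˡ-≤ : ∀ {c x y} → x ≤ y → c + x ≤ c + y
  +-monoˡ-≤ = +-mono-≤ ≤-refl

  pos-inverse : ∀ {x} → 0< x → ∃ λ y → 0< y × x * y ≈ # 1
  pos-inverse {x} p with inv (0<⇒≉0 p)
  ... | y , xy≈1 = y , 0≤∧≉0⇒0< (0≤-cancel p (0≤-resp (sym xy≈1) 0≤1))
    (λ y≈0 → 0<⇒≉0 0<1 (trans (sym xy≈1) (trans (*-congˡ y≈0) (*0≈ x)))) , xy≈1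

  ∣_∣ : K → K
  ∣ x ∣ = [ (λ _ → x) , (λ _ → - x) ]′ (0≤-total x)

  x≤∣x∣ : ∀ x → x ≤ ∣ x ∣
  x≤∣x∣ x with 0≤-total x
  ... | inj₁ p = ≤-refl
  ... | inj₂ p = by (x ∷ []) (λ x → (:- x) :+ (:- x) ⊢ x :≤ :- x) (p ⊹ p)

  -x≤∣x∣ : ∀ x → - x ≤ ∣ x ∣
  -x≤∣x∣ x with 0≤-total x
  ... | inj₁ p = by (x ∷ []) (λ x → x :+ x ⊢ :- x :≤ x) (p ⊹ p)
  ... | inj₂ p = ≤-refl

  0≤∣∣ : ∀ x → 0≤ ∣ x ∣
  0≤∣∣ x with 0≤-total x
  ... | inj₁ p = p
  ... | inj₂ p = p

  ∣∣-≤ : ∀ {x e} → x ≤ e → - x ≤ e → ∣ x ∣ ≤ e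
  ∣∣-≤ {x} p q with 0≤-total x
  ... | inj₁ _ = p
  ... | inj₂ _ = q

  ∣∣-cong-≤ : ∀ {x y} → x ≈ y → ∣ x ∣ ≤ ∣ y ∣
  ∣∣-cong-≤ {x} {y} eq = ∣∣-≤ (≤-trans (≤-reflexive eq) (x≤∣x∣ y))
    (≤-trans (≤-reflexive (-‿cong eq)) (-x≤∣x∣ y))

  ∣∣-cong : ∀ {x y} → x ≈ y → ∣ x ∣ ≈ ∣ y ∣
  ∣∣-cong eq = ≤-antisym (∣∣-cong-≤ eq) (∣∣-cong-≤ (sym eq))

  0≤⇒∣x∣≈x : ∀ {x} → 0≤ x → ∣ x ∣ ≈ x
  0≤⇒∣x∣≈x {x} p = ≤-antisym
    (∣∣-≤ ≤-refl (by (x ∷ []) (λ x → x :+ x ⊢ :- x :≤ x) (p ⊹ p))) (x≤∣x∣ x)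

  ∣-∣ : ∀ x → ∣ - x ∣ ≈ ∣ x ∣
  ∣-∣ x = ≤-antisym (∣∣-≤ (-x≤∣x∣ x) (≤-trans neg-neg (x≤∣x∣ x)))
    (∣∣-≤ (≤-trans (≤-reflexive (ring! (x ∷ []) λ x → x := :- (:- x))) (-x≤∣x∣ (- x))) (x≤∣x∣ (- x)))
    where
    neg-neg : - - x ≤ x
    neg-neg = ≤-reflexive (ring! (x ∷ []) λ x → :- (:- x) := x)

  ∣∣-flip : ∀ x y → ∣ x - y ∣ ≈ ∣ y - x ∣
  ∣∣-flip x y = trans (∣∣-cong (ring! (x ∷ y ∷ []) λ x y → x :- y := :- (y :- x))) (∣-∣ (y - x))

  ∣+∣ : ∀ x y → ∣ x + y ∣ ≤ ∣ x ∣ + ∣ y ∣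
  ∣+∣ x y = ∣∣-≤ (+-mono-≤ (x≤∣x∣ x) (x≤∣x∣ y))
    (≤-trans (≤-reflexive (ring! (x ∷ y ∷ []) λ x y → :- (x :+ y) := :- x :+ :- y))
      (+-mono-≤ (-x≤∣x∣ x) (-x≤∣x∣ y)))

  ∣+∣-≤ : ∀ {x y e f} → ∣ x ∣ ≤ e → ∣ y ∣ ≤ f → ∣ x + y ∣ ≤ e + f
  ∣+∣-≤ p q = ≤-trans (∣+∣ _ _) (+-mono-≤ p q)

  ∣-∣-≤ : ∀ {x y e f} → ∣ x ∣ ≤ e → ∣ y ∣ ≤ f → ∣ x - y ∣ ≤ e + f
  ∣-∣-≤ {y = y} p q = ∣+∣-≤ p (≤-trans (≤-reflexive (∣-∣ y)) q)

  ∣*∣ : ∀ x y → ∣ x * y ∣ ≈ ∣ x ∣ * ∣ y ∣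
  ∣*∣ x y with 0≤-total x | 0≤-total y
  ... | inj₁ p | inj₁ q = 0≤⇒∣x∣≈x (p · q)
  ... | inj₁ p | inj₂ q = trans (sym (∣-∣ (x * y))) (trans (∣∣-cong (ring! (x ∷ y ∷ []) λ x y → :- (x :* y) := x :* :- y)) (0≤⇒∣x∣≈x (p · q)))
  ... | inj₂ p | inj₁ q = trans (sym (∣-∣ (x * y))) (trans (∣∣-cong (ring! (x ∷ y ∷ []) λ x y → :- (x :* y) := (:- x) :* y)) (0≤⇒∣x∣≈x (p · q)))
  ... | inj₂ p | inj₂ q = trans (∣∣-cong (ring! (x ∷ y ∷ []) λ x y → x :* y := (:- x) :* (:- y))) (0≤⇒∣x∣≈x (p · q))

  ∣*∣-≤ : ∀ {x y e f} → ∣ x ∣ ≤ e → ∣ y ∣ ≤ f → ∣ x * y ∣ ≤ e * f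
  ∣*∣-≤ {x} {y} p q = ≤-trans (≤-reflexive (∣*∣ x y)) (*-mono-≤ (0≤∣∣ y) (≤⇒0≤ (≤-trans (0≤⇒≤ (0≤∣∣ x)) p)) p q)

  ∣∣≈0⇒≈0 : ∀ {x} → ∣ x ∣ ≤ # 0 → x ≈ # 0
  ∣∣≈0⇒≈0 {x} p = ≤-antisym (≤-trans (x≤∣x∣ x) p)
    (by (x ∷ ∣ x ∣ ∷ []) (λ x a → (a :- :- x) :+ (κ# 0 :- a) ⊢ κ# 0 :≤ x) (-x≤∣x∣ x ⊹ p))

  ≉0⇒0<∣∣ : ∀ {x} → ¬ x ≈ # 0 → 0< ∣ x ∣
  ≉0⇒0<∣∣ {x} p = 0≤∧≉0⇒0< (0≤∣∣ x) (λ q → p (∣∣≈0⇒≈0 (≤-reflexive q)))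

  ∣#∣ : ∀ n → ∣ # n ∣ ≈ # n
  ∣#∣ n = 0≤⇒∣x∣≈x (0≤# n)

  ≤∣∣+∣-∣ : ∀ x y → ∣ x ∣ ≤ ∣ y ∣ + ∣ x - y ∣
  ≤∣∣+∣-∣ x y = ≤-trans (∣∣-cong-≤ (ring! (x ∷ y ∷ []) λ x y → x := y :+ (x :- y))) (∣+∣ y (x - y))

  ^-congˡ : ∀ {x y} n → x ≈ y → x ^ n ≈ y ^ n
  ^-congˡ zero eq = refl
  ^-congˡ (suc n) eq = *-cong eq (^-congˡ n eq)

  ^-+ : ∀ x m n → x ^ (m ℕ.+ n) ≈ x ^ m * x ^ n
  ^-+ x zero n = ring! (x ^ n ∷ []) λ a → a := κ# 1 :* a
  ^-+ x (suc m) n = trans (*-congˡ (^-+ x m n)) (ring! (x ∷ x ^ m ∷ x ^ n ∷ []) λ x a b → x :* (a :* b) := x :* a :* b)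

  ^-* : ∀ x y n → (x * y) ^ n ≈ x ^ n * y ^ n
  ^-* x y zero = ring! [] (κ# 1 := κ# 1 :* κ# 1)
  ^-* x y (suc n) = trans (*-congˡ (^-* x y n)) (ring! (x ∷ y ∷ x ^ n ∷ y ^ n ∷ []) λ x y a b → x :* y :* (a :* b) := x :* a :* (y :* b))

  1^ : ∀ n → # 1 ^ n ≈ # 1
  1^ zero = refl
  1^ (suc n) = trans (1*≈ _) (1^ n)

  ^-^ : ∀ x m n → (x ^ m) ^ n ≈ x ^ (m ℕ.* n)
  ^-^ x zero n = 1^ n
  ^-^ x (suc m) n = trans (^-* x (x ^ m) n) (trans (*-congˡ (^-^ x m n)) (sym (^-+ x n (m ℕ.* n))))

  0≤-^ : ∀ {x} n → 0≤ x → 0≤ x ^ n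
  0≤-^ zero p = 0≤1
  0≤-^ (suc n) p = p · 0≤-^ n p

  0<-^ : ∀ {x} n → 0< x → 0< x ^ n
  0<-^ zero p = 0<1
  0<-^ (suc n) p = p <· 0<-^ n p

  ^-mono-≤ : ∀ {x y} n → 0≤ x → x ≤ y → x ^ n ≤ y ^ n
  ^-mono-≤ zero p q = ≤-refl
  ^-mono-≤ (suc n) p q = *-mono-≤ (0≤-^ n p) (≤⇒0≤ (≤-trans (0≤⇒≤ p) q)) q (^-mono-≤ n p q)

  1≤-^ : ∀ {x} n → # 1 ≤ x → # 1 ≤ x ^ n
  1≤-^ n p = ≤-trans (≤-reflexive (sym (1^ n))) (^-mono-≤ n 0≤1 p)

  ^-≤1 : ∀ {x} n → 0≤ x → x ≤ # 1 → x ^ n ≤ # 1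
  ^-≤1 n p q = ≤-trans (^-mono-≤ n p q) (≤-reflexive (1^ n))

  ^-monoʳ-≤ : ∀ {x m n} → # 1 ≤ x → m ℕ.≤ n → x ^ m ≤ x ^ n
  ^-monoʳ-≤ {n = n} p z≤n = 1≤-^ n p
  ^-monoʳ-≤ p (s≤s q) = *-monoˡ-≤ (1≤⇒0≤ p) (^-monoʳ-≤ p q)

  ^-antiʳ-≤ : ∀ {x m n} → 0≤ x → x ≤ # 1 → m ℕ.≤ n → x ^ n ≤ x ^ m
  ^-antiʳ-≤ {n = n} p q z≤n = ^-≤1 n p q
  ^-antiʳ-≤ p q (s≤s r) = *-monoˡ-≤ p (^-antiʳ-≤ p q r)

  ∣^∣ : ∀ x n → ∣ x ^ n ∣ ≈ ∣ x ∣ ^ n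
  ∣^∣ x zero = 0≤⇒∣x∣≈x 0≤1
  ∣^∣ x (suc n) = trans (∣*∣ x (x ^ n)) (*-congˡ (∣^∣ x n))

  ^-≈ : ∀ {m n} x → m ≡ n → x ^ m ≈ x ^ n
  ^-≈ x ≡.refl = refl

  #-≡ : ∀ {m n} → m ≡ n → # m ≈ # n
  #-≡ ≡.refl = refl

  #-^ : ∀ m n → # (m ℕ.^ n) ≈ # m ^ n
  #-^ m zero = refl
  #-^ m (suc n) = trans (#-* m (m ℕ.^ n)) (*-congˡ (#-^ m n))

  #-mono : ∀ {m n} → m ℕ.≤ n → # m ≤ # n
  #-mono {n = n} z≤n = 0≤⇒≤ (0≤# n)
  #-mono {suc m} {suc n} (s≤s p) = ≤-trans (≤-reflexive (#-suc m))
    (≤-trans (+-monoˡ-≤ (#-mono p)) (≤-reflexive (sym (#-suc n))))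

  #-mono⁻¹ : ∀ {m n} → # m ≤ # n → m ℕ.≤ n
  #-mono⁻¹ {m} {n} p with m ℕₚ.≤? n
  ... | yes q = q
  ... | no q = ⊥-elim (0<1 (0≤-resp (ring! (# n ∷ []) λ n → n :- (κ# 1 :+ n) := :- κ# 1)
    (≤-trans (≤-reflexive (sym (#-suc n))) (≤-trans (#-mono (ℕₚ.≰⇒> q)) p))))

  #-∸ : ∀ {m n} → n ℕ.≤ m → # (m ℕ.∸ n) ≈ # m - # n
  #-∸ {m} {n} p = trans (ring! (# (m ℕ.∸ n) ∷ # n ∷ []) λ d n → d := (d :+ n) :- n)
    (+-congʳ (trans (sym (#-+ (m ℕ.∸ n) n)) (#-≡ (ℕₚ.m∸n+n≡m p))))

  1≤# : ∀ {n} → 1 ℕ.≤ n → # 1 ≤ # n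
  1≤# = #-mono

  upper-bound : ∀ x → ∃ λ n → 1 ℕ.≤ n × x ≤ # n
  upper-bound x with archimedean x
  ... | n , p = suc n , s≤s z≤n , ≤-trans (≤-trans p (≤-reflexive (sym (#≈fromℕ n)))) (#-mono (ℕₚ.n≤1+n n))

  n≤2^n : ∀ n → n ℕ.≤ 2 ℕ.^ n
  n≤2^n zero = z≤n
  n≤2^n (suc n) = ≡.subst (ℕ._≤ 2 ℕ.^ suc n) (ℕₚ.+-comm n 1)
    (ℕₚ.+-mono-≤ (n≤2^n n) (≡.subst (1 ℕ.≤_) (≡.sym (ℕₚ.+-identityʳ _)) (ℕₚ.m^n>0 2 n)))

  reach : ∀ {d} → 0< d → ∀ C → ∃ λ n → 1 ℕ.≤ n × C ≤ # n * d
  reach {d} 0<d C =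
    let e , 0<e , de≈1 = pos-inverse 0<d
        n , 1≤n , p = upper-bound (C * e) in
    n , 1≤n , ≤-trans
    (≤-reflexive (trans (trans (sym (*1≈ C)) (*-congˡ (sym de≈1)))
      (ring! (C ∷ d ∷ e ∷ []) λ C d e → C :* (d :* e) := C :* e :* d)))
    (*-monoʳ-≤ (0<⇒0≤ 0<d) p)

  <-or-≤-elim : ∀ {x y} {P : Set} → (x ≤ y → P) → (y < x → P) → P
  <-or-≤-elim {x} {y} f g = [ f , g ]′ (≤-or-> x y)

  -- By the archimedean property, a difference with bounded multiples by 2ⁿ cannot be positive. This
  -- replaces passages to the limit for power series: inside half the radius their remainders are at
  -- most a constant times 2⁻ⁿ, so an inequality that holds up to such remainders holds exactly.
  dyadic-≤ : ∀ {x y} C → (∀ n → # 2 ^ n * (x - y) ≤ C) → x ≤ y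
  dyadic-≤ {x} {y} C p = <-or-≤-elim (λ q → q) λ q →
    let n , _ , r = reach q (C + # 1) in
    ⊥-elim (0<1 (0≤-resp (ring! (C ∷ []) λ C → C :- (C :+ κ# 1) := :- κ# 1)
      (≤-trans r (≤-trans (*-monoʳ-≤ (<⇒≤ q) (≤-trans (#-mono (n≤2^n n)) (≤-reflexive (#-^ 2 n)))) (p n)))))

  half : ∃ λ h → 0< h × h + h ≈ # 1
  half = from (pos-inverse (0<# 1))
    where
    from : (∃ λ h → 0< h × # 2 * h ≈ # 1) → ∃ λ h → 0< h × h + h ≈ # 1
    from (h , 0<h , eq) = h , 0<h , trans (ring! (h ∷ []) λ h → h :+ h := κ# 2 :* h) eq

  halve : ∀ {x} → 0< x → ∃ λ y → 0< y × y + y ≈ x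
  halve {x} 0<x = let h , 0<h , eq = half in x * h , 0<x <· 0<h ,
    trans (ring! (x ∷ h ∷ []) λ x h → x :* h :+ x :* h := x :* (h :+ h)) (trans (*-congˡ eq) (*1≈ x))

  ε-≤ : ∀ {x y} → (∀ ε → 0< ε → x ≤ y + ε) → x ≤ y
  ε-≤ {x} {y} p = <-or-≤-elim (λ q → q) λ q →
    let e , 0<e , eq = halve q in ⊥-elim (0<e (0≤-resp
    (trans (ring! (x ∷ y ∷ e ∷ []) λ x y e → (y :+ e) :- x := e :- (x :- y))
      (trans (+-congˡ (-‿cong (sym eq))) (ring! (e ∷ []) λ e → e :- (e :+ e) := :- e))) (p e 0<e)))

  -- Integers remain elements of `K`, so that expressions mixing them with arbitrary elements stay
  -- within reach of `ring!` and `by`.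
  IsInt : K → Set
  IsInt x = ∃₂ λ m n → x ≈ # m - # n

  int-# : ∀ n → IsInt (# n)
  int-# n = n , 0 , ring! (# n ∷ []) λ n → n := n :- κ# 0

  int-cong : ∀ {x y} → x ≈ y → IsInt x → IsInt y
  int-cong eq (m , n , p) = m , n , trans (sym eq) p

  int-neg : ∀ {x} → IsInt x → IsInt (- x)
  int-neg (m , n , p) = n , m , trans (-‿cong p) (ring! (# m ∷ # n ∷ []) λ m n → :- (m :- n) := n :- m)

  int-+ : ∀ {x y} → IsInt x → IsInt y → IsInt (x + y)
  int-+ (m , n , p) (m′ , n′ , q) = m ℕ.+ m′ , n ℕ.+ n′ , trans (+-cong p q)
    (trans (ring! (# m ∷ # n ∷ # m′ ∷ # n′ ∷ []) λ m n m′ n′ → (m :- n) :+ (m′ :- n′) := (m :+ m′) :- (n :+ n′))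
      (+-cong (sym (#-+ m m′)) (-‿cong (sym (#-+ n n′)))))

  int-sub : ∀ {x y} → IsInt x → IsInt y → IsInt (x - y)
  int-sub p q = int-+ p (int-neg q)

  int-* : ∀ {x y} → IsInt x → IsInt y → IsInt (x * y)
  int-* (m , n , p) (m′ , n′ , q) = m ℕ.* m′ ℕ.+ n ℕ.* n′ , m ℕ.* n′ ℕ.+ n ℕ.* m′ , trans (*-cong p q)
    (trans (ring! (# m ∷ # n ∷ # m′ ∷ # n′ ∷ []) λ m n m′ n′ →
        (m :- n) :* (m′ :- n′) := (m :* m′ :+ n :* n′) :- (m :* n′ :+ n :* m′))
      (+-cong (sym (#-+* m m′ n n′)) (-‿cong (sym (#-+* m n′ n m′)))))
    where
    #-+* : ∀ a b c d → # (a ℕ.* b ℕ.+ c ℕ.* d) ≈ # a * # b + # c * # d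
    #-+* a b c d = trans (#-+ (a ℕ.* b) (c ℕ.* d)) (+-cong (#-* a b) (#-* c d))

  int-<1 : ∀ {x} → IsInt x → x < # 1 → x ≤ # 0
  int-<1 {x} (m , n , p) q with m ℕₚ.≤? n
  ... | yes r = ≤-trans (≤-reflexive p) (by (# m ∷ # n ∷ []) (λ m n → n :- m ⊢ m :- n :≤ κ# 0) (#-mono r))
  ... | no r = ⊥-elim (<⇒≱ q (≤-trans
    (by (# m ∷ # n ∷ []) (λ m n → m :- (κ# 1 :+ n) ⊢ κ# 1 :≤ m :- n) (≤-trans (≤-reflexive (sym (#-suc n))) (#-mono (ℕₚ.≰⇒> r))))
    (≤-reflexive (sym p))))

  int-small : ∀ {x} → IsInt x → ∣ x ∣ < # 1 → x ≈ # 0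
  int-small {x} p q = ∣∣≈0⇒≈0 (∣∣-≤ (int-<1 p (≤-<-trans (x≤∣x∣ x) q)) (int-<1 (int-neg p) (≤-<-trans (-x≤∣x∣ x) q)))

  nat-floor : ∀ {x} → 0≤ x → ∃ λ n → # n ≤ x × x < # n + # 1
  nat-floor {x} p =
    let n , _ , q = upper-bound (x + # 1) in
    go n (by< (x ∷ # n ∷ []) (λ x n → κ# 1 :+ (n :- (x :+ κ# 1)) ⊢ x :≤ n) (0<1 <⊹ q))
    where
    go : ∀ n → x < # n → ∃ λ n → # n ≤ x × x < # n + # 1
    go zero q = ⊥-elim (<⇒≱ q (0≤⇒≤ p))
    go (suc n) q = <-or-≤-elim
      (λ r → n , r , <-≤-trans q (≤-reflexive (trans (#-suc n) (+-comm _ _)))) (go n)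

  floor : ∀ x → ∃ λ z → IsInt z × z ≤ x × x < z + # 1
  floor x =
    let N , _ , p = upper-bound (- x)
        n , q , r = nat-floor p in
    # n - # N , (n , N , refl)
    , by (# n ∷ x ∷ # N ∷ []) (λ n x N → (N :- (:- x)) :- n ⊢ n :- N :≤ x) q
    , by< (# n ∷ x ∷ # N ∷ []) (λ n x N → (n :+ κ# 1) :- (N :- (:- x)) ⊢ x :≤ (n :- N) :+ κ# 1) r

-- Cauchy sequences over an ordered field

module CauchySequences (𝕂 : OrderedField) (em : ExcludedMiddle 0ℓ) where
  open Basics 𝕂 em
  open import Data.Nat.Base as ℕ using (ℕ; zero; suc)
  import Data.Nat.Properties as ℕₚ
  open import Data.Product.Base using (∃; _×_; _,_; proj₁; proj₂)
  open import Data.Sum.Base using (_⊎_; inj₁; inj₂; [_,_]′)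
  open import Data.Vec.Base using (_∷_; [])
  open import Data.Empty using (⊥-elim)
  open import Relation.Binary.PropositionalEquality as ≡ using (_≡_)
  open import Function.Base using (case_of_)
  open import Relation.Nullary.Negation.Core using (¬_)
  open import Relation.Nullary.Decidable.Core using (yes; no; decidable-stable)

  dne : ∀ {P : Set} → ¬ ¬ P → P
  dne = decidable-stable em

  Sequence : Set
  Sequence = ℕ → K

  Eventually : (ℕ → Set) → Set
  Eventually P = ∃ λ N → ∀ n → N ℕ.≤ n → P n

  eventually : ∀ {P Q R : ℕ → Set} → (∀ n → P n → Q n → R n) → Eventually P → Eventually Q → Eventually R
  eventually h (M , p) (N , q) = M ℕ.⊔ N , λ n r → h n (p n (ℕₚ.m⊔n≤o⇒m≤o M N r)) (q n (ℕₚ.m⊔n≤o⇒n≤o M N r))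

  eventually-map : ∀ {P Q : ℕ → Set} → (∀ n → P n → Q n) → Eventually P → Eventually Q
  eventually-map h (M , p) = M , λ n r → h n (p n r)

  Cauchy Null NonNegative : Sequence → Set
  Cauchy u = ∀ ε → 0< ε → ∃ λ N → ∀ m n → N ℕ.≤ m → N ℕ.≤ n → ∣ u m - u n ∣ ≤ ε
  Null u = ∀ ε → 0< ε → Eventually λ n → ∣ u n ∣ ≤ ε
  NonNegative u = ∀ ε → 0< ε → Eventually λ n → 0≤ u n + ε

  small : ∀ {B ε} → 0≤ B → 0< ε → ∃ λ η → 0< η × B * η ≤ ε
  small {B} {ε} 0≤B 0<ε = let c , 0<c , eq = pos-inverse (0<1 <⊹ 0≤B) in c * ε , 0<c <· 0<ε
    , ≤-trans (by (B ∷ c ∷ ε ∷ []) (λ B c ε → c :* ε ⊢ B :* (c :* ε) :≤ (κ# 1 :+ B) :* c :* ε) (0<⇒0≤ (0<c <· 0<ε)))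
        (≤-reflexive (trans (*-congʳ eq) (1*≈ ε)))

  null-≈ : ∀ {u v} → (∀ n → u n ≈ v n) → Null u → Null v
  null-≈ eq nu ε 0<ε = eventually-map (λ n p → ≤-trans (∣∣-cong-≤ (sym (eq n))) p) (nu ε 0<ε)

  null-0 : ∀ {u} → (∀ n → u n ≈ # 0) → Null u
  null-0 eq ε 0<ε = 0 , λ n _ → ≤-trans (∣∣-cong-≤ (eq n)) (≤-trans (≤-reflexive (∣#∣ 0)) (0≤⇒≤ (0<⇒0≤ 0<ε)))

  null-+ : ∀ {u v} → Null u → Null v → Null (λ n → u n + v n)
  null-+ nu nv ε 0<ε = case halve 0<ε of λ { (δ , 0<δ , eq) →
    eventually (λ n p q → ≤-trans (∣+∣-≤ p q) (≤-reflexive eq)) (nu δ 0<δ) (nv δ 0<δ) }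

  null-neg : ∀ {u} → Null u → Null (λ n → - u n)
  null-neg nu ε 0<ε = eventually-map (λ n p → ≤-trans (≤-reflexive (∣-∣ _)) p) (nu ε 0<ε)

  Bounded : Sequence → Set
  Bounded u = ∃ λ B → 0≤ B × Eventually λ n → ∣ u n ∣ ≤ B

  cauchy-bounded : ∀ {u} → Cauchy u → Bounded u
  cauchy-bounded {u} cu = case cu (# 1) 0<1 of λ { (N , h) → # 1 + ∣ u N ∣ , 0≤1 ⊹ 0≤∣∣ _ , N , λ n p →
    ≤-trans (∣∣-cong-≤ (ring! (u n ∷ u N ∷ []) λ x y → x := (x :- y) :+ y)) (∣+∣-≤ (h n N p ℕₚ.≤-refl) ≤-refl) }

  null-* : ∀ {u v} → Bounded u → Null v → Null (λ n → u n * v n)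
  null-* (B , 0≤B , bu) nv ε 0<ε = case small 0≤B 0<ε of λ { (η , 0<η , q) →
    eventually (λ n p r → ≤-trans (∣*∣-≤ p r) q) bu (nv η 0<η) }

  nonNegative-cong : ∀ {u v} → Null (λ n → u n - v n) → NonNegative u → NonNegative v
  nonNegative-cong {u} {v} nuv nu ε 0<ε = case halve 0<ε of λ { (δ , 0<δ , eq) →
    eventually (λ n p q → 0≤-resp (trans (ring! (u n ∷ v n ∷ δ ∷ []) λ u v d → u :+ d :+ (d :- (u :- v)) := v :+ (d :+ d)) (+-congˡ eq))
      (p ⊹ ≤-trans (x≤∣x∣ _) q)) (nu δ 0<δ) (nuv δ 0<δ) }

  nonNegative-+ : ∀ {u v} → NonNegative u → NonNegative v → NonNegative (λ n → u n + v n)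
  nonNegative-+ {u} {v} nu nv ε 0<ε = case halve 0<ε of λ { (δ , 0<δ , eq) →
    eventually (λ n p q → 0≤-resp (trans (ring! (u n ∷ v n ∷ δ ∷ []) λ u v d → u :+ d :+ (v :+ d) := u :+ v :+ (d :+ d)) (+-congˡ eq)) (p ⊹ q))
      (nu δ 0<δ) (nv δ 0<δ) }

  product-bound : ∀ {x y B C δ ε} → 0≤ δ → 0≤ x + δ → 0≤ y + δ → ∣ x ∣ ≤ B → ∣ y ∣ ≤ C → (B + C) * δ ≤ ε → 0≤ x * y + ε
  product-bound {x} {y} {B} {C} {δ} {ε} 0≤δ p q r s t = cases (0≤-total x) (0≤-total y)
    where
    cases : 0≤ x ⊎ 0≤ - x → 0≤ y ⊎ 0≤ - y → 0≤ x * y + ε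
    0≤B : 0≤ B
    0≤B = ≤⇒0≤ (≤-trans (0≤⇒≤ (0≤∣∣ x)) r)
    0≤C : 0≤ C
    0≤C = ≤⇒0≤ (≤-trans (0≤⇒≤ (0≤∣∣ y)) s)
    0≤ε : 0≤ ε
    0≤ε = ≤⇒0≤ (≤-trans (0≤⇒≤ ((0≤B ⊹ 0≤C) · 0≤δ)) t)
    cases (inj₁ a) (inj₁ b) = a · b ⊹ 0≤ε
    cases (inj₂ a) (inj₂ b) = 0≤-resp (ring! (x ∷ y ∷ ε ∷ []) λ x y e → (:- x) :* (:- y) :+ e := x :* y :+ e) (a · b ⊹ 0≤ε)
    cases (inj₁ a) (inj₂ b) = 0≤-resp (ring! (x ∷ y ∷ B ∷ C ∷ δ ∷ ε ∷ []) λ x y B C d e →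
        x :* (y :+ d) :+ (B :- x) :* d :+ C :* d :+ (e :- (B :+ C) :* d) := x :* y :+ e)
      (a · q ⊹ ≤-trans (x≤∣x∣ x) r · 0≤δ ⊹ 0≤C · 0≤δ ⊹ t)
    cases (inj₂ a) (inj₁ b) = 0≤-resp (ring! (x ∷ y ∷ B ∷ C ∷ δ ∷ ε ∷ []) λ x y B C d e →
        y :* (x :+ d) :+ (C :- y) :* d :+ B :* d :+ (e :- (B :+ C) :* d) := x :* y :+ e)
      (b · p ⊹ ≤-trans (x≤∣x∣ y) s · 0≤δ ⊹ 0≤B · 0≤δ ⊹ t)

  nonNegative-* : ∀ {u v} → Bounded u → Bounded v → NonNegative u → NonNegative v → NonNegative (λ n → u n * v n)
  nonNegative-* {u} {v} (B , 0≤B , bu) (C , 0≤C , bv) nu nv ε 0<ε = case small (0≤B ⊹ 0≤C) 0<ε of λ { (δ , 0<δ , t) →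
    eventually (λ n pq rs → product-bound (0<⇒0≤ 0<δ) (proj₁ pq) (proj₂ pq) (proj₁ rs) (proj₂ rs) t)
      (eventually (λ n → _,_) (nu δ 0<δ) (nv δ 0<δ)) (eventually (λ n → _,_) bu bv) }

  -- If the first alternative fails, then for some δ arbitrarily late terms lie below -δ. One of
  -- them comes after the index from which all terms are within δ of each other, and this makes all
  -- later terms negative.
  nonNegative-total : ∀ {u} → Cauchy u → NonNegative u ⊎ NonNegative (λ n → - u n)
  nonNegative-total {u} cu with em {NonNegative u}
  ... | yes p = inj₁ p
  ... | no ¬p = inj₂ λ ε 0<ε → case dne (λ none → ¬p λ δ 0<δ → dne λ bad → none (δ , 0<δ , bad)) of λ { (δ , 0<δ , bad) →
      case cu δ 0<δ of λ { (N , h) → case dne (λ none → bad (N , λ n r → dne λ neg → none (n , r , neg))) of λ { (n , r , neg) →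
        N , λ m s → 0≤-resp (ring! (u m ∷ u n ∷ δ ∷ ε ∷ []) λ x y d e → (:- (y :+ d)) :+ (d :- (x :- y)) :+ e := :- x :+ e)
          (0<⇒0≤ (λ q → neg (0≤-resp (ring! (u n ∷ δ ∷ []) λ y d → :- (:- (y :+ d)) := y :+ d) q)) ⊹ ≤-trans (x≤∣x∣ _) (h m n s r) ⊹ 0<⇒0≤ 0<ε) } } }

  nonNegative-antisym : ∀ {u} → NonNegative u → NonNegative (λ n → - u n) → Null u
  nonNegative-antisym {u} p q ε 0<ε = eventually (λ n a b → ∣∣-≤
      (0≤-resp (ring! (u n ∷ ε ∷ []) λ x e → :- x :+ e := e :- x) b)
      (0≤-resp (ring! (u n ∷ ε ∷ []) λ x e → x :+ e := e :- :- x) a)) (p ε 0<ε) (q ε 0<ε)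

  away-from-0 : ∀ {u} → Cauchy u → ¬ Null u → ∃ λ δ → 0< δ × Eventually λ n → δ ≤ ∣ u n ∣
  away-from-0 {u} cu ¬nu =
    case dne (λ none → ¬nu λ ε 0<ε → dne λ bad → none (ε , 0<ε , bad)) of λ { (ε , 0<ε , bad) →
    case halve 0<ε of λ { (δ , 0<δ , eq) →
    case cu δ 0<δ of λ { (N , h) →
    case dne (λ none → bad (N , λ n r → dne λ big → none (n , r , big))) of λ { (n , r , big) →
      δ , 0<δ , N , λ m s → by (ε ∷ δ ∷ ∣ u m ∣ ∷ ∣ u n ∣ ∷ ∣ u n - u m ∣ ∷ []) (λ e d x y z → (y :- e) :+ (x :+ z :- y) :+ (d :- z) :+ (e :- (d :+ d)) ⊢ d :≤ x)
        (<⇒≤ (≰⇒> big) ⊹ ≤∣∣+∣-∣ (u n) (u m) ⊹ h n m r s ⊹ ≤-reflexive eq) } } } }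

  nonNegative-abs : ∀ {u} → NonNegative u → Null (λ n → ∣ u n ∣ - u n)
  nonNegative-abs {u} p ε 0<ε = case halve 0<ε of λ { (δ , 0<δ , eq) → eventually-map {λ n → 0≤ u n + δ} {λ n → ∣ ∣ u n ∣ - u n ∣ ≤ ε}
      (λ n q → ≤-trans (≤-reflexive (0≤⇒∣x∣≈x (x≤∣x∣ (u n)))) (side n δ eq 0<δ q (0≤-total (u n)))) (p δ 0<δ) }
    where
    side : ∀ n δ → δ + δ ≈ ε → 0< δ → 0≤ u n + δ → 0≤ u n ⊎ 0≤ - u n → ∣ u n ∣ - u n ≤ ε
    side n δ eq 0<δ q (inj₁ r) = ≤-trans (≤-reflexive (trans (+-congʳ (0≤⇒∣x∣≈x r)) (ring! (u n ∷ []) λ x → x :- x := κ# 0))) (0≤⇒≤ (0<⇒0≤ 0<ε))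
    side n δ eq 0<δ q (inj₂ r) = ≤-trans (≤-reflexive (+-congʳ (trans (sym (∣-∣ (u n))) (0≤⇒∣x∣≈x r))))
      (≤-trans (by (u n ∷ δ ∷ []) (λ x d → (x :+ d) :+ (x :+ d) ⊢ :- x :- x :≤ d :+ d) (q ⊹ q)) (≤-reflexive eq))

  -- A Cauchy sequence that does not tend to 0 stays away from 0, and being nearly nonnegative
  -- excludes the negative side. Halving the distance to 0 leaves room for "nearly".
  positive-gap : ∀ {u} → Cauchy u → ¬ NonNegative (λ n → - u n) → ∃ λ δ → 0< δ × Eventually λ n → δ ≤ u n
  positive-gap {u} cu ¬p = [ positive , (λ q → ⊥-elim (¬p q)) ]′ (nonNegative-total cu)
    where
    not-null : ¬ Null u
    not-null nu = ¬p λ ε 0<ε → eventually-map {λ n → ∣ u n ∣ ≤ ε} {λ n → 0≤ - u n + ε} (λ n → below n ε) (nu ε 0<ε)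
      where
      below : ∀ n ε → ∣ u n ∣ ≤ ε → 0≤ - u n + ε
      below n ε r = 0≤-resp (ring! (u n ∷ ε ∷ []) λ x e → e :- x := :- x :+ e) (≤-trans (x≤∣x∣ (u n)) r)
    side : ∀ {δ η} n → η + η ≈ δ → 0< η → δ ≤ ∣ u n ∣ → 0≤ u n + η → 0≤ u n ⊎ 0≤ - u n → η ≤ u n
    side {δ} {η} n eq 0<η r s (inj₁ p) = ≤-trans (≤-trans (by (η ∷ δ ∷ []) (λ e d → e :+ (d :- (e :+ e)) ⊢ e :≤ d) (0<⇒0≤ 0<η ⊹ ≤-reflexive eq)) r) (≤-reflexive (0≤⇒∣x∣≈x p))
    side {δ} {η} n eq 0<η r s (inj₂ p) = by (η ∷ δ ∷ u n ∷ []) (λ e d x → (x :+ e) :+ κ# 2 :* ((:- x :- d) :+ (d :- (e :+ e)) :+ (x :+ e)) ⊢ e :≤ x)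
      (s ⊹ 0≤# 2 · (≤-trans r (≤-reflexive (trans (sym (∣-∣ (u n))) (0≤⇒∣x∣≈x p))) ⊹ ≤-reflexive eq ⊹ s))
    positive : NonNegative u → ∃ λ δ → 0< δ × Eventually λ n → δ ≤ u n
    positive q = case away-from-0 cu not-null of λ { (δ , 0<δ , away) → case halve 0<δ of λ { (η , 0<η , eq) →
      η , 0<η , eventually (λ n r s → side n eq 0<η r s (0≤-total (u n))) away (q η 0<η) } }

  -- A sequence with nonzero limit may still contain zeros. The default value 0 at such terms is
  -- harmless, since only the terms away from 0 enter the limit.
  reciprocal-of : K → K
  reciprocal-of x with em {x ≈ # 0}
  ... | yes _ = # 0
  ... | no p = proj₁ (inv p)

  reciprocal-correct : ∀ {x} → ¬ x ≈ # 0 → x * reciprocal-of x ≈ # 1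
  reciprocal-correct {x} p with em {x ≈ # 0}
  ... | yes q = ⊥-elim (p q)
  ... | no q = proj₂ (inv q)

  ≤∣∣⇒≉0 : ∀ {δ x} → 0< δ → δ ≤ ∣ x ∣ → ¬ x ≈ # 0
  ≤∣∣⇒≉0 0<δ p eq = 0<⇒≉0 (0<-≤ 0<δ p) (trans (∣∣-cong eq) (∣#∣ 0))

  module _ {u : Sequence} (cu : Cauchy u) {δ : K} (0<δ : 0< δ) (away : Eventually λ n → δ ≤ ∣ u n ∣) where
    private
      d : K
      d = proj₁ (pos-inverse 0<δ)
      0<d : 0< d
      0<d = proj₁ (proj₂ (pos-inverse 0<δ))
      δd≈1 : δ * d ≈ # 1
      δd≈1 = proj₂ (proj₂ (pos-inverse 0<δ))
      v : Sequence
      v n = reciprocal-of (u n)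
      uv≈1 : ∀ {n} → δ ≤ ∣ u n ∣ → u n * v n ≈ # 1
      uv≈1 p = reciprocal-correct (≤∣∣⇒≉0 0<δ p)
      v≤d : ∀ {n} → δ ≤ ∣ u n ∣ → ∣ v n ∣ ≤ d
      v≤d {n} p = *-cancelˡ-≤ 0<δ (≤-trans (*-monoʳ-≤ (0≤∣∣ (v n)) p)
        (≤-reflexive (trans (sym (∣*∣ (u n) (v n))) (trans (∣∣-cong (uv≈1 p)) (trans (∣#∣ 1) (sym δd≈1))))))

    reciprocal-cauchy : Cauchy v
    reciprocal-cauchy ε 0<ε = case small (0<⇒0≤ 0<d · 0<⇒0≤ 0<d) 0<ε of λ { (η , 0<η , q) → case cu η 0<η of λ { (N , h) →
      N ℕ.⊔ proj₁ away , λ m n r s →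
        let am = proj₂ away m (ℕₚ.m⊔n≤o⇒n≤o N _ r)
            an = proj₂ away n (ℕₚ.m⊔n≤o⇒n≤o N _ s) in
        ≤-trans (∣∣-cong-≤ (trans (trans (ring! (v m ∷ v n ∷ []) λ x y → x :- y := x :* κ# 1 :- y :* κ# 1)
            (+-cong (*-congˡ (sym (uv≈1 an))) (-‿cong (*-congˡ (sym (uv≈1 am))))))
            (ring! (u m ∷ u n ∷ v m ∷ v n ∷ []) λ a b x y → x :* (b :* y) :- y :* (a :* x) := x :* y :* (b :- a))))
          (≤-trans (∣*∣-≤ (∣*∣-≤ (v≤d am) (v≤d an)) (h n m (ℕₚ.m⊔n≤o⇒m≤o N _ s) (ℕₚ.m⊔n≤o⇒m≤o N _ r))) q) } }

    reciprocal-null : Null (λ n → u n * v n - # 1)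
    reciprocal-null ε 0<ε = eventually-map (λ n p → ≤-trans (∣∣-cong-≤ (trans (+-congʳ (uv≈1 p)) (ring! [] (κ# 1 :- κ# 1 := κ# 0))))
      (≤-trans (≤-reflexive (∣#∣ 0)) (0≤⇒≤ (0<⇒0≤ 0<ε)))) away

  -- The diagonal sequence converges to the common point.
  module Nested (l u : ℕ → Sequence) (cl : ∀ n → Cauchy (l n)) (cu : ∀ n → Cauchy (u n))
    (l-up : ∀ n → NonNegative (λ i → l (suc n) i - l n i)) (u-down : ∀ n → NonNegative (λ i → u n i - u (suc n) i))
    (l≤u : ∀ n → NonNegative (λ i → u n i - l n i))
    (width : ∀ n → NonNegative (λ i → (u 0 i - l 0 i) - # 2 ^ n * (u n i - l n i))) where

    nonNegative-sum : ∀ {a b c} → (∀ i → a i + b i ≈ c i) → NonNegative a → NonNegative b → NonNegative c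
    nonNegative-sum eq p q ε 0<ε = eventually-map (λ n → 0≤-resp (+-congʳ (eq n))) (nonNegative-+ p q ε 0<ε)

    nonNegative-const : ∀ {a} → (∀ i → 0≤ a i) → NonNegative a
    nonNegative-const p ε 0<ε = 0 , λ n _ → p n ⊹ 0<⇒0≤ 0<ε

    l-mono : ∀ d n → NonNegative (λ i → l (d ℕ.+ n) i - l n i)
    l-mono zero n = nonNegative-const λ i → ≤-refl
    l-mono (suc d) n = nonNegative-sum (λ i → ring! (l (suc d ℕ.+ n) i ∷ l (d ℕ.+ n) i ∷ l n i ∷ []) λ a b c → (a :- b) :+ (b :- c) := a :- c) (l-up (d ℕ.+ n)) (l-mono d n)

    u-mono : ∀ d n → NonNegative (λ i → u n i - u (d ℕ.+ n) i)
    u-mono zero n = nonNegative-const λ i → ≤-refl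
    u-mono (suc d) n = nonNegative-sum (λ i → ring! (u n i ∷ u (d ℕ.+ n) i ∷ u (suc d ℕ.+ n) i ∷ []) λ a b c → (a :- b) :+ (b :- c) := a :- c) (u-mono d n) (u-down (d ℕ.+ n))

    h : K
    h = proj₁ half
    0<h : 0< h
    0<h = proj₁ (proj₂ half)
    2h≈1 : # 2 * h ≈ # 1
    2h≈1 = trans (ring! (h ∷ []) λ h → κ# 2 :* h := h :+ h) (proj₂ (proj₂ half))
    0<h^ : ∀ n → 0< h ^ n
    0<h^ n = 0<-^ n 0<h
    2^h^ : ∀ n → # 2 ^ n * h ^ n ≈ # 1
    2^h^ n = trans (sym (^-* (# 2) h n)) (trans (^-congˡ n 2h≈1) (1^ n))
    h^≤ : ∀ {m n} → m ℕ.≤ n → h ^ n ≤ h ^ m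
    h^≤ = ^-antiʳ-≤ (0<⇒0≤ 0<h) (by (h ∷ []) (λ h → h :+ (κ# 1 :- κ# 2 :* h) ⊢ h :≤ κ# 1) (0<⇒0≤ 0<h ⊹ ≤-reflexive 2h≈1))
    dyadic-small : ∀ {ε} → 0< ε → ∀ C → 0≤ C → ∃ λ n → C * h ^ n ≤ ε
    dyadic-small {ε} 0<ε C 0≤C = case reach 0<ε C of λ { (n , _ , q) → n , *-cancelˡ-≤ (0<-^ n (0<# 1))
      (≤-trans (≤-reflexive (trans (ring! (# 2 ^ n ∷ C ∷ h ^ n ∷ []) λ t C x → t :* (C :* x) := C :* (t :* x)) (trans (*-congˡ (2^h^ n)) (*1≈ C))))
        (≤-trans q (*-monoʳ-≤ (0<⇒0≤ 0<ε) (≤-trans (#-mono (n≤2^n n)) (≤-reflexive (#-^ 2 n)))))) }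

    -- The diagonal reads `l n` so late that it varies by at most `h ^ n` afterwards, where `h` is
    -- one half. With the intervals shrinking at the same rate, the diagonal becomes a Cauchy
    -- sequence.
    index : ℕ → ℕ
    index n = proj₁ (cl n (h ^ n) (0<h^ n))

    x : Sequence
    x n = l n (index n)

    x-close : ∀ n i → index n ℕ.≤ i → ∣ x n - l n i ∣ ≤ h ^ n
    x-close n i p = proj₂ (cl n (h ^ n) (0<h^ n)) (index n) i ℕₚ.≤-refl p

    private
      bound : Bounded (λ i → u 0 i - l 0 i)
      bound = case cauchy-bounded (cu 0) of λ { (B , 0≤B , bu) → case cauchy-bounded (cl 0) of λ { (C , 0≤C , bl) →
        B + C , 0≤B ⊹ 0≤C , eventually (λ n p q → ∣-∣-≤ p q) bu bl } }
      D : K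
      D = proj₁ bound
      0≤D : 0≤ D
      0≤D = proj₁ (proj₂ bound)

    narrow : ∀ n → Eventually λ i → u n i - l n i ≤ (# 1 + D) * h ^ n
    narrow n = eventually (λ i p q → *-cancelˡ-≤ (0<-^ n (0<# 1)) (≤-trans
        (by (u 0 i - l 0 i ∷ # 2 ^ n * (u n i - l n i) ∷ D ∷ []) (λ w z D → (w :- z :+ κ# 1) :+ (D :- w) ⊢ z :≤ κ# 1 :+ D) (p ⊹ ≤-trans (x≤∣x∣ _) q))
        (≤-reflexive (sym (trans (ring! (# 2 ^ n ∷ D ∷ h ^ n ∷ []) λ t D x → t :* ((κ# 1 :+ D) :* x) := (κ# 1 :+ D) :* (t :* x)) (trans (*-congˡ (2^h^ n)) (*1≈ _)))))))
      (width n (# 1) 0<1) (proj₂ (proj₂ bound))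

    gap : ∀ d n → Eventually λ i → ∣ l (d ℕ.+ n) i - l n i ∣ ≤ (# 3 + D) * h ^ n
    gap d n = eventually (λ i pq rs → ∣∣-≤
        (by (l (d ℕ.+ n) i ∷ l n i ∷ u (d ℕ.+ n) i ∷ u n i ∷ D ∷ h ^ n ∷ []) (λ a b c e D x → (e :- c :+ x) :+ (c :- a :+ x) :+ ((κ# 1 :+ D) :* x :- (e :- b)) ⊢ a :- b :≤ (κ# 3 :+ D) :* x)
          (proj₂ pq ⊹ proj₁ rs ⊹ proj₂ rs))
        (by (l (d ℕ.+ n) i ∷ l n i ∷ D ∷ h ^ n ∷ []) (λ a b D x → (a :- b :+ x) :+ (κ# 2 :+ D) :* x ⊢ :- (a :- b) :≤ (κ# 3 :+ D) :* x)
          (proj₁ pq ⊹ (0≤# 2 ⊹ 0≤D) · 0<⇒0≤ (0<h^ n))))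
      (eventually (λ i → _,_) (l-mono d n (h ^ n) (0<h^ n)) (u-mono d n (h ^ n) (0<h^ n)))
      (eventually (λ i → _,_) (l≤u (d ℕ.+ n) (h ^ n) (0<h^ n)) (narrow n))

    x-gap-at : ∀ d n i → ∣ l (d ℕ.+ n) i - l n i ∣ ≤ (# 3 + D) * h ^ n → index (d ℕ.+ n) ℕ.≤ i → index n ℕ.≤ i → ∣ x (d ℕ.+ n) - x n ∣ ≤ (# 5 + D) * h ^ n
    x-gap-at d n i q r s = ≤-trans (triangle {x (d ℕ.+ n)} {x n} {l (d ℕ.+ n) i} {l n i} (≤-trans (x-close (d ℕ.+ n) i r) (h^≤ (ℕₚ.m≤n+m n d))) q (x-close n i s))
      (≤-reflexive (ring! (D ∷ h ^ n ∷ []) λ D x → x :+ (κ# 3 :+ D) :* x :+ x := (κ# 5 :+ D) :* x))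
      where
      triangle : ∀ {a b c e p q r} → ∣ a - c ∣ ≤ p → ∣ c - e ∣ ≤ q → ∣ b - e ∣ ≤ r → ∣ a - b ∣ ≤ p + q + r
      triangle {a} {b} {c} {e} u v w = ≤-trans (∣∣-cong-≤ (ring! (a ∷ b ∷ c ∷ e ∷ []) λ a b c e → a :- b := (a :- c) :+ (c :- e) :- (b :- e)))
        (∣-∣-≤ (∣+∣-≤ u v) w)

    x-gap : ∀ d n → ∣ x (d ℕ.+ n) - x n ∣ ≤ (# 5 + D) * h ^ n
    x-gap d n = case gap d n of λ { (N , q) → x-gap-at d n (N ℕ.⊔ (index (d ℕ.+ n) ℕ.⊔ index n)) (q _ (ℕₚ.m≤m⊔n N _))
      (ℕₚ.≤-trans (ℕₚ.m≤m⊔n (index (d ℕ.+ n)) (index n)) (ℕₚ.m≤n⊔m N _)) (ℕₚ.≤-trans (ℕₚ.m≤n⊔m (index (d ℕ.+ n)) (index n)) (ℕₚ.m≤n⊔m N _)) }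

    x-cauchy : Cauchy x
    x-cauchy ε 0<ε = case dyadic-small 0<ε (# 2 * (# 5 + D)) (0≤# 2 · (0≤# 5 ⊹ 0≤D)) of λ { (N , q) → N , λ m n r s →
      ≤-trans (∣∣-cong-≤ (ring! (x m ∷ x n ∷ x N ∷ []) λ a b c → a :- b := (a :- c) :- (b :- c)))
        (≤-trans (∣-∣-≤ (from N m r) (from N n s)) (≤-trans (≤-reflexive (ring! (D ∷ h ^ N ∷ []) λ D x → (κ# 5 :+ D) :* x :+ (κ# 5 :+ D) :* x := κ# 2 :* (κ# 5 :+ D) :* x)) q)) }
      where
      from : ∀ N m → N ℕ.≤ m → ∣ x m - x N ∣ ≤ (# 5 + D) * h ^ N
      from N m r = ≡.subst (λ k → ∣ x k - x N ∣ ≤ (# 5 + D) * h ^ N) (ℕₚ.m∸n+n≡m r) (x-gap (m ℕ.∸ N) N)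

    near : ∀ n m i → index m ℕ.≤ i → n ℕ.≤ m → ∀ {ε} → (# 5 + D) * h ^ m ≤ ε → ∀ k → m ℕ.≤ k → ∣ x k - l m i ∣ ≤ ε + h ^ m
    near n m i p _ q k r = ≤-trans (∣∣-cong-≤ (ring! (x k ∷ l m i ∷ x m ∷ []) λ a b c → a :- b := (a :- c) :+ (c :- b)))
      (∣+∣-≤ (≤-trans (≡.subst (λ k → ∣ x k - x m ∣ ≤ (# 5 + D) * h ^ m) (ℕₚ.m∸n+n≡m r) (x-gap (k ℕ.∸ m) m)) q) (x-close m i p))

    -- Compare with l m and u m for m large, where all three differ by little.
    x-lower : ∀ n → NonNegative (λ i → x i - l n i)
    x-lower n ε 0<ε = case dyadic-small 0<ε (# 7 + D) (0≤# 7 ⊹ 0≤D) of λ { (d , q) →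
      let m = d ℕ.+ n
          q′ = ≤-trans (*-monoˡ-≤ (0≤# 7 ⊹ 0≤D) (h^≤ (ℕₚ.m≤m+n d n))) q in
      eventually (λ i p r → by-sum m i p (proj₁ r) (proj₂ r) q′) (l-mono d n (h ^ m) (0<h^ m)) (m ℕ.⊔ index m , λ i r → ℕₚ.m⊔n≤o⇒m≤o m (index m) r , ℕₚ.m⊔n≤o⇒n≤o m (index m) r) }
      where
      by-sum : ∀ m i → 0≤ l m i - l n i + h ^ m → m ℕ.≤ i → index m ℕ.≤ i → (# 7 + D) * h ^ m ≤ ε → 0≤ x i - l n i + ε
      by-sum m i p r s q = 0≤-resp (ring! (x i ∷ l n i ∷ l m i ∷ D ∷ h ^ m ∷ ε ∷ []) λ x a b D t e →
          ((κ# 5 :+ D) :* t :+ t :- (:- (x :- b))) :+ (b :- a :+ t) :+ (e :- (κ# 7 :+ D) :* t) := x :- a :+ e)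
        (≤-trans (-x≤∣x∣ _) (near m m i s ℕₚ.≤-refl ≤-refl i r) ⊹ p ⊹ q)

    x-upper : ∀ n → NonNegative (λ i → u n i - x i)
    x-upper n ε 0<ε = case dyadic-small 0<ε (# 8 + D) (0≤# 8 ⊹ 0≤D) of λ { (d , q) →
      let m = d ℕ.+ n
          q′ = ≤-trans (*-monoˡ-≤ (0≤# 8 ⊹ 0≤D) (h^≤ (ℕₚ.m≤m+n d n))) q in
      eventually (λ i p r → by-sum m i (proj₁ p) (proj₂ p) (proj₁ r) (proj₂ r) q′)
        (eventually (λ i → _,_) (u-mono d n (h ^ m) (0<h^ m)) (l≤u m (h ^ m) (0<h^ m)))
        (m ℕ.⊔ index m , λ i r → ℕₚ.m⊔n≤o⇒m≤o m (index m) r , ℕₚ.m⊔n≤o⇒n≤o m (index m) r) }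
      where
      by-sum : ∀ m i → 0≤ u n i - u m i + h ^ m → 0≤ u m i - l m i + h ^ m → m ℕ.≤ i → index m ℕ.≤ i → (# 8 + D) * h ^ m ≤ ε → 0≤ u n i - x i + ε
      by-sum m i p p′ r s q = 0≤-resp (ring! (x i ∷ u n i ∷ u m i ∷ l m i ∷ D ∷ h ^ m ∷ ε ∷ []) λ x a c b D t e →
          ((κ# 5 :+ D) :* t :+ t :- (x :- b)) :+ (a :- c :+ t) :+ (c :- b :+ t) :+ (e :- (κ# 8 :+ D) :* t) := a :- x :+ e)
        (≤-trans (x≤∣x∣ _) (near m m i s ℕₚ.≤-refl ≤-refl i r) ⊹ p ⊹ p′ ⊹ q)

module Analytic (𝕂 : RealField) (em : ExcludedMiddle 0ℓ) where
  open Basics (RealField.ordered 𝕂) em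
  open RealField 𝕂 using (complete)
  open import Data.Nat.Base as ℕ using (ℕ; zero; suc; z≤n; s≤s)
  import Data.Nat.Properties as ℕₚ
  open import Data.Product.Base using (∃; ∃₂; Σ; _×_; _,_; proj₁; proj₂)
  open import Data.Sum.Base using (_⊎_; inj₁; inj₂; [_,_]′)
  open import Data.Vec.Base using (_∷_; []; Vec)
  open import Data.Empty using (⊥; ⊥-elim)
  open import Relation.Binary.PropositionalEquality as ≡ using (_≡_)
  open import Function.Base using (case_of_)
  open import Relation.Nullary.Negation.Core using (¬_)
  open import Relation.Nullary.Decidable.Core using (Dec; yes; no; decidable-stable)
  open import Data.Nat.Induction using (<-rec)
  open import Relation.Binary.Definitions using (Tri; tri<; tri≈; tri>)
  open import Data.Nat.DivMod using (_/_; _%_; m%n<n; [m+kn]%n≡m%n; m<n⇒m%n≡m; m≡m%n+[m/n]*n; +-distrib-/; m<n⇒m/n≡0; m*n/n≡m; m<n*o⇒m/o<n; m*n%n≡0)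
  open import Data.Fin.Base as Fin using (Fin; toℕ; fromℕ<)
  open import Data.Fin.Properties using (pigeonhole; toℕ-fromℕ<; toℕ<n)
  open import Data.Nat.Tactic.RingSolver using (solve-∀)
  open import Data.Nat.Divisibility using (_∣_; divides)
  open import Data.Nat.Primality using (euclidsLemma; prime[2])
  open import Data.List.Base using (List) renaming (_∷_ to _∷ˡ_; [] to []ˡ)
  open import Data.List.Relation.Unary.All using (All) renaming (_∷_ to _∷ᵃ_; [] to []ᵃ)

  -- Sequences and finite sums

  infixr 5 _◂_

  _◂_ : K → (ℕ → K) → ℕ → K
  (x ◂ f) zero = x
  (x ◂ f) (suc i) = f i

  tail : (ℕ → K) → ℕ → K
  tail f i = f (suc i)

  ∑ : ℕ → (ℕ → K) → K
  ∑ zero f = # 0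
  ∑ (suc n) f = f 0 + ∑ n (tail f)

  ∑-cong : ∀ n {f g} → (∀ i → i ℕ.< n → f i ≈ g i) → ∑ n f ≈ ∑ n g
  ∑-cong zero h = refl
  ∑-cong (suc n) h = +-cong (h 0 (s≤s z≤n)) (∑-cong n λ i p → h (suc i) (s≤s p))

  ∑-mono : ∀ n {f g} → (∀ i → i ℕ.< n → f i ≤ g i) → ∑ n f ≤ ∑ n g
  ∑-mono zero h = ≤-refl
  ∑-mono (suc n) h = +-mono-≤ (h 0 (s≤s z≤n)) (∑-mono n λ i p → h (suc i) (s≤s p))

  ∑-const : ∀ n c → ∑ n (λ _ → c) ≈ # n * c
  ∑-const zero c = ring! (c ∷ []) λ c → κ# 0 := κ# 0 :* c
  ∑-const (suc n) c = trans (+-congˡ (∑-const n c))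
    (trans (ring! (c ∷ # n ∷ []) λ c n → c :+ n :* c := (κ# 1 :+ n) :* c) (*-congʳ (sym (#-suc n))))

  ∑-bound : ∀ n {f c} → (∀ i → i ℕ.< n → f i ≤ c) → ∑ n f ≤ # n * c
  ∑-bound n {c = c} h = ≤-trans (∑-mono n h) (≤-reflexive (∑-const n c))

  ∑-zero : ∀ n {f} → (∀ i → i ℕ.< n → f i ≈ # 0) → ∑ n f ≈ # 0
  ∑-zero n h = trans (∑-cong n h) (trans (∑-const n (# 0)) (*0≈ _))

  ∑-+ : ∀ n f g → ∑ n (λ i → f i + g i) ≈ ∑ n f + ∑ n g
  ∑-+ zero f g = ring! [] (κ# 0 := κ# 0 :+ κ# 0)
  ∑-+ (suc n) f g = trans (+-congˡ (∑-+ n (tail f) (tail g)))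
    (ring! (f 0 ∷ g 0 ∷ ∑ n (tail f) ∷ ∑ n (tail g) ∷ []) λ a b c d → (a :+ b) :+ (c :+ d) := (a :+ c) :+ (b :+ d))

  ∑-* : ∀ n c f → ∑ n (λ i → c * f i) ≈ c * ∑ n f
  ∑-* zero c f = sym (*0≈ c)
  ∑-* (suc n) c f = trans (+-congˡ (∑-* n c (tail f))) (sym (distribˡ c _ _))

  0≤∑ : ∀ n {f} → (∀ i → i ℕ.< n → 0≤ f i) → 0≤ ∑ n f
  0≤∑ zero h = 0≤0
  0≤∑ (suc n) h = h 0 (s≤s z≤n) ⊹ 0≤∑ n (λ i p → h (suc i) (s≤s p))

  ∣∑∣ : ∀ n f → ∣ ∑ n f ∣ ≤ ∑ n (λ i → ∣ f i ∣)
  ∣∑∣ zero f = ≤-reflexive (∣#∣ 0)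
  ∣∑∣ (suc n) f = ∣+∣-≤ ≤-refl (∣∑∣ n (tail f))

  ∣∑∣-bound : ∀ n {f c} → (∀ i → i ℕ.< n → ∣ f i ∣ ≤ c) → ∣ ∑ n f ∣ ≤ # n * c
  ∣∑∣-bound n {f} h = ≤-trans (∣∑∣ n f) (∑-bound n h)

  term≤∑ : ∀ n {f} → (∀ i → i ℕ.< n → 0≤ f i) → ∀ i → i ℕ.< n → f i ≤ ∑ n f
  term≤∑ (suc n) {f} h zero p = by (f 0 ∷ ∑ n (tail f) ∷ []) (λ a b → b ⊢ a :≤ a :+ b) (0≤∑ n (λ i p → h (suc i) (s≤s p)))
  term≤∑ (suc n) {f} h (suc i) (s≤s p) = ≤-trans (term≤∑ n (λ i p → h (suc i) (s≤s p)) i p)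
    (by (f 0 ∷ ∑ n (tail f) ∷ []) (λ a b → a ⊢ b :≤ a :+ b) (h 0 (s≤s z≤n)))

  ∑-swap : ∀ m n (f : ℕ → ℕ → K) → ∑ m (λ i → ∑ n (f i)) ≈ ∑ n (λ j → ∑ m (λ i → f i j))
  ∑-swap zero n f = sym (∑-zero n λ _ _ → refl)
  ∑-swap (suc m) n f = trans (+-congˡ (∑-swap m n (λ i → f (suc i)))) (sym (∑-+ n (f 0) _))

  δ : ℕ → ℕ → K
  δ zero zero = # 1
  δ zero (suc j) = # 0
  δ (suc i) zero = # 0
  δ (suc i) (suc j) = δ i j

  δ-same : ∀ i → δ i i ≡ # 1
  δ-same zero = ≡.refl
  δ-same (suc i) = δ-same i

  δ-diff : ∀ i j → ¬ i ≡ j → δ i j ≡ # 0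
  δ-diff zero zero p = ⊥-elim (p ≡.refl)
  δ-diff zero (suc j) p = ≡.refl
  δ-diff (suc i) zero p = ≡.refl
  δ-diff (suc i) (suc j) p = δ-diff i j λ q → p (≡.cong suc q)

  ∑-δ : ∀ n f i → i ℕ.< n → ∑ n (λ k → f k * δ k i) ≈ f i
  ∑-δ (suc n) f zero p = trans (+-cong (*1≈ _) (∑-zero n λ k _ → *0≈ _)) (+0≈ _)
  ∑-δ (suc n) f (suc i) (s≤s p) = trans (+-cong (*0≈ _) (∑-δ n (tail f) i p)) (0+≈ _)

  ∑-++ : ∀ m n f → ∑ (m ℕ.+ n) f ≈ ∑ m f + ∑ n (λ i → f (m ℕ.+ i))
  ∑-++ zero n f = sym (0+≈ _)
  ∑-++ (suc m) n f = trans (+-congˡ (∑-++ m n (tail f))) (sym (+-assoc _ _ _))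

  -- Polynomials

  ev : ℕ → (ℕ → K) → K → K
  ev zero e x = # 0
  ev (suc n) e x = e 0 + x * ev n (tail e) x

  ev-cong : ∀ n {e e′} {x} → (∀ i → i ℕ.< n → e i ≈ e′ i) → ev n e x ≈ ev n e′ x
  ev-cong zero h = refl
  ev-cong (suc n) h = +-cong (h 0 (s≤s z≤n)) (*-congˡ (ev-cong n λ i p → h (suc i) (s≤s p)))

  ev-congʳ : ∀ n e {x y} → x ≈ y → ev n e x ≈ ev n e y
  ev-congʳ zero e p = refl
  ev-congʳ (suc n) e p = +-congˡ (*-cong p (ev-congʳ n (tail e) p))

  ev-0 : ∀ n {e} x → (∀ i → i ℕ.< n → e i ≈ # 0) → ev n e x ≈ # 0
  ev-0 zero x h = refl
  ev-0 (suc n) x h = trans (+-cong (h 0 (s≤s z≤n)) (*-congˡ (ev-0 n x λ i p → h (suc i) (s≤s p))))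
    (ring! (x ∷ []) λ x → κ# 0 :+ x :* κ# 0 := κ# 0)

  ev-+ : ∀ n e e′ x → ev n (λ i → e i + e′ i) x ≈ ev n e x + ev n e′ x
  ev-+ zero e e′ x = ring! [] (κ# 0 := κ# 0 :+ κ# 0)
  ev-+ (suc n) e e′ x = trans (+-congˡ (*-congˡ (ev-+ n (tail e) (tail e′) x)))
    (ring! (e 0 ∷ e′ 0 ∷ x ∷ ev n (tail e) x ∷ ev n (tail e′) x ∷ []) λ a b x c d →
      (a :+ b) :+ x :* (c :+ d) := (a :+ x :* c) :+ (b :+ x :* d))

  ev-* : ∀ n c e x → ev n (λ i → c * e i) x ≈ c * ev n e x
  ev-* zero c e x = sym (*0≈ c)
  ev-* (suc n) c e x = trans (+-congˡ (*-congˡ (ev-* n c (tail e) x)))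
    (ring! (c ∷ e 0 ∷ x ∷ ev n (tail e) x ∷ []) λ c a x b → c :* a :+ x :* (c :* b) := c :* (a :+ x :* b))

  ev-∑ : ∀ T n (c : ℕ → K) (g : ℕ → ℕ → K) x →
    ev T (λ l → ∑ n (λ k → c k * g k l)) x ≈ ∑ n (λ k → c k * ev T (g k) x)
  ev-∑ T zero c g x = ev-0 T x (λ _ _ → refl)
  ev-∑ T (suc n) c g x = trans (ev-+ T (λ l → c 0 * g 0 l) _ x)
    (+-cong (ev-* T (c 0) (g 0) x) (ev-∑ T n (tail c) (λ k → g (suc k)) x))

  ev-++ : ∀ m n e x → ev (m ℕ.+ n) e x ≈ ev m e x + x ^ m * ev n (λ i → e (m ℕ.+ i)) x
  ev-++ zero n e x = ring! (ev n e x ∷ []) λ a → a := κ# 0 :+ κ# 1 :* a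
  ev-++ (suc m) n e x = trans (+-congˡ (*-congˡ (ev-++ m n (tail e) x)))
    (ring! (e 0 ∷ x ∷ ev m (tail e) x ∷ x ^ m ∷ ev n (λ i → e (suc m ℕ.+ i)) x ∷ []) λ a x b p c →
      a :+ x :* (b :+ p :* c) := (a :+ x :* b) :+ x :* p :* c)

  ev-∑^ : ∀ n e x → ev n e x ≈ ∑ n (λ i → e i * x ^ i)
  ev-∑^ zero e x = refl
  ev-∑^ (suc n) e x = +-cong (sym (*1≈ _)) (trans (*-congˡ (ev-∑^ n (tail e) x))
    (trans (sym (∑-* n x _)) (∑-cong n λ i _ →
      ring! (x ∷ e (suc i) ∷ x ^ i ∷ []) λ x a p → x :* (a :* p) := a :* (x :* p))))

  ev-leading : ∀ l e s → (∀ i → i ℕ.< l → e i ≈ # 0) → ev (suc l) e s ≈ s ^ l * e l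
  ev-leading l e s h = trans (trans (reflexive (≡.cong (λ n → ev n e s) (ℕₚ.+-comm 1 l))) (ev-++ l 1 e s))
    (trans (+-cong (ev-0 l s h) (*-congˡ (+-cong (reflexive (≡.cong e (ℕₚ.+-identityʳ l))) (*0≈ s))))
      (trans (0+≈ _) (*-congˡ (+0≈ _))))

  ev-bound : ∀ n {e B x} → (∀ i → i ℕ.< n → ∣ e i ∣ ≤ B) → ∣ x ∣ ≤ # 1 → ∣ ev n e x ∣ ≤ # n * B
  ev-bound n {e} {B} {x} h p = ≤-trans (∣∣-cong-≤ (ev-∑^ n e x)) (∣∑∣-bound n λ i i<n →
    ≤-trans (∣*∣-≤ (h i i<n) (≤-trans (≤-reflexive (∣^∣ x i)) (^-≤1 i (0≤∣∣ x) p))) (≤-reflexive (*1≈ B)))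

  ev-bound′ : ∀ n {e B x X} → (∀ i → i ℕ.< n → ∣ e i ∣ ≤ B) → ∣ x ∣ ≤ X → # 1 ≤ X → ∣ ev n e x ∣ ≤ # n * (B * X ^ n)
  ev-bound′ n {e} {B} {x} {X} h p q = ≤-trans (∣∣-cong-≤ (ev-∑^ n e x)) (∣∑∣-bound n λ i i<n →
    ∣*∣-≤ (h i i<n) (≤-trans (≤-reflexive (∣^∣ x i)) (≤-trans (^-mono-≤ i (0≤∣∣ x) p) (^-monoʳ-≤ q (ℕₚ.<⇒≤ i<n)))))

  ev-geometric : ∀ n {e B R x} → 0≤ B → 0≤ R → (∀ i → ∣ e i ∣ ≤ B * R ^ i) → # 2 * (R * ∣ x ∣) ≤ # 1 →
    ∣ ev n e x ∣ ≤ # 2 * B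
  ev-geometric zero {B = B} p q h r = ≤-trans (≤-reflexive (∣#∣ 0)) (0≤⇒≤ (0≤# 2 · p))
  ev-geometric (suc n) {e} {B} {R} {x} p q h r = ≤-trans
    (∣+∣-≤ (h 0) (∣*∣-≤ {x} ≤-refl (ev-geometric n (p · q) q (λ i → ≤-trans (h (suc i))
      (≤-reflexive (ring! (B ∷ R ∷ R ^ i ∷ []) λ B R p → B :* (R :* p) := B :* R :* p))) r)))
    (by (B ∷ R ∷ ∣ x ∣ ∷ []) (λ B R x → B :* (κ# 1 :- κ# 2 :* (R :* x)) ⊢ B :* κ# 1 :+ x :* (κ# 2 :* (B :* R)) :≤ κ# 2 :* B) (p · r))

  ev-top : ∀ n {e x} → e n ≈ # 0 → ev (suc n) e x ≈ ev n e x
  ev-top zero {e} {x} p = trans (+-cong p refl) (ring! (x ∷ []) λ x → κ# 0 :+ x :* κ# 0 := κ# 0)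
  ev-top (suc n) p = +-congˡ (*-congˡ (ev-top n p))

  ev-scale : ∀ n e v x → ev n (λ i → e i * v ^ i) x ≈ ev n e (v * x)
  ev-scale zero e v x = refl
  ev-scale (suc n) e v x = +-cong (*1≈ _) (trans (*-congˡ (trans
    (ev-cong n λ i _ → ring! (e (suc i) ∷ v ∷ v ^ i ∷ []) λ a v p → a :* (v :* p) := v :* (a :* p))
    (trans (ev-* n v _ x) (*-congˡ (ev-scale n (tail e) v x)))))
    (ring! (x ∷ v ∷ ev n (tail e) (v * x) ∷ []) λ x v a → x :* (v :* a) := v :* x :* a))

  -- The coefficients in y of the polynomial at s + y, that is, its divided derivatives at s,
  -- computed by Horner's scheme.
  tay : ℕ → K → (ℕ → K) → ℕ → K
  tay zero s e j = # 0
  tay (suc n) s e zero = e 0 + s * tay n s (tail e) 0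
  tay (suc n) s e (suc j) = s * tay n s (tail e) (suc j) + tay n s (tail e) j

  tay-top : ∀ n s e j → n ℕ.≤ j → tay n s e j ≈ # 0
  tay-top zero s e j p = refl
  tay-top (suc n) s e (suc j) (s≤s p) = trans
    (+-cong (*-congˡ (tay-top n s (tail e) (suc j) (ℕₚ.m≤n⇒m≤1+n p))) (tay-top n s (tail e) j p))
    (ring! (s ∷ []) λ s → s :* κ# 0 :+ κ# 0 := κ# 0)

  ev-tay : ∀ n s e y → ev n (tay n s e) y ≈ ev n e (s + y)
  ev-tay zero s e y = refl
  ev-tay (suc n) s e y = trans
    (+-congˡ (*-congˡ (trans (ev-+ n (λ j → s * S (suc j)) S y) (+-congʳ (ev-* n s (tail S) y)))))
    (trans (ring! (e 0 ∷ s ∷ y ∷ S 0 ∷ ev n (tail S) y ∷ ev n S y ∷ []) λ a s y b c d →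
        (a :+ s :* b) :+ y :* (s :* c :+ d) := a :+ (s :* (b :+ y :* c) :+ y :* d))
      (+-congˡ (trans (+-cong (*-congˡ (trans (ev-top n (tay-top n s (tail e) n ℕₚ.≤-refl)) (ev-tay n s (tail e) y)))
        (*-congˡ (ev-tay n s (tail e) y))) (sym (distribʳ _ s y)))))
    where
    S = tay n s (tail e)

  -- For s of absolute value at most 1 each Horner step at most doubles the coefficients; this
  -- explains the power of 2.
  tay-bound : ∀ n {s e B} → (∀ i → i ℕ.< n → ∣ e i ∣ ≤ B) → 0≤ B → ∣ s ∣ ≤ # 1 → ∀ j → ∣ tay n s e j ∣ ≤ # 2 ^ n * B
  tay-bound zero {B = B} h 0≤B p j = ≤-trans (≤-reflexive (∣#∣ 0)) (0≤⇒≤ (0≤1 · 0≤B))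
  tay-bound (suc n) {s} {e} {B} h 0≤B p zero = ≤-trans
    (∣+∣-≤ (h 0 (s≤s z≤n)) (∣*∣-≤ p (tay-bound n (λ i q → h (suc i) (s≤s q)) 0≤B p 0)))
    (by (B ∷ # 2 ^ n ∷ []) (λ B t → (t :- κ# 1) :* B ⊢ B :+ κ# 1 :* (t :* B) :≤ κ# 2 :* t :* B) (1≤-^ n (1≤# (s≤s z≤n)) · 0≤B))
  tay-bound (suc n) {s} {e} {B} h 0≤B p (suc j) = ≤-trans
    (∣+∣-≤ (∣*∣-≤ p (tay-bound n h′ 0≤B p (suc j))) (tay-bound n h′ 0≤B p j))
    (≤-reflexive (ring! (B ∷ # 2 ^ n ∷ []) λ B t → κ# 1 :* (t :* B) :+ t :* B := κ# 2 :* t :* B))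
    where
    h′ = λ i q → h (suc i) (s≤s q)

  -- Synthetic division by x - x₀.
  quot : ℕ → (ℕ → K) → K → ℕ → K
  quot zero e x₀ j = # 0
  quot (suc n) e x₀ zero = ev n (tail e) x₀
  quot (suc n) e x₀ (suc j) = quot n (tail e) x₀ j

  quot-top : ∀ n e x₀ → quot (suc n) e x₀ n ≈ # 0
  quot-top zero e x₀ = refl
  quot-top (suc n) e x₀ = quot-top n (tail e) x₀

  ev-quot : ∀ n e x₀ x → ev n e x ≈ ev n e x₀ + (x - x₀) * ev n (quot n e x₀) x
  ev-quot zero e x₀ x = ring! (x ∷ x₀ ∷ []) λ x x₀ → κ# 0 := κ# 0 :+ (x :- x₀) :* κ# 0
  ev-quot (suc n) e x₀ x = trans (+-congˡ (*-congˡ (ev-quot n (tail e) x₀ x)))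
    (ring! (e 0 ∷ x ∷ x₀ ∷ ev n (tail e) x₀ ∷ ev n (quot n (tail e) x₀) x ∷ []) λ a x x₀ b c →
      a :+ x :* (b :+ (x :- x₀) :* c) := (a :+ x₀ :* b) :+ (x :- x₀) :* (b :+ x :* c))

  ev-quot′ : ∀ n e x₀ x → ev (suc n) e x ≈ ev (suc n) e x₀ + (x - x₀) * ev n (quot (suc n) e x₀) x
  ev-quot′ n e x₀ x = trans (ev-quot (suc n) e x₀ x) (+-congˡ (*-congˡ (ev-top n (quot-top n e x₀))))

  quot-suc : ∀ n e x₀ j → j ℕ.< n → e (suc j) ≈ quot (suc n) e x₀ j - x₀ * quot (suc n) e x₀ (suc j)
  quot-suc (suc n) e x₀ zero p = ring! (e 1 ∷ x₀ ∷ ev n (tail (tail e)) x₀ ∷ []) λ a x b → a := (a :+ x :* b) :- x :* b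
  quot-suc (suc n) e x₀ (suc j) (s≤s p) = quot-suc n (tail e) x₀ j p

  interpolation-constant : ℕ → ℕ → K
  interpolation-constant zero N = # 1
  interpolation-constant (suc n) N = # 1 + # 2 * (# 1 + # N) * interpolation-constant n N

  1≤interpolation-constant : ∀ n N → # 1 ≤ interpolation-constant n N
  1≤interpolation-constant zero N = ≤-refl
  1≤interpolation-constant (suc n) N = by (# N ∷ interpolation-constant n N ∷ [])
    (λ N C → κ# 2 :* (κ# 1 :+ N) :* C ⊢ κ# 1 :≤ κ# 1 :+ κ# 2 :* (κ# 1 :+ N) :* C)
    (0≤# 2 · (0≤1 ⊹ 0≤# N) · 1≤⇒0≤ (1≤interpolation-constant n N))

  -- Newton's method: after division by x minus the last node, the quotient has one coefficient
  -- less, and its values at the other nodes are at most 2ε because distinct integers are at least 1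
  -- apart. The constant depends on the number of nodes and on their bound N, but not on the nodes
  -- themselves.
  interpolation : ∀ n N (k : ℕ → ℕ) → (∀ i → i ℕ.< n → k i ℕ.≤ N) →
    (∀ i j → i ℕ.< j → j ℕ.< n → k i ℕ.< k j) →
    ∀ e {ε} → (∀ i → i ℕ.< n → ∣ ev n e (# (k i)) ∣ ≤ ε) → ∀ j → j ℕ.< n → ∣ e j ∣ ≤ interpolation-constant n N * ε
  interpolation (suc n) N k k≤N k-mono e {ε} h = result
    where
    C = interpolation-constant n N
    x₀ = # (k n)
    q = quot (suc n) e x₀
    0≤ε : 0≤ ε
    0≤ε = ≤⇒0≤ (≤-trans (0≤⇒≤ (0≤∣∣ _)) (h 0 (s≤s z≤n)))
    0≤C : 0≤ C
    0≤C = 1≤⇒0≤ (1≤interpolation-constant n N)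
    gap : ∀ i → i ℕ.< n → # 1 ≤ ∣ # (k i) - x₀ ∣
    gap i p = ≤-trans (by (# (k i) ∷ x₀ ∷ []) (λ a b → b :- (κ# 1 :+ a) ⊢ κ# 1 :≤ :- (a :- b))
        (≤-trans (≤-reflexive (sym (#-suc (k i)))) (#-mono (k-mono i n p ℕₚ.≤-refl))))
      (-x≤∣x∣ _)
    small : ∀ i → i ℕ.< n → ∣ ev n q (# (k i)) ∣ ≤ # 2 * ε
    small i p = ≤-trans (by (∣ # (k i) - x₀ ∣ ∷ ∣ ev n q (# (k i)) ∣ ∷ []) (λ g v → (g :- κ# 1) :* v ⊢ v :≤ g :* v)
        (gap i p · 0≤∣∣ _))
      (≤-trans (≤-reflexive (sym (∣*∣ _ _))) (≤-trans (∣∣-cong-≤ (trans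
        (ring! (ev (suc n) e x₀ ∷ (# (k i) - x₀) * ev n q (# (k i)) ∷ []) λ a b → b := (a :+ b) :- a)
        (+-congʳ (sym (ev-quot′ n e x₀ (# (k i)))))))
      (≤-trans (∣-∣-≤ (h i (ℕₚ.m<n⇒m<1+n p)) (h n ℕₚ.≤-refl))
        (≤-reflexive (ring! (ε ∷ []) λ ε → ε :+ ε := κ# 2 :* ε)))))
    q-bound : ∀ j → j ℕ.≤ n → ∣ q j ∣ ≤ C * (# 2 * ε)
    q-bound j p with ℕₚ.m≤n⇒m<n∨m≡n p
    ... | inj₁ p = interpolation n N k (λ i r → k≤N i (ℕₚ.m<n⇒m<1+n r)) (λ i j r s → k-mono i j r (ℕₚ.m<n⇒m<1+n s)) q small j p
    ... | inj₂ ≡.refl = ≤-trans (∣∣-cong-≤ (quot-top n e x₀)) (≤-trans (≤-reflexive (∣#∣ 0)) (0≤⇒≤ (0≤C · (0≤# 2 · 0≤ε))))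
    x₀≤N : ∣ x₀ ∣ ≤ # N
    x₀≤N = ≤-trans (≤-reflexive (∣#∣ (k n))) (#-mono (k≤N n ℕₚ.≤-refl))
    result : ∀ j → j ℕ.< suc n → ∣ e j ∣ ≤ (# 1 + # 2 * (# 1 + # N) * C) * ε
    result zero p = ≤-trans (∣∣-cong-≤ (ring! (e 0 ∷ x₀ ∷ q 0 ∷ []) λ a x b → a := (a :+ x :* b) :- x :* b))
      (≤-trans (∣-∣-≤ (h n ℕₚ.≤-refl) (∣*∣-≤ x₀≤N (q-bound 0 z≤n)))
      (by (# N ∷ C ∷ ε ∷ []) (λ N C ε → κ# 2 :* C :* ε ⊢ ε :+ N :* (C :* (κ# 2 :* ε)) :≤ (κ# 1 :+ κ# 2 :* (κ# 1 :+ N) :* C) :* ε)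
        (0≤# 2 · 0≤C · 0≤ε)))
    result (suc j) (s≤s p) = ≤-trans (∣∣-cong-≤ (quot-suc n e x₀ j p))
      (≤-trans (∣-∣-≤ (q-bound j (ℕₚ.<⇒≤ p)) (∣*∣-≤ x₀≤N (q-bound (suc j) p)))
      (by (# N ∷ C ∷ ε ∷ []) (λ N C ε → ε ⊢ C :* (κ# 2 :* ε) :+ N :* (C :* (κ# 2 :* ε)) :≤ (κ# 1 :+ κ# 2 :* (κ# 1 :+ N) :* C) :* ε) 0≤ε))

  -- Bisection

  record Cut (P : K → Set) (a b : K) : Set where
    field
      lo hi : K
      a≤lo : a ≤ lo
      lo≤hi : lo ≤ hi
      hi≤b : hi ≤ b
      P-lo : P lo
      ¬P-hi : ¬ P hi

  module Bisection {P : K → Set} {a b : K} (h : K) (0<h : 0< h) (h+h≈1 : h + h ≈ # 1) where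
    open Cut

    private
      mid : K → K → K
      mid x y = h * (x + y)

      x≈ : ∀ x → x ≈ h * (x + x)
      x≈ x = trans (sym (1*≈ x)) (trans (*-congʳ (sym h+h≈1)) (ring! (x ∷ h ∷ []) λ x h → (h :+ h) :* x := h :* (x :+ x)))

      ≤mid : ∀ {x y} → x ≤ y → x ≤ mid x y
      ≤mid {x} {y} p = ≤-trans (≤-reflexive (x≈ x)) (by (x ∷ y ∷ h ∷ []) (λ x y h → h :* (y :- x) ⊢ h :* (x :+ x) :≤ h :* (x :+ y)) (0<⇒0≤ 0<h · p))

      mid≤ : ∀ {x y} → x ≤ y → mid x y ≤ y
      mid≤ {x} {y} p = ≤-trans (by (x ∷ y ∷ h ∷ []) (λ x y h → h :* (y :- x) ⊢ h :* (x :+ y) :≤ h :* (y :+ y)) (0<⇒0≤ 0<h · p)) (≤-reflexive (sym (x≈ y)))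

      record Refinement (c : Cut P a b) : Set where
        field
          cut : Cut P a b
          lo-up : lo c ≤ lo cut
          hi-down : hi cut ≤ hi c
          width : # 2 * (hi cut - lo cut) ≈ hi c - lo c

      refine-by : ∀ c → Dec (P (mid (lo c) (hi c))) → Refinement c
      refine-by c (yes p) = record
        { cut = record { lo = mid (lo c) (hi c) ; hi = hi c ; a≤lo = ≤-trans (a≤lo c) (≤mid (lo≤hi c)) ; lo≤hi = mid≤ (lo≤hi c) ; hi≤b = hi≤b c ; P-lo = p ; ¬P-hi = ¬P-hi c }
        ; lo-up = ≤mid (lo≤hi c) ; hi-down = ≤-refl
        ; width = trans (ring! (lo c ∷ hi c ∷ h ∷ []) λ x y h → κ# 2 :* (y :- h :* (x :+ y)) := κ# 2 :* y :- (h :+ h) :* (x :+ y))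
            (trans (+-congˡ (-‿cong (trans (*-congʳ h+h≈1) (1*≈ _)))) (ring! (lo c ∷ hi c ∷ []) λ x y → κ# 2 :* y :- (x :+ y) := y :- x)) }
      refine-by c (no p) = record
        { cut = record { lo = lo c ; hi = mid (lo c) (hi c) ; a≤lo = a≤lo c ; lo≤hi = ≤mid (lo≤hi c) ; hi≤b = ≤-trans (mid≤ (lo≤hi c)) (hi≤b c) ; P-lo = P-lo c ; ¬P-hi = p }
        ; lo-up = ≤-refl ; hi-down = mid≤ (lo≤hi c)
        ; width = trans (ring! (lo c ∷ hi c ∷ h ∷ []) λ x y h → κ# 2 :* (h :* (x :+ y) :- x) := (h :+ h) :* (x :+ y) :- κ# 2 :* x)
            (trans (+-congʳ (trans (*-congʳ h+h≈1) (1*≈ _))) (ring! (lo c ∷ hi c ∷ []) λ x y → (x :+ y) :- κ# 2 :* x := y :- x)) }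

    module _ (refined : ∀ c → Refinement c) (c₀ : Cut P a b) where
      open Refinement

      cuts : ℕ → Cut P a b
      cuts zero = c₀
      cuts (suc n) = cut (refined (cuts n))

      width-cuts : ∀ n → # 2 ^ n * (hi (cuts n) - lo (cuts n)) ≈ hi c₀ - lo c₀
      width-cuts zero = 1*≈ _
      width-cuts (suc n) = trans (ring! (# 2 ^ n ∷ hi (cuts (suc n)) - lo (cuts (suc n)) ∷ []) λ p d → κ# 2 :* p :* d := p :* (κ# 2 :* d))
        (trans (*-congˡ (width (refined (cuts n)))) (width-cuts n))

      limit-point : ∃ λ L → lo c₀ ≤ L × L ≤ hi c₀ × (∀ ε → 0< ε → Σ (Cut P a b) λ c → lo c ≤ L × L ≤ hi c × hi c - lo c ≤ ε)
      limit-point = from (complete (λ n → lo (cuts n)) (λ n → hi (cuts n)) (λ n → lo-up (refined (cuts n))) (λ n → hi-down (refined (cuts n)))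
          (λ n → lo≤hi (cuts n)) (λ n → ≤-reflexive (trans (*-congʳ (trans (sym (#≈fromℕ (2 ℕ.^ n))) (#-^ 2 n))) (width-cuts n))))
        where
        from : (∃ λ L → ∀ n → lo (cuts n) ≤ L × L ≤ hi (cuts n)) →
          ∃ λ L → lo c₀ ≤ L × L ≤ hi c₀ × (∀ ε → 0< ε → Σ (Cut P a b) λ c → lo c ≤ L × L ≤ hi c × hi c - lo c ≤ ε)
        from (L , bounds) = L , proj₁ (bounds 0) , proj₂ (bounds 0) , λ ε 0<ε → case reach 0<ε (hi c₀ - lo c₀) of λ { (n , _ , p) →
          cuts n , proj₁ (bounds n) , proj₂ (bounds n)
          , *-cancelˡ-≤ (0<-^ n (0<# 1)) (≤-trans (≤-reflexive (width-cuts n)) (≤-trans p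
              (*-monoʳ-≤ (0<⇒0≤ 0<ε) (≤-trans (#-mono (n≤2^n n)) (≤-reflexive (#-^ 2 n)))))) }

    bisect-with : a ≤ b → P a → ¬ P b → ∃ λ L → a ≤ L × L ≤ b ×
      (∀ ε → 0< ε → Σ (Cut P a b) λ c → lo c ≤ L × L ≤ hi c × hi c - lo c ≤ ε)
    bisect-with a≤b Pa ¬Pb = limit-point (λ c → refine-by c em)
      (record { lo = a ; hi = b ; a≤lo = ≤-refl ; lo≤hi = a≤b ; hi≤b = ≤-refl ; P-lo = Pa ; ¬P-hi = ¬Pb })

  bisect : ∀ {P : K → Set} {a b} → a ≤ b → P a → ¬ P b → ∃ λ L → a ≤ L × L ≤ b ×
    (∀ ε → 0< ε → Σ (Cut P a b) λ c → Cut.lo c ≤ L × L ≤ Cut.hi c × Cut.hi c - Cut.lo c ≤ ε)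
  bisect a≤b Pa ¬Pb = case half of λ { (h , 0<h , h+h≈1) → Bisection.bisect-with h 0<h h+h≈1 a≤b Pa ¬Pb }

  Lipschitz : (K → K) → K → K → K → Set
  Lipschitz F C a b = ∀ x y → a ≤ x → x ≤ b → a ≤ y → y ≤ b → ∣ F x - F y ∣ ≤ C * ∣ x - y ∣

  intermediate-value : ∀ F C a b v → a ≤ b → 0≤ C → Lipschitz F C a b → F a ≤ v → v ≤ F b →
    ∃ λ x → a ≤ x × x ≤ b × F x ≈ v
  intermediate-value F C a b v a≤b 0≤C lip p q = <-or-≤-elim
    (λ r → b , a≤b , ≤-refl , ≤-antisym r q)
    λ r → case bisect {λ x → F x ≤ v} a≤b p (<⇒≱ r) of λ { (L , a≤L , L≤b , cut) →
      L , a≤L , L≤b , ≤-antisym (ε-≤ (above L a≤L L≤b cut)) (ε-≤ (below L a≤L L≤b cut)) }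
    where
    open Cut
    module _ (L : K) (a≤L : a ≤ L) (L≤b : L ≤ b)
      (cut : ∀ ε → 0< ε → Σ (Cut (λ x → F x ≤ v) a b) λ c → lo c ≤ L × L ≤ hi c × hi c - lo c ≤ ε) where

      scaled : ∀ ε → 0< ε → ∃ λ η → 0< η × C * η ≤ ε
      scaled ε 0<ε = let c , 0<c , eq = pos-inverse (0<1 <⊹ 0≤C) in c * ε , 0<c <· 0<ε
        , ≤-trans (by (C ∷ c ∷ ε ∷ []) (λ C c ε → c :* ε ⊢ C :* (c :* ε) :≤ (κ# 1 :+ C) :* c :* ε) (0<⇒0≤ (0<c <· 0<ε)))
            (≤-reflexive (trans (*-congʳ eq) (1*≈ ε)))

      above : ∀ ε → 0< ε → F L ≤ v + ε
      above ε 0<ε =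
        let η , 0<η , Cη≤ε = scaled ε 0<ε
            c , lo≤L , L≤hi , w = cut η 0<η in
        by (F L ∷ F (lo c) ∷ v ∷ ε ∷ []) (λ L l v ε → (ε :- (L :- l)) :+ (v :- l) ⊢ L :≤ v :+ ε)
          (≤-trans (≤-trans (x≤∣x∣ _) (lip L (lo c) a≤L L≤b (a≤lo c) (≤-trans (lo≤hi c) (hi≤b c))))
            (≤-trans (*-monoˡ-≤ 0≤C (≤-trans (≤-reflexive (0≤⇒∣x∣≈x lo≤L))
              (≤-trans (+-mono-≤ L≤hi ≤-refl) w))) Cη≤ε) ⊹ P-lo c)

      below : ∀ ε → 0< ε → v ≤ F L + ε
      below ε 0<ε =
        let η , 0<η , Cη≤ε = scaled ε 0<ε
            c , lo≤L , L≤hi , w = cut η 0<η in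
        by (F L ∷ F (hi c) ∷ v ∷ ε ∷ []) (λ L u v ε → (ε :- (u :- L)) :+ (u :- v) ⊢ v :≤ L :+ ε)
          (≤-trans (≤-trans (x≤∣x∣ _) (lip (hi c) L (≤-trans (a≤lo c) (lo≤hi c)) (hi≤b c) a≤L L≤b))
            (≤-trans (*-monoˡ-≤ 0≤C (≤-trans (≤-reflexive (0≤⇒∣x∣≈x L≤hi))
              (≤-trans (by (hi c ∷ lo c ∷ L ∷ []) (λ h l L → L :- l ⊢ h :- L :≤ h :- l) lo≤L) w))) Cη≤ε) ⊹ <⇒≤ (≰⇒> (¬P-hi c)))

  -- Power series with geometric bounds

  small : ∀ {B ε} → 0≤ B → 0< ε → ∃ λ η → 0< η × B * η ≤ ε
  small {B} {ε} 0≤B 0<ε = let c , 0<c , eq = pos-inverse (0<1 <⊹ 0≤B) in c * ε , 0<c <· 0<ε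
    , ≤-trans (by (B ∷ c ∷ ε ∷ []) (λ B c ε → c :* ε ⊢ B :* (c :* ε) :≤ (κ# 1 :+ B) :* c :* ε) (0<⇒0≤ (0<c <· 0<ε)))
        (≤-reflexive (trans (*-congʳ eq) (1*≈ ε)))

  min-pos : ∀ {x y} → 0< x → 0< y → ∃ λ z → 0< z × z ≤ x × z ≤ y
  min-pos {x} {y} p q = [ (λ r → x , p , ≤-refl , r) , (λ r → y , q , r , ≤-refl) ]′ (≤-total x y)

  -- On the disc ∣s∣ ≤ 1/(2R) the function F is the sum of the power series a.
  record GermWith (A R : K) (a : ℕ → K) (F : K → K) : Set where
    field
      1≤A : # 1 ≤ A
      1≤R : # 1 ≤ R
      coef : ∀ i → ∣ a i ∣ ≤ A * R ^ i
      rem : ∀ s n → # 2 * (R * ∣ s ∣) ≤ # 1 → ∣ F s - ev n a s ∣ ≤ # 2 * A * (R * ∣ s ∣) ^ n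

    0≤A : 0≤ A
    0≤A = 1≤⇒0≤ 1≤A

    0≤R : 0≤ R
    0≤R = 1≤⇒0≤ 1≤R

  Germ : (ℕ → K) → (K → K) → Set
  Germ a F = ∃₂ λ A R → GermWith A R a F

  germ-cong : ∀ {A R a F G} → (∀ s → F s ≈ G s) → GermWith A R a F → GermWith A R a G
  germ-cong eq g = record { GermWith g ; rem = λ s n p → ≤-trans (∣∣-cong-≤ (+-congʳ (sym (eq s)))) (GermWith.rem g s n p) }

  germ-weaken : ∀ {A A′ R R′ a F} → A ≤ A′ → R ≤ R′ → GermWith A R a F → GermWith A′ R′ a F
  germ-weaken {A} {A′} {R} {R′} p q g = record
    { 1≤A = ≤-trans 1≤A p ; 1≤R = ≤-trans 1≤R q
    ; coef = λ i → ≤-trans (coef i) (*-mono-≤ (0≤-^ i 0≤R) 0≤A′ p (^-mono-≤ i 0≤R q))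
    ; rem = λ s n r → ≤-trans (rem s n (≤-trans (*-monoˡ-≤ (0≤# 2) (*-monoʳ-≤ (0≤∣∣ s) q)) r))
        (*-mono-≤ (0≤-^ n (0≤R · 0≤∣∣ s)) (0≤# 2 · 0≤A′) (*-monoˡ-≤ (0≤# 2) p)
          (^-mono-≤ n (0≤R · 0≤∣∣ s) (*-monoʳ-≤ (0≤∣∣ s) q)))
    }
    where
    open GermWith g
    0≤A′ = 1≤⇒0≤ (≤-trans 1≤A p)

  one : ℕ → K
  one = # 1 ◂ λ _ → # 0

  germ-one : GermWith (# 1) (# 1) one (λ _ → # 1)
  germ-one = record { 1≤A = ≤-refl ; 1≤R = ≤-refl ; coef = c ; rem = r }
    where
    c : ∀ i → ∣ one i ∣ ≤ # 1 * # 1 ^ i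
    c zero = ≤-trans (≤-reflexive (∣#∣ 1)) (≤-reflexive (ring! [] (κ# 1 := κ# 1 :* κ# 1)))
    c (suc i) = ≤-trans (≤-reflexive (∣#∣ 0)) (0≤⇒≤ (0≤1 · 0≤-^ (suc i) 0≤1))
    r : ∀ s n → # 2 * (# 1 * ∣ s ∣) ≤ # 1 → ∣ # 1 - ev n one s ∣ ≤ # 2 * # 1 * (# 1 * ∣ s ∣) ^ n
    r s zero p = ≤-trans (∣∣-cong-≤ (ring! [] (κ# 1 :- κ# 0 := κ# 1))) (≤-trans (≤-reflexive (∣#∣ 1))
      (by [] (κ# 1 ⊢ κ# 1 :≤ κ# 2 :* κ# 1 :* κ# 1) 0≤1))
    r s (suc n) p = ≤-trans (∣∣-cong-≤ (trans (+-congˡ (-‿cong (+-congˡ (*-congˡ (ev-0 n s λ _ _ → refl)))))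
        (ring! (s ∷ []) λ s → κ# 1 :- (κ# 1 :+ s :* κ# 0) := κ# 0)))
      (≤-trans (≤-reflexive (∣#∣ 0)) (0≤⇒≤ (0≤# 2 · 0≤1 · 0≤-^ (suc n) (0≤1 · 0≤∣∣ s))))

  germ-shift : ∀ {A R a F} → GermWith A R a F → GermWith A R (# 0 ◂ a) (λ s → s * F s)
  germ-shift {A} {R} {a} {F} g = record { 1≤A = 1≤A ; 1≤R = 1≤R ; coef = c ; rem = r }
    where
    open GermWith g
    c : ∀ i → ∣ (# 0 ◂ a) i ∣ ≤ A * R ^ i
    c zero = ≤-trans (≤-reflexive (∣#∣ 0)) (0≤⇒≤ (0≤A · 0≤1))
    c (suc i) = ≤-trans (coef i) (by (A ∷ R ∷ R ^ i ∷ []) (λ A R p → A :* ((R :- κ# 1) :* p) ⊢ A :* p :≤ A :* (R :* p))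
      (0≤A · (1≤R · 0≤-^ i 0≤R)))
    ∣s∣≤ : ∀ s → ∣ s ∣ ≤ R * ∣ s ∣
    ∣s∣≤ s = by (R ∷ ∣ s ∣ ∷ []) (λ R s → (R :- κ# 1) :* s ⊢ s :≤ R :* s) (1≤R · 0≤∣∣ s)
    r : ∀ s n → # 2 * (R * ∣ s ∣) ≤ # 1 → ∣ s * F s - ev n (# 0 ◂ a) s ∣ ≤ # 2 * A * (R * ∣ s ∣) ^ n
    r s zero p = ≤-trans (∣∣-cong-≤ (ring! (s ∷ F s ∷ []) λ s F → s :* F :- κ# 0 := s :* (F :- κ# 0)))
      (≤-trans (∣*∣-≤ (∣s∣≤ s) (rem s 0 p)) (≤-trans
        (by (A ∷ R * ∣ s ∣ ∷ []) (λ A t → κ# 2 :* A :* (κ# 1 :- κ# 2 :* t) :+ κ# 2 :* A :* t ⊢ t :* (κ# 2 :* A :* κ# 1) :≤ κ# 2 :* A)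
          (0≤# 2 · 0≤A · p ⊹ 0≤# 2 · 0≤A · (0≤R · 0≤∣∣ s))) (≤-reflexive (sym (*1≈ _)))))
    r s (suc n) p = ≤-trans (∣∣-cong-≤ (ring! (s ∷ F s ∷ ev n a s ∷ []) λ s F e → s :* F :- (κ# 0 :+ s :* e) := s :* (F :- e)))
      (≤-trans (∣*∣-≤ (∣s∣≤ s) (rem s n p)) (≤-reflexive
        (ring! (A ∷ R * ∣ s ∣ ∷ (R * ∣ s ∣) ^ n ∷ []) λ A t p → t :* (κ# 2 :* A :* p) := κ# 2 :* A :* (t :* p))))

  shift : ℕ → (ℕ → K) → ℕ → K
  shift zero a = a
  shift (suc k) a = # 0 ◂ shift k a

  germ-shifts : ∀ {A R a F} k → GermWith A R a F → GermWith A R (shift k a) (λ s → s ^ k * F s)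
  germ-shifts zero g = germ-cong (λ s → sym (1*≈ _)) g
  germ-shifts (suc k) g = germ-cong (λ s → sym (*-assoc _ _ _)) (germ-shift (germ-shifts k g))

  ev-shift : ∀ k n a x → ev (k ℕ.+ n) (shift k a) x ≈ x ^ k * ev n a x
  ev-shift zero n a x = sym (1*≈ _)
  ev-shift (suc k) n a x = trans (+-congˡ (*-congˡ (ev-shift k n a x)))
    (ring! (x ∷ x ^ k ∷ ev n a x ∷ []) λ x p e → κ# 0 :+ x :* (p :* e) := x :* p :* e)

  germs-common : ∀ n {g : ℕ → ℕ → K} {φ : ℕ → K → K} → (∀ k → k ℕ.< n → Germ (g k) (φ k)) →
    ∃₂ λ A R → # 1 ≤ A × # 1 ≤ R × (∀ k → k ℕ.< n → GermWith A R (g k) (φ k))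
  germs-common zero h = # 1 , # 1 , ≤-refl , ≤-refl , λ _ ()
  germs-common (suc n) {g} {φ} h =
    let A , R , 1≤A , 1≤R , c = germs-common n (λ k p → h (suc k) (s≤s p))
        A₀ , R₀ , g₀ = h 0 (s≤s z≤n)
        a≤ = by (A₀ ∷ A ∷ []) (λ a b → b ⊢ a :≤ a :+ b) (1≤⇒0≤ 1≤A)
        b≤ = by (A₀ ∷ A ∷ []) (λ a b → a ⊢ b :≤ a :+ b) (GermWith.0≤A g₀)
        r≤ = by (R₀ ∷ R ∷ []) (λ a b → b ⊢ a :≤ a :+ b) (1≤⇒0≤ 1≤R)
        q≤ = by (R₀ ∷ R ∷ []) (λ a b → a ⊢ b :≤ a :+ b) (GermWith.0≤R g₀)
    in A₀ + A , R₀ + R , ≤-trans 1≤A b≤ , ≤-trans 1≤R q≤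
     , λ { zero p → germ-weaken a≤ r≤ g₀ ; (suc k) (s≤s p) → germ-weaken b≤ q≤ (c k p) }

  ∑∣∣ : ℕ → (ℕ → K) → K
  ∑∣∣ n c = ∑ n λ k → ∣ c k ∣

  0≤∑∣∣ : ∀ n c → 0≤ ∑∣∣ n c
  0≤∑∣∣ n c = 0≤∑ n λ k _ → 0≤∣∣ (c k)

  ∣∑*∣ : ∀ n (c x : ℕ → K) {B} → (∀ k → k ℕ.< n → ∣ x k ∣ ≤ B) → ∣ ∑ n (λ k → c k * x k) ∣ ≤ ∑∣∣ n c * B
  ∣∑*∣ n c x {B} h = ≤-trans (∣∑∣ n _) (≤-trans (∑-mono n λ k p → ≤-trans (∣*∣-≤ {c k} ≤-refl (h k p)) (≤-reflexive (*-comm _ _)))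
    (≤-reflexive (trans (∑-* n B _) (*-comm _ _))))

  ∑-rem : ∀ n {A R} {g : ℕ → ℕ → K} {φ : ℕ → K → K} (c : ℕ → K) → (∀ k → k ℕ.< n → GermWith A R (g k) (φ k)) →
    ∀ s m → # 2 * (R * ∣ s ∣) ≤ # 1 →
    ∣ ∑ n (λ k → c k * φ k s) - ev m (λ l → ∑ n λ k → c k * g k l) s ∣ ≤ ∑∣∣ n c * (# 2 * A * (R * ∣ s ∣) ^ m)
  ∑-rem n {A} {R} {g} {φ} c h s m p = ≤-trans (∣∣-cong-≤ (trans (+-congˡ (-‿cong (ev-∑ m n c g s))) difference))
      (∣∑*∣ n c (λ k → φ k s - ev m (g k) s) λ k q → GermWith.rem (h k q) s m p)
    where
    difference : ∑ n (λ k → c k * φ k s) - ∑ n (λ k → c k * ev m (g k) s) ≈ ∑ n (λ k → c k * (φ k s - ev m (g k) s))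
    difference = trans (+-congˡ (trans (ring! (∑ n (λ k → c k * ev m (g k) s) ∷ []) λ x → :- x := (:- κ# 1) :* x) (sym (∑-* n (- # 1) _))))
      (trans (sym (∑-+ n (λ k → c k * φ k s) _)) (∑-cong n λ k _ →
        ring! (c k ∷ φ k s ∷ ev m (g k) s ∷ []) λ c x y → c :* x :+ (:- κ# 1) :* (c :* y) := c :* (x :- y)))

  germ-∑ : ∀ n {A R} {g : ℕ → ℕ → K} {φ : ℕ → K → K} (c : ℕ → K) → # 1 ≤ A → # 1 ≤ R →
    (∀ k → k ℕ.< n → GermWith A R (g k) (φ k)) →
    GermWith ((# 1 + ∑∣∣ n c) * A) R (λ l → ∑ n λ k → c k * g k l) (λ s → ∑ n λ k → c k * φ k s)
  germ-∑ n {A} {R} {g} {φ} c 1≤A 1≤R h = record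
    { 1≤A = ≤-trans 1≤A A≤ ; 1≤R = 1≤R
    ; coef = λ i → ≤-trans (∣∑*∣ n c (λ k → g k i) λ k p → GermWith.coef (h k p) i)
        (by (∑∣∣ n c ∷ A ∷ R ^ i ∷ []) (λ S A r → A :* r ⊢ S :* (A :* r) :≤ (κ# 1 :+ S) :* A :* r) (1≤⇒0≤ 1≤A · 0≤-^ i (1≤⇒0≤ 1≤R)))
    ; rem = λ s m p → ≤-trans (∑-rem n c h s m p)
          (by (∑∣∣ n c ∷ A ∷ (R * ∣ s ∣) ^ m ∷ []) (λ S A r → κ# 2 :* A :* r ⊢ S :* (κ# 2 :* A :* r) :≤ κ# 2 :* ((κ# 1 :+ S) :* A) :* r)
            (0≤# 2 · 1≤⇒0≤ 1≤A · 0≤-^ m (1≤⇒0≤ 1≤R · 0≤∣∣ s)))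
    }
    where
    A≤ : A ≤ (# 1 + ∑∣∣ n c) * A
    A≤ = by (∑∣∣ n c ∷ A ∷ []) (λ S A → S :* A ⊢ A :≤ (κ# 1 :+ S) :* A) (0≤∑∣∣ n c · 1≤⇒0≤ 1≤A)

  -- Convergence without any rate suffices: the coefficient bounds alone estimate the part of the
  -- series between the n-th partial sum and a partial sum close to the limit.
  germ-limit : ∀ {A R a F} → # 1 ≤ A → # 1 ≤ R → (∀ i → ∣ a i ∣ ≤ A * R ^ i) →
    (∀ s → # 2 * (R * ∣ s ∣) ≤ # 1 → ∀ ε → 0< ε → ∃ λ N → ∀ n → N ℕ.≤ n → ∣ F s - ev n a s ∣ ≤ ε) →
    GermWith A R a F
  germ-limit {A} {R} {a} {F} 1≤A 1≤R c lim = record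
    { 1≤A = 1≤A ; 1≤R = 1≤R ; coef = c
    ; rem = λ s n p → ε-≤ λ ε 0<ε → let N , close = lim s p ε 0<ε in
        ≤-trans (∣∣-cong-≤ (ring! (F s ∷ ev n a s ∷ ev (n ℕ.+ N) a s ∷ []) λ f x y → f :- x := (y :- x) :+ (f :- y)))
          (∣+∣-≤ (tail-bound s n N p) (close (n ℕ.+ N) (ℕₚ.m≤n+m N n)))
    }
    where
    tail-bound : ∀ s n m → # 2 * (R * ∣ s ∣) ≤ # 1 → ∣ ev (n ℕ.+ m) a s - ev n a s ∣ ≤ # 2 * A * (R * ∣ s ∣) ^ n
    tail-bound s n m p = ≤-trans (∣∣-cong-≤ (trans (+-congʳ (ev-++ n m a s))
        (ring! (ev n a s ∷ s ^ n * ev m (λ i → a (n ℕ.+ i)) s ∷ []) λ x y → (x :+ y) :- x := y)))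
      (≤-trans (∣*∣-≤ (≤-reflexive (∣^∣ s n)) (ev-geometric m (1≤⇒0≤ 1≤A · 0≤-^ n (1≤⇒0≤ 1≤R)) (1≤⇒0≤ 1≤R)
          (λ i → ≤-trans (c (n ℕ.+ i)) (≤-reflexive (trans (*-congˡ (^-+ R n i)) (sym (*-assoc _ _ _))))) p))
        (≤-reflexive (trans (ring! (A ∷ R ^ n ∷ ∣ s ∣ ^ n ∷ []) λ A r t → t :* (κ# 2 :* (A :* r)) := κ# 2 :* A :* (r :* t))
          (*-congˡ (sym (^-* R ∣ s ∣ n))))))

  bounded-prefix : ∀ n (f : ℕ → K) {B} → 0≤ B → (∀ i → n ℕ.≤ i → ∣ f i ∣ ≤ B) → ∀ i → ∣ f i ∣ ≤ ∑∣∣ n f + B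
  bounded-prefix n f {B} 0≤B h i with n ℕₚ.≤? i
  ... | yes p = ≤-trans (h i p) (by (∑∣∣ n f ∷ B ∷ []) (λ S B → S ⊢ B :≤ S :+ B) (0≤∑∣∣ n f))
  ... | no p = ≤-trans (term≤∑ n (λ k _ → 0≤∣∣ (f k)) i (ℕₚ.≰⇒> p)) (by (∑∣∣ n f ∷ B ∷ []) (λ S B → B ⊢ S :≤ S :+ B) 0≤B)

  -- Convergence at the single point ρ makes the terms bounded there, since a term is the difference
  -- of two consecutive partial sums, both within 1 of the limit from some index on. So the
  -- coefficients grow at most like Rⁱ with R = 1 + 1/ρ.
  germ-convergent : ∀ {a F ρ} → 0< ρ →
    (∀ s → ∣ s ∣ ≤ ρ → ∀ ε → 0< ε → ∃ λ N → ∀ n → N ℕ.≤ n → ∣ F s - ev n a s ∣ ≤ ε) → Germ a F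
  germ-convergent {a} {F} {ρ} 0<ρ lim = A , R , germ-limit 1≤A 1≤R c
      λ s p → lim s (*-cancelˡ-≤ (0<-≤ 0<1 1≤R) (≤-trans
        (by (R * ∣ s ∣ ∷ []) (λ t → (κ# 1 :- κ# 2 :* t) :+ t ⊢ t :≤ κ# 1) (p ⊹ 1≤⇒0≤ 1≤R · 0≤∣∣ s)) 1≤Rρ))
    where
    σ = proj₁ (pos-inverse 0<ρ)
    0<σ = proj₁ (proj₂ (pos-inverse 0<ρ))
    R = # 1 + σ
    1≤R : # 1 ≤ R
    1≤R = by (σ ∷ []) (λ s → s ⊢ κ# 1 :≤ κ# 1 :+ s) (0<⇒0≤ 0<σ)
    1≤Rρ : # 1 ≤ R * ρ
    1≤Rρ = ≤-trans (≤-reflexive (sym (proj₂ (proj₂ (pos-inverse 0<ρ)))))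
      (by (σ ∷ ρ ∷ []) (λ s r → r ⊢ r :* s :≤ (κ# 1 :+ s) :* r) (0<⇒0≤ 0<ρ))
    close = lim ρ (≤-reflexive (0≤⇒∣x∣≈x (0<⇒0≤ 0<ρ))) (# 1) 0<1
    N = proj₁ close
    term : ∀ n → N ℕ.≤ n → ∣ a n * ρ ^ n ∣ ≤ # 2
    term n p = ≤-trans (∣∣-cong-≤ (trans (ring! (a n ∷ ρ ^ n ∷ ev n a ρ ∷ ρ ∷ F ρ ∷ []) λ a r e ρ f →
          a :* r := (f :- e) :- (f :- (e :+ r :* (a :+ ρ :* κ# 0))))
        (+-congˡ (-‿cong (+-congˡ (-‿cong (sym step)))))))
      (≤-trans (∣-∣-≤ (proj₂ close n p) (proj₂ close (n ℕ.+ 1) (ℕₚ.≤-trans p (ℕₚ.m≤m+n n 1)))) (≤-reflexive (ring! [] (κ# 1 :+ κ# 1 := κ# 2))))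
      where
      step : ev (n ℕ.+ 1) a ρ ≈ ev n a ρ + ρ ^ n * (a n + ρ * # 0)
      step = trans (ev-++ n 1 a ρ) (+-congˡ (*-congˡ (+-congʳ (reflexive (≡.cong a (ℕₚ.+-identityʳ n))))))
    S = ∑∣∣ N (λ n → a n * ρ ^ n)
    A = # 1 + (S + # 2)
    1≤A : # 1 ≤ A
    1≤A = by (S ∷ []) (λ S → S :+ κ# 2 ⊢ κ# 1 :≤ κ# 1 :+ (S :+ κ# 2)) (0≤∑∣∣ N _ ⊹ 0≤# 2)
    c : ∀ i → ∣ a i ∣ ≤ A * R ^ i
    c i = ≤-trans (by (∣ a i ∣ ∷ (R * ρ) ^ i ∷ []) (λ a r → a :* (r :- κ# 1) ⊢ a :≤ a :* r) (0≤∣∣ (a i) · 1≤-^ i 1≤Rρ))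
      (≤-trans (≤-reflexive (trans (*-congˡ (trans (^-* R ρ i) (*-congˡ (trans (^-congˡ i (sym (0≤⇒∣x∣≈x (0<⇒0≤ 0<ρ)))) (sym (∣^∣ ρ i))))))
          (trans (ring! (∣ a i ∣ ∷ R ^ i ∷ ∣ ρ ^ i ∣ ∷ []) λ a r p → a :* (r :* p) := (a :* p) :* r) (*-congʳ (sym (∣*∣ (a i) (ρ ^ i)))))))
        (*-monoʳ-≤ (0≤-^ i (1≤⇒0≤ 1≤R)) (≤-trans (bounded-prefix N (λ n → a n * ρ ^ n) (0≤# 2) term i)
          (by (S ∷ []) (λ S → κ# 1 ⊢ S :+ κ# 2 :≤ κ# 1 :+ (S :+ κ# 2)) 0≤1))))

  module _ {A R a F} (g : GermWith A R a F) where
    open GermWith g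

    halves : ∀ {x} n → 0≤ x → # 2 * x ≤ # 1 → # 2 ^ n * x ^ n ≤ # 1
    halves {x} n p q = ≤-trans (≤-reflexive (sym (^-* (# 2) x n))) (^-≤1 n (0≤# 2 · p) q)

    dyadic-rem : ∀ s n → # 2 * (R * ∣ s ∣) ≤ # 1 → # 2 ^ n * ∣ F s - ev n a s ∣ ≤ # 2 * A
    dyadic-rem s n p = ≤-trans (*-monoˡ-≤ (0≤-^ n (0≤# 2)) (rem s n p))
      (by (A ∷ # 2 ^ n ∷ (R * ∣ s ∣) ^ n ∷ []) (λ A t r → κ# 2 :* A :* (κ# 1 :- t :* r) ⊢ t :* (κ# 2 :* A :* r) :≤ κ# 2 :* A)
        (0≤# 2 · 0≤A · halves n (0≤R · 0≤∣∣ s) p))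

    germ-vanishes : (∀ l → a l ≈ # 0) → ∀ s → # 2 * (R * ∣ s ∣) ≤ # 1 → F s ≈ # 0
    germ-vanishes h s p = ∣∣≈0⇒≈0 (dyadic-≤ (# 2 * A) λ n → ≤-trans
      (*-monoˡ-≤ (0≤-^ n (0≤# 2)) (≤-trans (≤-reflexive (+-congˡ (ring! [] (:- κ# 0 := κ# 0)))) (≤-trans (≤-reflexive (+0≈ _))
        (∣∣-cong-≤ (trans (ring! (F s ∷ []) λ f → f := f :- κ# 0) (+-congˡ (-‿cong (sym (ev-0 n s λ i _ → h i)))))))))
      (dyadic-rem s n p))

    -- The identity theorem. If all earlier coefficients vanish, a zero s of F gives |sˡ a_l| ≤ W
    -- |s|^(l+1); dividing by |s|ˡ and letting s tend to 0 shows that a_l vanishes as well.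
    accumulating-zeros : (∀ ε → 0< ε → ∃ λ s → ¬ s ≈ # 0 × ∣ s ∣ ≤ ε × F s ≈ # 0) → ∀ l → a l ≈ # 0
    accumulating-zeros zeros = <-rec _ step
      where
      step : ∀ l → (∀ {i} → i ℕ.< l → a i ≈ # 0) → a l ≈ # 0
      step l ih = ∣∣≈0⇒≈0 (ε-≤ λ ε 0<ε → ≤-trans (bound ε 0<ε) (≤-reflexive (sym (0+≈ ε))))
        where
        W = # 2 * A * R ^ suc l
        0≤W : 0≤ W
        0≤W = 0≤# 2 · 0≤A · 0≤-^ (suc l) 0≤R
        bound : ∀ ε → 0< ε → ∣ a l ∣ ≤ ε
        bound ε 0<ε =
          let η₁ , 0<η₁ , p₁ = small 0≤W 0<ε
              η₂ , 0<η₂ , p₂ = small (0≤# 2 · 0≤R) 0<1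
              η , 0<η , q₁ , q₂ = min-pos 0<η₁ 0<η₂
              s , s≉0 , ∣s∣≤η , Fs≈0 = zeros η 0<η
              2Rs≤1 = ≤-trans (≤-trans (≤-reflexive (sym (*-assoc _ _ _))) (*-monoˡ-≤ (0≤# 2 · 0≤R) (≤-trans ∣s∣≤η q₂))) p₂
              value : ev (suc l) a s ≈ s ^ l * a l
              value = ev-leading l a s λ i p → ih p
              term : ∣ s ∣ ^ l * ∣ a l ∣ ≤ ∣ s ∣ ^ l * (W * ∣ s ∣)
              term = ≤-trans (≤-reflexive (trans (*-congʳ (sym (∣^∣ s l))) (sym (∣*∣ (s ^ l) (a l)))))
                (≤-trans (≤-trans (∣∣-cong-≤ (sym value)) (≤-trans (≤-reflexive (sym (∣-∣ _)))
                  (∣∣-cong-≤ (trans (sym (0+≈ _)) (+-congʳ (sym Fs≈0))))))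
                (≤-trans (rem s (suc l) 2Rs≤1) (≤-reflexive (trans (*-congˡ (^-* R ∣ s ∣ (suc l)))
                  (ring! (A ∷ R ^ suc l ∷ ∣ s ∣ ∷ ∣ s ∣ ^ l ∷ []) λ A r s t → κ# 2 :* A :* (r :* (s :* t)) := t :* (κ# 2 :* A :* r :* s))))))
          in ≤-trans (*-cancelˡ-≤ (0<-^ l (≉0⇒0<∣∣ s≉0)) term)
               (≤-trans (*-monoˡ-≤ 0≤W (≤-trans ∣s∣≤η q₁)) p₁)

  -- Differences of power series

  ev-difference : ∀ m {b B R σ s s′} → 0≤ B → 0≤ R → (∀ i → ∣ b i ∣ ≤ B * R ^ i) → # 4 * (R * σ) ≤ # 1 →
    ∣ s ∣ ≤ σ → ∣ s′ ∣ ≤ σ → ∣ ev m b s′ - ev m b s ∣ ≤ # 4 * (B * R) * ∣ s′ - s ∣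
  ev-difference zero {B = B} {R} {s = s} {s′} p q h r u v = ≤-trans (∣∣-cong-≤ (ring! [] (κ# 0 :- κ# 0 := κ# 0)))
    (≤-trans (≤-reflexive (∣#∣ 0)) (0≤⇒≤ (0≤# 4 · (p · q) · 0≤∣∣ _)))
  ev-difference (suc m) {b} {B} {R} {σ} {s} {s′} p q h r u v = ≤-trans
    (∣∣-cong-≤ (ring! (b 0 ∷ s ∷ s′ ∷ ev m (tail b) s ∷ ev m (tail b) s′ ∷ []) λ b s t x y →
      (b :+ t :* y) :- (b :+ s :* x) := t :* (y :- x) :+ (t :- s) :* x))
    (≤-trans (∣+∣-≤ (∣*∣-≤ v (ev-difference m (p · q) q h′ r u v)) (∣*∣-≤ {s′ - s} ≤-refl (ev-geometric m (p · q) q h′ r′)))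
      (by (B ∷ R ∷ σ ∷ ∣ s′ - s ∣ ∷ []) (λ B R σ d → B :* R :* d :* (κ# 1 :- κ# 4 :* (R :* σ)) :+ B :* R :* d ⊢
          σ :* (κ# 4 :* (B :* R :* R) :* d) :+ d :* (κ# 2 :* (B :* R)) :≤ κ# 4 :* (B :* R) :* d)
        (p · q · 0≤∣∣ _ · r ⊹ p · q · 0≤∣∣ _)))
    where
    h′ : ∀ i → ∣ b (suc i) ∣ ≤ B * R * R ^ i
    h′ i = ≤-trans (h (suc i)) (≤-reflexive (sym (*-assoc _ _ _)))
    0≤σ : 0≤ σ
    0≤σ = ≤⇒0≤ (≤-trans (0≤⇒≤ (0≤∣∣ s)) u)
    r′ : # 2 * (R * ∣ s ∣) ≤ # 1
    r′ = by (R ∷ σ ∷ ∣ s ∣ ∷ []) (λ R σ s → (κ# 1 :- κ# 4 :* (R :* σ)) :+ κ# 2 :* (R :* σ) :+ κ# 2 :* R :* (σ :- s) ⊢ κ# 2 :* (R :* s) :≤ κ# 1)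
      (r ⊹ 0≤# 2 · (q · 0≤σ) ⊹ 0≤# 2 · q · u)

  ^-difference : ∀ p m {b B R σ s s′} → 0≤ B → 0≤ R → (∀ i → ∣ b i ∣ ≤ B * R ^ i) → # 4 * (R * σ) ≤ # 1 →
    ∣ s ∣ ≤ σ → ∣ s′ ∣ ≤ σ →
    ∣ s′ ^ suc p * ev m b s′ - s ^ suc p * ev m b s ∣ ≤ (# 2 * # p + # 3) * B * (∣ s′ - s ∣ * σ ^ p)
  ^-difference zero m {b} {B} {R} {σ} {s} {s′} p q h r u v = ≤-trans
    (∣∣-cong-≤ (ring! (s ∷ s′ ∷ ev m b s ∷ ev m b s′ ∷ []) λ s t x y → t :* κ# 1 :* y :- s :* κ# 1 :* x := t :* (y :- x) :+ (t :- s) :* x))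
    (≤-trans (∣+∣-≤ (∣*∣-≤ v (ev-difference m p q h r u v)) (∣*∣-≤ {s′ - s} ≤-refl (ev-geometric m p q h r′)))
      (by (B ∷ R ∷ σ ∷ ∣ s′ - s ∣ ∷ []) (λ B R σ d → B :* d :* (κ# 1 :- κ# 4 :* (R :* σ)) ⊢
          σ :* (κ# 4 :* (B :* R) :* d) :+ d :* (κ# 2 :* B) :≤ (κ# 2 :* κ# 0 :+ κ# 3) :* B :* (d :* κ# 1))
        (p · 0≤∣∣ _ · r)))
    where
    0≤σ : 0≤ σ
    0≤σ = ≤⇒0≤ (≤-trans (0≤⇒≤ (0≤∣∣ s)) u)
    r′ : # 2 * (R * ∣ s ∣) ≤ # 1
    r′ = by (R ∷ σ ∷ ∣ s ∣ ∷ []) (λ R σ s → (κ# 1 :- κ# 4 :* (R :* σ)) :+ κ# 2 :* (R :* σ) :+ κ# 2 :* R :* (σ :- s) ⊢ κ# 2 :* (R :* s) :≤ κ# 1)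
      (r ⊹ 0≤# 2 · (q · 0≤σ) ⊹ 0≤# 2 · q · u)
  ^-difference (suc n) m {b} {B} {R} {σ} {s} {s′} p q h r u v = ≤-trans
    (∣∣-cong-≤ (ring! (s ∷ s′ ∷ s ^ suc n ∷ s′ ^ suc n ∷ ev m b s ∷ ev m b s′ ∷ []) λ s t sn tn x y →
      t :* tn :* y :- s :* sn :* x := t :* (tn :* y :- sn :* x) :+ (t :- s) :* (sn :* x)))
    (≤-trans (∣+∣-≤ (∣*∣-≤ v (^-difference n m p q h r u v)) (∣*∣-≤ {s′ - s} ≤-refl
        (∣*∣-≤ (≤-trans (≤-reflexive (∣^∣ s (suc n))) (^-mono-≤ (suc n) (0≤∣∣ s) u)) (ev-geometric m p q h r′))))
      (≤-reflexive (trans (ring! (# n ∷ B ∷ σ ∷ σ ^ n ∷ ∣ s′ - s ∣ ∷ []) (λ n B σ t d →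
          σ :* ((κ# 2 :* n :+ κ# 3) :* B :* (d :* t)) :+ d :* (σ :* t :* (κ# 2 :* B)) := (κ# 2 :* (κ# 1 :+ n) :+ κ# 3) :* B :* (d :* (σ :* t))))
        (*-congʳ (*-congʳ (+-congʳ (*-congˡ (sym (#-suc n)))))))))
    where
    0≤σ : 0≤ σ
    0≤σ = ≤⇒0≤ (≤-trans (0≤⇒≤ (0≤∣∣ s)) u)
    r′ : # 2 * (R * ∣ s ∣) ≤ # 1
    r′ = by (R ∷ σ ∷ ∣ s ∣ ∷ []) (λ R σ s → (κ# 1 :- κ# 4 :* (R :* σ)) :+ κ# 2 :* (R :* σ) :+ κ# 2 :* R :* (σ :- s) ⊢ κ# 2 :* (R :* s) :≤ κ# 1)
      (r ⊹ 0≤# 2 · (q · 0≤σ) ⊹ 0≤# 2 · q · u)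

  -- A mean value inequality without derivatives. The terms of degree above p are s^(p+1) times a
  -- power series; by the product rule the first factor s contributes 3 to the constant and each of
  -- the p others 2, whence 2p + 3. The estimate is proved for partial sums and carried over by
  -- `dyadic-≤`.
  germ-difference : ∀ {A R a F} → GermWith A R a F → ∀ p {σ s s′} → # 4 * (R * σ) ≤ # 1 → ∣ s ∣ ≤ σ → ∣ s′ ∣ ≤ σ →
    ∣ (F s′ - F s) - (ev (suc p) a s′ - ev (suc p) a s) ∣ ≤ (# 2 * # p + # 3) * (A * R ^ suc p) * (∣ s′ - s ∣ * σ ^ p)
  germ-difference {A} {R} {a} {F} g p {σ} {s} {s′} r u v = dyadic-≤ (# 4 * A) bound
    where
    open GermWith g
    X = ∣ (F s′ - F s) - (ev (suc p) a s′ - ev (suc p) a s) ∣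
    Y = (# 2 * # p + # 3) * (A * R ^ suc p) * (∣ s′ - s ∣ * σ ^ p)
    0≤σ : 0≤ σ
    0≤σ = ≤⇒0≤ (≤-trans (0≤⇒≤ (0≤∣∣ s)) u)
    r′ : ∀ s → ∣ s ∣ ≤ σ → # 2 * (R * ∣ s ∣) ≤ # 1
    r′ s u = by (R ∷ σ ∷ ∣ s ∣ ∷ []) (λ R σ s → (κ# 1 :- κ# 4 :* (R :* σ)) :+ κ# 2 :* (R :* σ) :+ κ# 2 :* R :* (σ :- s) ⊢ κ# 2 :* (R :* s) :≤ κ# 1)
      (r ⊹ 0≤# 2 · (0≤R · 0≤σ) ⊹ 0≤# 2 · 0≤R · u)
    finite : ∀ m → ∣ (ev (suc p ℕ.+ m) a s′ - ev (suc p) a s′) - (ev (suc p ℕ.+ m) a s - ev (suc p) a s) ∣ ≤ Y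
    finite m = ≤-trans (∣∣-cong-≤ (+-cong (part s′) (-‿cong (part s))))
      (^-difference p m (0≤A · 0≤-^ (suc p) 0≤R) 0≤R
        (λ i → ≤-trans (coef (suc p ℕ.+ i)) (≤-reflexive (trans (*-congˡ (^-+ R (suc p) i)) (sym (*-assoc _ _ _))))) r u v)
      where
      part : ∀ s → ev (suc p ℕ.+ m) a s - ev (suc p) a s ≈ s ^ suc p * ev m (λ i → a (suc p ℕ.+ i)) s
      part s = trans (+-congʳ (ev-++ (suc p) m a s)) (ring! (ev (suc p) a s ∷ _ ∷ []) λ x y → (x :+ y) :- x := y)
    bound : ∀ m → # 2 ^ m * (X - Y) ≤ # 4 * A
    bound m = ≤-trans (*-monoˡ-≤ (0≤-^ m (0≤# 2)) (by (X ∷ Y ∷ e s′ ∷ e s ∷ []) (λ X Y a b → ((Y :+ a) :+ b) :- X ⊢ X :- Y :≤ a :+ b)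
        (≤-trans (∣∣-cong-≤ (ring! (F s′ ∷ F s ∷ ev (suc p) a s′ ∷ ev (suc p) a s ∷ ev (suc p ℕ.+ m) a s′ ∷ ev (suc p ℕ.+ m) a s ∷ []) λ f g x y u v →
          (f :- g) :- (x :- y) := ((u :- x) :- (v :- y)) :+ (f :- u) :- (g :- v)))
          (∣-∣-≤ (∣+∣-≤ (finite m) ≤-refl) ≤-refl))))
      (≤-trans (≤-reflexive (distribˡ _ _ _)) (≤-trans (+-mono-≤ (half-bound s′ v) (half-bound s u)) (≤-reflexive (ring! (A ∷ []) λ A → κ# 2 :* A :+ κ# 2 :* A := κ# 4 :* A))))
      where
      e : K → K
      e s = ∣ F s - ev (suc p ℕ.+ m) a s ∣
      half-bound : ∀ s → ∣ s ∣ ≤ σ → # 2 ^ m * e s ≤ # 2 * A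
      half-bound s u = ≤-trans (*-monoʳ-≤ (0≤∣∣ _) (^-monoʳ-≤ (1≤# (s≤s z≤n)) (ℕₚ.m≤n+m m (suc p)))) (dyadic-rem g s (suc p ℕ.+ m) (r′ s u))

  -- The families sⁱ and sʲ F and their power series

  joined : ∀ {a} {A : Set a} → ℕ → (ℕ → A) → (ℕ → A) → ℕ → A
  joined zero u v k = v k
  joined (suc E) u v zero = u 0
  joined (suc E) u v (suc k) = joined E (λ i → u (suc i)) v k

  joined-left : ∀ {a} {A : Set a} E (u v : ℕ → A) k → k ℕ.< E → joined E u v k ≡ u k
  joined-left (suc E) u v zero p = ≡.refl
  joined-left (suc E) u v (suc k) (s≤s p) = joined-left E (λ i → u (suc i)) v k p

  joined-right : ∀ {a} {A : Set a} E (u v : ℕ → A) j → joined E u v (E ℕ.+ j) ≡ v j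
  joined-right zero u v j = ≡.refl
  joined-right (suc E) u v j = joined-right E (λ i → u (suc i)) v j

  joined-∀₂ : ∀ {a b p} {A : Set a} {B : Set b} (P : A → B → Set p) E D {u v : ℕ → A} {u′ v′ : ℕ → B} →
    (∀ k → k ℕ.< E → P (u k) (u′ k)) → (∀ j → j ℕ.< D → P (v j) (v′ j)) →
    ∀ k → k ℕ.< E ℕ.+ D → P (joined E u v k) (joined E u′ v′ k)
  joined-∀₂ P zero D f g k p = g k p
  joined-∀₂ P (suc E) D f g zero p = f 0 (s≤s z≤n)
  joined-∀₂ P (suc E) D f g (suc k) (s≤s p) = joined-∀₂ P E D (λ k p → f (suc k) (s≤s p)) g k p

  split-< : ∀ E D k → k ℕ.< E ℕ.+ D → k ℕ.< E ⊎ (∃ λ j → j ℕ.< D × k ≡ E ℕ.+ j)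
  split-< zero D k p = inj₂ (k , p , ≡.refl)
  split-< (suc E) D zero p = inj₁ (s≤s z≤n)
  split-< (suc E) D (suc k) (s≤s p) with split-< E D k p
  ... | inj₁ q = inj₁ (s≤s q)
  ... | inj₂ (j , q , eq) = inj₂ (j , q , ≡.cong suc eq)

  ∑-joined : ∀ E D (c u v : ℕ → K) → ∑ (E ℕ.+ D) (λ k → c k * joined E u v k) ≈
    ∑ E (λ k → c k * u k) + ∑ D (λ j → c (E ℕ.+ j) * v j)
  ∑-joined E D c u v = trans (∑-++ E D _) (+-cong
    (∑-cong E λ k p → *-congˡ (reflexive (joined-left E u v k p)))
    (∑-cong D λ j _ → *-congˡ (reflexive (joined-right E u v j))))

  Independent : ℕ → (ℕ → ℕ → K) → Set
  Independent n g = ∀ (c : ℕ → K) → (∀ l → ∑ n (λ k → c k * g k l) ≈ # 0) → ∀ k → k ℕ.< n → c k ≈ # 0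

  -- The functions 1, s, …, s^(E-1), F, s F, … and their Taylor coefficients.
  functions : ℕ → (K → K) → ℕ → K → K
  functions E F = joined E (λ k s → s ^ k * # 1) (λ j s → s ^ j * F s)

  coefficients : ℕ → (ℕ → K) → ℕ → ℕ → K
  coefficients E a = joined E (λ k → shift k one) (λ j → shift j a)

  joined-map : ∀ E {u v : ℕ → K → K} k s → joined E u v k s ≡ joined E (λ k → u k s) (λ j → v j s) k
  joined-map zero k s = ≡.refl
  joined-map (suc E) zero s = ≡.refl
  joined-map (suc E) (suc k) s = joined-map E k s

  ∑-functions : ∀ E D F c s → ∑ (E ℕ.+ D) (λ k → c k * functions E F k s) ≈ ev E c s + ev D (λ j → c (E ℕ.+ j)) s * F s
  ∑-functions E D F c s = trans (∑-cong (E ℕ.+ D) λ k _ → *-congˡ (reflexive (joined-map E k s)))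
    (trans (∑-joined E D c _ _) (+-cong
      (trans (∑-cong E λ k _ → *-congˡ (*1≈ _)) (sym (ev-∑^ E c s)))
      (trans (∑-cong D λ j _ → ring! (c (E ℕ.+ j) ∷ s ^ j ∷ F s ∷ []) λ c p f → c :* (p :* f) := f :* (c :* p))
        (trans (∑-* D (F s) _) (trans (*-comm _ _) (*-congʳ (sym (ev-∑^ D _ s))))))))

  germ-functions : ∀ E D {a F} → Germ a F → ∀ k → k ℕ.< E ℕ.+ D → Germ (coefficients E a k) (functions E F k)
  germ-functions E D (A , R , g) = joined-∀₂ Germ E D (λ k _ → # 1 , # 1 , germ-shifts k germ-one) (λ j _ → A , R , germ-shifts j g)

  shift-one : ∀ k l → shift k one l ≡ δ k l
  shift-one zero zero = ≡.refl
  shift-one zero (suc l) = ≡.refl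
  shift-one (suc k) zero = ≡.refl
  shift-one (suc k) (suc l) = shift-one k l

  dne : ∀ {P : Set} → ¬ ¬ P → P
  dne = decidable-stable em

  ¬¬≈ : ∀ {x} → ¬ ¬ x ≈ # 0 → x ≈ # 0
  ¬¬≈ = dne

  -- Interpolation at 0, ..., D - 1 with error 0.
  poly-zero : ∀ D q → (∀ x → ev D q x ≈ # 0) → ∀ j → j ℕ.< D → q j ≈ # 0
  poly-zero D q h j p = ∣∣≈0⇒≈0 (≤-trans
    (interpolation D D (λ i → i) (λ i → ℕₚ.<⇒≤) (λ i j p _ → p) q
      (λ i _ → ≤-trans (∣∣-cong-≤ (h (# i))) (≤-reflexive (∣#∣ 0))) j p)
    (≤-reflexive (*0≈ _)))

  -- Continuation of a rational relation along U, and linear independence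

  module Continuation (U : K → Set) (f : K → K)
    (f-cong : ∀ {x y} → x ≈ y → f x ≈ f y)
    (U-cong : ∀ {x y} → x ≈ y → U x → U y)
    (U-convex : ∀ {x y z} → U x → U y → x ≤ z → z ≤ y → U z)
    (U-open : ∀ {x} → U x → ∃ λ ρ → 0< ρ × (∀ s → ∣ s ∣ ≤ ρ → U (x + s)))
    (germ : ∀ {c} → U c → ∃ λ a → Germ a (λ s → f (c + s)))
    where

    RationalOn : Set
    RationalOn = ∃₂ λ D E → ∃₂ λ q p → ∀ x → U x → ¬ ev D q x ≈ # 0 × f x * ev D q x ≈ ev E p x

    module _ (D E : ℕ) (q p : ℕ → K) where

      Zero : K → Set
      Zero x = ev D q x * f x ≈ ev E p x

      Zero-cong : ∀ {x y} → x ≈ y → Zero x → Zero y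
      Zero-cong eq z = trans (*-cong (ev-congʳ D q (sym eq)) (f-cong (sym eq))) (trans z (ev-congʳ E p eq))

      -- After recentring the polynomials at x₀ by `tay`, the defect q f - p is a combination of the
      -- functions sⁱ and sʲ F. It is therefore a germ again, and the identity theorem applies to
      -- it.
      local-identity : ∀ {x₀} → U x₀ → (∀ ε → 0< ε → ∃ λ s → ¬ s ≈ # 0 × ∣ s ∣ ≤ ε × Zero (x₀ + s)) →
        ∃ λ ρ → 0< ρ × (∀ s → ∣ s ∣ ≤ ρ → Zero (x₀ + s))
      local-identity {x₀} Ux₀ zeros = case germ Ux₀ of λ { (a , ga) → finish ga (germs-common (E ℕ.+ D) (germ-functions E D ga)) }
        where
        c = joined E (λ i → - # 1 * tay E x₀ p i) (tay D x₀ q)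
        F = λ s → f (x₀ + s)
        value : ∀ s → ∑ (E ℕ.+ D) (λ k → c k * functions E F k s) ≈ ev D q (x₀ + s) * f (x₀ + s) - ev E p (x₀ + s)
        value s = trans (∑-functions E D F c s) (trans (+-cong
          (trans (ev-cong E λ i p → reflexive (joined-left E _ _ i p)) (trans (ev-* E (- # 1) _ s) (*-congˡ (ev-tay E x₀ p s))))
          (*-congʳ (trans (ev-cong D λ j _ → reflexive (joined-right E _ _ j)) (ev-tay D x₀ q s))))
          (ring! (ev E p (x₀ + s) ∷ ev D q (x₀ + s) * f (x₀ + s) ∷ []) λ x y → (:- κ# 1) :* x :+ y := y :- x))

        finish : ∀ {a} → Germ a F → (∃₂ λ A R → # 1 ≤ A × # 1 ≤ R × (∀ k → k ℕ.< E ℕ.+ D → GermWith A R (coefficients E a k) (functions E F k))) →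
          ∃ λ ρ → 0< ρ × (∀ s → ∣ s ∣ ≤ ρ → Zero (x₀ + s))
        finish ga (A , R , 1≤A , 1≤R , gs) =
          case small (0≤# 2 · 1≤⇒0≤ 1≤R) 0<1 of λ { (ρ , 0<ρ , Rρ≤1) →
            ρ , 0<ρ , λ s s≤ρ → trans (ring! (ev D q (x₀ + s) * f (x₀ + s) ∷ ev E p (x₀ + s) ∷ []) λ x y → x := (x :- y) :+ y)
             (trans (+-congʳ (trans (sym (value s)) (germ-vanishes G (accumulating-zeros G G-zeros) s (≤-trans (≤-reflexive (sym (*-assoc _ _ _)))
               (≤-trans (*-monoˡ-≤ (0≤# 2 · 1≤⇒0≤ 1≤R) s≤ρ) Rρ≤1))))) (0+≈ _)) }
          where
          G = germ-∑ (E ℕ.+ D) c 1≤A 1≤R gs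
          G-zeros : ∀ ε → 0< ε → ∃ λ s → ¬ s ≈ # 0 × ∣ s ∣ ≤ ε × ∑ (E ℕ.+ D) (λ k → c k * functions E F k s) ≈ # 0
          G-zeros ε 0<ε = case zeros ε 0<ε of λ { (s , s≉0 , s≤ε , z) → s , s≉0 , s≤ε
                , trans (value s) (trans (+-congˡ (-‿cong (sym z))) (ring! (ev D q (x₀ + s) * f (x₀ + s) ∷ []) λ x → x :- x := κ# 0)) }

      segment : ∀ {c x} → U c → U x → ∀ θ → 0≤ θ → θ ≤ # 1 → U (c + θ * (x - c))
      segment {c} {x} Uc Ux θ 0≤θ θ≤1 = [
          (λ r → U-convex Uc Ux (by (c ∷ x ∷ θ ∷ []) (λ c x t → t :* (x :- c) ⊢ c :≤ c :+ t :* (x :- c)) (0≤θ · r))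
            (by (c ∷ x ∷ θ ∷ []) (λ c x t → (κ# 1 :- t) :* (x :- c) ⊢ c :+ t :* (x :- c) :≤ x) (θ≤1 · r)))
        , (λ r → U-convex Ux Uc (by (c ∷ x ∷ θ ∷ []) (λ c x t → (κ# 1 :- t) :* (c :- x) ⊢ x :≤ c :+ t :* (x :- c)) (θ≤1 · r))
            (by (c ∷ x ∷ θ ∷ []) (λ c x t → t :* (c :- x) ⊢ c :+ t :* (x :- c) :≤ c) (0≤θ · r))) ]′ (≤-total c x)

      -- Bisection along the segment from c to x finds the point L up to which the relation holds.
      -- The zeros below L accumulate there, so the relation extends a little beyond L, against the
      -- upper end of a short enough cut.
      continuation : ∀ {c ρ} → U c → 0< ρ → (∀ s → ∣ s ∣ ≤ ρ → Zero (c + s)) → ∀ x → U x → Zero x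
      continuation {c} {ρ} Uc 0<ρ near x Ux = dne contra
        where
        open Cut
        d = x - c
        W : K → Set
        W θ = ∀ θ′ → 0≤ θ′ → θ′ ≤ θ → Zero (c + θ′ * d)
        ∣θd∣ : ∀ {θ} → 0≤ θ → ∣ θ * d ∣ ≈ ∣ d ∣ * θ
        ∣θd∣ p = trans (∣*∣ _ _) (trans (*-congʳ (0≤⇒∣x∣≈x p)) (*-comm _ _))
        d≉0 : ¬ Zero x → ¬ d ≈ # 0
        d≉0 ¬z eq = ¬z (Zero-cong (trans (+-congˡ (sym eq)) (ring! (c ∷ x ∷ []) λ c x → c :+ (x :- c) := x))
          (near (# 0) (≤-trans (≤-reflexive (∣#∣ 0)) (0≤⇒≤ (0<⇒0≤ 0<ρ)))))
        module _ {α} (0<α : 0< α) (α≤1 : α ≤ # 1) (W-α : W α) {L} (α≤L : α ≤ L) (L≤1 : L ≤ # 1)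
          (cut : ∀ ε → 0< ε → Σ (Cut W α (# 1)) λ c → lo c ≤ L × L ≤ hi c × hi c - lo c ≤ ε) (d≉0 : ¬ d ≈ # 0) where

          0≤L : 0≤ L
          0≤L = ≤⇒0≤ (≤-trans (0≤⇒≤ (0<⇒0≤ 0<α)) α≤L)

          zeros : ∀ ε → 0< ε → ∃ λ s → ¬ s ≈ # 0 × ∣ s ∣ ≤ ε × Zero (c + L * d + s)
          zeros ε 0<ε =
            case small (0≤∣∣ d) 0<ε of λ { (η′ , 0<η′ , dη′≤ε) →
            case min-pos 0<η′ 0<α of λ { (η , 0<η , η≤η′ , η≤α) →
            case cut η 0<η of λ { (k , lo≤L , L≤hi , w) →
              - η * d
              , *-≉0 (λ e → 0<⇒≉0 0<η (trans (ring! (η ∷ []) λ e → e := :- (:- e)) (trans (-‿cong e) (ring! [] (:- κ# 0 := κ# 0))))) d≉0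
              , ≤-trans (≤-reflexive (trans (∣*∣ _ _) (*-congʳ (∣-∣ η)))) (≤-trans (≤-reflexive (trans (sym (∣*∣ _ _)) (∣θd∣ (0<⇒0≤ 0<η))))
                  (≤-trans (*-monoˡ-≤ (0≤∣∣ d) η≤η′) dη′≤ε))
              , Zero-cong (ring! (c ∷ L ∷ η ∷ d ∷ []) λ c L e d → c :+ (L :- e) :* d := (c :+ L :* d) :+ (:- e) :* d)
                  (P-lo k (L - η) (≤-trans η≤α α≤L)
                    (by (L ∷ η ∷ lo k ∷ hi k ∷ []) (λ L e l h → (h :- L) :+ (e :- (h :- l)) ⊢ L :- e :≤ l) (L≤hi ⊹ w))) } } }

          absurd : (∃ λ ρ′ → 0< ρ′ × (∀ s → ∣ s ∣ ≤ ρ′ → Zero (c + L * d + s))) → ⊥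
          absurd (ρ′ , 0<ρ′ , near′) =
            case small (0≤∣∣ d) 0<ρ′ of λ { (η , 0<η , dη≤ρ′) →
            case cut η 0<η of λ { (k , lo≤L , L≤hi , w) →
              ¬P-hi k λ θ 0≤θ θ≤hi → [ P-lo k θ 0≤θ
               , (λ lo≤θ → Zero-cong (ring! (c ∷ L ∷ θ ∷ d ∷ []) λ c L t d → (c :+ L :* d) :+ (t :- L) :* d := c :+ t :* d)
                   (near′ ((θ - L) * d) (≤-trans (≤-reflexive (trans (∣*∣ _ _) (*-comm _ _))) (≤-trans (*-monoˡ-≤ (0≤∣∣ d)
                     (∣∣-≤ (by (θ ∷ L ∷ η ∷ lo k ∷ hi k ∷ []) (λ t L e l h → (h :- t) :+ (L :- l) :+ (e :- (h :- l)) ⊢ t :- L :≤ e) (θ≤hi ⊹ lo≤L ⊹ w))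
                           (by (θ ∷ L ∷ η ∷ lo k ∷ hi k ∷ []) (λ t L e l h → (t :- l) :+ (h :- L) :+ (e :- (h :- l)) ⊢ :- (t :- L) :≤ e) (lo≤θ ⊹ L≤hi ⊹ w))))
                     dη≤ρ′)))) ]′ (≤-total θ (lo k)) } }

          false : ⊥
          false = absurd (local-identity (segment Uc Ux L 0≤L L≤1) zeros)

        contra : ¬ ¬ Zero x
        contra ¬z =
          case small (0≤∣∣ d) 0<ρ of λ { (α′ , 0<α′ , dα′≤ρ) →
          case min-pos 0<α′ 0<1 of λ { (α , 0<α , α≤α′ , α≤1) →
            let W-α : W α
                W-α = λ θ 0≤θ θ≤α → near (θ * d) (≤-trans (≤-reflexive (∣θd∣ 0≤θ)) (≤-trans (*-monoˡ-≤ (0≤∣∣ d) (≤-trans θ≤α α≤α′)) dα′≤ρ))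
            in case bisect {W} α≤1 W-α (λ w → ¬z (Zero-cong (ring! (c ∷ x ∷ []) λ c x → c :+ κ# 1 :* (x :- c) := x) (w (# 1) 0≤1 ≤-refl)))
            of λ { (L , α≤L , L≤1 , cut) → false 0<α α≤1 W-α α≤L L≤1 cut (d≉0 ¬z) } } }

    -- A common zero of numerator and denominator is cancelled; the degree of the denominator drops.
    cancel-zeros : ∀ D E q p → (∃ λ i → i ℕ.< D × ¬ q i ≈ # 0) → (∀ x → U x → Zero D E q p x) → RationalOn
    cancel-zeros D E q p nz zero-on with em {∃ λ x → U x × ev D q x ≈ # 0}
    ... | no h = D , E , q , p , λ x Ux → (λ z → h (x , Ux , z)) , trans (*-comm _ _) (zero-on x Ux)
    cancel-zeros zero E q p (i , () , _) zero-on | yes _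
    cancel-zeros (suc D) E q p (i , i<D , qi≉0) zero-on | yes (x₀ , Ux₀ , qx₀≈0) =
      cancel-zeros D E q′ p′ nonzero λ x Ux → everywhere x Ux
      where
      q′ = quot (suc D) q x₀
      p′ = quot E p x₀
      px₀≈0 : ev E p x₀ ≈ # 0
      px₀≈0 = trans (sym (zero-on x₀ Ux₀)) (trans (*-congʳ qx₀≈0) (trans (*-comm _ _) (*0≈ _)))
      away : ∀ x → U x → ¬ x - x₀ ≈ # 0 → Zero D E q′ p′ x
      away x Ux ne = trans (ring! (ev D q′ x * f x ∷ ev E p′ x ∷ []) λ a b → a := (a :- b) :+ b)
        (trans (+-congʳ (¬¬≈ λ n → *-≉0 ne n (trans (ring! (x - x₀ ∷ ev D q′ x ∷ f x ∷ ev E p′ x ∷ []) λ d a f b →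
            d :* (a :* f :- b) := d :* a :* f :- d :* b)
          (trans (+-cong (*-congʳ (trans (sym (0+≈ _)) (trans (+-congʳ (sym qx₀≈0)) (sym (ev-quot′ D q x₀ x)))))
              (-‿cong (trans (sym (0+≈ _)) (trans (+-congʳ (sym px₀≈0)) (sym (ev-quot E p x₀ x))))))
            (trans (+-congʳ (zero-on x Ux)) (ring! (ev E p x ∷ []) λ x → x :- x := κ# 0)))))) (0+≈ _))
      everywhere : ∀ x → U x → Zero D E q′ p′ x
      everywhere x Ux with em {x - x₀ ≈ # 0}
      ... | no ne = away x Ux ne
      -- At x₀ itself nothing can be divided out. The cancelled relation holds at all nearby points
      -- of U other than x₀, and these are zeros accumulating at x₀.
      ... | yes eq =
        let ρ , 0<ρ , U-near = U-open Ux₀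
            ρ′ , 0<ρ′ , z = local-identity D E q′ p′ Ux₀ λ ε 0<ε →
              let η , 0<η , η≤ε , η≤ρ = min-pos 0<ε 0<ρ
                  ∣η∣≤ = λ {e} (r : η ≤ e) → ≤-trans (≤-reflexive (0≤⇒∣x∣≈x (0<⇒0≤ 0<η))) r
              in η , 0<⇒≉0 0<η , ∣η∣≤ η≤ε
               , away (x₀ + η) (U-near η (∣η∣≤ η≤ρ)) (λ e → 0<⇒≉0 0<η (trans (ring! (x₀ ∷ η ∷ []) λ x e → e := (x :+ e) :- x) e))
        in Zero-cong D E q′ p′ (trans (+-congˡ (sym eq)) (ring! (x₀ ∷ x ∷ []) λ a b → a :+ (b :- a) := b))
             (z (# 0) (≤-trans (≤-reflexive (∣#∣ 0)) (0≤⇒≤ (0<⇒0≤ 0<ρ′))))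
      nonzero : ∃ λ i → i ℕ.< D × ¬ q′ i ≈ # 0
      nonzero with em {∃ λ i → i ℕ.< D × ¬ q′ i ≈ # 0}
      ... | yes h = h
      ... | no h = ⊥-elim (qi≉0 (vanish i i<D))
        where
        q′≈0 : ∀ i → i ℕ.≤ D → q′ i ≈ # 0
        q′≈0 i p with ℕₚ.m≤n⇒m<n∨m≡n p
        ... | inj₁ r = ¬¬≈ λ n → h (i , r , n)
        ... | inj₂ ≡.refl = quot-top D q x₀
        vanish : ∀ i → i ℕ.< suc D → q i ≈ # 0
        vanish zero _ = trans (ring! (q 0 ∷ x₀ ∷ q′ 0 ∷ []) λ a x b → a := (a :+ x :* b) :- x :* b)
          (trans (+-cong qx₀≈0 (-‿cong (*-congˡ (q′≈0 0 z≤n)))) (ring! (x₀ ∷ []) λ x → κ# 0 :- x :* κ# 0 := κ# 0))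
        vanish (suc j) (s≤s r) = trans (quot-suc D q x₀ j r) (trans (+-cong (q′≈0 j (ℕₚ.<⇒≤ r)) (-‿cong (*-congˡ (q′≈0 (suc j) r))))
          (ring! (x₀ ∷ []) λ x → κ# 0 :- x :* κ# 0 := κ# 0))

    -- A vanishing combination is a relation p + q f = 0 near c₀, hence on all of U. If q were
    -- nonzero, cancelling common zeros would turn f into a rational function without poles; so q =
    -- 0, and then the series of the powers of s shows p = 0.
    independent : ¬ RationalOn → ∀ {c₀} → U c₀ → ∀ {a} → Germ a (λ s → f (c₀ + s)) → ∀ E D → Independent (E ℕ.+ D) (coefficients E a)
    independent ¬rat {c₀} Uc₀ {a} ga E D c h k k< = [ (λ p → c≈0 k p) , (λ { (j , p , ≡.refl) → q≈0 j p }) ]′ (split-< E D k k<)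
      where
      q = λ j → c (E ℕ.+ j)
      F = λ s → f (c₀ + s)
      q̂ = tay D (- c₀) q
      p̂ = λ i → - # 1 * tay E (- c₀) c i
      back : ∀ s → - c₀ + (c₀ + s) ≈ s
      back s = ring! (c₀ ∷ s ∷ []) λ c s → :- c :+ (c :+ s) := s
      q̂-value : ∀ s → ev D q̂ (c₀ + s) ≈ ev D q s
      q̂-value s = trans (ev-tay D (- c₀) q (c₀ + s)) (ev-congʳ D q (back s))
      p̂-value : ∀ s → ev E p̂ (c₀ + s) ≈ - # 1 * ev E c s
      p̂-value s = trans (ev-* E (- # 1) _ _) (*-congˡ (trans (ev-tay E (- c₀) c (c₀ + s)) (ev-congʳ E c (back s))))
      near : ∃ λ ρ → 0< ρ × (∀ s → ∣ s ∣ ≤ ρ → Zero D E q̂ p̂ (c₀ + s))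
      near =
        case germs-common (E ℕ.+ D) (germ-functions E D ga) of λ { (A , R , 1≤A , 1≤R , gs) →
        case small (0≤# 2 · 1≤⇒0≤ 1≤R) 0<1 of λ { (ρ , 0<ρ , Rρ≤1) → ρ , 0<ρ , λ s s≤ρ →
          trans (*-congʳ (q̂-value s)) (trans (ring! (ev E c s ∷ ev D q s * F s ∷ []) λ p q → q := (p :+ q) :+ (:- κ# 1) :* p)
            (trans (+-congʳ (trans (sym (∑-functions E D F c s))
                (germ-vanishes (germ-∑ (E ℕ.+ D) c 1≤A 1≤R gs) h s (≤-trans (≤-reflexive (sym (*-assoc _ _ _)))
                  (≤-trans (*-monoˡ-≤ (0≤# 2 · 1≤⇒0≤ 1≤R) s≤ρ) Rρ≤1)))))
              (trans (0+≈ _) (sym (p̂-value s))))) } }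
      q≈0 : ∀ j → j ℕ.< D → q j ≈ # 0
      q≈0 with em {∃ λ i → i ℕ.< D × ¬ q̂ i ≈ # 0}
      ... | yes nz = ⊥-elim (¬rat (cancel-zeros D E q̂ p̂ nz
              (case near of λ { (ρ , 0<ρ , z) → continuation D E q̂ p̂ Uc₀ 0<ρ z })))
      ... | no ¬nz = poly-zero D q λ x → trans (sym (q̂-value x)) (ev-0 D _ λ i p → ¬¬≈ λ n → ¬nz (i , p , n))
      c≈0 : ∀ k → k ℕ.< E → c k ≈ # 0
      c≈0 k p = trans (sym (trans (+-cong (trans (∑-cong E λ i _ → *-congˡ (reflexive (shift-one i k))) (∑-δ E c k p))
            (∑-zero D λ j r → trans (*-congʳ (q≈0 j r)) (trans (*-comm _ _) (*0≈ _)))) (+0≈ _)))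
        (trans (sym (trans (∑-cong (E ℕ.+ D) λ i _ → *-congˡ (reflexive (joined-at E i))) (∑-joined E D c _ _))) (h k))
        where
        joined-at : ∀ E {u v : ℕ → ℕ → K} i → joined E u v i k ≡ joined E (λ i → u i k) (λ j → v j k) i
        joined-at zero i = ≡.refl
        joined-at (suc E) zero = ≡.refl
        joined-at (suc E) (suc i) = joined-at E i

  -- Reduced echelon bases of power series

  least : ∀ {P : ℕ → Set} → ∃ P → ∃ λ n → P n × (∀ i → i ℕ.< n → ¬ P i)
  least {P} (n , p) = <-rec (λ n → P n → ∃ λ n → P n × (∀ i → i ℕ.< n → ¬ P i)) step n p
    where
    step : ∀ n → (∀ {m} → m ℕ.< n → P m → ∃ λ n → P n × (∀ i → i ℕ.< n → ¬ P i)) → P n → ∃ λ n → P n × (∀ i → i ℕ.< n → ¬ P i)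
    step n ih p with em {∃ λ i → i ℕ.< n × P i}
    ... | yes (i , i<n , q) = ih i<n q
    ... | no h = n , p , λ i i<n q → h (i , i<n , q)

  ∑∑ : ∀ n m (a : ℕ → K) (M : ℕ → ℕ → K) (x : ℕ → K) →
    ∑ n (λ i → a i * ∑ m (λ k → M i k * x k)) ≈ ∑ m (λ k → ∑ n (λ i → a i * M i k) * x k)
  ∑∑ n m a M x = trans (∑-cong n λ i _ → sym (∑-* m (a i) _)) (trans (∑-swap n m _)
    (∑-cong m λ k _ → trans (∑-cong n λ i _ → ring! (a i ∷ M i k ∷ x k ∷ []) λ a m x → a :* (m :* x) := x :* (a :* m))
      (trans (∑-* n (x k) _) (*-comm _ _))))

  ∑-neg : ∀ n f → ∑ n (λ i → - f i) ≈ - ∑ n f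
  ∑-neg n f = trans (∑-cong n λ i _ → ring! (f i ∷ []) λ x → :- x := (:- κ# 1) :* x)
    (trans (∑-* n (- # 1) f) (ring! (∑ n f ∷ []) λ x → (:- κ# 1) :* x := :- x))

  -- A basis of the span of g 0, …, g (n - 1) in reduced echelon form with pivots o.
  record Echelon (n : ℕ) (g : ℕ → ℕ → K) : Set where
    field
      o : ℕ → ℕ
      G M : ℕ → ℕ → K
      G-span : ∀ i → i ℕ.< n → ∀ l → G i l ≈ ∑ n (λ k → M i k * g k l)
      G-pivot : ∀ i j → i ℕ.< n → j ℕ.< n → G i (o j) ≈ δ i j
      G-low : ∀ i → i ℕ.< n → ∀ l → l ℕ.< o i → G i l ≈ # 0
      g-span : ∀ k → k ℕ.< n → ∀ l → g k l ≈ ∑ n (λ i → g k (o i) * G i l)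

  independent-tail : ∀ {n g} → Independent (suc n) g → Independent n (λ k → g (suc k))
  independent-tail ind c h k p = ind (# 0 ◂ c) (λ l → trans (+-cong (trans (*-comm _ _) (*0≈ _)) (h l)) (0+≈ _)) (suc k) (s≤s p)

  -- One step of Gaussian elimination. Subtracting from `g 0` its part at the existing pivots leaves
  -- a series `h`, nonzero by independence. The first index where `h` does not vanish becomes the
  -- new pivot, and it is cleared from the old basis.
  module Extend {n : ℕ} {g : ℕ → ℕ → K} (ech : Echelon n (λ k → g (suc k))) where
    open Echelon ech

    defect : (ℕ → K) → ℕ → K
    defect u l = u l - ∑ n (λ i → u (o i) * G i l)

    defect-pivot : ∀ u j → j ℕ.< n → defect u (o j) ≈ # 0
    defect-pivot u j p = trans (+-congˡ (-‿cong (trans (∑-cong n λ i q → *-congˡ (G-pivot i j q p)) (∑-δ n (λ i → u (o i)) j p))))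
      (ring! (u (o j) ∷ []) λ x → x :- x := κ# 0)

    defect-tail : ∀ k → k ℕ.< n → ∀ l → defect (g (suc k)) l ≈ # 0
    defect-tail k p l = trans (+-congˡ (-‿cong (sym (g-span k p l)))) (ring! (g (suc k) l ∷ []) λ x → x :- x := κ# 0)

    h : ℕ → K
    h = defect (g 0)

    weights : ℕ → K
    weights k = - ∑ n (λ i → g 0 (o i) * M i k)

    h-span : ∀ l → h l ≈ g 0 l + ∑ n (λ k → weights k * g (suc k) l)
    h-span l = +-congˡ (trans (-‿cong (trans (∑-cong n λ i p → *-congˡ (G-span i p l)) (∑∑ n n _ M _)))
      (trans (sym (∑-neg n _)) (∑-cong n λ k _ → ring! (∑ n (λ i → g 0 (o i) * M i k) ∷ g (suc k) l ∷ []) λ a b → :- (a :* b) := (:- a) :* b)))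

    h≉0 : Independent (suc n) g → ∃ λ l → ¬ h l ≈ # 0
    h≉0 ind = dne λ none → 0<⇒≉0 0<1 (ind (# 1 ◂ weights)
      (λ l → trans (+-congʳ (1*≈ _)) (trans (sym (h-span l)) (¬¬≈ λ ne → none (l , ne)))) 0 (s≤s z≤n))

    module _ {p : ℕ} {w : K} (h-p : h p * w ≈ # 1) (h-low : ∀ l → l ℕ.< p → h l ≈ # 0) where
      H : ℕ → K
      H l = w * h l

      H-p : H p ≈ # 1
      H-p = trans (*-comm _ _) h-p

      H-low : ∀ l → l ℕ.< p → H l ≈ # 0
      H-low l q = trans (*-congˡ (h-low l q)) (*0≈ w)

      H-pivot : ∀ j → j ℕ.< n → H (o j) ≈ # 0
      H-pivot j q = trans (*-congˡ (defect-pivot (g 0) j q)) (*0≈ w)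

      o′ : ℕ → ℕ
      o′ zero = p
      o′ (suc i) = o i

      G′ M′ : ℕ → ℕ → K
      G′ zero l = H l
      G′ (suc i) l = G i l - G i p * H l
      M′ zero zero = w
      M′ zero (suc k) = w * weights k
      M′ (suc i) zero = - G i p * w
      M′ (suc i) (suc k) = M i k - G i p * (w * weights k)

      H-span : ∀ l → H l ≈ w * g 0 l + ∑ n (λ k → w * weights k * g (suc k) l)
      H-span l = trans (*-congˡ (h-span l)) (trans (distribˡ _ _ _) (+-congˡ (trans (sym (∑-* n w _)) (∑-cong n λ k _ → sym (*-assoc _ _ _)))))

      G′-span : ∀ i → i ℕ.< suc n → ∀ l → G′ i l ≈ ∑ (suc n) (λ k → M′ i k * g k l)
      G′-span zero _ l = H-span l
      G′-span (suc i) (s≤s q) l = trans (+-cong (G-span i q l) (-‿cong (*-congˡ (H-span l))))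
        (trans (ring! (∑ n (λ k → M i k * g (suc k) l) ∷ G i p ∷ w ∷ g 0 l ∷ ∑ n (λ k → w * weights k * g (suc k) l) ∷ [])
            (λ a γ w b c → a :- γ :* (w :* b :+ c) := (:- γ) :* w :* b :+ (a :+ (:- γ) :* c)))
          (+-congˡ (trans (+-congˡ (sym (∑-* n (- G i p) _))) (trans (sym (∑-+ n _ _))
            (∑-cong n λ k _ → ring! (M i k ∷ g (suc k) l ∷ G i p ∷ w ∷ weights k ∷ []) λ m x γ w v →
              m :* x :+ (:- γ) :* (w :* v :* x) := (m :- γ :* (w :* v)) :* x)))))

      G′-pivot : ∀ i j → i ℕ.< suc n → j ℕ.< suc n → G′ i (o′ j) ≈ δ i j
      G′-pivot zero zero _ _ = H-p
      G′-pivot zero (suc j) _ (s≤s r) = H-pivot j r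
      G′-pivot (suc i) zero _ _ = trans (+-congˡ (-‿cong (trans (*-congˡ H-p) (*1≈ _)))) (ring! (G i p ∷ []) λ x → x :- x := κ# 0)
      G′-pivot (suc i) (suc j) (s≤s q) (s≤s r) = trans (+-cong (G-pivot i j q r) (-‿cong (*-congˡ (H-pivot j r))))
        (ring! (δ i j ∷ G i p ∷ []) λ d x → d :- x :* κ# 0 := d)

      G′-low : ∀ i → i ℕ.< suc n → ∀ l → l ℕ.< o′ i → G′ i l ≈ # 0
      G′-low zero _ l r = H-low l r
      G′-low (suc i) (s≤s q) l r = trans (+-cong (G-low i q l r) (-‿cong (product (p ℕₚ.≤? l)))) (ring! [] (κ# 0 :- κ# 0 := κ# 0))
        where
        -- Clearing the new pivot p does not spoil the leading zeros: if p ≤ l < `o i`, the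
        -- multiplier `G i p` is 0 already, and if l < p, then `H l` is 0.
        product : Dec (p ℕ.≤ l) → G i p * H l ≈ # 0
        product (yes p≤l) = trans (*-congʳ (G-low i q p (ℕₚ.≤-<-trans p≤l r))) (trans (*-comm _ _) (*0≈ _))
        product (no p≰l) = trans (*-congˡ (H-low l (ℕₚ.≰⇒> p≰l))) (*0≈ _)

      span : ∀ u → (∀ l → defect u l ≈ defect u p * H l) → ∀ l → u l ≈ u p * H l + ∑ n (λ i → u (o i) * (G i l - G i p * H l))
      span u eq l = trans (ring! (u l ∷ S l ∷ []) λ x y → x := (x :- y) :+ y) (trans (+-congʳ (eq l)) (sym (trans
        (+-congˡ (trans (∑-cong n λ i _ → ring! (u (o i) ∷ G i l ∷ G i p ∷ H l ∷ []) λ u g γ h → u :* (g :- γ :* h) := u :* g :+ (:- h) :* (u :* γ))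
          (trans (∑-+ n _ _) (+-congˡ (∑-* n (- H l) _)))))
        (ring! (u p ∷ H l ∷ S l ∷ S p ∷ []) λ u h a b → u :* h :+ (a :+ (:- h) :* b) := (u :- b) :* h :+ a))))
        where
        S : ℕ → K
        S l = ∑ n (λ i → u (o i) * G i l)

      g′-span : ∀ k → k ℕ.< suc n → ∀ l → g k l ≈ ∑ (suc n) (λ i → g k (o′ i) * G′ i l)
      g′-span zero _ = span (g 0) λ l → sym (trans (sym (*-assoc _ _ _)) (trans (*-congʳ h-p) (1*≈ _)))
      g′-span (suc k) (s≤s q) = span (g (suc k)) λ l → trans (defect-tail k q l) (sym (trans (*-congʳ (defect-tail k q p)) (trans (*-comm _ _) (*0≈ _))))

      extended : Echelon (suc n) g
      extended = record { o = o′ ; G = G′ ; M = M′ ; G-span = G′-span ; G-pivot = G′-pivot ; G-low = G′-low ; g-span = g′-span }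

  echelon : ∀ n g → Independent n g → Echelon n g
  echelon zero g ind = record { o = λ i → i ; G = λ _ _ → # 0 ; M = λ _ _ → # 0 ; G-span = λ _ () ; G-pivot = λ _ _ () ; G-low = λ _ () ; g-span = λ _ () }
  echelon (suc n) g ind = extend (echelon n (λ k → g (suc k)) (independent-tail {n} {g} ind))
    where
    extend : Echelon n (λ k → g (suc k)) → Echelon (suc n) g
    extend ech = case least (Extend.h≉0 {n} {g} ech ind) of λ { (p , hp≉0 , low) →
      case inv {Extend.h {g = g} ech p} hp≉0 of λ { (w , eq) → Extend.extended {g = g} ech {p} {w} eq (λ l q → ¬¬≈ (low l q)) } }

  module _ {n : ℕ} {g : ℕ → ℕ → K} (ind : Independent n g) (ech : Echelon n g) (c : ℕ → K) where
    open Echelon ech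

    combination : ℕ → K
    combination l = ∑ n (λ k → c k * g k l)

    combination-span : ∀ l → combination l ≈ ∑ n (λ i → combination (o i) * G i l)
    combination-span l = trans (∑-cong n λ k p → *-congˡ (g-span k p l)) (∑∑ n n c (λ k i → g k (o i)) (λ i → G i l))

    -- The combination is determined by its values at the pivots, and independence turns this
    -- equality of series into one of coefficients. Bounds at the pivots thus become bounds for the
    -- `c k`.
    combination-coefficient : ∀ k → k ℕ.< n → c k ≈ ∑ n (λ i → combination (o i) * M i k)
    combination-coefficient k p = trans (ring! (c k ∷ c′ k ∷ []) λ x y → x := (x :- y) :+ y)
      (trans (+-congʳ (ind (λ k → c k - c′ k) relation k p)) (0+≈ _))
      where
      c′ : ℕ → K
      c′ k = ∑ n (λ i → combination (o i) * M i k)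
      relation : ∀ l → ∑ n (λ k → (c k - c′ k) * g k l) ≈ # 0
      relation l = trans (∑-cong n λ k _ → ring! (c k ∷ c′ k ∷ g k l ∷ []) λ a b x → (a :- b) :* x := a :* x :+ (:- (b :* x)))
        (trans (∑-+ n _ _) (trans (+-cong (combination-span l) (trans (∑-neg n _) (-‿cong (trans (sym (∑∑ n n _ M _)) (∑-cong n λ i q → *-congˡ (sym (G-span i q l)))))))
          (ring! (∑ n (λ i → combination (o i) * G i l) ∷ []) λ x → x :- x := κ# 0)))

  -- Euler operators and a lower bound for combinations

  tay-cong : ∀ T {s e e′} → (∀ l → e l ≈ e′ l) → ∀ j → tay T s e j ≈ tay T s e′ j
  tay-cong zero h j = refl
  tay-cong (suc T) h zero = +-cong (h 0) (*-congˡ (tay-cong T (λ l → h (suc l)) 0))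
  tay-cong (suc T) h (suc j) = +-cong (*-congˡ (tay-cong T (λ l → h (suc l)) (suc j))) (tay-cong T (λ l → h (suc l)) j)

  tay-* : ∀ T s c e j → tay T s (λ l → c * e l) j ≈ c * tay T s e j
  tay-* zero s c e j = sym (*0≈ c)
  tay-* (suc T) s c e zero = trans (+-congˡ (*-congˡ (tay-* T s c (tail e) 0)))
    (ring! (c ∷ s ∷ e 0 ∷ tay T s (tail e) 0 ∷ []) λ c s a b → c :* a :+ s :* (c :* b) := c :* (a :+ s :* b))
  tay-* (suc T) s c e (suc j) = trans (+-cong (*-congˡ (tay-* T s c (tail e) (suc j))) (tay-* T s c (tail e) j))
    (ring! (c ∷ s ∷ tay T s (tail e) (suc j) ∷ tay T s (tail e) j ∷ []) λ c s a b → s :* (c :* a) :+ c :* b := c :* (s :* a :+ b))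

  -- Scaling the variable by s moves the expansion point from s to 1, where the Euler operators act
  -- on Taylor coefficients by formulas that do not involve s.
  tay-scale : ∀ T s r j → tay T (# 1) (λ l → r l * s ^ l) j ≈ tay T s r j * s ^ j
  tay-scale zero s r j = trans (sym (*0≈ _)) (*-comm _ _)
  tay-scale (suc T) s r j = step j
    where
    S = tay T s (tail r)
    inner : ∀ j → tay T (# 1) (λ l → r (suc l) * s ^ suc l) j ≈ s * (S j * s ^ j)
    inner j = trans (tay-cong T (λ l → ring! (r (suc l) ∷ s ∷ s ^ l ∷ []) λ a s p → a :* (s :* p) := s :* (a :* p)) j)
      (trans (tay-* T (# 1) s _ j) (*-congˡ (tay-scale T s (tail r) j)))
    step : ∀ j → tay (suc T) (# 1) (λ l → r l * s ^ l) j ≈ tay (suc T) s r j * s ^ j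
    step zero = trans (+-congˡ (*-congˡ (inner 0)))
      (ring! (r 0 ∷ s ∷ S 0 ∷ []) λ a s b → a :* κ# 1 :+ κ# 1 :* (s :* (b :* κ# 1)) := (a :+ s :* b) :* κ# 1)
    step (suc j) = trans (+-cong (*-congˡ (inner (suc j))) (inner j))
      (ring! (s ∷ S (suc j) ∷ S j ∷ s ^ j ∷ []) λ s a b p → κ# 1 :* (s :* (a :* (s :* p))) :+ s :* (b :* p) := (s :* a :+ b) :* (s :* p))

  tay-0 : ∀ T x → tay T (# 1) x 0 ≈ ∑ T x
  tay-0 zero x = refl
  tay-0 (suc T) x = +-congˡ (trans (1*≈ _) (tay-0 T (tail x)))

  -- The Euler operator x_l ↦ (l - o) x_l in terms of the Taylor coefficients at 1.
  tay-Euler : ∀ T o x j → tay T (# 1) (λ l → (# l - o) * x l) j ≈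
    (# j + # 1) * tay T (# 1) x (suc j) + (# j - o) * tay T (# 1) x j
  tay-Euler zero o x j = ring! (# j ∷ o ∷ []) λ j o → κ# 0 := (j :+ κ# 1) :* κ# 0 :+ (j :- o) :* κ# 0
  tay-Euler (suc T) o x j = step j
    where
    S = tay T (# 1) (tail x)
    inner : ∀ j → tay T (# 1) (λ l → (# (suc l) - o) * x (suc l)) j ≈ (# j + # 1) * S (suc j) + (# j - (o - # 1)) * S j
    inner j = trans (tay-cong T (λ l → *-congʳ (trans (+-congʳ (#-suc l)) (ring! (# l ∷ o ∷ []) λ l o → κ# 1 :+ l :- o := l :- (o :- κ# 1)))) j)
      (tay-Euler T (o - # 1) (tail x) j)
    step : ∀ j → tay (suc T) (# 1) (λ l → (# l - o) * x l) j ≈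
      (# j + # 1) * tay (suc T) (# 1) x (suc j) + (# j - o) * tay (suc T) (# 1) x j
    step zero = trans (+-congˡ (*-congˡ (inner 0))) (ring! (o ∷ x 0 ∷ S 0 ∷ S 1 ∷ []) λ o x a b →
      (κ# 0 :- o) :* x :+ κ# 1 :* ((κ# 0 :+ κ# 1) :* b :+ (κ# 0 :- (o :- κ# 1)) :* a) :=
      (κ# 0 :+ κ# 1) :* (κ# 1 :* b :+ a) :+ (κ# 0 :- o) :* (x :+ κ# 1 :* a))
    step (suc j) = trans (+-cong (*-congˡ (inner (suc j))) (inner j))
      (trans (ring! (# j ∷ # (suc j) ∷ o ∷ S j ∷ S (suc j) ∷ S (suc (suc j)) ∷ []) λ a b o x y z →
          κ# 1 :* ((b :+ κ# 1) :* z :+ (b :- (o :- κ# 1)) :* y) :+ ((a :+ κ# 1) :* y :+ (a :- (o :- κ# 1)) :* x) :=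
          ((b :+ κ# 1) :* (κ# 1 :* z :+ y) :+ (b :- o) :* (κ# 1 :* y :+ x)) :+ (κ# 1 :+ a :- b) :* (x :+ y))
        (trans (+-congˡ (trans (*-congʳ (trans (+-congʳ (sym (#-suc j))) (ring! (# (suc j) ∷ []) λ b → b :- b := κ# 0)))
          (trans (*-comm _ _) (*0≈ _)))) (+0≈ _)))

  Euler : ℕ → (ℕ → ℕ) → (ℕ → K) → ℕ → K
  Euler zero p x = x
  Euler (suc m) p x = Euler m (λ i → p (suc i)) (λ l → (# l - # (p 0)) * x l)

  factor : ℕ → (ℕ → ℕ) → ℕ → K
  factor zero p l = # 1
  factor (suc m) p l = factor m (λ i → p (suc i)) l * (# l - # (p 0))

  Euler-factor : ∀ m p x l → Euler m p x l ≈ factor m p l * x l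
  Euler-factor zero p x l = sym (1*≈ _)
  Euler-factor (suc m) p x l = trans (Euler-factor m _ _ l) (sym (*-assoc _ _ _))

  -- An operator turns the j-th Taylor coefficient into a combination of those of orders j and j +
  -- 1. So m operators use up the orders up to m, each at the cost of a factor W.
  Euler-bound : ∀ T m p x {B W e} → (∀ i → i ℕ.< m → p i ℕ.≤ B) → # 2 * # m + # 1 + # B ≤ W → 0≤ W →
    (∀ j → j ℕ.≤ m → ∣ tay T (# 1) x j ∣ ≤ e) → ∣ tay T (# 1) (Euler m p x) 0 ∣ ≤ W ^ m * e
  Euler-bound T zero p x hp hW 0≤W h = ≤-trans (h 0 z≤n) (≤-reflexive (sym (1*≈ _)))
  Euler-bound T (suc m) p x {B} {W} {e} hp hW 0≤W h = ≤-trans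
    (Euler-bound T m (λ i → p (suc i)) _ {B} {W} {W * e} (λ i q → hp (suc i) (s≤s q))
      (≤-trans (by (# m ∷ # (suc m) ∷ # B ∷ []) (λ m s B → (s :- m) :+ (s :- m) ⊢ κ# 2 :* m :+ κ# 1 :+ B :≤ κ# 2 :* s :+ κ# 1 :+ B)
        (#-mono (ℕₚ.n≤1+n m) ⊹ #-mono (ℕₚ.n≤1+n m))) hW) 0≤W step)
    (≤-reflexive (ring! (W ∷ W ^ m ∷ e ∷ []) λ W p e → p :* (W :* e) := W :* p :* e))
    where
    0≤e : 0≤ e
    0≤e = ≤⇒0≤ (≤-trans (0≤⇒≤ (0≤∣∣ _)) (h 0 z≤n))
    step : ∀ j → j ℕ.≤ m → ∣ tay T (# 1) (λ l → (# l - # (p 0)) * x l) j ∣ ≤ W * e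
    step j q = ≤-trans (∣∣-cong-≤ (tay-Euler T (# (p 0)) x j))
      (≤-trans (∣+∣-≤ (∣*∣-≤ (≤-reflexive (0≤⇒∣x∣≈x (0≤# j ⊹ 0≤1))) (h (suc j) (s≤s q)))
        (∣*∣-≤ (∣-∣-≤ (≤-reflexive (∣#∣ j)) (≤-reflexive (∣#∣ (p 0)))) (h j (ℕₚ.m≤n⇒m≤1+n q))))
      (by (# j ∷ # (suc m) ∷ # (p 0) ∷ # B ∷ W ∷ e ∷ []) (λ j m p B W e →
          ((W :- (κ# 2 :* m :+ κ# 1 :+ B)) :+ ((m :- j) :+ (m :- j)) :+ (B :- p)) :* e ⊢ (j :+ κ# 1) :* e :+ (j :+ p) :* e :≤ W :* e)
        ((hW ⊹ (#-mono (ℕₚ.m≤n⇒m≤1+n q) ⊹ #-mono (ℕₚ.m≤n⇒m≤1+n q)) ⊹ #-mono (hp 0 (s≤s z≤n))) · 0≤e)))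

  1≤∣#-#∣ : ∀ {a b} → ¬ a ≡ b → # 1 ≤ ∣ # a - # b ∣
  1≤∣#-#∣ {a} {b} ne with ℕₚ.<-cmp a b
  ... | tri< p _ _ = ≤-trans (by (# a ∷ # b ∷ []) (λ a b → b :- (κ# 1 :+ a) ⊢ κ# 1 :≤ :- (a :- b)) (≤-trans (≤-reflexive (sym (#-suc a))) (#-mono p))) (-x≤∣x∣ _)
  ... | tri≈ _ p _ = ⊥-elim (ne p)
  ... | tri> _ _ p = ≤-trans (by (# a ∷ # b ∷ []) (λ a b → a :- (κ# 1 :+ b) ⊢ κ# 1 :≤ a :- b) (≤-trans (≤-reflexive (sym (#-suc b))) (#-mono p))) (x≤∣x∣ _)

  1≤∣factor∣ : ∀ m p l → (∀ j → j ℕ.< m → ¬ l ≡ p j) → # 1 ≤ ∣ factor m p l ∣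
  1≤∣factor∣ zero p l h = ≤-reflexive (sym (∣#∣ 1))
  1≤∣factor∣ (suc m) p l h = ≤-trans (≤-reflexive (sym (1*≈ _)))
    (≤-trans (*-mono-≤ 0≤1 (0≤∣∣ _) (1≤∣factor∣ m _ l λ j q → h (suc j) (s≤s q)) (1≤∣#-#∣ (h 0 (s≤s z≤n)))) (≤-reflexive (sym (∣*∣ _ _))))

  factor≈0 : ∀ m p l j → j ℕ.< m → l ≡ p j → factor m p l ≈ # 0
  factor≈0 (suc m) p l zero q ≡.refl = trans (*-congˡ (ring! (# l ∷ []) λ l → l :- l := κ# 0)) (*0≈ _)
  factor≈0 (suc m) p l (suc j) (s≤s q) eq = trans (*-congʳ (factor≈0 m _ l j q eq)) (trans (*-comm _ _) (*0≈ _))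

  ∣#-#∣≤ : ∀ {a b T} → a ℕ.≤ T → b ℕ.≤ T → ∣ # a - # b ∣ ≤ # T
  ∣#-#∣≤ {a} {b} {T} p q = ∣∣-≤ (by (# a ∷ # b ∷ # T ∷ []) (λ a b T → (T :- a) :+ b ⊢ a :- b :≤ T) (#-mono p ⊹ 0≤# b))
    (by (# a ∷ # b ∷ # T ∷ []) (λ a b T → (T :- b) :+ a ⊢ :- (a :- b) :≤ T) (#-mono q ⊹ 0≤# a))

  ∣factor∣≤ : ∀ m p l T → l ℕ.≤ T → (∀ j → j ℕ.< m → p j ℕ.≤ T) → ∣ factor m p l ∣ ≤ # T ^ m
  ∣factor∣≤ zero p l T q h = ≤-reflexive (∣#∣ 1)
  ∣factor∣≤ (suc m) p l T q h = ≤-trans (∣*∣-≤ (∣factor∣≤ m _ l T q λ j r → h (suc j) (s≤s r)) (∣#-#∣≤ q (h 0 (s≤s z≤n)))) (≤-reflexive (*-comm _ _))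

  ∑-isolate : ∀ T f p {b} → p ℕ.< T → 0≤ b → (∀ l → l ℕ.< T → ¬ l ≡ p → ∣ f l ∣ ≤ b) → ∣ f p ∣ ≤ ∣ ∑ T f ∣ + # T * b
  ∑-isolate T f p {b} p<T 0≤b h = ≤-trans
    (∣∣-cong-≤ (trans (ring! (f p ∷ ∑ T f ∷ []) λ a S → a := S :- (S :+ (:- a))) (+-congˡ (-‿cong (sym rest)))))
    (∣-∣-≤ ≤-refl (∣∑∣-bound T λ l q → bound l q (l ℕₚ.≟ p)))
    where
    rest : ∑ T (λ l → f l + - (f l * δ l p)) ≈ ∑ T f + - f p
    rest = trans (∑-+ T _ _) (+-congˡ (trans (∑-neg T _) (-‿cong (∑-δ T f p p<T))))
    bound : ∀ l → l ℕ.< T → Dec (l ≡ p) → ∣ f l + - (f l * δ l p) ∣ ≤ b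
    bound l q (yes ≡.refl) = ≤-trans (∣∣-cong-≤ (trans (+-congˡ (-‿cong (*-congˡ (reflexive (δ-same p))))) (ring! (f l ∷ []) λ x → x :- x :* κ# 1 := κ# 0)))
      (≤-trans (≤-reflexive (∣#∣ 0)) (0≤⇒≤ 0≤b))
    bound l q (no ne) = ≤-trans (∣∣-cong-≤ (trans (+-congˡ (-‿cong (*-congˡ (reflexive (δ-diff l p ne))))) (ring! (f l ∷ []) λ x → x :- x :* κ# 0 := x))) (h l q ne)

  max : ℕ → (ℕ → ℕ) → ℕ
  max zero f = 0
  max (suc n) f = f 0 ℕ.⊔ max n (λ i → f (suc i))

  ≤max : ∀ n f i → i ℕ.< n → f i ℕ.≤ max n f
  ≤max (suc n) f zero p = ℕₚ.m≤m⊔n (f 0) _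
  ≤max (suc n) f (suc i) (s≤s p) = ℕₚ.≤-trans (≤max n _ i p) (ℕₚ.m≤n⊔m (f 0) _)

  -- The Euler operators that kill all pivots but one isolate the coefficient at that pivot, up to
  -- terms of higher order in s.
  module LowerBound {n : ℕ} {g : ℕ → ℕ → K} (ind : Independent n g) (ech : Echelon n g) (T : ℕ)
    (o<T : ∀ i → i ℕ.< n → Echelon.o ech i ℕ.< T) where
    open Echelon ech

    W Fb Gb Mb Q C : K
    W = # 2 * # n + # 1 + # T
    Fb = # T ^ n
    Gb = ∑ n λ i → ∑∣∣ T (G i)
    Mb = ∑ n λ i → ∑∣∣ n (M i)
    Q = # n * (# T * (Fb * Gb))
    C = # 2 * (# n * W ^ n) * Mb

    0≤W : 0≤ W
    0≤W = 0≤# 2 · 0≤# n ⊹ 0≤1 ⊹ 0≤# T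
    0≤Gb : 0≤ Gb
    0≤Gb = 0≤∑ n λ i _ → 0≤∑∣∣ T (G i)
    0≤Mb : 0≤ Mb
    0≤Mb = 0≤∑ n λ i _ → 0≤∑∣∣ n (M i)
    0≤Q : 0≤ Q
    0≤Q = 0≤# n · (0≤# T · (0≤-^ n (0≤# T) · 0≤Gb))
    0≤C : 0≤ C
    0≤C = 0≤# 2 · (0≤# n · 0≤-^ n 0≤W) · 0≤Mb

    ∣G∣≤ : ∀ i l → i ℕ.< n → l ℕ.< T → ∣ G i l ∣ ≤ Gb
    ∣G∣≤ i l p q = ≤-trans (term≤∑ T (λ l _ → 0≤∣∣ (G i l)) l q) (term≤∑ n (λ i _ → 0≤∑∣∣ T (G i)) i p)
    ∣M∣≤ : ∀ i k → i ℕ.< n → k ℕ.< n → ∣ M i k ∣ ≤ Mb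
    ∣M∣≤ i k p q = ≤-trans (term≤∑ n (λ k _ → 0≤∣∣ (M i k)) k q) (term≤∑ n (λ i _ → 0≤∑∣∣ n (M i)) i p)

    o-injective : ∀ i j → i ℕ.< n → j ℕ.< n → ¬ i ≡ j → ¬ o i ≡ o j
    o-injective i j p q ne eq = 0<⇒≉0 0<1 (trans (sym (reflexive (δ-same i))) (trans (sym (G-pivot i i p p))
      (trans (reflexive (≡.cong (G i) eq)) (trans (G-pivot i j p q) (reflexive (δ-diff i j ne))))))

    module _ (c : ℕ → K) {s e : K} (0<s : 0< s) (s≤1 : s ≤ # 1) (Qs≤ : # 2 * (Q * s) ≤ # 1)
      (small-tay : ∀ j → j ℕ.≤ n → ∣ tay T s (combination ind ech c) j * s ^ j ∣ ≤ e) where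

      r x y : ℕ → K
      r = combination ind ech c
      x l = r l * s ^ l
      y i = ∣ r (o i) ∣ * s ^ o i

      Y : K
      Y = ∑ n y

      0≤s : 0≤ s
      0≤s = 0<⇒0≤ 0<s
      0≤y : ∀ i → 0≤ y i
      0≤y i = 0≤∣∣ _ · 0≤-^ (o i) 0≤s
      0≤Y : 0≤ Y
      0≤Y = 0≤∑ n λ i _ → 0≤y i
      0≤e : 0≤ e
      0≤e = ≤⇒0≤ (≤-trans (0≤⇒≤ (0≤∣∣ _)) (small-tay 0 z≤n))

      -- A basis series vanishes before its own pivot, so at l only pivots below l contribute, and
      -- each such contribution is smaller than its pivot term by at least a factor s.
      off-pivot : ∀ l → l ℕ.< T → (∀ i → i ℕ.< n → ¬ l ≡ o i) → ∣ x l ∣ ≤ Y * (Gb * s)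
      off-pivot l l<T ne = ≤-trans (≤-reflexive (∣*∣ _ _))
        (≤-trans (*-mono-≤ (0≤∣∣ _) (0≤∑ n λ i _ → 0≤∣∣ _) (≤-trans (∣∣-cong-≤ (combination-span ind ech c l)) (∣∑∣ n _))
          (≤-reflexive (0≤⇒∣x∣≈x (0≤-^ l 0≤s))))
        (≤-trans (≤-reflexive (trans (*-comm _ _) (sym (∑-* n _ _))))
        (≤-trans (∑-mono n (λ i p → term i p (ℕₚ.<-cmp l (o i)))) (≤-reflexive (trans (∑-cong n λ i _ → *-comm _ _) (trans (∑-* n (Gb * s) y) (*-comm _ _)))))))
        where
        term : ∀ i → i ℕ.< n → Tri (l ℕ.< o i) (l ≡ o i) (o i ℕ.< l) → s ^ l * ∣ r (o i) * G i l ∣ ≤ y i * (Gb * s)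
        term i p (tri≈ _ q _) = ⊥-elim (ne i p q)
        term i p (tri< q _ _) = ≤-trans (≤-reflexive (trans (*-congˡ (trans (∣∣-cong (trans (*-congˡ (G-low i p l q)) (*0≈ _))) (∣#∣ 0))) (*0≈ _)))
          (0≤⇒≤ (0≤y i · (0≤Gb · 0≤s)))
        term i p (tri> _ _ q) = ≤-trans (≤-reflexive (*-congˡ (∣*∣ _ _)))
          (≤-trans (*-mono-≤ (0≤∣∣ _ · 0≤∣∣ _) (0≤s · 0≤-^ (o i) 0≤s) (^-antiʳ-≤ {m = suc (o i)} 0≤s s≤1 q) (*-monoˡ-≤ (0≤∣∣ _) (∣G∣≤ i l p l<T)))
            (≤-reflexive (ring! (s ∷ s ^ o i ∷ ∣ r (o i) ∣ ∷ Gb ∷ []) λ s p r g → s :* p :* (r :* g) := r :* p :* (g :* s))))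

      -- The operator that would kill the pivot under study is replaced by one with parameter T. Its
      -- factor l - T is nonzero for every l < T, and the number of operators remains n.
      others : ℕ → ℕ → ℕ
      others i j with j ℕₚ.≟ i
      ... | yes _ = T
      ... | no _ = o j

      others-≤ : ∀ i j → j ℕ.< n → others i j ℕ.≤ T
      others-≤ i j p with j ℕₚ.≟ i
      ... | yes _ = ℕₚ.≤-refl
      ... | no _ = ℕₚ.<⇒≤ (o<T j p)

      others-pivot : ∀ i j → i ℕ.< n → j ℕ.< n → ¬ o i ≡ others i j
      others-pivot i j p q with j ℕₚ.≟ i
      ... | yes _ = ℕₚ.<⇒≢ (o<T i p)
      ... | no ne = o-injective i j p q (λ eq → ne (≡.sym eq))

      others-other : ∀ i j → ¬ j ≡ i → others i j ≡ o j
      others-other i j ne with j ℕₚ.≟ i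
      ... | yes eq = ⊥-elim (ne eq)
      ... | no _ = ≡.refl

      Z : K
      Z = Fb * (Y * (Gb * s))

      0≤Z : 0≤ Z
      0≤Z = 0≤-^ n (0≤# T) · (0≤Y · (0≤Gb · 0≤s))

      y-bound : ∀ i → i ℕ.< n → y i ≤ W ^ n * e + # T * Z
      y-bound i p = ≤-trans (≤-trans (by (y i ∷ ∣ factor n (others i) (o i) ∣ ∷ []) (λ y f → y :* (f :- κ# 1) ⊢ y :≤ f :* y)
            (0≤y i · 1≤∣factor∣ n (others i) (o i) λ j → others-pivot i j p))
          (≤-reflexive (trans (*-congˡ (trans (*-congˡ (sym (0≤⇒∣x∣≈x (0≤-^ (o i) 0≤s)))) (sym (∣*∣ _ _)))) (sym (∣*∣ _ _)))))
        (≤-trans (∑-isolate T (λ l → factor n (others i) l * x l) (o i) (o<T i p) 0≤Z rest)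
          (+-mono-≤ (≤-trans (∣∣-cong-≤ (trans (∑-cong T λ l _ → sym (Euler-factor n (others i) x l)) (sym (tay-0 T _))))
            (Euler-bound T n (others i) x (others-≤ i) ≤-refl 0≤W λ j q → ≤-trans (∣∣-cong-≤ (tay-scale T s r j)) (small-tay j q))) ≤-refl))
        where
        rest : ∀ l → l ℕ.< T → ¬ l ≡ o i → ∣ factor n (others i) l * x l ∣ ≤ Z
        rest l l<T ne = go (em {∃ λ j → j ℕ.< n × l ≡ o j})
          where
          go : Dec (∃ λ j → j ℕ.< n × l ≡ o j) → ∣ factor n (others i) l * x l ∣ ≤ Z
          go (yes (j , q , ≡.refl)) = ≤-trans (∣∣-cong-≤ (trans (*-congʳ (factor≈0 n (others i) l j q
              (≡.sym (others-other i j λ { ≡.refl → ne ≡.refl })))) (trans (*-comm _ _) (*0≈ _))))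
            (≤-trans (≤-reflexive (∣#∣ 0)) (0≤⇒≤ 0≤Z))
          go (no h) = ∣*∣-≤ (∣factor∣≤ n (others i) l T (ℕₚ.<⇒≤ l<T) (others-≤ i)) (off-pivot l l<T λ j q eq → h (j , q , eq))

      -- Summing `y-bound` over the pivots puts Y on both sides. On the right its factor is Q s, at
      -- most one half, so it can be absorbed.
      Y-bound : Y ≤ # 2 * (# n * W ^ n) * e
      Y-bound = by (Y ∷ # n ∷ W ^ n ∷ e ∷ # T ∷ Fb ∷ Gb ∷ s ∷ []) (λ Y n w e T F G s →
          ((n :* (w :* e :+ T :* (F :* (Y :* (G :* s)))) :- Y) :+ (n :* (w :* e :+ T :* (F :* (Y :* (G :* s)))) :- Y)) :+ (κ# 1 :- κ# 2 :* (n :* (T :* (F :* G)) :* s)) :* Y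
            ⊢ Y :≤ κ# 2 :* (n :* w) :* e)
        (∑-bound n y-bound ⊹ ∑-bound n y-bound ⊹ Qs≤ · 0≤Y)

      coefficient-bound : ∀ m → (∀ i → i ℕ.< n → o i ℕ.≤ m) → ∀ k → k ℕ.< n → ∣ c k ∣ * s ^ m ≤ C * e
      coefficient-bound m o≤m k k<n = ≤-trans (*-monoʳ-≤ (0≤-^ m 0≤s) (≤-trans (∣∣-cong-≤ (combination-coefficient ind ech c k k<n)) (∣∑∣ n _)))
        (≤-trans (≤-reflexive (trans (*-comm _ _) (sym (∑-* n _ _))))
        (≤-trans (∑-mono n term) (≤-trans (≤-reflexive (∑-* n Mb y)) (≤-trans (*-monoˡ-≤ 0≤Mb Y-bound)
          (≤-reflexive (ring! (# n ∷ W ^ n ∷ e ∷ Mb ∷ []) λ n w e M → M :* (κ# 2 :* (n :* w) :* e) := κ# 2 :* (n :* w) :* M :* e))))))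
        where
        term : ∀ i → i ℕ.< n → s ^ m * ∣ r (o i) * M i k ∣ ≤ Mb * y i
        term i p = ≤-trans (≤-reflexive (*-congˡ (∣*∣ _ _)))
          (≤-trans (*-mono-≤ (0≤∣∣ _ · 0≤∣∣ _) (0≤-^ (o i) 0≤s) (^-antiʳ-≤ 0≤s s≤1 (o≤m i p)) (*-monoˡ-≤ (0≤∣∣ _) (∣M∣≤ i k p k<n)))
            (≤-reflexive (ring! (s ^ o i ∷ ∣ r (o i) ∣ ∷ Mb ∷ []) λ p r m → p :* (r :* m) := m :* (r :* p))))

  -- Separation: small values at many points force small coefficients

  ^-≤-first : ∀ {x n} → 0≤ x → x ≤ # 1 → 1 ℕ.≤ n → x ^ n ≤ x
  ^-≤-first {x} p q r = ≤-trans (^-antiʳ-≤ {m = 1} p q r) (≤-reflexive (*1≈ x))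

  -- All conditions on the smallness of h are gathered in one inequality C h ≤ 1, where C is a sum
  -- of nonnegative constants. Each single condition is recovered from it in this way.
  shrink : ∀ {x X h} → 0≤ h → x ≤ X → X * h ≤ # 1 → x * h ≤ # 1
  shrink p q r = ≤-trans (*-monoʳ-≤ p q) r

  -- At the points s + k h^Γ a combination is nearly a polynomial in k. Its values at n + 1 points
  -- give its first n + 1 Taylor coefficients at s by interpolation; these bound the values at the
  -- pivots by `LowerBound`, and hence the coefficients of the combination.
  module Separate {n : ℕ} {g : ℕ → ℕ → K} {φ : ℕ → K → K} {A R : K} (1≤A : # 1 ≤ A) (1≤R : # 1 ≤ R)
    (germs : ∀ k → k ℕ.< n → GermWith A R (g k) (φ k)) (ind : Independent n g) (ech : Echelon n g) where

    M : ℕ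
    M = max n (Echelon.o ech)

    o≤M : ∀ i → i ℕ.< n → Echelon.o ech i ℕ.≤ M
    o≤M = ≤max n (Echelon.o ech)

    module _ (Γ B : ℕ) (M<Γ : M ℕ.< Γ) where
      N d T : ℕ
      N = suc n
      -- The total loss in powers of h: the largest pivot costs `h ^ M`, and recovering Taylor
      -- coefficients of order up to n on a net of mesh `h ^ Γ` costs `h ^ (Γ ℕ.* n)`. Truncating at
      -- T = n + 1 + d leaves an error below `h ^ d * h`.
      d = M ℕ.+ Γ ℕ.* n
      T = N ℕ.+ d

      M<T : M ℕ.< T
      M<T = s≤s (ℕₚ.≤-trans (ℕₚ.m≤m+n M (Γ ℕ.* n)) (ℕₚ.m≤n+m d n))

      open LowerBound ind ech T (λ i p → ℕₚ.≤-<-trans (o≤M i p) M<T) using (Q; 0≤Q; coefficient-bound) renaming (C to C₁; 0≤C to 0≤C₁)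

      B₁ B₂ Z₁ Z₂ C₂ : K
      B₁ = # 2 + # B
      B₂ = # 1 + # B
      Z₁ = B₂ ^ N * (# d * (# 2 ^ T * (A * R ^ T) * B₂ ^ d))
      Z₂ = # 2 * A * (R * B₁) ^ T + Z₁
      C₂ = # 4 ^ M * (C₁ * interpolation-constant N B)

      C : K
      C = # 2 + # 2 * (R * B₁) + # 4 * Q + # 2 * (# n * C₂ * Z₂) + # 2 * (# n * C₂)

      0≤A : 0≤ A
      0≤A = 1≤⇒0≤ 1≤A
      0≤R : 0≤ R
      0≤R = 1≤⇒0≤ 1≤R
      0≤B₁ : 0≤ B₁
      0≤B₁ = 0≤# 2 ⊹ 0≤# B
      0≤B₂ : 0≤ B₂
      0≤B₂ = 0≤1 ⊹ 0≤# B
      0≤Ci : 0≤ interpolation-constant N B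
      0≤Ci = 1≤⇒0≤ (1≤interpolation-constant N B)
      0≤C₂ : 0≤ C₂
      0≤C₂ = 0≤-^ M (0≤# 4) · (0≤C₁ · 0≤Ci)
      0≤Z₁ : 0≤ Z₁
      0≤Z₁ = 0≤-^ N 0≤B₂ · (0≤# d · (0≤-^ T (0≤# 2) · (0≤A · 0≤-^ T 0≤R) · 0≤-^ d 0≤B₂))
      0≤Z₂ : 0≤ Z₂
      0≤Z₂ = 0≤# 2 · 0≤A · 0≤-^ T (0≤R · 0≤B₁) ⊹ 0≤Z₁

      private
        a₂ = 0≤# 2 · (0≤R · 0≤B₁)
        a₃ = 0≤# 4 · 0≤Q
        a₄ = 0≤# 2 · (0≤# n · 0≤C₂ · 0≤Z₂)
        a₅ = 0≤# 2 · (0≤# n · 0≤C₂)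
        summands : Vec K 4
        summands = # 2 * (R * B₁) ∷ # 4 * Q ∷ # 2 * (# n * C₂ * Z₂) ∷ # 2 * (# n * C₂) ∷ []

      0≤C : 0≤ C
      0≤C = 0≤# 2 ⊹ a₂ ⊹ a₃ ⊹ a₄ ⊹ a₅

      module _ {h s ε : K} (c : ℕ → K) (k : ℕ → ℕ) (0<h : 0< h) (Ch≤1 : C * h ≤ # 1) (h≤4s : h ≤ # 4 * s) (s≤2h : s ≤ # 2 * h)
        (k≤B : ∀ i → i ℕ.≤ n → k i ℕ.≤ B) (k-mono : ∀ i j → i ℕ.< j → j ℕ.≤ n → k i ℕ.< k j)
        (values : ∀ i → i ℕ.≤ n → ∣ ∑ n (λ j → c j * φ j (s + # (k i) * h ^ Γ)) ∣ ≤ ε) where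

        η L V : K
        η = h ^ Γ
        L = ∑∣∣ n c
        V = ε + Z₂ * (L * (h ^ d * h))

        0≤h : 0≤ h
        0≤h = 0<⇒0≤ 0<h
        0<s : 0< s
        0<s = 0≤∧≉0⇒0< (0≤-cancel (0<# 3) (≤⇒0≤ (≤-trans (0≤⇒≤ 0≤h) h≤4s)))
          λ eq → <⇒≱ (0<-resp (ring! (h ∷ []) λ h → h := h :- κ# 0) 0<h) (≤-trans h≤4s (≤-reflexive (trans (*-congˡ eq) (*0≈ _))))
        0≤s : 0≤ s
        0≤s = 0<⇒0≤ 0<s
        2h≤1 : # 2 * h ≤ # 1
        2h≤1 = shrink 0≤h (by summands (λ b c d e → b :+ c :+ d :+ e ⊢ κ# 2 :≤ κ# 2 :+ b :+ c :+ d :+ e) (a₂ ⊹ a₃ ⊹ a₄ ⊹ a₅)) Ch≤1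
        2RB₁h≤1 : # 2 * (R * B₁) * h ≤ # 1
        2RB₁h≤1 = shrink 0≤h (by summands (λ b c d e → κ# 2 :+ c :+ d :+ e ⊢ b :≤ κ# 2 :+ b :+ c :+ d :+ e) (0≤# 2 ⊹ a₃ ⊹ a₄ ⊹ a₅)) Ch≤1
        4Qh≤1 : # 4 * Q * h ≤ # 1
        4Qh≤1 = shrink 0≤h (by summands (λ b c d e → κ# 2 :+ b :+ d :+ e ⊢ c :≤ κ# 2 :+ b :+ c :+ d :+ e) (0≤# 2 ⊹ a₂ ⊹ a₄ ⊹ a₅)) Ch≤1
        2nCZh≤1 : # 2 * (# n * C₂ * Z₂) * h ≤ # 1
        2nCZh≤1 = shrink 0≤h (by summands (λ b c d e → κ# 2 :+ b :+ c :+ e ⊢ d :≤ κ# 2 :+ b :+ c :+ d :+ e) (0≤# 2 ⊹ a₂ ⊹ a₃ ⊹ a₅)) Ch≤1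
        h≤1 : h ≤ # 1
        h≤1 = ≤-trans (by (h ∷ []) (λ h → h ⊢ h :≤ κ# 2 :* h) 0≤h) 2h≤1
        s≤1 : s ≤ # 1
        s≤1 = ≤-trans s≤2h 2h≤1
        0≤η : 0≤ η
        0≤η = 0≤-^ Γ 0≤h
        η≤1 : η ≤ # 1
        η≤1 = ^-≤1 Γ 0≤h h≤1
        η≤h : η ≤ h
        η≤h = ^-≤-first 0≤h h≤1 (ℕₚ.≤-trans (s≤s z≤n) M<Γ)
        0≤L : 0≤ L
        0≤L = 0≤∑∣∣ n c
        0≤hd : 0≤ h ^ d
        0≤hd = 0≤-^ d 0≤h

        r e′ : ℕ → K
        r = combination ind ech c
        e′ j = tay T s r j * η ^ j

        ∣r∣≤ : ∀ l → l ℕ.< T → ∣ r l ∣ ≤ L * (A * R ^ T)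
        ∣r∣≤ l p = ∣∑*∣ n c (λ j → g j l) λ j q → ≤-trans (GermWith.coef (germs j q) l) (*-monoˡ-≤ 0≤A (^-monoʳ-≤ 1≤R (ℕₚ.<⇒≤ p)))

        ∣tay∣≤ : ∀ j → ∣ tay T s r j ∣ ≤ # 2 ^ T * (L * (A * R ^ T))
        ∣tay∣≤ = tay-bound T ∣r∣≤ (0≤L · (0≤A · 0≤-^ T 0≤R)) (≤-trans (≤-reflexive (0≤⇒∣x∣≈x 0≤s)) s≤1)

        h^T≤ : h ^ T ≤ h ^ d * h
        h^T≤ = ≤-trans (≤-reflexive (^-+ h N d)) (≤-trans (*-monoʳ-≤ 0≤hd (^-≤-first {n = N} 0≤h h≤1 (s≤s z≤n))) (≤-reflexive (*-comm _ _)))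

        h^d : h ^ d ≈ h ^ M * η ^ n
        h^d = trans (^-+ h M (Γ ℕ.* n)) (*-congˡ (sym (^-^ h Γ n)))

        -- Here M < Γ enters: the first neglected Taylor order is n + 1, and one more factor η is
        -- smaller than `h ^ M` by a further factor h. This factor makes the error absorbable.
        η^N≤ : η ^ N ≤ h ^ d * h
        η^N≤ = ≤-trans (*-monoʳ-≤ (0≤-^ n 0≤η) (^-antiʳ-≤ {m = suc M} 0≤h h≤1 M<Γ))
          (≤-reflexive (trans (ring! (h ∷ h ^ M ∷ η ^ n ∷ []) λ h m e → h :* m :* e := m :* e :* h) (*-congʳ (sym h^d))))

        module _ (i : ℕ) (i≤n : i ℕ.≤ n) where
          x y : K
          x = # (k i)
          y = s + x * η

          0≤y : 0≤ y
          0≤y = 0≤s ⊹ 0≤# (k i) · 0≤η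

          x≤B : x ≤ # B
          x≤B = #-mono (k≤B i i≤n)

          x≤B₂ : ∣ x ∣ ≤ B₂
          x≤B₂ = ≤-trans (≤-reflexive (∣#∣ (k i))) (≤-trans x≤B (by (# B ∷ []) (λ B → κ# 1 ⊢ B :≤ κ# 1 :+ B) 0≤1))

          y≤ : ∣ y ∣ ≤ B₁ * h
          y≤ = ≤-trans (≤-reflexive (0≤⇒∣x∣≈x 0≤y)) (≤-trans (+-mono-≤ s≤2h (*-mono-≤ 0≤η (0≤# B) x≤B η≤h)) (≤-reflexive (sym (distribʳ h (# 2) (# B)))))

          truncation : ∣ ∑ n (λ j → c j * φ j y) - ev T r y ∣ ≤ L * (# 2 * A * ((R * B₁) ^ T * (h ^ d * h)))
          truncation = ≤-trans (∑-rem n c germs y T (≤-trans (*-monoˡ-≤ (0≤# 2) (*-monoˡ-≤ 0≤R y≤))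
              (≤-trans (≤-reflexive (ring! (R ∷ B₁ ∷ h ∷ []) λ R B h → κ# 2 :* (R :* (B :* h)) := κ# 2 :* (R :* B) :* h)) 2RB₁h≤1)))
            (*-monoˡ-≤ 0≤L (*-monoˡ-≤ (0≤# 2 · 0≤A) (≤-trans (^-mono-≤ T (0≤R · 0≤∣∣ y) (≤-trans (*-monoˡ-≤ 0≤R y≤) (≤-reflexive (sym (*-assoc R B₁ h)))))
              (≤-trans (≤-reflexive (^-* (R * B₁) h T)) (*-monoˡ-≤ (0≤-^ T (0≤R · 0≤B₁)) h^T≤)))))

          rest : K
          rest = x ^ N * ev d (λ i → e′ (N ℕ.+ i)) x

          rest≤ : ∣ rest ∣ ≤ Z₁ * (L * (h ^ d * h))
          rest≤ = ≤-trans (∣*∣-≤ (≤-trans (≤-reflexive (∣^∣ x N)) (^-mono-≤ N (0≤∣∣ x) x≤B₂))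
              (ev-bound′ d (λ j _ → ∣*∣-≤ (∣tay∣≤ (N ℕ.+ j)) (≤-trans (≤-reflexive (0≤⇒∣x∣≈x (0≤-^ (N ℕ.+ j) 0≤η)))
                  (≤-trans (^-antiʳ-≤ 0≤η η≤1 (ℕₚ.m≤m+n N j)) η^N≤))) x≤B₂
                (by (# B ∷ []) (λ B → B ⊢ κ# 1 :≤ κ# 1 :+ B) (0≤# B))))
            (≤-reflexive (ring! (B₂ ^ N ∷ # d ∷ # 2 ^ T ∷ L ∷ A * R ^ T ∷ h ^ d * h ∷ B₂ ^ d ∷ []) λ b d t L a w b′ →
              b :* (d :* (t :* (L :* a) :* w :* b′)) := b :* (d :* (t :* a :* b′)) :* (L :* w)))

          expansion : ev T r y ≈ ev N e′ x + rest
          expansion = trans (sym (ev-tay T s r (x * η))) (trans (ev-congʳ T (tay T s r) (*-comm x η))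
            (trans (sym (ev-scale T (tay T s r) η x)) (ev-++ N d e′ x)))

          low-value : ∣ ev N e′ x ∣ ≤ V
          low-value = ≤-trans (∣∣-cong-≤ (trans (ring! (ev N e′ x ∷ rest ∷ ∑ n (λ j → c j * φ j y) ∷ []) λ a b v → a := (v :- (v :- (a :+ b))) :- b)
              (+-congʳ (+-congˡ (-‿cong (+-congˡ (-‿cong (sym expansion))))))))
            (≤-trans (∣-∣-≤ (∣-∣-≤ (values i i≤n) truncation) rest≤)
              (≤-reflexive (ring! (ε ∷ L ∷ A ∷ (R * B₁) ^ T ∷ Z₁ ∷ h ^ d * h ∷ []) λ ε L A p z w →
                ε :+ L :* (κ# 2 :* A :* (p :* w)) :+ z :* (L :* w) := ε :+ (κ# 2 :* A :* p :+ z) :* (L :* w))))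

        ∣e′∣≤ : ∀ j → j ℕ.≤ n → ∣ e′ j ∣ ≤ interpolation-constant N B * V
        ∣e′∣≤ j p = interpolation N B k (λ { i (s≤s q) → k≤B i q }) (λ { i j q (s≤s r) → k-mono i j q r }) e′ (λ { i (s≤s q) → low-value i q }) j (s≤s p)

        module _ {τ : K} (0<τ : 0< τ) (ητ≈1 : η ^ n * τ ≈ # 1) where

          tay-small : ∀ j → j ℕ.≤ n → ∣ tay T s r j * s ^ j ∣ ≤ interpolation-constant N B * V * τ
          tay-small j p = ≤-trans (≤-reflexive (trans (trans (sym (*1≈ _)) (*-congˡ (sym ητ≈1))) (sym (*-assoc _ _ _))))
            (*-monoʳ-≤ (0<⇒0≤ 0<τ) (≤-trans (≤-trans (*-mono-≤ (0≤-^ n 0≤η) (0≤∣∣ _)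
                (≤-trans (≤-reflexive (trans (∣*∣ _ _) (*-congˡ (0≤⇒∣x∣≈x (0≤-^ j 0≤s))))) (≤-trans (*-monoˡ-≤ (0≤∣∣ _) (^-≤1 j 0≤s s≤1)) (≤-reflexive (*1≈ _))))
                (^-antiʳ-≤ 0≤η η≤1 p))
              (≤-reflexive (trans (*-congˡ (sym (0≤⇒∣x∣≈x (0≤-^ j 0≤η)))) (sym (∣*∣ _ _))))) (∣e′∣≤ j p)))

          coefficient : ∀ j → j ℕ.< n → ∣ c j ∣ * h ^ d ≤ C₂ * V
          coefficient j p = ≤-trans (≤-reflexive (trans (*-congˡ h^d) (sym (*-assoc _ _ _))))
            (≤-trans (*-monoʳ-≤ (0≤-^ n 0≤η) (≤-trans (*-monoˡ-≤ (0≤∣∣ _) (≤-trans (^-mono-≤ M 0≤h h≤4s) (≤-reflexive (^-* (# 4) s M))))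
                (≤-trans (≤-reflexive (ring! (∣ c j ∣ ∷ # 4 ^ M ∷ s ^ M ∷ []) λ c f s → c :* (f :* s) := f :* (c :* s)))
                  (*-monoˡ-≤ (0≤-^ M (0≤# 4)) (coefficient-bound c 0<s s≤1
                    (≤-trans (*-monoˡ-≤ (0≤# 2) (*-monoˡ-≤ 0≤Q s≤2h)) (≤-trans (≤-reflexive (ring! (Q ∷ h ∷ []) λ Q h → κ# 2 :* (Q :* (κ# 2 :* h)) := κ# 4 :* Q :* h)) 4Qh≤1))
                    tay-small M o≤M j p)))))
              (≤-reflexive (trans (ring! (# 4 ^ M ∷ C₁ ∷ interpolation-constant N B ∷ V ∷ τ ∷ η ^ n ∷ []) λ f c i v t e →
                  f :* (c :* (i :* v :* t)) :* e := f :* (c :* i) :* v :* (e :* t)) (trans (*-congˡ ητ≈1) (*1≈ _)))))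

        -- The error terms in V are proportional to the sum L of the coefficients. Summing the
        -- coefficient bounds gives L h^d on both sides, on the right with a factor at most one
        -- half, so that only ε remains.
        separation : ∀ j → j ℕ.< n → ∣ c j ∣ * h ^ d ≤ C * ε
        separation j p = case pos-inverse (0<-^ n (0<-^ Γ 0<h)) of λ { (τ , 0<τ , eq) → finish (coefficient 0<τ eq) }
          where
          0≤ε : 0≤ ε
          0≤ε = ≤⇒0≤ (≤-trans (0≤⇒≤ (0≤∣∣ _)) (values 0 z≤n))
          finish : (∀ j → j ℕ.< n → ∣ c j ∣ * h ^ d ≤ C₂ * V) → ∣ c j ∣ * h ^ d ≤ C * ε
          finish bound = ≤-trans (*-monoʳ-≤ 0≤hd (term≤∑ n (λ i _ → 0≤∣∣ (c i)) j p))
            (≤-trans (by (L ∷ h ^ d ∷ # n ∷ C₂ ∷ ε ∷ Z₂ ∷ h ∷ []) (λ L w n c ε z h →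
                  (n :* (c :* (ε :+ z :* (L :* (w :* h)))) :- L :* w) :+ (n :* (c :* (ε :+ z :* (L :* (w :* h)))) :- L :* w) :+ (κ# 1 :- κ# 2 :* (n :* c :* z) :* h) :* (L :* w)
                  ⊢ L :* w :≤ κ# 2 :* (n :* c) :* ε)
                (total ⊹ total ⊹ 2nCZh≤1 · (0≤L · 0≤hd)))
              (*-monoʳ-≤ 0≤ε (by summands (λ b c d e → κ# 2 :+ b :+ c :+ d ⊢ e :≤ κ# 2 :+ b :+ c :+ d :+ e) (0≤# 2 ⊹ a₂ ⊹ a₃ ⊹ a₄))))
            where
            total : L * h ^ d ≤ # n * (C₂ * V)
            total = ≤-trans (≤-reflexive (trans (*-comm _ _) (sym (∑-* n (h ^ d) _)))) (∑-bound n λ i q → ≤-trans (≤-reflexive (*-comm _ _)) (bound i q))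

  -- Simultaneous approximation by the pigeonhole principle

  module Digits (b : ℕ) where
    base = suc b

    digit : ℕ → ℕ → ℕ
    digit i zero = i % base
    digit i (suc j) = digit (i / base) j

    -- Vectors with entries at most b are numbered by their digits in base b + 1. The pigeonhole
    -- principle for finite ordinals then applies to vectors of coefficients and to vectors of
    -- boxes.
    encode : ℕ → (ℕ → ℕ) → ℕ
    encode zero f = 0
    encode (suc n) f = f 0 ℕ.+ encode n (λ i → f (suc i)) ℕ.* base

    digit-≤ : ∀ i j → digit i j ℕ.≤ b
    digit-≤ i zero = ℕₚ.≤-pred (m%n<n i base)
    digit-≤ i (suc j) = digit-≤ (i / base) j

    encode-digit : ∀ n i → i ℕ.< base ℕ.^ n → encode n (digit i) ≡ i
    encode-digit zero zero p = ≡.refl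
    encode-digit zero (suc i) (s≤s ())
    encode-digit (suc n) i p = ≡.trans (≡.cong (λ k → i % base ℕ.+ k ℕ.* base)
      (encode-digit n (i / base) (m<n*o⇒m/o<n (≡.subst (i ℕ.<_) (ℕₚ.*-comm base _) p)))) (≡.sym (m≡m%n+[m/n]*n i base))

    encode-cong : ∀ n {f g} → (∀ i → i ℕ.< n → f i ≡ g i) → encode n f ≡ encode n g
    encode-cong zero h = ≡.refl
    encode-cong (suc n) h = ≡.cong₂ (λ x y → x ℕ.+ y ℕ.* base) (h 0 (s≤s z≤n)) (encode-cong n λ i p → h (suc i) (s≤s p))

    encode-< : ∀ n f → (∀ i → i ℕ.< n → f i ℕ.≤ b) → encode n f ℕ.< base ℕ.^ n
    encode-< zero f h = s≤s z≤n
    encode-< (suc n) f h = ℕₚ.≤-trans (ℕₚ.+-monoˡ-≤ _ (s≤s (h 0 (s≤s z≤n))))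
      (≡.subst (base ℕ.+ encode n (λ i → f (suc i)) ℕ.* base ℕ.≤_) (ℕₚ.*-comm (base ℕ.^ n) base)
        (ℕₚ.*-monoˡ-≤ base (encode-< n (λ i → f (suc i)) λ i p → h (suc i) (s≤s p))))

    digit-encode : ∀ n f → (∀ i → i ℕ.< n → f i ℕ.≤ b) → ∀ i → i ℕ.< n → digit (encode n f) i ≡ f i
    digit-encode (suc n) f h zero p = ≡.trans ([m+kn]%n≡m%n (f 0) (encode n (λ i → f (suc i))) base) (m<n⇒m%n≡m (s≤s (h 0 (s≤s z≤n))))
    digit-encode (suc n) f h (suc i) (s≤s p) = ≡.trans (≡.cong (λ k → digit k i) quotient)
      (digit-encode n _ (λ i p → h (suc i) (s≤s p)) i p)
      where
      e = encode n (λ i → f (suc i))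
      f0< = s≤s (h 0 (s≤s z≤n))
      quotient : (f 0 ℕ.+ e ℕ.* base) / base ≡ e
      quotient = ≡.trans (+-distrib-/ (f 0) (e ℕ.* base) (≡.subst (ℕ._< base)
          (≡.sym (≡.trans (≡.cong₂ ℕ._+_ (m<n⇒m%n≡m f0<) (m*n%n≡0 e base)) (ℕₚ.+-identityʳ _))) f0<))
        (≡.cong₂ ℕ._+_ (m<n⇒m/n≡0 f0<) (m*n/n≡m e base))

  -- The unit interval modulo 1 is divided into Y boxes.
  record Box (Y : ℕ) (x : K) : Set where
    field
      z : K
      z-int : IsInt z
      index : ℕ
      index<Y : index ℕ.< Y
      lower : # index ≤ # Y * (x - z)
      upper : # Y * (x - z) ≤ # index + # 1

  box : ∀ Y → 1 ℕ.≤ Y → ∀ x → Box Y x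
  box Y 1≤Y x =
    case floor x of λ { (z , z-int , z≤x , x<z+1) →
    case nat-floor (0≤# Y · z≤x) of λ { (k , k≤ , <k+1) → record
      { z = z ; z-int = z-int ; index = k
      ; index<Y = ℕₚ.≰⇒> λ Y≤k → <⇒≱ (0<-resp (ring! (# Y ∷ x ∷ z ∷ []) λ Y x z → Y :* (z :+ κ# 1 :- x) := Y :- Y :* (x :- z)) (1≤⇒0< (1≤# 1≤Y) <· x<z+1))
          (≤-trans (#-mono Y≤k) k≤)
      ; lower = k≤ ; upper = <⇒≤ <k+1 } } }

  #-injective : ∀ {m n} → # m ≈ # n → m ≡ n
  #-injective eq = ℕₚ.≤-antisym (#-mono⁻¹ (≤-reflexive eq)) (#-mono⁻¹ (≤-reflexive (sym eq)))

  record Approximation (D E X Y : ℕ) (M : ℕ → ℕ → K) : Set where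
    field
      β α : ℕ → K
      β-int : ∀ j → IsInt (β j)
      α-int : ∀ m → IsInt (α m)
      β-bound : ∀ j → ∣ β j ∣ ≤ # X
      β-nonzero : ∃ λ j → j ℕ.< D × ¬ β j ≈ # 0
      close : ∀ m → m ℕ.< E → ∣ α m + ∑ D (λ j → β j * M m j) ∣ * # Y ≤ # 1

  -- Two different coefficient vectors whose linear forms fall into the same boxes modulo 1 are
  -- subtracted: their difference is β, and the integer parts of the forms yield α.
  dirichlet : ∀ D E X Y M → suc Y ℕ.^ E ℕ.< suc X ℕ.^ D → Approximation D E X (suc Y) M
  dirichlet D E X Y M fewer = case pigeonhole fewer (λ i → fromℕ< (code< (toℕ i))) of λ { (i , j , i<j , eq) →
    approximation (toℕ i) (toℕ j) (toℕ<n i) (toℕ<n j) (ℕₚ.<⇒≢ i<j)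
      (≡.trans (≡.sym (toℕ-fromℕ< (code< (toℕ i)))) (≡.trans (≡.cong toℕ eq) (toℕ-fromℕ< (code< (toℕ j))))) }
    where
    module X = Digits X
    module Y = Digits Y

    value : ℕ → ℕ → K
    value i m = ∑ D (λ j → # (X.digit i j) * M m j)

    boxes : ∀ i m → Box (suc Y) (value i m)
    boxes i m = box (suc Y) (s≤s z≤n) (value i m)

    code : ℕ → ℕ
    code i = Y.encode E (λ m → Box.index (boxes i m))

    index≤ : ∀ i m → Box.index (boxes i m) ℕ.≤ Y
    index≤ i m = ℕₚ.≤-pred (Box.index<Y (boxes i m))

    code< : ∀ i → code i ℕ.< suc Y ℕ.^ E
    code< i = Y.encode-< E _ λ m _ → index≤ i m

    module _ (i j : ℕ) (i< : i ℕ.< suc X ℕ.^ D) (j< : j ℕ.< suc X ℕ.^ D) (i≢j : ¬ i ≡ j) (eq : code i ≡ code j) where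
      β α : ℕ → K
      β k = # (X.digit i k) - # (X.digit j k)
      α m = - (Box.z (boxes i m) - Box.z (boxes j m))

      index-≡ : ∀ m → m ℕ.< E → Box.index (boxes i m) ≡ Box.index (boxes j m)
      index-≡ m p = ≡.trans (≡.sym (Y.digit-encode E _ (λ m _ → index≤ i m) m p))
        (≡.trans (≡.cong (λ k → Y.digit k m) eq) (Y.digit-encode E _ (λ m _ → index≤ j m) m p))

      β-value : ∀ m → ∑ D (λ k → β k * M m k) ≈ value i m - value j m
      β-value m = trans (∑-cong D λ k _ → ring! (# (X.digit i k) ∷ # (X.digit j k) ∷ M m k ∷ []) λ a b x → (a :- b) :* x := a :* x :+ (:- κ# 1) :* (b :* x))
        (trans (∑-+ D _ _) (+-congˡ (trans (∑-* D (- # 1) _) (ring! (value j m ∷ []) λ x → (:- κ# 1) :* x := :- x))))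

      close : ∀ m → m ℕ.< E → ∣ α m + ∑ D (λ k → β k * M m k) ∣ * # (suc Y) ≤ # 1
      close m p = ≤-trans (≤-reflexive (trans (*-comm _ _) (trans (*-congʳ (sym (∣#∣ (suc Y)))) (sym (∣*∣ _ _)))))
        (≤-trans (∣∣-cong-≤ (trans (*-congˡ (+-congˡ (β-value m)))
            (ring! (Box.z (boxes i m) ∷ Box.z (boxes j m) ∷ value i m ∷ value j m ∷ # (suc Y) ∷ []) λ z z′ v v′ Y →
              Y :* (:- (z :- z′) :+ (v :- v′)) := Y :* (v :- z) :- Y :* (v′ :- z′))))
          (∣∣-≤ (by (# (Box.index (boxes i m)) ∷ # (Box.index (boxes j m)) ∷ a ∷ b ∷ []) (λ k l a b → ((k :+ κ# 1) :- a) :+ (b :- l) :+ (l :- k) ⊢ a :- b :≤ κ# 1)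
              (Box.upper (boxes i m) ⊹ Box.lower (boxes j m) ⊹ ≤-reflexive (reflexive (≡.cong #_ (index-≡ m p)))))
            (by (# (Box.index (boxes i m)) ∷ # (Box.index (boxes j m)) ∷ a ∷ b ∷ []) (λ k l a b → ((l :+ κ# 1) :- b) :+ (a :- k) :+ (k :- l) ⊢ :- (a :- b) :≤ κ# 1)
              (Box.upper (boxes j m) ⊹ Box.lower (boxes i m) ⊹ ≤-reflexive (reflexive (≡.cong #_ (≡.sym (index-≡ m p))))))))
        where
        a = # (suc Y) * (value i m - Box.z (boxes i m))
        b = # (suc Y) * (value j m - Box.z (boxes j m))

      ∣β∣≤ : ∀ k → ∣ β k ∣ ≤ # X
      ∣β∣≤ k = ∣∣-≤ (by (# (X.digit i k) ∷ # (X.digit j k) ∷ # X ∷ []) (λ a b X → (X :- a) :+ b ⊢ a :- b :≤ X) (#-mono (X.digit-≤ i k) ⊹ 0≤# _))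
        (by (# (X.digit i k) ∷ # (X.digit j k) ∷ # X ∷ []) (λ a b X → (X :- b) :+ a ⊢ :- (a :- b) :≤ X) (#-mono (X.digit-≤ j k) ⊹ 0≤# _))

      nonzero : ∃ λ k → k ℕ.< D × ¬ β k ≈ # 0
      nonzero = dne λ none → i≢j (≡.trans (≡.sym (X.encode-digit D i i<)) (≡.trans
        (X.encode-cong D λ k p → #-injective (trans (ring! (# (X.digit i k) ∷ # (X.digit j k) ∷ []) λ a b → a := (a :- b) :+ b)
          (trans (+-congʳ (¬¬≈ λ ne → none (k , p , ne))) (0+≈ _)))) (X.encode-digit D j j<)))

      approximation : Approximation D E X (suc Y) M
      approximation = record
        { β = β ; α = α ; β-int = λ k → int-sub (int-# _) (int-# _)
        ; α-int = λ m → int-neg (int-sub (Box.z-int (boxes i m)) (Box.z-int (boxes j m)))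
        ; β-bound = ∣β∣≤ ; β-nonzero = nonzero ; close = close }

  -- Taylor polynomials in the index of a sample point, and integral relations

  module Taylor′ {a : ℕ → K} {F : K → K} {A R : K} (g : GermWith A R a F) (m Γ B : ℕ) (1≤Γ : 1 ℕ.≤ Γ) where
    open GermWith g

    d T : ℕ
    d = Γ ℕ.* m
    T = m ℕ.+ d

    B₁ B₂ Z C : K
    B₁ = # 2 + # B
    B₂ = # 1 + # B
    Z = B₂ ^ m * (# d * (# 2 ^ T * (A * R ^ T) * B₂ ^ d))
    C = # 2 + # 2 * (R * B₁) + # 2 * A * (R * B₁) ^ T + Z

    0≤B₁ : 0≤ B₁
    0≤B₁ = 0≤# 2 ⊹ 0≤# B
    0≤B₂ : 0≤ B₂
    0≤B₂ = 0≤1 ⊹ 0≤# B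

    private
      summands : Vec K 3
      summands = # 2 * (R * B₁) ∷ # 2 * A * (R * B₁) ^ T ∷ Z ∷ []
      a₂ = 0≤# 2 · (0≤R · 0≤B₁)
      a₃ = 0≤# 2 · 0≤A · 0≤-^ T (0≤R · 0≤B₁)
      a₄ = 0≤-^ m 0≤B₂ · (0≤# d · (0≤-^ T (0≤# 2) · (0≤A · 0≤-^ T 0≤R) · 0≤-^ d 0≤B₂))

    0≤C : 0≤ C
    0≤C = 0≤# 2 ⊹ a₂ ⊹ a₃ ⊹ a₄

    module _ {h s : K} (0≤h : 0≤ h) (Ch≤1 : C * h ≤ # 1) (0≤s : 0≤ s) (s≤2h : s ≤ # 2 * h) where
      η : K
      η = h ^ Γ
      2h≤1 : # 2 * h ≤ # 1
      2h≤1 = shrink 0≤h (by summands (λ b c d → b :+ c :+ d ⊢ κ# 2 :≤ κ# 2 :+ b :+ c :+ d) (a₂ ⊹ a₃ ⊹ a₄)) Ch≤1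
      2RB₁h≤1 : # 2 * (R * B₁) * h ≤ # 1
      2RB₁h≤1 = shrink 0≤h (by summands (λ b c d → κ# 2 :+ c :+ d ⊢ b :≤ κ# 2 :+ b :+ c :+ d) (0≤# 2 ⊹ a₃ ⊹ a₄)) Ch≤1
      h≤1 : h ≤ # 1
      h≤1 = ≤-trans (by (h ∷ []) (λ h → h ⊢ h :≤ κ# 2 :* h) 0≤h) 2h≤1
      0≤η : 0≤ η
      0≤η = 0≤-^ Γ 0≤h
      η≤1 : η ≤ # 1
      η≤1 = ^-≤1 Γ 0≤h h≤1
      η≤h : η ≤ h
      η≤h = ^-≤-first 0≤h h≤1 1≤Γ

      expansion : ℕ → K
      expansion j = tay T s a j * η ^ j

      ∣tay∣≤ : ∀ j → ∣ tay T s a j ∣ ≤ # 2 ^ T * (A * R ^ T)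
      ∣tay∣≤ = tay-bound T (λ l p → ≤-trans (coef l) (*-monoˡ-≤ 0≤A (^-monoʳ-≤ 1≤R (ℕₚ.<⇒≤ p)))) (0≤A · 0≤-^ T 0≤R)
        (≤-trans (≤-reflexive (0≤⇒∣x∣≈x 0≤s)) (≤-trans s≤2h 2h≤1))

      h^T≤ : h ^ T ≤ η ^ m
      h^T≤ = ≤-trans (^-antiʳ-≤ 0≤h h≤1 (ℕₚ.m≤n+m d m)) (≤-reflexive (sym (^-^ h Γ m)))

      module _ (k : ℕ) (k≤B : k ℕ.≤ B) where
        x y rest : K
        x = # k
        y = s + x * η
        rest = x ^ m * ev d (λ i → expansion (m ℕ.+ i)) x

        0≤y : 0≤ y
        0≤y = 0≤s ⊹ 0≤# k · 0≤η

        x≤B₂ : ∣ x ∣ ≤ B₂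
        x≤B₂ = ≤-trans (≤-reflexive (∣#∣ k)) (≤-trans (#-mono k≤B) (by (# B ∷ []) (λ B → κ# 1 ⊢ B :≤ κ# 1 :+ B) 0≤1))

        y≤ : ∣ y ∣ ≤ B₁ * h
        y≤ = ≤-trans (≤-reflexive (0≤⇒∣x∣≈x 0≤y)) (≤-trans (+-mono-≤ s≤2h (*-mono-≤ 0≤η (0≤# B) (#-mono k≤B) η≤h)) (≤-reflexive (sym (distribʳ h (# 2) (# B)))))

        truncation : ∣ F y - ev T a y ∣ ≤ # 2 * A * ((R * B₁) ^ T * η ^ m)
        truncation = ≤-trans (rem y T (≤-trans (*-monoˡ-≤ (0≤# 2) (*-monoˡ-≤ 0≤R y≤))
            (≤-trans (≤-reflexive (ring! (R ∷ B₁ ∷ h ∷ []) λ R B h → κ# 2 :* (R :* (B :* h)) := κ# 2 :* (R :* B) :* h)) 2RB₁h≤1)))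
          (*-monoˡ-≤ (0≤# 2 · 0≤A) (≤-trans (^-mono-≤ T (0≤R · 0≤∣∣ y) (≤-trans (*-monoˡ-≤ 0≤R y≤) (≤-reflexive (sym (*-assoc R B₁ h)))))
            (≤-trans (≤-reflexive (^-* (R * B₁) h T)) (*-monoˡ-≤ (0≤-^ T (0≤R · 0≤B₁)) h^T≤))))

        rest≤ : ∣ rest ∣ ≤ Z * η ^ m
        rest≤ = ≤-trans (∣*∣-≤ (≤-trans (≤-reflexive (∣^∣ x m)) (^-mono-≤ m (0≤∣∣ x) x≤B₂))
            (ev-bound′ d (λ j _ → ∣*∣-≤ (∣tay∣≤ (m ℕ.+ j)) (≤-trans (≤-reflexive (0≤⇒∣x∣≈x (0≤-^ (m ℕ.+ j) 0≤η)))
                (^-antiʳ-≤ 0≤η η≤1 (ℕₚ.m≤m+n m j)))) x≤B₂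
              (by (# B ∷ []) (λ B → B ⊢ κ# 1 :≤ κ# 1 :+ B) (0≤# B))))
          (≤-reflexive (ring! (B₂ ^ m ∷ # d ∷ # 2 ^ T * (A * R ^ T) ∷ η ^ m ∷ B₂ ^ d ∷ []) λ b d t w b′ →
            b :* (d :* (t :* w :* b′)) := b :* (d :* (t :* b′)) :* w))

        -- Two errors occur: cutting the power series after T = m + Γ m terms, where h^T ≤ η^m, and
        -- dropping the orders from m on in the expansion about s, each of which carries η^m.
        taylor : ∣ F y - ev m expansion x ∣ ≤ C * η ^ m
        taylor = ≤-trans (∣∣-cong-≤ (trans (ring! (F y ∷ ev m expansion x ∷ rest ∷ []) λ f a b → f :- a := (f :- (a :+ b)) :+ b)
            (+-congʳ (+-congˡ (-‿cong (sym (trans (sym (ev-tay T s a (x * η))) (trans (ev-congʳ T (tay T s a) (*-comm x η))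
              (trans (sym (ev-scale T (tay T s a) η x)) (ev-++ m d expansion x))))))))))
          (≤-trans (∣+∣-≤ truncation rest≤) (by (η ^ m ∷ R ∷ B₁ ∷ A ∷ (R * B₁) ^ T ∷ Z ∷ []) (λ w R b A t z →
            (κ# 2 :+ κ# 2 :* (R :* b)) :* w ⊢ κ# 2 :* A :* (t :* w) :+ z :* w :≤ (κ# 2 :+ κ# 2 :* (R :* b) :+ κ# 2 :* A :* t :+ z) :* w)
            ((0≤# 2 ⊹ a₂) · 0≤-^ m 0≤η)))

  ≤-via : ∀ {m n} d → m ℕ.+ d ≡ n → m ℕ.≤ n
  ≤-via {m} d eq = ≡.subst (m ℕ.≤_) eq (ℕₚ.m≤m+n m d)

  int-half : ∀ {x} → IsInt x → # 2 * ∣ x ∣ ≤ # 1 → x ≈ # 0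
  int-half {x} i p = int-small i (≰⇒> λ q → ℕₚ.<-irrefl ≡.refl (#-mono⁻¹ {2} {1} (≤-trans
    (by (∣ x ∣ ∷ []) (λ x → κ# 2 :* (x :- κ# 1) ⊢ κ# 2 :≤ κ# 2 :* x) (0≤# 2 · q)) p)))

  int-ev : ∀ n e x → (∀ i → IsInt (e i)) → IsInt x → IsInt (ev n e x)
  int-ev zero e x h p = int-# 0
  int-ev (suc n) e x h p = int-+ (h 0) (int-* p (int-ev n (tail e) x (λ i → h (suc i)) p))

  truncate : ℕ → (ℕ → K) → ℕ → K
  truncate zero f j = # 0
  truncate (suc n) f zero = f 0
  truncate (suc n) f (suc j) = truncate n (tail f) j

  ev-truncate : ∀ n m f x → ev (n ℕ.+ m) (truncate n f) x ≈ ev n f x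
  ev-truncate zero m f x = ev-0 m x λ _ _ → refl
  ev-truncate (suc n) m f x = +-congˡ (*-congˡ (ev-truncate n m (tail f) x))

  ev-column : ∀ D j f x → j ℕ.≤ D → ev (D ℕ.+ D) (shift j (truncate D f)) x ≈ x ^ j * ev D f x
  ev-column D j f x p = trans (reflexive (≡.cong (λ T → ev T (shift j (truncate D f)) x) size))
    (trans (ev-shift j (D ℕ.+ (D ℕ.∸ j)) _ x) (*-congˡ (ev-truncate D (D ℕ.∸ j) f x)))
    where
    size : D ℕ.+ D ≡ j ℕ.+ (D ℕ.+ (D ℕ.∸ j))
    size = ≡.trans (≡.cong (D ℕ.+_) (≡.sym (ℕₚ.m+[n∸m]≡n p)))
      (≡.trans (≡.sym (ℕₚ.+-assoc D j _)) (≡.trans (≡.cong (ℕ._+ (D ℕ.∸ j)) (ℕₚ.+-comm D j)) (ℕₚ.+-assoc j D _)))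

  -- The polynomial A + B Ψ, with Ψ the Taylor polynomial, has 2D coefficients. They are linear
  -- forms in the coefficients β of B plus integers α, which is the situation of simultaneous
  -- approximation.
  ev-relation : ∀ D f α β x → ev (D ℕ.+ D) (λ m → α m + ∑ D (λ j → β j * shift j (truncate D f) m)) x ≈
    ev (D ℕ.+ D) α x + ev D β x * ev D f x
  ev-relation D f α β x = trans (ev-+ (D ℕ.+ D) α _ x) (+-congˡ (trans (ev-∑ (D ℕ.+ D) D β (λ j m → shift j (truncate D f) m) x)
    (trans (∑-cong D λ j j<D → trans (*-congˡ (ev-column D j f x (ℕₚ.<⇒≤ j<D)))
        (ring! (β j ∷ x ^ j ∷ ev D f x ∷ []) λ b p z → b :* (p :* z) := z :* (b :* p)))
      (trans (∑-* D (ev D f x) _) (trans (*-comm _ _) (*-congʳ (sym (ev-∑^ D β x))))))))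

  -- The balance of parameters: D coefficients up to Y² against 2D forms with Y boxes each, and (Y²
  -- + 1)^D > Y^(2D). Errors of 1/Y are paid for with coefficients of size Y².
  dirichlet-square : ∀ D Y M → 1 ℕ.≤ Y → 1 ℕ.≤ D → Approximation D (D ℕ.+ D) (Y ℕ.* Y) Y M
  dirichlet-square (suc D) (suc Y) M _ _ = dirichlet (suc D) (suc D ℕ.+ suc D) (suc Y ℕ.* suc Y) Y M
    (≡.subst (ℕ._< suc (suc Y ℕ.* suc Y) ℕ.^ suc D) square (ℕₚ.^-monoˡ-< (suc D) (ℕₚ.n<1+n _)))
    where
    square : (suc Y ℕ.* suc Y) ℕ.^ suc D ≡ suc Y ℕ.^ (suc D ℕ.+ suc D)
    square = ≡.trans (≡.cong (λ z → (suc Y ℕ.* z) ℕ.^ suc D) (≡.sym (ℕₚ.*-identityʳ (suc Y))))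
      (≡.trans (ℕₚ.^-*-assoc (suc Y) 2 (suc D)) (≡.cong (λ z → suc Y ℕ.^ (suc D ℕ.+ z)) (ℕₚ.+-identityʳ (suc D))))

  -- Every scale is a power of ρ or of u = 1/ρ, so the estimates that follow reduce to comparing
  -- natural exponents.
  module Reciprocal {ρ u : K} (uρ≈1 : u * ρ ≈ # 1) (0≤u : 0≤ u) (u≤1 : u ≤ # 1) (0≤ρ : 0≤ ρ) where

    powers : ∀ m → u ^ m * ρ ^ m ≈ # 1
    powers m = trans (sym (^-* u ρ m)) (trans (^-congˡ m uρ≈1) (1^ m))

    cancel : ∀ m n {k} → m ℕ.+ n ℕ.≤ k → ρ ^ m * u ^ k ≤ u ^ n
    cancel m n p = ≤-trans (*-monoˡ-≤ (0≤-^ m 0≤ρ) (≤-trans (^-antiʳ-≤ 0≤u u≤1 p) (≤-reflexive (^-+ u m n))))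
      (≤-reflexive (trans (ring! (ρ ^ m ∷ u ^ m ∷ u ^ n ∷ []) λ a b c → a :* (b :* c) := b :* a :* c) (trans (*-congʳ (powers m)) (1*≈ _))))

    move : ∀ m {z w} → z * ρ ^ m ≤ w → z ≤ w * u ^ m
    move m {z} {w} p = ≤-trans (≤-reflexive (trans (sym (*1≈ z)) (trans (*-congˡ (sym (powers m)))
        (ring! (z ∷ u ^ m ∷ ρ ^ m ∷ []) λ z u r → z :* (u :* r) := z :* r :* u))))
      (*-monoʳ-≤ (0≤-^ m 0≤u) p)

  -- Bad sample points

  record Bad (F : K → K) (r m : ℕ) (x : K) : Set where
    field
      num : K
      den : ℕ
      num-int : IsInt num
      r^≤den : r ℕ.^ m ℕ.≤ den
      den≤r^ : den ℕ.≤ r ℕ.^ suc m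
      -- The exponent 89 stays nine below the final 98. These nine powers of b repay the half that
      -- is lost when the sample point is later moved.
      close : ∣ # den * F x - num ∣ * # den ^ 89 ≤ # 1

  -- With D = κ + 2 the polynomial B has D coefficients and A has 2D, as many as the product of B
  -- with a Taylor polynomial of D terms. `size` is the number 3D of all functions involved.
  double size : ℕ → ℕ
  double κ = suc (suc κ) ℕ.+ suc (suc κ)
  size κ = double κ ℕ.+ suc (suc κ)

  -- Denominators b between r^(κ+1) and r^(κ+2), at the sample points s + k r⁻⁶. A bad point satisfies an
  -- integral relation A + B F = 0 up to a tiny error; too many bad points contradict the separation bound.
  module Class {a : ℕ → K} {F : K → K} {A₀ R₀ : K} (g₀ : GermWith A₀ R₀ a F) (κ : ℕ) {A R : K} (1≤A : # 1 ≤ A) (1≤R : # 1 ≤ R)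
    (germs : ∀ k → k ℕ.< size κ → GermWith A R (coefficients (double κ) a k) (functions (double κ) F k))
    (ind : Independent (size κ) (coefficients (double κ) a)) (ech : Echelon (size κ) (coefficients (double κ) a)) where

    private
      D Eₙ n λ₁ : ℕ
      D = suc (suc κ)
      Eₙ = double κ
      n = size κ
      λ₁ = suc κ

    module S = Separate 1≤A 1≤R germs ind ech

    module Scale (J B : ℕ) (M<J : S.M ℕ.< J) (D≤B : D ℕ.≤ B) where
      -- Since `h ^ J` is 1/r, `h ^ Γ` is the mesh r⁻⁶. The exponent 6 makes the mesh fine enough
      -- for the Taylor error in `yyyη≤1`, and later for b⁴ r⁻⁶ ≤ 1/r when b ≤ r.
      Γ : ℕ
      Γ = J ℕ.* 6

      J≤Γ : J ℕ.≤ Γ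
      J≤Γ = ≤-via (J ℕ.* 5) (J+5J J)
        where
        J+5J : ∀ J → J ℕ.+ J ℕ.* 5 ≡ J ℕ.* 6
        J+5J = solve-∀

      M<Γ : S.M ℕ.< Γ
      M<Γ = ℕₚ.≤-trans M<J J≤Γ

      module TA = Taylor′ g₀ D Γ B (ℕₚ.≤-trans (s≤s z≤n) M<Γ)

      Cs Ct B₂ E₁ D₁ C₂ C : K
      Cs = S.C Γ B M<Γ
      Ct = TA.C
      B₂ = # 1 + # B
      E₁ = # Eₙ * (# 1 * B₂ ^ Eₙ)
      D₁ = # D * B₂ ^ D
      C₂ = E₁ + D₁ * Ct
      C = Cs + Ct + # 2 * (C₂ + D₁) + # 2 * (# D * (Cs * D₁)) + (# 2 + # B)

      0≤Cs : 0≤ Cs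
      0≤Cs = S.0≤C Γ B M<Γ
      0≤B₂ : 0≤ B₂
      0≤B₂ = 0≤1 ⊹ 0≤# B
      0≤D₁ : 0≤ D₁
      0≤D₁ = 0≤# D · 0≤-^ D 0≤B₂
      0≤E₁ : 0≤ E₁
      0≤E₁ = 0≤# Eₙ · (0≤1 · 0≤-^ Eₙ 0≤B₂)
      0≤C₂ : 0≤ C₂
      0≤C₂ = 0≤E₁ ⊹ 0≤D₁ · TA.0≤C

      private
        summands : Vec K 5
        summands = Cs ∷ Ct ∷ # 2 * (C₂ + D₁) ∷ # 2 * (# D * (Cs * D₁)) ∷ # 2 + # B ∷ []
        a₃ = 0≤# 2 · (0≤C₂ ⊹ 0≤D₁)
        a₄ = 0≤# 2 · (0≤# D · (0≤Cs · 0≤D₁))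
        a₅ = 0≤# 2 ⊹ 0≤# B

      module Sample {h s : K} (t : ℕ) (1≤t : 1 ℕ.≤ t) (0<h : 0< h) (ht≈1 : h * # t ≈ # 1) (Ch≤1 : C * h ≤ # 1) (h≤4s : h ≤ # 4 * s) (s≤2h : s ≤ # 2 * h) where
        0≤h : 0≤ h
        0≤h = 0<⇒0≤ 0<h
        0≤s : 0≤ s
        0≤s = 0≤-cancel (0<# 3) (≤⇒0≤ (≤-trans (0≤⇒≤ 0≤h) h≤4s))
        Cs-h : Cs * h ≤ # 1
        Cs-h = shrink 0≤h (by summands (λ a b c d e → b :+ c :+ d :+ e ⊢ a :≤ a :+ b :+ c :+ d :+ e) (TA.0≤C ⊹ a₃ ⊹ a₄ ⊹ a₅)) Ch≤1
        Ct-h : Ct * h ≤ # 1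
        Ct-h = shrink 0≤h (by summands (λ a b c d e → a :+ c :+ d :+ e ⊢ b :≤ a :+ b :+ c :+ d :+ e) (0≤Cs ⊹ a₃ ⊹ a₄ ⊹ a₅)) Ch≤1
        CD-h : # 2 * (C₂ + D₁) * h ≤ # 1
        CD-h = shrink 0≤h (by summands (λ a b c d e → a :+ b :+ d :+ e ⊢ c :≤ a :+ b :+ c :+ d :+ e) (0≤Cs ⊹ TA.0≤C ⊹ a₄ ⊹ a₅)) Ch≤1
        DC-h : # 2 * (# D * (Cs * D₁)) * h ≤ # 1
        DC-h = shrink 0≤h (by summands (λ a b c d e → a :+ b :+ c :+ e ⊢ d :≤ a :+ b :+ c :+ d :+ e) (0≤Cs ⊹ TA.0≤C ⊹ a₃ ⊹ a₅)) Ch≤1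
        B-h : (# 2 + # B) * h ≤ # 1
        B-h = shrink 0≤h (by summands (λ a b c d e → a :+ b :+ c :+ d ⊢ e :≤ a :+ b :+ c :+ d :+ e) (0≤Cs ⊹ TA.0≤C ⊹ a₃ ⊹ a₄)) Ch≤1
        h≤1 : h ≤ # 1
        h≤1 = ≤-trans (by (h ∷ # B ∷ []) (λ h B → (κ# 1 :+ B) :* h ⊢ h :≤ (κ# 2 :+ B) :* h) (0≤B₂ · 0≤h)) B-h

        r : ℕ
        r = t ℕ.^ J
        ρ u η : K
        ρ = # t ^ J
        u = h ^ J
        η = h ^ Γ

        #r : # r ≈ ρ
        #r = #-^ t J
        #r^ : ∀ m → # (r ℕ.^ m) ≈ ρ ^ m
        #r^ m = trans (#-^ r m) (^-congˡ m #r)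
        0≤ρ : 0≤ ρ
        0≤ρ = 0≤-^ J (0≤# t)
        0≤u : 0≤ u
        0≤u = 0≤-^ J 0≤h
        u≤1 : u ≤ # 1
        u≤1 = ^-≤1 J 0≤h h≤1
        u≤h : u ≤ h
        u≤h = ^-≤-first 0≤h h≤1 (ℕₚ.≤-trans (s≤s z≤n) M<J)
        uρ≈1 : u * ρ ≈ # 1
        uρ≈1 = trans (sym (^-* h (# t) J)) (trans (^-congˡ J ht≈1) (1^ J))
        0≤η : 0≤ η
        0≤η = 0≤-^ Γ 0≤h
        η≈u^6 : η ≈ u ^ 6
        η≈u^6 = sym (^-^ h J 6)

        open Reciprocal uρ≈1 0≤u u≤1 0≤ρ

        point : ℕ → K
        point k = s + # k * η

        y : K
        y = ρ ^ suc (suc λ₁)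
        Y : ℕ
        -- Y = r^(κ+3) is one power of r above the denominators of the class, so that b (A + B F) is
        -- at most a constant over r.
        Y = r ℕ.^ suc (suc λ₁)
        #Y : # Y ≈ y
        #Y = #r^ (suc (suc λ₁))
        0≤y : 0≤ y
        0≤y = 0≤-^ (suc (suc λ₁)) 0≤ρ
        yy : y * y ≈ ρ ^ (suc (suc λ₁) ℕ.+ suc (suc λ₁))
        yy = sym (^-+ ρ (suc (suc λ₁)) (suc (suc λ₁)))

        ψ : ℕ → K
        ψ = TA.expansion 0≤h Ct-h 0≤s s≤2h

        matrix : ℕ → ℕ → K
        matrix m j = shift j (truncate D ψ) m

        module Relation (ap : Approximation D Eₙ (Y ℕ.* Y) Y matrix) where
          open Approximation ap renaming (close to ap-close)

          num-at den-at : ℕ → K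
          num-at k = ev Eₙ α (# k)
          den-at k = ev D β (# k)

          relation : ℕ → K
          relation k = num-at k + den-at k * F (point k)

          -- The relation is integral in the index k, while separation concerns functions of the
          -- point. The substitution k = (x - s) r⁶ passes from one to the other.
          q p : ℕ → K
          q = tay D (- s) (λ i → β i * (ρ ^ 6) ^ i)
          p = tay Eₙ (- s) (λ i → α i * (ρ ^ 6) ^ i)

          rescale : ∀ T γ k → ev T (tay T (- s) (λ i → γ i * (ρ ^ 6) ^ i)) (point k) ≈ ev T γ (# k)
          rescale T γ k = trans (ev-tay T (- s) _ (point k)) (trans (ev-scale T γ (ρ ^ 6) _) (ev-congʳ T γ
            (trans (ring! (ρ ^ 6 ∷ s ∷ # k ∷ η ∷ []) λ v s k e → v :* (:- s :+ (s :+ k :* e)) := e :* v :* k)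
              (trans (*-congʳ (trans (*-congʳ η≈u^6) (powers 6))) (1*≈ _)))))

          c : ℕ → K
          c = joined Eₙ p q

          relation-value : ∀ k → ∑ n (λ i → c i * functions Eₙ F i (point k)) ≈ relation k
          relation-value k = trans (∑-functions Eₙ D F c (point k)) (+-cong
            (trans (ev-cong Eₙ λ i i<Eₙ → reflexive (joined-left Eₙ p q i i<Eₙ)) (rescale Eₙ α k))
            (*-congʳ (trans (ev-cong D λ j _ → reflexive (joined-right Eₙ p q j)) (rescale D β k))))

          module _ (k : ℕ) (k≤B : k ℕ.≤ B) where
            x f Ψ : K
            x = # k
            f = F (point k)
            Ψ = ev D ψ x

            x≤B₂ : ∣ x ∣ ≤ B₂
            x≤B₂ = ≤-trans (≤-reflexive (∣#∣ k)) (≤-trans (#-mono k≤B) (by (# B ∷ []) (λ B → κ# 1 ⊢ B :≤ κ# 1 :+ B) 0≤1))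
            1≤B₂ : # 1 ≤ B₂
            1≤B₂ = by (# B ∷ []) (λ B → B ⊢ κ# 1 :≤ κ# 1 :+ B) (0≤# B)

            γ : ℕ → K
            γ m = α m + ∑ D (λ j → β j * matrix m j)

            ev-γ : ev Eₙ γ x ≈ num-at k + den-at k * Ψ
            ev-γ = ev-relation D ψ α β x

            polynomial-part : ∣ num-at k + den-at k * Ψ ∣ * y ≤ E₁
            polynomial-part = ≤-trans (≤-reflexive (trans (trans (*-comm _ _) (*-cong (sym (0≤⇒∣x∣≈x 0≤y)) (∣∣-cong (sym ev-γ))))
                (trans (sym (∣*∣ y _)) (∣∣-cong (sym (ev-* Eₙ y γ x))))))
              (ev-bound′ Eₙ (λ m m<Eₙ → ≤-trans (≤-reflexive (trans (∣*∣ y (γ m)) (trans (*-comm _ _)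
                  (*-congˡ (trans (0≤⇒∣x∣≈x 0≤y) (sym #Y)))))) (ap-close m m<Eₙ)) x≤B₂ 1≤B₂)

            den≤ : ∣ den-at k ∣ ≤ D₁ * (y * y)
            den≤ = ≤-trans (ev-bound′ D (λ j _ → ≤-trans (β-bound j) (≤-reflexive (trans (#-* Y Y) (*-cong #Y #Y)))) x≤B₂ 1≤B₂)
              (≤-reflexive (ring! (# D ∷ y ∷ B₂ ^ D ∷ []) λ D y b → D :* (y :* y :* b) := D :* b :* (y :* y)))

            -- B has size y² and the Taylor error is η^D; their product must stay below 1/y. This
            -- amounts to 3(κ + 3) ≤ 6(κ + 2) and explains the choice D = κ + 2.
            yyyη≤1 : y * y * y * η ^ D ≤ # 1
            yyyη≤1 = ≤-trans (≤-reflexive (*-cong (trans (*-congʳ yy) (sym (^-+ ρ (suc (suc λ₁) ℕ.+ suc (suc λ₁)) (suc (suc λ₁)))))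
                (trans (^-congˡ D η≈u^6) (^-^ u 6 D)))) (cancel (suc (suc λ₁) ℕ.+ suc (suc λ₁) ℕ.+ suc (suc λ₁)) 0 (≤-via (3 ℕ.+ 3 ℕ.* κ) (arith κ)))
              where
              arith : ∀ κ → (suc (suc (suc κ)) ℕ.+ suc (suc (suc κ)) ℕ.+ suc (suc (suc κ)) ℕ.+ 0) ℕ.+ (3 ℕ.+ 3 ℕ.* κ) ≡ 6 ℕ.* suc (suc κ)
              arith = solve-∀

            error-part : ∣ den-at k * (f - Ψ) ∣ * y ≤ D₁ * Ct
            error-part = ≤-trans (*-monoʳ-≤ 0≤y (∣*∣-≤ den≤ (TA.taylor 0≤h Ct-h 0≤s s≤2h k k≤B)))
              (≤-trans (≤-reflexive (ring! (D₁ ∷ Ct ∷ y ∷ η ^ D ∷ []) λ D C y e → D :* (y :* y) :* (C :* e) :* y := D :* C :* (y :* y :* y :* e)))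
                (≤-trans (*-monoˡ-≤ (0≤D₁ · TA.0≤C) yyyη≤1) (≤-reflexive (*1≈ _))))

            relation≤ : ∣ relation k ∣ * y ≤ C₂
            relation≤ = ≤-trans (*-monoʳ-≤ 0≤y (≤-trans (∣∣-cong-≤ (ring! (num-at k ∷ den-at k ∷ f ∷ Ψ ∷ []) λ a b f z →
                a :+ b :* f := (a :+ b :* z) :+ b :* (f :- z))) (∣+∣ _ _)))
              (≤-trans (≤-reflexive (distribʳ y _ _)) (+-mono-≤ polynomial-part error-part))

            module _ (bad : Bad F r λ₁ (point k)) where
              open Bad bad

              b g G : K
              b = # den
              g = ∣ b * f - num ∣
              G = ∣ relation k ∣

              0≤G : 0≤ G
              0≤G = 0≤∣∣ (relation k)
              0≤g : 0≤ g
              0≤g = 0≤∣∣ (b * f - num)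
              ρ^≤b : ρ ^ λ₁ ≤ b
              ρ^≤b = ≤-trans (≤-reflexive (sym (#r^ λ₁))) (#-mono r^≤den)

              bG≤ : b * G ≤ C₂ * u
              bG≤ = ≤-trans (move 1 (≤-trans (≤-trans (*-monoʳ-≤ (0≤ρ · 0≤1) (*-monoʳ-≤ 0≤G (≤-trans (#-mono den≤r^) (≤-reflexive (#r^ (suc λ₁))))))
                  (≤-reflexive (ring! (ρ ∷ ρ ^ suc λ₁ ∷ G ∷ []) λ r p G → p :* G :* (r :* κ# 1) := G :* (r :* p)))) relation≤))
                (≤-reflexive (*-congˡ (*1≈ u)))

              g≤ : g ≤ u ^ (λ₁ ℕ.* 89)
              g≤ = ≤-trans (move (λ₁ ℕ.* 89) (≤-trans (*-monoˡ-≤ 0≤g (≤-trans (≤-reflexive (sym (^-^ ρ λ₁ 89))) (^-mono-≤ 89 (0≤-^ λ₁ 0≤ρ) ρ^≤b))) close)) (≤-reflexive (1*≈ _))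

              Bg≤ : ∣ den-at k ∣ * g ≤ D₁ * u
              Bg≤ = ≤-trans (*-mono-≤ 0≤g (0≤D₁ · (0≤y · 0≤y)) den≤ g≤)
                (≤-trans (≤-reflexive (trans (*-assoc _ _ _) (*-congˡ (*-congʳ yy))))
                  (≤-trans (*-monoˡ-≤ 0≤D₁ (cancel (suc (suc λ₁) ℕ.+ suc (suc λ₁)) 1 {λ₁ ℕ.* 89} (≤-via (82 ℕ.+ 87 ℕ.* κ) (arith κ)))) (≤-reflexive (*-congˡ (*1≈ u)))))
                where
                arith : ∀ κ → (suc (suc (suc κ)) ℕ.+ suc (suc (suc κ)) ℕ.+ 1) ℕ.+ (82 ℕ.+ 87 ℕ.* κ) ≡ suc κ ℕ.* 89
                arith = solve-∀

              integer : K
              integer = num-at k * b + den-at k * num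

              integer≈ : integer ≈ b * relation k - den-at k * (b * f - num)
              integer≈ = ring! (num-at k ∷ den-at k ∷ b ∷ f ∷ num ∷ []) λ A B b f a → A :* b :+ B :* a := b :* (A :+ B :* f) :- B :* (b :* f :- a)

              integer≈0 : integer ≈ # 0
              integer≈0 = int-half (int-+ (int-* (int-ev Eₙ α x α-int (int-# k)) (int-# den)) (int-* (int-ev D β x β-int (int-# k)) num-int))
                (≤-trans (*-monoˡ-≤ (0≤# 2) (≤-trans (≤-trans (∣∣-cong-≤ integer≈)
                    (∣-∣-≤ (≤-trans (≤-reflexive (trans (∣*∣ _ _) (*-congʳ (∣#∣ den)))) bG≤) (≤-trans (≤-reflexive (∣*∣ _ _)) Bg≤)))
                  (≤-trans (≤-reflexive (sym (distribʳ u C₂ D₁))) (*-monoˡ-≤ (0≤C₂ ⊹ 0≤D₁) u≤h))))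
                (≤-trans (≤-reflexive (sym (*-assoc _ _ _))) CD-h))

              bG≈Bg : b * G ≈ ∣ den-at k ∣ * g
              bG≈Bg = trans (trans (*-congʳ (sym (∣#∣ den))) (sym (∣*∣ _ _))) (trans (∣∣-cong
                (trans (ring! (b * relation k ∷ den-at k * (b * f - num) ∷ []) λ p q → p := (p :- q) :+ q)
                  (trans (+-congʳ (trans (sym integer≈) integer≈0)) (0+≈ _)))) (∣*∣ _ _))

              -- Since the integer A b + B a vanishes, b (A + B F) equals B (b F - a) in absolute
              -- value. The closeness of a/b and the factor b give b⁻⁹⁰ against Y², and 2(κ + 3) +
              -- 84(κ + 1) ≤ 90(κ + 1).
              tiny : G ≤ D₁ * u ^ (λ₁ ℕ.* 84)
              tiny = ≤-trans (move (λ₁ ℕ.* 90) (≤-trans (*-monoˡ-≤ 0≤G (≤-trans (≤-reflexive (sym (^-^ ρ λ₁ 90))) (^-mono-≤ 90 (0≤-^ λ₁ 0≤ρ) ρ^≤b)))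
                  (≤-trans (≤-reflexive (trans (ring! (G ∷ b ∷ b ^ 89 ∷ []) λ G b p → G :* (b :* p) := b :* G :* p)
                      (trans (*-congʳ bG≈Bg) (*-assoc _ _ _))))
                    (≤-trans (*-mono-≤ (0≤g · 0≤-^ 89 (0≤# den)) (0≤D₁ · (0≤y · 0≤y)) den≤ close) (≤-reflexive (*1≈ _))))))
                (≤-trans (≤-reflexive (trans (*-assoc _ _ _) (*-congˡ (*-congʳ yy))))
                  (*-monoˡ-≤ 0≤D₁ (cancel (suc (suc λ₁) ℕ.+ suc (suc λ₁)) (λ₁ ℕ.* 84) {λ₁ ℕ.* 90} (≤-via (4 ℕ.* κ) (arith κ)))))
                where
                arith : ∀ κ → (suc (suc (suc κ)) ℕ.+ suc (suc (suc κ)) ℕ.+ suc κ ℕ.* 84) ℕ.+ 4 ℕ.* κ ≡ suc κ ℕ.* 90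
                arith = solve-∀

          module _ (k : ℕ → ℕ) (k≤B : ∀ i → i ℕ.≤ n → k i ℕ.≤ B) (k-mono : ∀ i j → i ℕ.< j → j ℕ.≤ n → k i ℕ.< k j)
            (bad : ∀ i → i ℕ.≤ n → Bad F r λ₁ (point (k i))) where

            ε : K
            ε = D₁ * u ^ (λ₁ ℕ.* 84)

            0≤hd : 0< h ^ (S.M ℕ.+ Γ ℕ.* n)
            0≤hd = 0<-^ (S.M ℕ.+ Γ ℕ.* n) 0<h

            -- The gain 84(κ + 1) beats the loss in `separation`: 6n = 18(κ + 2) powers of r for the
            -- mesh, and one more, which covers h^(M+1) because M < J.
            scale≤ : u ^ (λ₁ ℕ.* 84) ≤ h * h ^ (S.M ℕ.+ Γ ℕ.* n)
            scale≤ = ≤-trans (^-antiʳ-≤ 0≤u u≤1 (≤-via {suc (6 ℕ.* n)} (47 ℕ.+ 66 ℕ.* κ) (arith κ)))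
              (≤-trans (*-mono-≤ (0≤-^ (6 ℕ.* n) 0≤u) (0≤h · 0≤-^ S.M 0≤h) (^-antiʳ-≤ {m = suc S.M} 0≤h h≤1 M<J) ≤-refl)
                (≤-reflexive (trans (*-assoc _ _ _) (*-congˡ (trans (*-congˡ (trans (^-^ h J (6 ℕ.* n)) (^-≈ h (≡.sym (ℕₚ.*-assoc J 6 n))))) (sym (^-+ h S.M (Γ ℕ.* n))))))))
              where
              arith : ∀ κ → suc (6 ℕ.* (suc (suc κ) ℕ.+ suc (suc κ) ℕ.+ suc (suc κ))) ℕ.+ (47 ℕ.+ 66 ℕ.* κ) ≡ suc κ ℕ.* 84
              arith = solve-∀

            q≤ : ∀ j → j ℕ.< D → ∣ q j ∣ ≤ Cs * D₁ * h
            q≤ j j<D = *-cancelˡ-≤ 0≤hd (≤-trans (≤-reflexive (trans (*-comm _ _) (*-congʳ (∣∣-cong (sym (reflexive (joined-right Eₙ p q j)))))))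
              (≤-trans (S.separation Γ B M<Γ c k 0<h Cs-h h≤4s s≤2h k≤B k-mono
                  (λ i i≤n → ≤-trans (∣∣-cong-≤ (relation-value (k i))) (tiny (k i) (k≤B i i≤n) (bad i i≤n))) (Eₙ ℕ.+ j) (ℕₚ.+-monoʳ-< Eₙ j<D))
                (≤-trans (*-monoˡ-≤ 0≤Cs (*-monoˡ-≤ 0≤D₁ scale≤))
                  (≤-reflexive (ring! (Cs ∷ D₁ ∷ h ∷ h ^ (S.M ℕ.+ Γ ℕ.* n) ∷ []) λ C D h w → C :* (D :* (h :* w)) := w :* (C :* D :* h))))))

            point≤1 : ∀ k → k ℕ.≤ B → ∣ point k ∣ ≤ # 1
            point≤1 k k≤B = ≤-trans (≤-reflexive (0≤⇒∣x∣≈x (0≤s ⊹ 0≤# k · 0≤η)))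
              (≤-trans (+-mono-≤ s≤2h (*-mono-≤ 0≤η (0≤# B) (#-mono k≤B) (^-≤-first 0≤h h≤1 (ℕₚ.≤-trans (s≤s z≤n) M<Γ))))
                (≤-trans (≤-reflexive (sym (distribʳ h (# 2) (# B)))) B-h))

            -- As a function of the point, B has tiny coefficients; as a function of k it has
            -- integral ones. Its values are therefore integers of absolute value at most one half.
            -- The zeros 0, ..., D - 1 then kill all D coefficients.
            den≈0 : ∀ k → k ℕ.≤ B → den-at k ≈ # 0
            den≈0 k k≤B = int-half (int-ev D β (# k) β-int (int-# k)) (≤-trans (*-monoˡ-≤ (0≤# 2)
                (≤-trans (∣∣-cong-≤ (sym (rescale D β k))) (ev-bound D q≤ (point≤1 k k≤B))))
              (≤-trans (≤-reflexive (ring! (# D ∷ Cs ∷ D₁ ∷ h ∷ []) λ D C d h → κ# 2 :* (D :* (C :* d :* h)) := κ# 2 :* (D :* (C :* d)) :* h)) DC-h))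

            β≈0 : ∀ j → j ℕ.< D → β j ≈ # 0
            β≈0 j p = ∣∣≈0⇒≈0 (≤-trans (interpolation D D (λ i → i) (λ i → ℕₚ.<⇒≤) (λ i j q _ → q) β
                (λ i i<D → ≤-trans (∣∣-cong-≤ (den≈0 i (ℕₚ.≤-trans (ℕₚ.<⇒≤ i<D) D≤B))) (≤-reflexive (∣#∣ 0))) j p) (≤-reflexive (*0≈ _)))

            contradictory : ⊥
            contradictory = case β-nonzero of λ { (j , j<D , ne) → ne (β≈0 j j<D) }

        1≤Y : 1 ℕ.≤ Y
        1≤Y = #-mono⁻¹ (≤-trans (1≤-^ (suc (suc λ₁)) (1≤-^ J (1≤# 1≤t))) (≤-reflexive (sym #Y)))

        few-bad : ∀ k → (∀ i → i ℕ.≤ n → k i ℕ.≤ B) → (∀ i j → i ℕ.< j → j ℕ.≤ n → k i ℕ.< k j) → ¬ (∀ i → i ℕ.≤ n → Bad F r λ₁ (point (k i)))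
        few-bad = Relation.contradictory (dirichlet-square D Y matrix 1≤Y (s≤s z≤n))

  -- Induction over the classes: take N m consecutive disjoint windows for the first m classes. Each
  -- contains an index good for those classes, and these N m indices cannot all be bad for class m.
  -- The free offset o allows the windows to be placed side by side.
  window : ∀ m (N : ℕ → ℕ) → ∃ λ W → ∀ (P : ℕ → ℕ → Set) →
    (∀ κ → κ ℕ.< m → ∀ (k : ℕ → ℕ) → (∀ i j → i ℕ.< j → j ℕ.< N κ → k i ℕ.< k j) → ¬ (∀ i → i ℕ.< N κ → P κ (k i))) →
    ∀ o → ∃ λ k → o ℕ.≤ k × k ℕ.< o ℕ.+ W × (∀ κ → κ ℕ.< m → ¬ P κ k)
  window zero N = 1 , λ P few o → o , ℕₚ.≤-refl , ≡.subst (o ℕ.<_) (ℕₚ.+-comm 1 o) ℕₚ.≤-refl , λ _ ()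
  window (suc m) N = case window m N of λ { (W , good) → N m ℕ.* W , λ P few o → step W good P few o }
    where
    step : ∀ W → (∀ (P : ℕ → ℕ → Set) →
      (∀ κ → κ ℕ.< m → ∀ (k : ℕ → ℕ) → (∀ i j → i ℕ.< j → j ℕ.< N κ → k i ℕ.< k j) → ¬ (∀ i → i ℕ.< N κ → P κ (k i))) →
      ∀ o → ∃ λ k → o ℕ.≤ k × k ℕ.< o ℕ.+ W × (∀ κ → κ ℕ.< m → ¬ P κ k)) → (P : ℕ → ℕ → Set) →
      (∀ κ → κ ℕ.< suc m → ∀ (k : ℕ → ℕ) → (∀ i j → i ℕ.< j → j ℕ.< N κ → k i ℕ.< k j) → ¬ (∀ i → i ℕ.< N κ → P κ (k i))) →
      ∀ o → ∃ λ k → o ℕ.≤ k × k ℕ.< o ℕ.+ N m ℕ.* W × (∀ κ → κ ℕ.< suc m → ¬ P κ k)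
    step W good P few o = case dne one-good of λ { (i , i<N , ¬P) →
        k i , ℕₚ.≤-trans (ℕₚ.m≤m+n o (i ℕ.* W)) (lower i)
        , ℕₚ.<-≤-trans (upper i) (ℕₚ.≤-trans (ℕₚ.≤-reflexive (≡.trans (ℕₚ.+-assoc o (i ℕ.* W) W) (≡.cong (o ℕ.+_) (ℕₚ.+-comm (i ℕ.* W) W))))
            (ℕₚ.+-monoʳ-≤ o (ℕₚ.*-monoˡ-≤ W i<N)))
        , λ κ κ<sm → [ (λ κ<m → good-at i κ κ<m) , (λ { ≡.refl → ¬P }) ]′ (ℕₚ.m≤n⇒m<n∨m≡n (ℕₚ.≤-pred κ<sm)) }
      where
      found : ∀ i → ∃ λ k → o ℕ.+ i ℕ.* W ℕ.≤ k × k ℕ.< o ℕ.+ i ℕ.* W ℕ.+ W × (∀ κ → κ ℕ.< m → ¬ P κ k)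
      found i = good P (λ κ p → few κ (ℕₚ.m<n⇒m<1+n p)) (o ℕ.+ i ℕ.* W)
      k : ℕ → ℕ
      k i = proj₁ (found i)
      lower : ∀ i → o ℕ.+ i ℕ.* W ℕ.≤ k i
      lower i = proj₁ (proj₂ (found i))
      upper : ∀ i → k i ℕ.< o ℕ.+ i ℕ.* W ℕ.+ W
      upper i = proj₁ (proj₂ (proj₂ (found i)))
      good-at : ∀ i κ → κ ℕ.< m → ¬ P κ (k i)
      good-at i = proj₂ (proj₂ (proj₂ (found i)))
      mono : ∀ i j → i ℕ.< j → j ℕ.< N m → k i ℕ.< k j
      mono i j i<j _ = ℕₚ.<-≤-trans (upper i) (ℕₚ.≤-trans
        (ℕₚ.≤-trans (ℕₚ.≤-reflexive (≡.trans (ℕₚ.+-assoc o (i ℕ.* W) W) (≡.cong (o ℕ.+_) (ℕₚ.+-comm (i ℕ.* W) W)))) (ℕₚ.+-monoʳ-≤ o (ℕₚ.*-monoˡ-≤ W i<j)))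
        (lower j))
      one-good : ¬ ¬ (∃ λ i → i ℕ.< N m × ¬ P m (k i))
      one-good none = few m ℕₚ.≤-refl k mono λ i p → dne λ ¬P → none (i , p , ¬P)

  -- One more than the number 3(κ + 2) of functions, because separation needs that many points.
  length-of-class : ℕ → ℕ
  length-of-class κ = suc (suc (suc κ) ℕ.+ suc (suc κ) ℕ.+ suc (suc κ))

  FewBad : (K → K) → ℕ → ℕ → ℕ → K → Set
  FewBad F κ J B C = ∀ h s t → 1 ℕ.≤ t → 0< h → h * # t ≈ # 1 → C * h ≤ # 1 → h ≤ # 4 * s → s ≤ # 2 * h →
    ∀ (k : ℕ → ℕ) → (∀ i → i ℕ.< length-of-class κ → k i ℕ.≤ B) → (∀ i j → i ℕ.< j → j ℕ.< length-of-class κ → k i ℕ.< k j) →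
    ¬ (∀ i → i ℕ.< length-of-class κ → Bad F (t ℕ.^ J) (suc κ) (s + # (k i) * h ^ (J ℕ.* 6)))

  module _ {a : ℕ → K} {F : K → K} (ga : Germ a F) (ind : ∀ E D → Independent (E ℕ.+ D) (coefficients E a)) where

    few-bad : ∀ κ → ∃ λ J₀ → ∀ J → J₀ ℕ.≤ J → ∀ B → ∃ λ C → 0≤ C × FewBad F κ J B C
    few-bad κ = case ga of λ { (A₀ , R₀ , g₀) → case germs-common (E₁ ℕ.+ D) (germ-functions E₁ D ga) of λ { (A , R , 1≤A , 1≤R , gs) →
        use g₀ 1≤A 1≤R gs (echelon (E₁ ℕ.+ D) (coefficients E₁ a) (ind E₁ D)) } }
      where
      D = suc (suc κ)
      E₁ = D ℕ.+ D
      use : ∀ {A₀ R₀ A R} → GermWith A₀ R₀ a F → # 1 ≤ A → # 1 ≤ R →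
        (∀ k → k ℕ.< E₁ ℕ.+ D → GermWith A R (coefficients E₁ a k) (functions E₁ F k)) → Echelon (E₁ ℕ.+ D) (coefficients E₁ a) →
        ∃ λ J₀ → ∀ J → J₀ ℕ.≤ J → ∀ B → ∃ λ C → 0≤ C × FewBad F κ J B C
      use g₀ 1≤A 1≤R gs ech = suc C.S.M , λ J J₀≤J B → bound J J₀≤J B
        where
        module C = Class g₀ κ 1≤A 1≤R gs (ind E₁ D) ech
        module _ (J : ℕ) (J₀≤J : suc C.S.M ℕ.≤ J) (B : ℕ) where
          -- The range is enlarged by D: the indices 0, ..., D - 1, at which B is shown to vanish,
          -- must belong to it.
          module Sc = C.Scale J (B ℕ.+ D) J₀≤J (ℕₚ.m≤n+m D B)
          bound : ∃ λ C → 0≤ C × FewBad F κ J B C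
          bound = Sc.C , (Sc.0≤Cs ⊹ Sc.TA.0≤C ⊹ 0≤# 2 · (Sc.0≤C₂ ⊹ Sc.0≤D₁) ⊹ 0≤# 2 · (0≤# D · (Sc.0≤Cs · Sc.0≤D₁)) ⊹ (0≤# 2 ⊹ 0≤# (B ℕ.+ D)))
            , λ h s t 1≤t 0<h ht Ch≤1 h≤4s s≤2h k k≤B mono bad →
                Sc.Sample.few-bad t 1≤t 0<h ht Ch≤1 h≤4s s≤2h k (λ i p → ℕₚ.≤-trans (k≤B i (s≤s p)) (ℕₚ.m≤m+n B D))
                  (λ i j p q → mono i j p (s≤s q)) λ i p → bad i (s≤s p)

    Good : ℕ → ℕ → Set
    Good m J = ∃₂ λ B C → 0≤ C × (∀ h s t → 1 ℕ.≤ t → 0< h → h * # t ≈ # 1 → C * h ≤ # 1 → h ≤ # 4 * s → s ≤ # 2 * h →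
      ∃ λ k → k ℕ.≤ B × (∀ κ → κ ℕ.< m → ¬ Bad F (t ℕ.^ J) (suc κ) (s + # k * h ^ (J ℕ.* 6))))

    module _ (m W J : ℕ) (good : ∀ (P : ℕ → ℕ → Set) →
          (∀ κ → κ ℕ.< m → ∀ (k : ℕ → ℕ) → (∀ i j → i ℕ.< j → j ℕ.< length-of-class κ → k i ℕ.< k j) → ¬ (∀ i → i ℕ.< length-of-class κ → P κ (k i))) →
          ∀ o → ∃ λ k → o ℕ.≤ k × k ℕ.< o ℕ.+ W × (∀ κ → κ ℕ.< m → ¬ P κ k))
        (c : ℕ → K) (0≤c : ∀ κ → 0≤ c κ) (few : ∀ κ → κ ℕ.< m → FewBad F κ J W (c κ)) where

      good-index : Good m J
      good-index = W , ∑ m c , 0≤∑ m (λ κ _ → 0≤c κ) , λ h s t 1≤t 0<h ht Ch≤1 h≤4s s≤2h →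
        case good (λ κ k → Bad F (t ℕ.^ J) (suc κ) (s + # k * h ^ (J ℕ.* 6)) × k ℕ.≤ W)
          (λ κ κ<m k mono bad → few κ κ<m h s t 1≤t 0<h ht
            (shrink (0<⇒0≤ 0<h) (term≤∑ m (λ κ _ → 0≤c κ) κ κ<m) Ch≤1) h≤4s s≤2h k
            (λ i p → proj₂ (bad i p)) mono λ i p → proj₁ (bad i p)) 0
        of λ { (k , _ , k<W , none) → k , ℕₚ.<⇒≤ k<W , λ κ p b → none κ p (b , ℕₚ.<⇒≤ k<W) }

    -- The order of choices matters. A bound for J comes from the pivots of all m classes, and J
    -- stays free above it so that it can also exceed the local order; the window depends on the
    -- class lengths only; the constants for h come last.
    good-sample : ∀ m → ∃ λ J₀ → ∀ J → J₀ ℕ.≤ J → Good m J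
    good-sample m = collect few-bad
      where
      collect : (∀ κ → ∃ λ J₀ → ∀ J → J₀ ℕ.≤ J → ∀ B → ∃ λ C → 0≤ C × FewBad F κ J B C) → ∃ λ J₀ → ∀ J → J₀ ℕ.≤ J → Good m J
      collect few = max m (λ κ → proj₁ (few κ)) , λ J J₀≤J → case window m length-of-class of λ { (W , good) → finish J W good (constant J J₀≤J W) }
        where
        constant : ∀ J → max m (λ κ → proj₁ (few κ)) ℕ.≤ J → ∀ W κ → ∃ λ C → 0≤ C × (κ ℕ.< m → FewBad F κ J W C)
        constant J J₀≤J W κ = [ (λ p → case proj₂ (few κ) J (ℕₚ.≤-trans (≤max m (λ κ → proj₁ (few κ)) κ p) J₀≤J) W of λ { (C , 0≤C , f) → C , 0≤C , λ _ → f })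
                     , (λ m≤κ → # 0 , 0≤0 , λ κ<m → ⊥-elim (ℕₚ.<⇒≱ κ<m m≤κ)) ]′ (ℕₚ.<-≤-connex κ m)
        finish : ∀ J W → (∀ (P : ℕ → ℕ → Set) →
          (∀ κ → κ ℕ.< m → ∀ (k : ℕ → ℕ) → (∀ i j → i ℕ.< j → j ℕ.< length-of-class κ → k i ℕ.< k j) → ¬ (∀ i → i ℕ.< length-of-class κ → P κ (k i))) →
          ∀ o → ∃ λ k → o ℕ.≤ k × k ℕ.< o ℕ.+ W × (∀ κ → κ ℕ.< m → ¬ P κ k)) →
          (∀ κ → ∃ λ C → 0≤ C × (κ ℕ.< m → FewBad F κ J W C)) → Good m J
        finish J W good const = good-index m W J good (λ κ → proj₁ (const κ)) (λ κ → proj₁ (proj₂ (const κ))) (λ κ → proj₂ (proj₂ (const κ)))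

  -- Badly approximable values built from √2

  2∣sq⇒2∣ : ∀ a → 2 ∣ a ℕ.* a → 2 ∣ a
  2∣sq⇒2∣ a p = [ (λ q → q) , (λ q → q) ]′ (euclidsLemma a a prime[2] p)

  -- Infinite descent: a = 2q leads to b² = 2q² with b < a. If a ≤ b instead, the equation forces b
  -- = 0 at once.
  √2-irrational : ∀ a b → a ℕ.* a ≡ 2 ℕ.* (b ℕ.* b) → b ≡ 0
  √2-irrational = <-rec _ step
    where
    step : ∀ a → (∀ {c} → c ℕ.< a → ∀ b → c ℕ.* c ≡ 2 ℕ.* (b ℕ.* b) → b ≡ 0) → ∀ b → a ℕ.* a ≡ 2 ℕ.* (b ℕ.* b) → b ≡ 0
    step a ih b eq = go (2∣sq⇒2∣ a (divides (b ℕ.* b) (≡.trans eq (ℕₚ.*-comm 2 (b ℕ.* b))))) (ℕₚ.<-≤-connex b a)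
      where
      go : 2 ∣ a → b ℕ.< a ⊎ a ℕ.≤ b → b ≡ 0
      go (divides q ≡.refl) (inj₁ b<a) = sq≡0 b (≡.trans bb≡ (≡.cong (λ q → 2 ℕ.* (q ℕ.* q)) (ih b<a q bb≡)))
        where
        sq≡0 : ∀ b → b ℕ.* b ≡ 0 → b ≡ 0
        sq≡0 zero _ = ≡.refl
        arith : ∀ q → (q ℕ.* 2) ℕ.* (q ℕ.* 2) ≡ 2 ℕ.* (2 ℕ.* (q ℕ.* q))
        arith = solve-∀
        bb≡ : b ℕ.* b ≡ 2 ℕ.* (q ℕ.* q)
        bb≡ = ℕₚ.*-cancelˡ-≡ _ _ 2 (≡.trans (≡.sym eq) (arith q))
      go _ (inj₂ a≤b) = case-zero b (ℕₚ.+-cancelˡ-≤ (b ℕ.* b) _ _ (ℕₚ.≤-trans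
          (ℕₚ.≤-reflexive (≡.trans (≡.cong (b ℕ.* b ℕ.+_) (≡.sym (ℕₚ.+-identityʳ (b ℕ.* b)))) (≡.sym eq)))
          (ℕₚ.≤-trans (ℕₚ.*-mono-≤ a≤b a≤b) (ℕₚ.≤-reflexive (≡.sym (ℕₚ.+-identityʳ _))))))
        where
        case-zero : ∀ b → b ℕ.* b ℕ.≤ 0 → b ≡ 0
        case-zero zero _ = ≡.refl

  int-abs : ∀ {x} → IsInt x → ∃ λ n → ∣ x ∣ ≈ # n
  int-abs (m , n , p) = [ (λ q → n ℕ.∸ m , trans (∣∣-cong p) (trans (∣∣-flip _ _) (trans (0≤⇒∣x∣≈x (#-mono q)) (sym (#-∸ q)))))
                        , (λ q → m ℕ.∸ n , trans (∣∣-cong p) (trans (0≤⇒∣x∣≈x (#-mono q)) (sym (#-∸ q)))) ]′ (ℕₚ.≤-total m n)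

  1≤∣int∣ : ∀ {x} → IsInt x → ¬ x ≈ # 0 → # 1 ≤ ∣ x ∣
  1≤∣int∣ i ne = <-or-≤-elim (λ q → q) λ q → ⊥-elim (ne (int-small i q))

  ∣∣*∣∣ : ∀ x → ∣ x ∣ * ∣ x ∣ ≈ x * x
  ∣∣*∣∣ x = trans (sym (∣*∣ x x)) (0≤⇒∣x∣≈x (0≤sq x))

  norm-form : ∀ {a} b → IsInt a → 1 ℕ.≤ b → # 1 ≤ ∣ # 2 * (# b * # b) - a * a ∣
  norm-form {a} b i 1≤b = 1≤∣int∣ (int-sub (int-* (int-# 2) (int-* (int-# b) (int-# b))) (int-* i i)) λ eq →
    case int-abs i of λ { (n , p) → ℕₚ.<⇒≢ 1≤b (≡.sym (√2-irrational n b (#-injective′ (trans (#-* n n)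
      (trans (trans (*-cong (sym p) (sym p)) (∣∣*∣∣ a)) (trans (ring! (# b ∷ a ∷ []) λ b a → a :* a := κ# 2 :* (b :* b) :- (κ# 2 :* (b :* b) :- a :* a))
        (trans (+-congˡ (-‿cong eq)) (trans (ring! (# b ∷ []) λ b → κ# 2 :* (b :* b) :- κ# 0 := κ# 2 :* (b :* b))
          (trans (*-congˡ (sym (#-* b b))) (sym (#-* 2 (b ℕ.* b)))))))))))) }
    where
    #-injective′ : ∀ {m n} → # m ≈ # n → m ≡ n
    #-injective′ eq = ℕₚ.≤-antisym (#-mono⁻¹ (≤-reflexive eq)) (#-mono⁻¹ (≤-reflexive (sym eq)))

  sqrt2 : ∃ λ w → # 1 ≤ w × w ≤ # 2 × w * w ≈ # 2
  sqrt2 = intermediate-value (λ x → x * x) (# 4) (# 1) (# 2) (# 2) (1≤# (s≤s z≤n)) (0≤# 4) lip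
      (by [] (κ# 1 ⊢ κ# 1 :* κ# 1 :≤ κ# 2) 0≤1) (by [] (κ# 2 ⊢ κ# 2 :≤ κ# 2 :* κ# 2) (0≤# 2))
    where
    lip : Lipschitz (λ x → x * x) (# 4) (# 1) (# 2)
    lip x y 1≤x x≤2 1≤y y≤2 = ≤-trans (∣∣-cong-≤ (ring! (x ∷ y ∷ []) λ x y → x :* x :- y :* y := (x :+ y) :* (x :- y)))
      (∣*∣-≤ (≤-trans (≤-reflexive (0≤⇒∣x∣≈x (1≤⇒0≤ 1≤x ⊹ 1≤⇒0≤ 1≤y))) (≤-trans (+-mono-≤ x≤2 y≤2) (≤-reflexive (ring! [] (κ# 2 :+ κ# 2 := κ# 4))))) ≤-refl)

  -- Liouville's inequality for (√2 + e)/T with an explicit constant. The factor T is the price for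
  -- finding such a number in every interval of length 1/T.
  Nice : ℕ → K → Set
  Nice T y = ∀ a b → IsInt a → 1 ℕ.≤ b → # 1 ≤ # 5 * # T * # b * ∣ # b * y - a ∣

  nice-cong : ∀ {T y y′} → y ≈ y′ → Nice T y → Nice T y′
  nice-cong eq nice a b i p = ≤-trans (nice a b i p) (≤-reflexive (*-congˡ (∣∣-cong (+-congʳ (*-congˡ eq)))))

  nice-neg : ∀ {T y} → Nice T (- y) → Nice T y
  nice-neg {y = y} nice a b i p = ≤-trans (nice (- a) b (int-neg i) p) (≤-reflexive (*-congˡ (trans
    (∣∣-cong (ring! (# b ∷ y ∷ a ∷ []) λ b y a → b :* :- y :- :- a := :- (b :* y :- a))) (∣-∣ _))))

  -- The nice numbers are (√2 + e)/T for integers e.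
  nice-between : ∀ {T y₁ y₂} → 1 ℕ.≤ T → # 1 ≤ # T * (y₂ - y₁) → ∃ λ y → y₁ ≤ y × y ≤ y₂ × Nice T y
  nice-between {T} {y₁} {y₂} 1≤T gap =
    case sqrt2 of λ { (w , 1≤w , w≤2 , ww≈2) →
    case floor (# T * y₁ - w) of λ { (z , z-int , z≤ , <z+1) →
    case pos-inverse (1≤⇒0< (1≤# 1≤T)) of λ { (τ , 0<τ , Tτ≈1) → build w 1≤w w≤2 ww≈2 z z-int z≤ <z+1 τ Tτ≈1 } } }
    where
    0<T = 1≤⇒0< (1≤# 1≤T)
    module _ (w : K) (1≤w : # 1 ≤ w) (w≤2 : w ≤ # 2) (ww≈2 : w * w ≈ # 2) (z : K) (z-int : IsInt z)
      (z≤ : z ≤ # T * y₁ - w) (<z+1 : # T * y₁ - w < z + # 1) (τ : K) (Tτ≈1 : # T * τ ≈ # 1) where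
      e y : K
      e = z + # 1
      y = (w + e) * τ
      Ty : # T * y ≈ w + e
      Ty = trans (ring! (# T ∷ w + e ∷ τ ∷ []) λ T w t → T :* (w :* t) := T :* t :* w) (trans (*-congʳ Tτ≈1) (1*≈ _))
      niceness : Nice T y
      niceness a b i 1≤b = ≤-trans key (≤-reflexive (trans (*-congˡ X≈) (ring! (# b ∷ # T ∷ ∣ # b * y - a ∣ ∷ []) λ b T x → κ# 5 :* b :* (T :* x) := κ# 5 :* T :* b :* x)))
        where
        a′ X : K
        a′ = a * # T - # b * e
        X = ∣ # b * w - a′ ∣
        a′-int : IsInt a′
        a′-int = int-sub (int-* i (int-# T)) (int-* (int-# b) (int-+ z-int (int-# 1)))
        X≈ : X ≈ # T * ∣ # b * y - a ∣
        X≈ = trans (∣∣-cong (trans (ring! (# b ∷ w ∷ a ∷ # T ∷ e ∷ []) λ b w a T e → b :* w :- (a :* T :- b :* e) := b :* (w :+ e) :- T :* a)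
            (trans (+-congʳ (*-congˡ (sym Ty))) (ring! (# b ∷ # T ∷ y ∷ a ∷ []) λ b T y a → b :* (T :* y) :- T :* a := T :* (b :* y :- a)))))
          (trans (∣*∣ _ _) (*-congʳ (∣#∣ T)))
        product : # 1 ≤ X * ∣ # b * w + a′ ∣
        product = ≤-trans (norm-form b a′-int 1≤b) (≤-reflexive (trans (∣∣-cong (trans (+-congʳ (*-congʳ (sym ww≈2)))
          (ring! (# b ∷ w ∷ a′ ∷ []) λ b w a → w :* w :* (b :* b) :- a :* a := (b :* w :- a) :* (b :* w :+ a)))) (∣*∣ _ _)))
        -- X times |b √2 + a′| is the norm |2b² - a′²|, at least 1. If X ≤ 1, the conjugate factor
        -- is at most 2b√2 + 1, hence at most 5b because √2 ≤ 2; if X > 1, nothing is to be done.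
        key : # 1 ≤ # 5 * # b * X
        key = <-or-≤-elim
          (λ X≤1 → ≤-trans product (≤-trans (*-monoˡ-≤ (0≤∣∣ _) (≤-trans
              (∣∣-cong-≤ (ring! (# b ∷ w ∷ a′ ∷ []) λ b w a → b :* w :+ a := κ# 2 :* (b :* w) :- (b :* w :- a)))
              (≤-trans (∣-∣-≤ (≤-reflexive (0≤⇒∣x∣≈x (0≤# 2 · (0≤# b · 1≤⇒0≤ 1≤w)))) X≤1)
                (by (# b ∷ w ∷ []) (λ b w → κ# 2 :* (b :* (κ# 2 :- w)) :+ (b :- κ# 1) ⊢ κ# 2 :* (b :* w) :+ κ# 1 :≤ κ# 5 :* b)
                  (0≤# 2 · (0≤# b · w≤2) ⊹ 1≤# 1≤b)))))
            (≤-reflexive (*-comm _ _))))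
          (λ 1<X → by (# b ∷ X ∷ []) (λ b X → κ# 5 :* b :* (X :- κ# 1) :+ (b :- κ# 1) :+ κ# 4 :* b ⊢ κ# 1 :≤ κ# 5 :* b :* X)
            (0≤# 5 · 0≤# b · <⇒≤ 1<X ⊹ 1≤# 1≤b ⊹ 0≤# 4 · 0≤# b))
      build : ∃ λ y → y₁ ≤ y × y ≤ y₂ × Nice T y
      build = y
        , *-cancelˡ-≤ 0<T (≤-trans (by (# T * y₁ ∷ w ∷ z ∷ []) (λ t w z → (z :+ κ# 1) :- (t :- w) ⊢ t :≤ w :+ (z :+ κ# 1)) (<⇒≤ <z+1)) (≤-reflexive (sym Ty)))
        , *-cancelˡ-≤ 0<T (≤-trans (≤-reflexive Ty) (by (# T ∷ y₁ ∷ y₂ ∷ w ∷ z ∷ []) (λ T y₁ y₂ w z → (T :* y₁ :- w :- z) :+ (T :* (y₂ :- y₁) :- κ# 1) ⊢ w :+ (z :+ κ# 1) :≤ T :* y₂) (z≤ ⊹ gap)))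
        , niceness

  nice-value : ∀ F {C a b} T → 1 ℕ.≤ T → a ≤ b → 0≤ C → Lipschitz F C a b → # 1 ≤ # T * ∣ F b - F a ∣ →
    ∃ λ x → a ≤ x × x ≤ b × Nice T (F x)
  nice-value F {C} {a} {b} T 1≤T a≤b 0≤C lip gap = [
      (λ r → increasing F lip (≤-trans gap (≤-reflexive (*-congˡ (0≤⇒∣x∣≈x r)))))
    , (λ r → case increasing (λ x → - F x) (λ x y p q u v → ≤-trans (≤-reflexive (trans (∣∣-cong (ring! (F x ∷ F y ∷ []) λ x y → :- x :- :- y := :- (x :- y))) (∣-∣ _))) (lip x y p q u v))
          (≤-trans gap (≤-reflexive (*-congˡ (trans (sym (∣-∣ _)) (trans (0≤⇒∣x∣≈x r) (ring! (F a ∷ F b ∷ []) λ x y → :- (y :- x) := :- y :- :- x))))))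
        of λ { (x , p , q , nice) → x , p , q , nice-neg nice }) ]′ (0≤-total (F b - F a))
    where
    increasing : ∀ F → Lipschitz F C a b → # 1 ≤ # T * (F b - F a) → ∃ λ x → a ≤ x × x ≤ b × Nice T (F x)
    increasing F lip gap = case nice-between 1≤T gap of λ { (y , p , q , nice) →
      case intermediate-value F C a b y a≤b 0≤C lip p q of λ { (x , a≤x , x≤b , eq) → x , a≤x , x≤b , nice-cong (sym eq) nice } }

  -- The local order of F

  -- The increments of F to the right of 0 are comparable with those of s^(p+1).
  record LocalOrder (F : K → K) : Set where
    field
      p : ℕ
      c₁ C₁ C₂ : K
      0<c₁ : 0< c₁
      0≤C₁ : 0≤ C₁
      0≤C₂ : 0≤ C₂
      upper : ∀ s s′ → 0≤ s → s ≤ s′ → C₂ * s′ ≤ # 1 → ∣ F s′ - F s ∣ ≤ C₁ * ((s′ - s) * s′ ^ p)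
      lower : ∀ s s′ → 0≤ s → s ≤ s′ → C₂ * s′ ≤ # 1 → c₁ * ((s′ - s) * s′ ^ p) ≤ ∣ F s′ - F s ∣

  module _ {F : K → K} (lo : LocalOrder F) where
    open LocalOrder lo

    local-lipschitz : ∀ {d} → d ≤ # 1 → C₂ * d ≤ # 1 → ∀ a b → 0≤ a → b ≤ d → Lipschitz F C₁ a b
    local-lipschitz {d} d≤1 C₂d≤1 a b 0≤a b≤d x y a≤x x≤b a≤y y≤b = [ (λ x≤y → ≤-trans (≤-reflexive (∣∣-flip (F x) (F y)))
            (≤-trans (ordered x y (0≤-up a≤x) x≤y (≤-trans y≤b b≤d)) (≤-reflexive (*-congˡ (∣∣-flip y x)))))
          , (λ y≤x → ordered y x (0≤-up a≤y) y≤x (≤-trans x≤b b≤d)) ]′ (≤-total x y)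
      where
      0≤-up : ∀ {x} → a ≤ x → 0≤ x
      0≤-up q = ≤⇒0≤ (≤-trans (0≤⇒≤ 0≤a) q)
      ordered : ∀ x y → 0≤ x → x ≤ y → y ≤ d → ∣ F y - F x ∣ ≤ C₁ * ∣ y - x ∣
      ordered x y 0≤x x≤y y≤d = ≤-trans (upper x y 0≤x x≤y (≤-trans (*-monoˡ-≤ 0≤C₂ y≤d) C₂d≤1)) (*-monoˡ-≤ 0≤C₁ (≤-trans
        (≤-trans (*-monoˡ-≤ x≤y (^-≤1 p (≤⇒0≤ (≤-trans (0≤⇒≤ 0≤x) x≤y)) (≤-trans y≤d d≤1))) (≤-reflexive (*1≈ _))) (x≤∣x∣ _)))

  nonconstant : ∀ {a} → Independent 2 (coefficients 1 a) → ∃ λ i → ¬ a (suc i) ≈ # 0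
  nonconstant {a} ind = dne λ none → 0<⇒≉0 0<1 (ind (- a 0 ◂ λ _ → # 1) (relation λ i → ¬¬≈ λ ne → none (i , ne)) 1 (s≤s (s≤s z≤n)))
    where
    relation : (∀ i → a (suc i) ≈ # 0) → ∀ l → - a 0 * one l + (# 1 * a l + # 0) ≈ # 0
    relation h zero = ring! (a 0 ∷ []) λ a → :- a :* κ# 1 :+ (κ# 1 :* a :+ κ# 0) := κ# 0
    relation h (suc l) = trans (+-congˡ (+-congʳ (*-congˡ (h l)))) (ring! (a 0 ∷ []) λ a → :- a :* κ# 0 :+ (κ# 1 :* κ# 0 :+ κ# 0) := κ# 0)

  module _ {a F A R} (g : GermWith A R a F) (p : ℕ) (ap≉0 : ¬ a (suc p) ≈ # 0) (low : ∀ i → i ℕ.< p → a (suc i) ≈ # 0)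
    {c₁ w : K} (c₁+c₁ : c₁ + c₁ ≈ ∣ a (suc p) ∣) (0<c₁ : 0< c₁) (0<w : 0< w) (c₁w≈1 : c₁ * w ≈ # 1) where
    open GermWith g
    private
      W C₁ C₂ : K
      W = (# 2 * # (suc p) + # 3) * (A * R ^ suc (suc p))
      C₁ = (# 2 * # p + # 3) * (A * R ^ suc p)
      C₂ = # 4 * R + W * w
      0≤W : 0≤ W
      0≤W = (0≤# 2 · 0≤# (suc p) ⊹ 0≤# 3) · (0≤A · 0≤-^ (suc (suc p)) 0≤R)

      module _ (s s′ : K) (0≤s : 0≤ s) (s≤s′ : s ≤ s′) (C₂s′≤1 : C₂ * s′ ≤ # 1) where
        X : K
        X = (s′ - s) * s′ ^ p
        0≤s′ : 0≤ s′
        0≤s′ = ≤⇒0≤ (≤-trans (0≤⇒≤ 0≤s) s≤s′)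
        4Rs′≤1 : # 4 * (R * s′) ≤ # 1
        4Rs′≤1 = ≤-trans (≤-reflexive (sym (*-assoc _ _ _))) (shrink 0≤s′ (by (# 4 * R ∷ W * w ∷ []) (λ a b → b ⊢ a :≤ a :+ b) (0≤W · 0<⇒0≤ 0<w)) C₂s′≤1)
        Ws′≤c₁ : W * s′ ≤ c₁
        Ws′≤c₁ = *-cancelˡ-≤ 0<w (≤-trans (≤-reflexive (ring! (w ∷ W ∷ s′ ∷ []) λ w W s → w :* (W :* s) := W :* w :* s))
          (≤-trans (shrink 0≤s′ (by (# 4 * R ∷ W * w ∷ []) (λ a b → a ⊢ b :≤ a :+ b) (0≤# 4 · 0≤R)) C₂s′≤1)
            (≤-reflexive (trans (sym c₁w≈1) (*-comm _ _)))))
        0≤X : 0≤ X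
        0≤X = s≤s′ · 0≤-^ p 0≤s′
        ∣s∣≤ : ∣ s ∣ ≤ s′
        ∣s∣≤ = ≤-trans (≤-reflexive (0≤⇒∣x∣≈x 0≤s)) s≤s′
        ∣s′∣≤ : ∣ s′ ∣ ≤ s′
        ∣s′∣≤ = ≤-reflexive (0≤⇒∣x∣≈x 0≤s′)
        Δ main : K
        Δ = F s′ - F s
        main = a (suc p) * (s′ * s′ ^ p - s * s ^ p)

        upper : ∣ Δ ∣ ≤ C₁ * X
        upper = ≤-trans (∣∣-cong-≤ (trans (ring! (Δ ∷ a 0 ∷ s ∷ s′ ∷ []) λ d a s t → d := d :- ((a :+ t :* κ# 0) :- (a :+ s :* κ# 0)))
            (+-congˡ (-‿cong (+-cong (+-congˡ (*-congˡ (sym (ev-0 p s′ low)))) (-‿cong (+-congˡ (*-congˡ (sym (ev-0 p s low))))))))))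
          (≤-trans (germ-difference g p 4Rs′≤1 ∣s∣≤ ∣s′∣≤) (≤-reflexive (*-congˡ (*-congʳ (0≤⇒∣x∣≈x s≤s′)))))

        main≥ : ∣ a (suc p) ∣ * X ≤ ∣ main ∣
        main≥ = ≤-trans (*-monoˡ-≤ (0≤∣∣ _) (≤-trans
            (by (s ∷ s′ ∷ s ^ p ∷ s′ ^ p ∷ []) (λ s t a b → s :* (b :- a) ⊢ (t :- s) :* b :≤ t :* b :- s :* a) (0≤s · ^-mono-≤ p 0≤s s≤s′)) (x≤∣x∣ _)))
          (≤-reflexive (sym (∣*∣ _ _)))

        remainder : ∣ Δ - main ∣ ≤ W * (X * s′)
        remainder = ≤-trans (∣∣-cong-≤ (+-congˡ (-‿cong (trans (ring! (a 0 ∷ a (suc p) ∷ s ∷ s′ ∷ s ^ p ∷ s′ ^ p ∷ []) λ z a s t p q →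
              a :* (t :* q :- s :* p) := (z :+ t :* (q :* a)) :- (z :+ s :* (p :* a)))
            (+-cong (+-congˡ (*-congˡ (sym (ev-leading p (tail a) s′ low)))) (-‿cong (+-congˡ (*-congˡ (sym (ev-leading p (tail a) s low))))))))))
          (≤-trans (germ-difference g (suc p) 4Rs′≤1 ∣s∣≤ ∣s′∣≤) (≤-reflexive (*-congˡ (trans (*-congʳ (0≤⇒∣x∣≈x s≤s′))
            (ring! (s′ - s ∷ s′ ∷ s′ ^ p ∷ []) λ d s p → d :* (s :* p) := d :* p :* s)))))

        -- The leading term contributes at least 2 c₁ X, since s′^(p+1) - s^(p+1) ≥ (s′ - s) s′^p.
        -- The remainder is at most W s′ X, and the summand W/c₁ of C₂ makes this at most c₁ X.
        lower : c₁ * X ≤ ∣ Δ ∣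
        lower = by (c₁ ∷ X ∷ W ∷ s′ ∷ ∣ Δ ∣ ∷ ∣ main ∣ ∷ ∣ main - Δ ∣ ∷ []) (λ c X W s d m r →
            (m :- (c :+ c) :* X) :+ (d :+ r :- m) :+ (W :* (X :* s) :- r) :+ (c :- W :* s) :* X ⊢ c :* X :≤ d)
          (≤-trans (≤-reflexive (*-congʳ c₁+c₁)) main≥ ⊹ ≤∣∣+∣-∣ main Δ ⊹ ≤-trans (≤-reflexive (∣∣-flip main Δ)) remainder ⊹ Ws′≤c₁ · 0≤X)

    local-order-at : LocalOrder F
    local-order-at = record
      { p = p ; c₁ = c₁ ; C₁ = C₁ ; C₂ = C₂ ; 0<c₁ = 0<c₁
      ; 0≤C₁ = (0≤# 2 · 0≤# p ⊹ 0≤# 3) · (0≤A · 0≤-^ (suc p) 0≤R)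
      ; 0≤C₂ = 0≤# 4 · 0≤R ⊹ 0≤W · 0<⇒0≤ 0<w ; upper = upper ; lower = lower }

  local-order : ∀ {a F} → Germ a F → Independent 2 (coefficients 1 a) → LocalOrder F
  local-order (A , R , g) ind =
    case least (nonconstant ind) of λ { (p , ap≉0 , low) →
    case halve (≉0⇒0<∣∣ ap≉0) of λ { (c₁ , 0<c₁ , c₁+c₁) →
    case pos-inverse 0<c₁ of λ { (w , 0<w , c₁w≈1) →
      local-order-at g p ap≉0 (λ i i<p → ¬¬≈ (low i i<p)) c₁+c₁ 0<c₁ 0<w c₁w≈1 } } }

  -- One step from a centre to the next

  locate : ∀ r b N → r ℕ.^ 1 ℕ.≤ b → b ℕ.≤ r ℕ.^ suc (suc N) →
    ∃ λ κ → κ ℕ.< suc N × r ℕ.^ suc κ ℕ.≤ b × b ℕ.≤ r ℕ.^ suc (suc κ)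
  locate r b zero p q = 0 , s≤s z≤n , p , q
  locate r b (suc N) p q = [ (λ u → case locate r b N p u of λ { (κ , κ< , v , w) → κ , ℕₚ.m<n⇒m<1+n κ< , v , w })
                           , (λ u → suc N , ℕₚ.≤-refl , u , q) ]′ (ℕₚ.≤-total b (r ℕ.^ suc (suc N)))

  -- Dividing by b turns the exponent 98 into 99 for the distance to a/b; the step from 99 to 100
  -- makes the final inequality strict for b ≥ 2.
  FarFrom : K → ℕ → K → Set
  FarFrom μ b₀ y = ∀ a b → IsInt a → 1 ℕ.≤ b → b₀ ℕ.≤ b → # 1 + μ ≤ ∣ # b * y - a ∣ * # b ^ 98

  record Advance (c : K) (F : K → K) (b₀ N : ℕ) (ρ₀ : K) : Set where
    field
      s : K
      0<s : 0< s
      s≤ρ₀ : s ≤ ρ₀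
      T : ℕ
      nice : Nice T (F s)
      μ : K
      0<μ : 0< μ
      μ≤1 : μ ≤ # 1
      far : FarFrom μ b₀ (F s)
      num : K
      num-int : IsInt num
      den : ℕ
      N≤den : N ℕ.≤ den
      2≤den : 2 ℕ.≤ den
      above : num ≤ # den * (c + s)
      -- The factor 2 reserves half of the tolerance for the distance from this centre to the limit.
      near : # 2 * ((# den * (c + s) - num) * # den ^ suc N) ≤ # 1

  record Situation (c : K) (F : K → K) (b₀ N : ℕ) (ρ₀ : K) : Set where
    field
      lo : LocalOrder F
    open LocalOrder lo public
    field
      T₀ : ℕ
      nice₀ : Nice T₀ (F (# 0))
      μ : K
      0<μ : 0< μ
      μ≤1 : μ ≤ # 1
      far₀ : FarFrom μ b₀ (F (# 0))
      J B : ℕ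
      p<J : p ℕ.< J
      Cg : K
      0≤Cg : 0≤ Cg
      good : ∀ h s t → 1 ℕ.≤ t → 0< h → h * # t ≈ # 1 → Cg * h ≤ # 1 → h ≤ # 4 * s → s ≤ # 2 * h →
        ∃ λ k → k ℕ.≤ B × (∀ κ → κ ℕ.< suc N → ¬ Bad F (t ℕ.^ J) (suc κ) (s + # k * h ^ (J ℕ.* 6)))
      0<ρ₀ : 0< ρ₀

  -- m₂ is the new margin and ν the relative loss that small b may suffer: (1 - ν)(1 + μ) ≥ 1 + m₂.
  -- The integers N₁ and K₀ absorb the constants in T₁ and in the threshold t^(p+1) ≤ K₀ b². The
  -- other conditions say that h = 1/t is small compared with everything fixed before.
  record Scale {c : K} {F : K → K} {b₀ N : ℕ} {ρ₀ : K} (situation : Situation c F b₀ N ρ₀) : Set where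
    open Situation situation
    field
      m₂ ν : K
      0<m₂ : 0< m₂
      m₂+m₂≈μ : m₂ + m₂ ≈ μ
      0<ν : 0< ν
      ν-small : (# 1 + μ) * ν ≤ m₂
      N₁ K₀ : ℕ
      1≤N₁ : 1 ℕ.≤ N₁
      1≤K₀ : 1 ℕ.≤ K₀
      N₁c₁≥2 : # 2 ≤ # N₁ * c₁
      K₀-large : # 5 * # T₀ * (C₁ * # 2 ^ suc p) ≤ # K₀ * ν
      w ρ₀⁻¹ h : K
      c₁w≈1 : c₁ * w ≈ # 1
      ρ₀ρ₀⁻¹≈1 : ρ₀ * ρ₀⁻¹ ≈ # 1
      t : ℕ
      1≤t : 1 ℕ.≤ t
      0<h : 0< h
      ht≈1 : h * # t ≈ # 1
      Cg-h : Cg * h ≤ # 1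
      B-h : # 4 * (# B + # 2) * h ≤ # 1
      C₂-h : # 2 * C₂ * h ≤ # 1
      4w-h : # 4 ^ p * w * h ≤ # 1
      C₁-h : # 2 * C₁ * h ≤ # 1
      NK-h : # (20 ℕ.* N₁ ℕ.* K₀ ℕ.* K₀) * h ≤ # 1
      NKC-h : # 10 * # N₁ * # K₀ * (C₁ * (# B + # 2)) * h ≤ # 1
      N-h : # N * h ≤ # 1
      ρ-h : # 2 * ρ₀⁻¹ * h ≤ # 1
      10-h : # 10 * h ≤ # 1

  module StepAt {c : K} {F : K → K} {b₀ N : ℕ} {ρ₀ : K} (situation : Situation c F b₀ N ρ₀) (scale : Scale situation) where
    open Situation situation
    open Scale scale

    private
      0≤h : 0≤ h
      0≤h = 0<⇒0≤ 0<h
      h≤1 : h ≤ # 1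
      h≤1 = ≤-trans (by (h ∷ []) (λ h → κ# 9 :* h ⊢ h :≤ κ# 10 :* h) (0≤# 9 · 0≤h)) 10-h

      X≤t : ∀ {X} → X * h ≤ # 1 → X ≤ # t
      X≤t {X} q = *-cancelˡ-≤ 0<h (≤-trans (≤-reflexive (*-comm h X)) (≤-trans q (≤-reflexive (sym ht≈1))))

      r q₁ : ℕ
      r = t ℕ.^ J
      q₁ = r ℕ.^ 6
      ρ u η : K
      ρ = # t ^ J
      u = h ^ J
      η = h ^ (J ℕ.* 6)

      #r^ : ∀ m → # (r ℕ.^ m) ≈ ρ ^ m
      #r^ m = trans (#-^ r m) (^-congˡ m (#-^ t J))
      0≤ρ : 0≤ ρ
      0≤ρ = 0≤-^ J (0≤# t)
      0≤u : 0≤ u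
      0≤u = 0≤-^ J 0≤h
      0<u : 0< u
      0<u = 0<-^ J 0<h
      u≤1 : u ≤ # 1
      u≤1 = ^-≤1 J 0≤h h≤1
      1≤J : 1 ℕ.≤ J
      1≤J = ℕₚ.≤-trans (s≤s z≤n) p<J
      u≤h : u ≤ h
      u≤h = ^-≤-first 0≤h h≤1 1≤J
      uρ≈1 : u * ρ ≈ # 1
      uρ≈1 = trans (sym (^-* h (# t) J)) (trans (^-congˡ J ht≈1) (1^ J))
      0≤η : 0≤ η
      0≤η = 0≤-^ (J ℕ.* 6) 0≤h
      η≈u^6 : η ≈ u ^ 6
      η≈u^6 = sym (^-^ h J 6)
      open Reciprocal uρ≈1 0≤u u≤1 0≤ρ

      η≤hh : η ≤ h * h
      η≤hh = ≤-trans (≤-reflexive η≈u^6) (≤-trans (^-antiʳ-≤ {m = 2} {6} 0≤u u≤1 (s≤s (s≤s z≤n)))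
        (≤-trans (≤-reflexive (*-congˡ (*1≈ u))) (*-mono-≤ 0≤u 0≤h u≤h u≤h)))
      Bη≤ : # 4 * ((# B + # 2) * η) ≤ h
      Bη≤ = ≤-trans (*-monoˡ-≤ (0≤# 4) (*-monoˡ-≤ (0≤# B ⊹ 0≤# 2) η≤hh))
        (≤-trans (≤-reflexive (ring! (# B ∷ h ∷ []) λ B h → κ# 4 :* ((B :+ κ# 2) :* (h :* h)) := κ# 4 :* (B :+ κ# 2) :* h :* h))
          (≤-trans (*-monoʳ-≤ 0≤h B-h) (≤-reflexive (1*≈ h))))
      t≤r : t ℕ.≤ r
      t≤r = #-mono⁻¹ (≤-trans (≤-trans (≤-reflexive (sym (*1≈ (# t)))) (^-monoʳ-≤ {m = 1} (1≤# 1≤t) 1≤J)) (≤-reflexive (sym (#-^ t J))))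
      10≤t : 10 ℕ.≤ t
      10≤t = #-mono⁻¹ (X≤t 10-h)

      C₂≤ : ∀ {s} → 0≤ s → s ≤ # 2 * h → C₂ * s ≤ # 1
      C₂≤ {s} _ s≤2h = ≤-trans (*-monoˡ-≤ 0≤C₂ s≤2h) (≤-trans (≤-reflexive (ring! (C₂ ∷ h ∷ []) λ C h → C :* (κ# 2 :* h) := κ# 2 :* C :* h)) C₂-h)
      2h≤1 : # 2 * h ≤ # 1
      2h≤1 = ≤-trans (by (h ∷ []) (λ h → κ# 8 :* h ⊢ κ# 2 :* h :≤ κ# 10 :* h) (0≤# 8 · 0≤h)) 10-h

      lipschitz : ∀ a b → 0≤ a → b ≤ # 2 * h → Lipschitz F C₁ a b
      lipschitz = local-lipschitz lo 2h≤1 (≤-trans (≤-reflexive (ring! (C₂ ∷ h ∷ []) λ C h → C :* (κ# 2 :* h) := κ# 2 :* C :* h)) C₂-h)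

      h₂ : K
      h₂ = proj₁ (halve 0<h)
      0<h₂ : 0< h₂
      0<h₂ = proj₁ (proj₂ (halve 0<h))
      h₂+h₂ : h₂ + h₂ ≈ h
      h₂+h₂ = proj₂ (proj₂ (halve 0<h))
      h₂≤h : h₂ ≤ h
      h₂≤h = ≤-trans (by (h₂ ∷ []) (λ x → x ⊢ x :≤ x :+ x) (0<⇒0≤ 0<h₂)) (≤-reflexive h₂+h₂)
      h≤2h : h ≤ # 2 * h
      h≤2h = by (h ∷ []) (λ h → h ⊢ h :≤ κ# 2 :* h) 0≤h

      T₁ : ℕ
      T₁ = N₁ ℕ.* t ℕ.^ suc p
      #T₁ : # T₁ ≈ # N₁ * # t ^ suc p
      #T₁ = trans (#-* N₁ _) (*-congˡ (#-^ t (suc p)))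

      hᵖtᵖ : ∀ m → h ^ m * # t ^ m ≈ # 1
      hᵖtᵖ m = trans (sym (^-* h (# t) m)) (trans (^-congˡ m ht≈1) (1^ m))

      -- Over the right half of [0, h] the function varies by at least c₁ h^(p+1)/2, and N₁ c₁ ≥ 2
      -- compensates the constants. A net of mesh 1/T₁ therefore meets its range.
      gap₁ : # 1 ≤ # T₁ * ∣ F h - F h₂ ∣
      gap₁ = *-cancelˡ-≤ (0<# 1) (≤-trans (≤-reflexive (ring! [] (κ# 2 :* κ# 1 := κ# 2))) (≤-trans N₁c₁≥2 (≤-trans (≤-reflexive (sym (trans
          (trans (*-congˡ (*-cong #T₁ (*-congˡ (*-congʳ (trans (+-congʳ (sym h₂+h₂)) (ring! (h₂ ∷ []) λ x → x :+ x :- x := x))))))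
            (ring! (# N₁ ∷ # t ^ suc p ∷ c₁ ∷ h₂ ∷ h ^ p ∷ []) λ N t c x q → κ# 2 :* (N :* t :* (c :* (x :* q))) := N :* c :* ((x :+ x) :* q :* t)))
          (trans (*-congˡ (trans (*-congʳ (*-congʳ h₂+h₂)) (hᵖtᵖ (suc p)))) (*1≈ _)))))
        (*-monoˡ-≤ (0≤# 2) (*-monoˡ-≤ (0≤# T₁) (lower h₂ h (0<⇒0≤ 0<h₂) h₂≤h (C₂≤ 0≤h h≤2h)))))))

      1≤t^ : ∀ m → 1 ℕ.≤ t ℕ.^ m
      1≤t^ m = #-mono⁻¹ (≤-trans (1≤-^ m (1≤# 1≤t)) (≤-reflexive (sym (#-^ t m))))
      1≤r^ : ∀ m → 1 ℕ.≤ r ℕ.^ m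
      1≤r^ m = #-mono⁻¹ (≤-trans (1≤-^ m (≤-trans (1≤# (1≤t^ J)) (≤-reflexive (#-^ t J)))) (≤-reflexive (sym (#r^ m))))
      1≤T₁ : 1 ℕ.≤ T₁
      1≤T₁ = ℕₚ.*-mono-≤ 1≤N₁ (1≤t^ (suc p))

      e₂ : ℕ
      e₂ = suc (suc N)
      -- 92 lies between two demands. For b ≤ r^(N+2) it gives b⁹⁰ σ ≤ h, so moving by σ hardly
      -- affects the middle range. And with T₂ = r^(93(N+2)) it gives T₂ σ = r^(N+2), large enough
      -- for F to pass a value with denominator T₂ on an interval of length σ.
      σ : K
      σ = u ^ (e₂ ℕ.* 92)
      T₂ H₁ : ℕ
      H₁ = r ℕ.^ e₂
      T₂ = H₁ ℕ.^ 93
      #H₁ : # H₁ ≈ ρ ^ e₂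
      #H₁ = #r^ e₂
      #T₂ : # T₂ ≈ ρ ^ (e₂ ℕ.* 93)
      #T₂ = trans (#-^ H₁ 93) (trans (^-congˡ 93 #H₁) (^-^ ρ e₂ 93))
      0<σ : 0< σ
      0<σ = 0<-^ (e₂ ℕ.* 92) 0<u
      0≤σ : 0≤ σ
      0≤σ = 0<⇒0≤ 0<σ
      σ≤η : σ ≤ η
      σ≤η = ≤-trans (^-antiʳ-≤ {m = 6} 0≤u u≤1 (≤-via (178 ℕ.+ 92 ℕ.* N) (arith N))) (≤-reflexive (sym η≈u^6))
        where
        arith : ∀ N → 6 ℕ.+ (178 ℕ.+ 92 ℕ.* N) ≡ suc (suc N) ℕ.* 92
        arith = solve-∀

      module Chosen {s* z : K} (h₂≤s* : h₂ ≤ s*) (s*≤h : s* ≤ h) (nice* : Nice T₁ (F s*))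
        (z-int : IsInt z) (z≤ : z ≤ ρ ^ 6 * (c + s*)) (<z+1 : ρ ^ 6 * (c + s*) < z + # 1) where

        ηρ⁶ : η * ρ ^ 6 ≈ # 1
        ηρ⁶ = trans (*-congʳ η≈u^6) (powers 6)
        -- c + sᵤ is the fraction z/r⁶ just below c + s*; the sample points are therefore the
        -- fractions (z + k)/r⁶.
        sᵤ : K
        sᵤ = z * η - c
        sᵤ≤s* : sᵤ ≤ s*
        sᵤ≤s* = ≤-trans (by (z ∷ η ∷ ρ ^ 6 ∷ c ∷ s* ∷ []) (λ z e r c s → e :* (r :* (c :+ s) :- z) ⊢ z :* e :- c :≤ e :* r :* (c :+ s) :- c) (0≤η · z≤))
          (≤-reflexive (trans (+-congʳ (trans (*-congʳ ηρ⁶) (1*≈ _))) (ring! (c ∷ s* ∷ []) λ c s → c :+ s :- c := s)))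
        s*-η≤sᵤ : s* ≤ sᵤ + η
        s*-η≤sᵤ = ≤-trans (≤-reflexive (sym (trans (+-congʳ (trans (*-congʳ ηρ⁶) (1*≈ _))) (ring! (c ∷ s* ∷ []) λ c s → c :+ s :- c := s))))
          (by (z ∷ η ∷ ρ ^ 6 ∷ c ∷ s* ∷ []) (λ z e r c s → e :* (z :+ κ# 1 :- r :* (c :+ s)) ⊢ e :* r :* (c :+ s) :- c :≤ z :* e :- c :+ e) (0≤η · <⇒≤ <z+1))
        h≤4sᵤ : h ≤ # 4 * sᵤ
        h≤4sᵤ = ≤-trans (≤-reflexive (sym h₂+h₂)) (by (h₂ ∷ s* ∷ sᵤ ∷ η ∷ # B ∷ []) (λ x s v e B →
            κ# 4 :* (s :- x) :+ κ# 4 :* (v :+ e :- s) :+ ((x :+ x) :- κ# 4 :* ((B :+ κ# 2) :* e)) :+ κ# 4 :* ((B :+ κ# 1) :* e) ⊢ x :+ x :≤ κ# 4 :* v)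
          (0≤# 4 · h₂≤s* ⊹ 0≤# 4 · s*-η≤sᵤ ⊹ ≤-trans Bη≤ (≤-reflexive (sym h₂+h₂)) ⊹ 0≤# 4 · ((0≤# B ⊹ 0≤1) · 0≤η)))
        sᵤ≤2h : sᵤ ≤ # 2 * h
        sᵤ≤2h = ≤-trans (≤-trans sᵤ≤s* s*≤h) h≤2h
        0≤sᵤ : 0≤ sᵤ
        0≤sᵤ = 0≤-cancel (0<# 3) (≤⇒0≤ (≤-trans (0≤⇒≤ 0≤h) h≤4sᵤ))

        module Index (k : ℕ) (k≤B : k ℕ.≤ B) (good-k : ∀ κ → κ ℕ.< suc N → ¬ Bad F r (suc κ) (sᵤ + # k * η)) where
          sₖ : K
          sₖ = sᵤ + # k * η
          kη≤Bη : # k * η ≤ # B * η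
          kη≤Bη = *-monoʳ-≤ 0≤η (#-mono k≤B)
          0≤kη : 0≤ # k * η
          0≤kη = 0≤# k · 0≤η
          0≤sₖ : 0≤ sₖ
          0≤sₖ = 0≤sᵤ ⊹ 0≤kη
          sₖ≤sₖ+σ : sₖ ≤ sₖ + σ
          sₖ≤sₖ+σ = by (sₖ ∷ σ ∷ []) (λ s e → e ⊢ s :≤ s :+ e) 0≤σ
          end≤2h : sₖ + σ ≤ # 2 * h
          end≤2h = by (sᵤ ∷ s* ∷ # k * η ∷ # B ∷ η ∷ σ ∷ h ∷ []) (λ s s* k B e g h →
              (s* :- s) :+ (h :- s*) :+ (B :* e :- k) :+ (e :- g) :+ (h :- κ# 4 :* ((B :+ κ# 2) :* e)) :+ (κ# 3 :* B :+ κ# 7) :* e ⊢ s :+ k :+ g :≤ κ# 2 :* h)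
            (sᵤ≤s* ⊹ s*≤h ⊹ kη≤Bη ⊹ σ≤η ⊹ Bη≤ ⊹ (0≤# 3 · 0≤# B ⊹ 0≤# 7) · 0≤η)
          h≤4end : h ≤ # 4 * (sₖ + σ)
          h≤4end = ≤-trans h≤4sᵤ (by (sᵤ ∷ # k * η ∷ σ ∷ []) (λ s k g → κ# 4 :* k :+ κ# 4 :* g ⊢ κ# 4 :* s :≤ κ# 4 :* (s :+ k :+ g)) (0≤# 4 · 0≤kη ⊹ 0≤# 4 · 0≤σ))

          -- Near sₖ the slope of F is at least c₁ (h/4)^p. The product T₂ σ = r^(N+2) is at least
          -- t^(p+1), as p < J; p factors t compensate h^p, and the last one pays for 4^p and c₁.
          gap₂ : # 1 ≤ # T₂ * ∣ F (sₖ + σ) - F sₖ ∣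
          gap₂ = ≤-trans (*-cancelˡ-≤ (0<-^ p (0<# 3)) scaled)
              (*-monoˡ-≤ (0≤# T₂) (≤-trans (≤-reflexive (*-congˡ (*-congʳ (ring! (sₖ ∷ σ ∷ []) λ s g → g := s :+ g :- s))))
                (lower sₖ (sₖ + σ) 0≤sₖ sₖ≤sₖ+σ (C₂≤ (0≤sₖ ⊹ 0≤σ) end≤2h))))
            where
            X : K
            X = (sₖ + σ) ^ p
            T₂σ : # T₂ * σ ≈ ρ ^ e₂
            T₂σ = trans (*-congʳ (trans #T₂ (trans (^-≈ ρ (arith N)) (^-+ ρ e₂ (e₂ ℕ.* 92)))))
              (trans (*-assoc _ _ _) (trans (*-congˡ (trans (*-comm _ _) (powers (e₂ ℕ.* 92)))) (*1≈ _)))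
              where
              arith : ∀ N → suc (suc N) ℕ.* 93 ≡ suc (suc N) ℕ.+ suc (suc N) ℕ.* 92
              arith = solve-∀
            1≤ρ : # 1 ≤ ρ
            1≤ρ = 1≤-^ J (1≤# 1≤t)
            t^≤ρ : # t ^ suc p ≤ ρ ^ e₂
            t^≤ρ = ≤-trans (^-monoʳ-≤ (1≤# 1≤t) p<J) (≤-trans (≤-reflexive (sym (*1≈ ρ))) (^-monoʳ-≤ {m = 1} {e₂} 1≤ρ (s≤s z≤n)))
            h^≤ : h ^ p ≤ # 4 ^ p * X
            h^≤ = ≤-trans (^-mono-≤ p 0≤h h≤4end) (≤-reflexive (^-* (# 4) _ p))
            c₁t≥ : # 4 ^ p ≤ c₁ * # t
            c₁t≥ = *-cancelˡ-≤ 0<h (≤-trans (≤-trans (≤-reflexive (trans (sym (*1≈ _)) (trans (*-congˡ (sym c₁w≈1))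
                (ring! (h ∷ # 4 ^ p ∷ c₁ ∷ w ∷ []) λ h f c w → h :* f :* (c :* w) := c :* (f :* w :* h)))))
              (*-monoˡ-≤ (0<⇒0≤ 0<c₁) 4w-h)) (≤-reflexive (trans (*-congˡ (sym ht≈1)) (ring! (c₁ ∷ h ∷ # t ∷ []) λ c h t → c :* (h :* t) := h :* (c :* t)))))
            scaled : # 4 ^ p * # 1 ≤ # 4 ^ p * (# T₂ * (c₁ * (σ * X)))
            scaled = ≤-trans (≤-reflexive (*1≈ _)) (≤-trans c₁t≥ (≤-trans (≤-reflexive (trans (sym (*1≈ _)) (trans (*-congˡ (sym (hᵖtᵖ p)))
                (ring! (c₁ ∷ # t ∷ h ^ p ∷ # t ^ p ∷ []) λ c t x y → c :* t :* (x :* y) := c :* (x :* (t :* y))))))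
              (≤-trans (*-monoˡ-≤ (0<⇒0≤ 0<c₁) (*-mono-≤ (0≤-^ (suc p) (0≤# t)) (0≤-^ p (0≤# 4) · 0≤-^ p (0≤sₖ ⊹ 0≤σ)) h^≤ t^≤ρ))
                (≤-reflexive (trans (*-congˡ (*-congˡ (sym T₂σ)))
                  (ring! (c₁ ∷ # 4 ^ p ∷ X ∷ # T₂ ∷ σ ∷ []) λ c f x T g → c :* (f :* x :* (T :* g)) := f :* (T :* (c :* (g :* x)))))))))

          module Final {s : K} (sₖ≤s : sₖ ≤ s) (s≤end : s ≤ sₖ + σ) (nice₂ : Nice T₂ (F s)) where
            0<s : 0< s
            0<s = 0<-≤ (0≤∧≉0⇒0< 0≤sᵤ λ eq → 0<⇒≉0 0<h (≤-antisym (≤-trans h≤4sᵤ (≤-reflexive (trans (*-congˡ eq) (*0≈ _)))) (0≤⇒≤ 0≤h)))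
              (≤-trans (by (sᵤ ∷ # k * η ∷ []) (λ s k → k ⊢ s :≤ s :+ k) 0≤kη) sₖ≤s)
            0≤s : 0≤ s
            0≤s = 0<⇒0≤ 0<s
            s≤2h : s ≤ # 2 * h
            s≤2h = ≤-trans s≤end end≤2h
            s≤ρ₀ : s ≤ ρ₀
            s≤ρ₀ = ≤-trans s≤2h (≤-trans (≤-reflexive (trans (sym (*1≈ _)) (trans (*-congˡ (sym ρ₀ρ₀⁻¹≈1)) (ring! (h ∷ ρ₀ ∷ ρ₀⁻¹ ∷ []) λ h r i → κ# 2 :* h :* (r :* i) := r :* (κ# 2 :* i :* h)))))
              (≤-trans (*-monoˡ-≤ (0<⇒0≤ 0<ρ₀) ρ-h) (≤-reflexive (*1≈ _))))

            near-s* : ∣ F s* - F s ∣ ≤ C₁ * ((# B + # 2) * η)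
            near-s* = ≤-trans (lipschitz (# 0) (# 2 * h) 0≤0 ≤-refl s* s (≤-trans (0≤⇒≤ (0<⇒0≤ 0<h₂)) h₂≤s*) (≤-trans s*≤h h≤2h) (0≤⇒≤ 0≤s) s≤2h)
              (*-monoˡ-≤ 0≤C₁ (∣∣-≤
                (by (s* ∷ s ∷ sᵤ ∷ # k * η ∷ η ∷ # B ∷ []) (λ s* s v k e B → (v :+ e :- s*) :+ k :+ (s :- (v :+ k)) :+ (B :+ κ# 1) :* e ⊢ s* :- s :≤ (B :+ κ# 2) :* e)
                  (s*-η≤sᵤ ⊹ 0≤kη ⊹ sₖ≤s ⊹ (0≤# B ⊹ 0≤1) · 0≤η))
                (by (s* ∷ s ∷ sᵤ ∷ # k * η ∷ η ∷ # B ∷ σ ∷ []) (λ s* s v k e B g → (s* :- v) :+ (v :+ k :+ g :- s) :+ (e :- g) :+ (B :* e :- k) :+ e ⊢ :- (s* :- s) :≤ (B :+ κ# 2) :* e)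
                  (sᵤ≤s* ⊹ s≤end ⊹ σ≤η ⊹ kη≤Bη ⊹ 0≤η))))
            near-sₖ : ∣ F sₖ - F s ∣ ≤ C₁ * σ
            near-sₖ = ≤-trans (lipschitz (# 0) (# 2 * h) 0≤0 ≤-refl sₖ s (0≤⇒≤ 0≤sₖ) (≤-trans sₖ≤s s≤2h) (0≤⇒≤ 0≤s) s≤2h)
              (*-monoˡ-≤ 0≤C₁ (∣∣-≤ (by (sₖ ∷ s ∷ σ ∷ []) (λ a s g → (s :- a) :+ g ⊢ a :- s :≤ g) (sₖ≤s ⊹ 0≤σ))
                (by (sₖ ∷ s ∷ σ ∷ []) (λ a s g → a :+ g :- s ⊢ :- (a :- s) :≤ g) s≤end)))
            near-0 : ∣ F (# 0) - F s ∣ ≤ C₁ * (# 2 ^ suc p * h ^ suc p)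
            near-0 = ≤-trans (≤-reflexive (∣∣-flip _ _)) (≤-trans (upper (# 0) s 0≤0 (0≤⇒≤ 0≤s) (C₂≤ 0≤s s≤2h))
              (*-monoˡ-≤ 0≤C₁ (≤-trans (*-mono-≤ (0≤-^ p 0≤s) (0≤# 2 · 0≤h) (≤-trans (≤-reflexive (ring! (s ∷ []) λ s → s :- κ# 0 := s)) s≤2h) (^-mono-≤ p 0≤s s≤2h))
                (≤-reflexive (^-* (# 2) h (suc p))))))

            perturb : ∀ {y e} b a → ∣ y - F s ∣ ≤ e → ∣ # b * y - a ∣ ≤ ∣ # b * F s - a ∣ + # b * e
            perturb {y} {e} b a q = ≤-trans (∣∣-cong-≤ (ring! (# b ∷ y ∷ F s ∷ a ∷ []) λ b y f a → b :* y :- a := (b :* f :- a) :+ b :* (y :- f)))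
              (∣+∣-≤ ≤-refl (≤-trans (≤-reflexive (trans (∣*∣ _ _) (*-congʳ (∣#∣ b)))) (*-monoˡ-≤ (0≤# b) q)))

            module Denominator (a : K) (b : ℕ) (a-int : IsInt a) (1≤b : 1 ℕ.≤ b) (b₀≤b : b₀ ℕ.≤ b) where
              X : K
              X = ∣ # b * F s - a ∣
              0≤X : 0≤ X
              0≤X = 0≤∣∣ (# b * F s - a)
              β : K
              β = # b
              0≤β : 0≤ β
              0≤β = 0≤# b
              1≤β : # 1 ≤ β
              1≤β = 1≤# 1≤b
              0≤β^ : ∀ m → 0≤ β ^ m
              0≤β^ m = 0≤-^ m 0≤β
              β≤β^ : ∀ m → β ≤ β ^ suc m
              β≤β^ m = ≤-trans (≤-reflexive (sym (*1≈ β))) (^-monoʳ-≤ {m = 1} {suc m} 1≤β (s≤s z≤n))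

              Large : Set
              Large = # 2 ≤ X * β ^ 98

              -- T₂ is at most b⁹³, so niceness at s leaves |b F(s) - a| ≥ 1/(5 b⁹⁴), and the
              -- remaining b⁴ is at least 10.
              huge : H₁ ℕ.≤ b → 10 ℕ.≤ b → Large
              huge H₁≤b 10≤b = *-cancelˡ-≤ (0<# 4) (≤-trans (≤-trans (≤-reflexive (ring! [] (κ# 5 :* κ# 2 := κ# 1 :* κ# 10)))
                  (*-mono-≤ (0≤# 10) (0≤# 5 · 0≤β^ 93 · 0≤β · 0≤X)
                    (≤-trans (nice₂ a b a-int 1≤b) (*-monoʳ-≤ 0≤X (*-monoʳ-≤ 0≤β (*-monoˡ-≤ (0≤# 5) (≤-trans (≤-reflexive (#-^ H₁ 93)) (^-mono-≤ 93 (0≤# H₁) (#-mono H₁≤b)))))))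
                    (≤-trans (#-mono 10≤b) (β≤β^ 3))))
                (≤-reflexive (trans (ring! (β ^ 93 ∷ β ∷ X ∷ []) λ p b x → κ# 5 :* p :* b :* x :* b :^ 4 := κ# 5 :* (x :* (p :* b :^ 5))) (*-congˡ (*-congˡ (sym (^-+ β 93 5)))))))

              -- As sₖ is not bad, the bound with exponent 89 holds there. Moving from sₖ to s costs
              -- at most half of it, because b⁹⁰ σ ≤ h, and the factor b⁹ more than restores the
              -- loss.
              medium : ∀ κ → κ ℕ.< suc N → r ℕ.^ suc κ ℕ.≤ b → b ℕ.≤ r ℕ.^ suc (suc κ) → b ℕ.≤ H₁ → 10 ℕ.≤ b → Large
              medium κ κ< lower-b upper-b b≤H₁ 10≤b = ≤-trans (by (Z ∷ β ^ 9 ∷ []) (λ z p → z :* (p :- κ# 10) :+ κ# 5 :* (κ# 2 :* z :- κ# 1) :+ κ# 3 ⊢ κ# 2 :≤ z :* p)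
                  ((0≤X · 0≤β^ 89) · ≤-trans (#-mono 10≤b) (β≤β^ 8) ⊹ 0≤# 5 · 2Z≥1 ⊹ 0≤# 3))
                (≤-reflexive (trans (*-assoc _ _ _) (*-congˡ (sym (^-+ β 89 9)))))
                where
                Z Xₖ : K
                Z = X * β ^ 89
                Xₖ = ∣ β * F sₖ - a ∣
                not-bad : # 1 ≤ Xₖ * β ^ 89
                not-bad = <-or-≤-elim {Xₖ * β ^ 89} {# 1} (λ q → ⊥-elim (good-k κ κ< record
                  { num = a ; den = b ; num-int = a-int ; r^≤den = lower-b ; den≤r^ = upper-b ; close = q })) <⇒≤
                β⁹⁰σ≤h : β ^ 90 * σ ≤ h
                β⁹⁰σ≤h = ≤-trans (*-monoʳ-≤ 0≤σ (≤-trans (^-mono-≤ 90 0≤β (≤-trans (#-mono b≤H₁) (≤-reflexive #H₁))) (≤-reflexive (^-^ ρ e₂ 90))))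
                  (≤-trans (cancel (e₂ ℕ.* 90) 1 (≤-via (3 ℕ.+ 2 ℕ.* N) (arith N))) (≤-trans (≤-reflexive (*1≈ u)) u≤h))
                  where
                  arith : ∀ N → (suc (suc N) ℕ.* 90 ℕ.+ 1) ℕ.+ (3 ℕ.+ 2 ℕ.* N) ≡ suc (suc N) ℕ.* 92
                  arith = solve-∀
                2Z≥1 : # 1 ≤ # 2 * Z
                2Z≥1 = by (X ∷ Xₖ ∷ β ∷ β ^ 89 ∷ C₁ ∷ σ ∷ h ∷ []) (λ X Y b p C g h →
                    κ# 2 :* ((X :+ b :* (C :* g) :- Y) :* p) :+ κ# 2 :* (Y :* p :- κ# 1) :+ κ# 2 :* C :* (h :- b :* p :* g) :+ (κ# 1 :- κ# 2 :* C :* h) ⊢ κ# 1 :≤ κ# 2 :* (X :* p))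
                  (0≤# 2 · (perturb b a near-sₖ · 0≤β^ 89) ⊹ 0≤# 2 · not-bad ⊹ 0≤# 2 · 0≤C₁ · β⁹⁰σ≤h ⊹ C₁-h)

              tᵖ : K
              tᵖ = # t ^ suc p

              -- Here t^(p+1) ≤ K₀ b² bounds T₁ by a constant times b², so niceness at s* gives |b
              -- F(s*) - a| of order at least b⁻³. The distance from s* to s changes this by a
              -- multiple of b r⁻⁶, which is negligible since b⁴ r⁻⁶ ≤ 1/r.
              middling : b ℕ.≤ r → t ℕ.^ suc p ℕ.≤ K₀ ℕ.* (b ℕ.* b) → Large
              middling b≤r tᵖ≤ = ≤-trans (by (X ∷ β ∷ # N₁ ∷ # K₀ ∷ []) (λ X b N K →
                  (b :* b :- κ# 20 :* N :* K) :* (b :* b :* b :* X) :+ κ# 2 :* (κ# 10 :* N :* K :* (b :* b :* b) :* X :- κ# 1) ⊢ κ# 2 :≤ X :* b :^ 5)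
                  (β²≥ · (0≤β · 0≤β · 0≤β · 0≤X) ⊹ 0≤# 2 · key)) (*-monoˡ-≤ 0≤X (^-monoʳ-≤ {m = 5} {98} 1≤β (ℕₚ.m≤m+n 5 93)))
                where
                0≤N₁ = 0≤# N₁
                0≤K₀ = 0≤# K₀
                tᵖ≤K : tᵖ ≤ # K₀ * (β * β)
                tᵖ≤K = ≤-trans (≤-reflexive (sym (#-^ t (suc p)))) (≤-trans (#-mono tᵖ≤) (≤-reflexive (trans (#-* K₀ _) (*-congˡ (#-* b b)))))
                β²≥ : # 20 * # N₁ * # K₀ ≤ β * β
                β²≥ = *-cancelˡ-≤ (1≤⇒0< (1≤# 1≤K₀)) (≤-trans (≤-reflexive (sym (trans
                    (trans (#-* (20 ℕ.* N₁ ℕ.* K₀) K₀) (*-congʳ (trans (#-* (20 ℕ.* N₁) K₀) (*-congʳ (#-* 20 N₁))))) (*-comm _ _))))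
                  (≤-trans (X≤t NK-h) (≤-trans (≤-trans (≤-reflexive (sym (*1≈ _))) (^-monoʳ-≤ {m = 1} {suc p} (1≤# 1≤t) (s≤s z≤n))) tᵖ≤K)))
                β⁴η≤h : β ^ 4 * η ≤ h
                β⁴η≤h = ≤-trans (*-mono-≤ 0≤η (0≤-^ 4 0≤ρ) (^-mono-≤ 4 0≤β (≤-trans (#-mono b≤r) (≤-reflexive (#-^ t J)))) (≤-reflexive η≈u^6))
                  (≤-trans (cancel 4 1 {6} (ℕₚ.m≤m+n 5 1)) (≤-trans (≤-reflexive (*1≈ u)) u≤h))
                first : # 1 ≤ # 5 * (# N₁ * (# K₀ * (β * β))) * β * (X + β * (C₁ * ((# B + # 2) * η)))
                first = ≤-trans (nice* a b a-int 1≤b) (*-mono-≤ (0≤∣∣ _) (0≤# 5 · (0≤N₁ · (0≤K₀ · (0≤β · 0≤β))) · 0≤β)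
                  (*-monoʳ-≤ 0≤β (*-monoˡ-≤ (0≤# 5) (≤-trans (≤-reflexive #T₁) (*-monoˡ-≤ 0≤N₁ tᵖ≤K)))) (perturb b a near-s*))
                key : # 1 ≤ # 10 * # N₁ * # K₀ * (β * β * β) * X
                key = by (X ∷ β ∷ # N₁ ∷ # K₀ ∷ C₁ ∷ # B ∷ η ∷ h ∷ []) (λ X b N K C B e h →
                    κ# 2 :* (κ# 5 :* (N :* (K :* (b :* b))) :* b :* (X :+ b :* (C :* ((B :+ κ# 2) :* e))) :- κ# 1)
                      :+ κ# 10 :* N :* K :* (C :* (B :+ κ# 2)) :* (h :- b :^ 4 :* e) :+ (κ# 1 :- κ# 10 :* N :* K :* (C :* (B :+ κ# 2)) :* h)
                      ⊢ κ# 1 :≤ κ# 10 :* N :* K :* (b :* b :* b) :* X)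
                  (0≤# 2 · first ⊹ 0≤# 10 · 0≤N₁ · 0≤K₀ · (0≤C₁ · (0≤# B ⊹ 0≤# 2)) · β⁴η≤h ⊹ NKC-h)

              -- The perturbation is small relative to |b F(0) - a|, not just absolutely: niceness
              -- at the old centre bounds that quantity below by 1/(5 T₀ b), while F(s) - F(0) is of
              -- order h^(p+1) and K₀ b² h^(p+1) ≤ 1. So the old bound loses only the factor 1 - ν.
              tiny : K₀ ℕ.* (b ℕ.* b) ℕ.≤ t ℕ.^ suc p → # 1 + m₂ ≤ X * β ^ 98
              tiny ≤tᵖ = by (X ∷ X₀ ∷ q ∷ ν ∷ μ ∷ m₂ ∷ β ^ 98 ∷ []) (λ X Y q n m k P →
                  (X :+ q :- Y) :* P :+ (n :* Y :- q) :* P :+ (κ# 1 :- n) :* (Y :* P :- (κ# 1 :+ m)) :+ (m :- (k :+ k)) :+ (k :- (κ# 1 :+ m) :* n) ⊢ κ# 1 :+ k :≤ X :* P)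
                (perturb′ · 0≤β^ 98 ⊹ q≤νX₀ · 0≤β^ 98 ⊹ ν≤1 · far₀ a b a-int 1≤b b₀≤b ⊹ ≤-reflexive m₂+m₂≈μ ⊹ ν-small)
                where
                X₀ q : K
                X₀ = ∣ β * F (# 0) - a ∣
                q = β * (C₁ * (# 2 ^ suc p * h ^ suc p))
                perturb′ : X₀ ≤ X + q
                perturb′ = perturb b a near-0
                0≤μ : 0≤ μ
                0≤μ = 0≤-resp m₂+m₂≈μ (0<⇒0≤ 0<m₂ ⊹ 0<⇒0≤ 0<m₂)
                ν≤1 : ν ≤ # 1
                ν≤1 = by (ν ∷ μ ∷ m₂ ∷ []) (λ n m k → (k :- (κ# 1 :+ m) :* n) :+ (κ# 1 :- m) :+ (m :- (k :+ k)) :+ n :* m :+ k ⊢ n :≤ κ# 1)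
                  (ν-small ⊹ μ≤1 ⊹ ≤-reflexive m₂+m₂≈μ ⊹ 0<⇒0≤ 0<ν · 0≤μ ⊹ 0<⇒0≤ 0<m₂)
                hᵖ : K
                hᵖ = h ^ suc p
                0≤hᵖ : 0≤ hᵖ
                0≤hᵖ = 0≤-^ (suc p) 0≤h
                0≤q : 0≤ q
                0≤q = 0≤β · (0≤C₁ · (0≤-^ (suc p) (0≤# 2) · 0≤hᵖ))
                K₀β²hᵖ≤1 : # K₀ * (β * β) * hᵖ ≤ # 1
                K₀β²hᵖ≤1 = ≤-trans (*-monoʳ-≤ 0≤hᵖ (≤-trans (≤-reflexive (sym (trans (#-* K₀ _) (*-congˡ (#-* b b))))) (≤-trans (#-mono ≤tᵖ) (≤-reflexive (#-^ t (suc p))))))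
                  (≤-reflexive (trans (*-comm _ _) (hᵖtᵖ (suc p))))
                q≤νX₀ : q ≤ ν * X₀
                q≤νX₀ = by (q ∷ ν ∷ X₀ ∷ # 5 * # T₀ ∷ β ∷ C₁ ∷ # 2 ^ suc p ∷ hᵖ ∷ # K₀ ∷ []) (λ q n Y T b C P H K →
                    b :* (C :* (P :* H)) :* (T :* b :* Y :- κ# 1) :+ (K :* n :- T :* (C :* P)) :* (b :* b :* H :* Y) :+ n :* Y :* (κ# 1 :- K :* (b :* b) :* H) :+ (b :* (C :* (P :* H)) :- q) ⊢ q :≤ n :* Y)
                  (0≤q · nice₀ a b a-int 1≤b ⊹ K₀-large · (0≤β · 0≤β · 0≤hᵖ · 0≤∣∣ _) ⊹ 0<⇒0≤ 0<ν · 0≤∣∣ _ · K₀β²hᵖ≤1 ⊹ ≤-refl)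

              1+m₂≤2 : # 1 + m₂ ≤ # 2
              1+m₂≤2 = by (m₂ ∷ μ ∷ []) (λ k m → (κ# 1 :- m) :+ (m :- (k :+ k)) :+ k ⊢ κ# 1 :+ k :≤ κ# 2) (μ≤1 ⊹ ≤-reflexive m₂+m₂≈μ ⊹ 0<⇒0≤ 0<m₂)

              far-at : # 1 + m₂ ≤ X * β ^ 98
              far-at = by-size (ℕₚ.<-≤-connex b r) (ℕₚ.≤-total b H₁) (ℕₚ.≤-total (K₀ ℕ.* (b ℕ.* b)) (t ℕ.^ suc p))
                where
                by-size : b ℕ.< r ⊎ r ℕ.≤ b → b ℕ.≤ H₁ ⊎ H₁ ℕ.≤ b → K₀ ℕ.* (b ℕ.* b) ℕ.≤ t ℕ.^ suc p ⊎ t ℕ.^ suc p ℕ.≤ K₀ ℕ.* (b ℕ.* b) →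
                  # 1 + m₂ ≤ X * β ^ 98
                by-size (inj₁ b<r) _ (inj₁ q) = tiny q
                by-size (inj₁ b<r) _ (inj₂ q) = ≤-trans 1+m₂≤2 (middling (ℕₚ.<⇒≤ b<r) q)
                by-size (inj₂ r≤b) (inj₂ q) _ = ≤-trans 1+m₂≤2 (huge q (ℕₚ.≤-trans 10≤t (ℕₚ.≤-trans t≤r r≤b)))
                by-size (inj₂ r≤b) (inj₁ q) _ = case locate r b N (≡.subst (ℕ._≤ b) (≡.sym (ℕₚ.^-identityʳ r)) r≤b) q of λ { (κ , κ< , u , v) →
                  ≤-trans 1+m₂≤2 (medium κ κ< u v q (ℕₚ.≤-trans 10≤t (ℕₚ.≤-trans t≤r r≤b))) }

            #q₁ : # q₁ ≈ ρ ^ 6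
            #q₁ = #r^ 6
            numerator-gap : # q₁ * (c + s) - (z + # k) ≈ ρ ^ 6 * (s - sₖ)
            numerator-gap = trans (+-congʳ (*-congʳ #q₁)) (trans (ring! (ρ ^ 6 ∷ c ∷ s ∷ z ∷ # k ∷ η ∷ []) λ v c s z k e →
                v :* (c :+ s) :- (z :+ k) := v :* (s :- (z :* e :- c :+ k :* e)) :+ (e :* v :- κ# 1) :* (z :+ k))
              (trans (+-congˡ (trans (*-congʳ (trans (+-congʳ ηρ⁶) (ring! [] (κ# 1 :- κ# 1 := κ# 0)))) (trans (*-comm _ _) (*0≈ _)))) (+0≈ _)))

            t≤q₁ : t ℕ.≤ q₁
            t≤q₁ = ℕₚ.≤-trans t≤r (#-mono⁻¹ (≤-trans (≤-trans (≤-reflexive (sym (*1≈ _))) (^-monoʳ-≤ {m = 1} {6} (≤-trans (1≤# 1≤t) (#-mono t≤r)) (s≤s z≤n))) (≤-reflexive (sym (#-^ r 6)))))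

            advance : Advance c F b₀ N ρ₀
            advance = record
              { s = s ; 0<s = 0<s ; s≤ρ₀ = s≤ρ₀ ; T = T₂ ; nice = nice₂ ; μ = m₂ ; 0<μ = 0<m₂
              ; μ≤1 = by (m₂ ∷ μ ∷ []) (λ k m → (κ# 1 :- m) :+ (m :- (k :+ k)) :+ k ⊢ k :≤ κ# 1) (μ≤1 ⊹ ≤-reflexive m₂+m₂≈μ ⊹ 0<⇒0≤ 0<m₂)
              ; far = λ a b i p q → Denominator.far-at a b i p q
              ; num = z + # k ; num-int = int-+ z-int (int-# k) ; den = q₁
              ; N≤den = ℕₚ.≤-trans (#-mono⁻¹ (X≤t N-h)) t≤q₁
              ; 2≤den = ℕₚ.≤-trans (ℕₚ.m≤m+n 2 8) (ℕₚ.≤-trans 10≤t t≤q₁)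
              ; above = 0≤-resp (sym numerator-gap) (0≤-^ 6 0≤ρ · sₖ≤s)
              ; near = ≤-trans (*-monoˡ-≤ (0≤# 2) (≤-trans (≤-reflexive (*-cong numerator-gap (trans (^-congˡ (suc N) #q₁) (^-^ ρ 6 (suc N)))))
                  (≤-trans (*-monoʳ-≤ (0≤-^ (6 ℕ.* suc N) 0≤ρ) (*-monoˡ-≤ (0≤-^ 6 0≤ρ) (by (s ∷ sₖ ∷ σ ∷ []) (λ s a g → a :+ g :- s ⊢ s :- a :≤ g) s≤end)))
                    (≤-trans (≤-reflexive (trans (ring! (ρ ^ 6 ∷ σ ∷ ρ ^ (6 ℕ.* suc N) ∷ []) λ a g b → a :* g :* b := a :* b :* g) (*-congʳ (sym (^-+ ρ 6 (6 ℕ.* suc N))))))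
                      (≤-trans (cancel (6 ℕ.+ 6 ℕ.* suc N) 1 (≤-via (171 ℕ.+ 86 ℕ.* N) (arith N))) (≤-trans (≤-reflexive (*1≈ u)) u≤h))))))
                  2h≤1 }
              where
              arith : ∀ N → (6 ℕ.+ 6 ℕ.* suc N ℕ.+ 1) ℕ.+ (171 ℕ.+ 86 ℕ.* N) ≡ suc (suc N) ℕ.* 92
              arith = solve-∀

          advance : Advance c F b₀ N ρ₀
          advance = case nice-value F T₂ 1≤T₂ sₖ≤sₖ+σ 0≤C₁ (lipschitz sₖ (sₖ + σ) 0≤sₖ end≤2h) gap₂ of λ { (s , sₖ≤s , s≤end , nice₂) →
              Final.advance sₖ≤s s≤end nice₂ }
            where
            1≤T₂ : 1 ℕ.≤ T₂
            1≤T₂ = #-mono⁻¹ (≤-trans (1≤-^ 93 (1≤# (1≤r^ e₂))) (≤-reflexive (sym (#-^ H₁ 93))))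

        advance : Advance c F b₀ N ρ₀
        advance = case good h sᵤ t 1≤t 0<h ht≈1 Cg-h h≤4sᵤ sᵤ≤2h of λ { (k , k≤B , good-k) → Index.advance k k≤B good-k }

    step : Advance c F b₀ N ρ₀
    step =
      case nice-value F T₁ 1≤T₁ h₂≤h 0≤C₁ (lipschitz h₂ h (0<⇒0≤ 0<h₂) h≤2h) gap₁ of λ { (s* , h₂≤s* , s*≤h , nice*) →
      case floor (ρ ^ 6 * (c + s*)) of λ { (z , z-int , z≤ , <z+1) →
        Chosen.advance h₂≤s* s*≤h nice* z-int z≤ <z+1 } }

  -- The sequence of centres and its limit

  total : List K → K
  total []ˡ = # 0
  total (X ∷ˡ Xs) = X + total Xs

  0≤total : ∀ {Xs} → All 0≤_ Xs → 0≤ total Xs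
  0≤total []ᵃ = 0≤0
  0≤total (p ∷ᵃ ps) = p ⊹ 0≤total ps

  each≤total : ∀ {Xs} → All 0≤_ Xs → All (_≤ total Xs) Xs
  each≤total []ᵃ = []ᵃ
  each≤total {X ∷ˡ Xs} (p ∷ᵃ ps) = by (X ∷ total Xs ∷ []) (λ x t → t ⊢ x :≤ x :+ t) (0≤total ps)
    ∷ᵃ weaken (each≤total ps)
    where
    weaken : ∀ {Ys} → All (_≤ total Xs) Ys → All (_≤ X + total Xs) Ys
    weaken []ᵃ = []ᵃ
    weaken (q ∷ᵃ qs) = ≤-trans q (by (X ∷ total Xs ∷ []) (λ x t → x ⊢ t :≤ x :+ t) p) ∷ᵃ weaken qs

  -- An integer t above the sum of all the constants meets every condition at once.
  reciprocal : ∀ {Xs} → All 0≤_ Xs → ∃₂ λ t h → 1 ℕ.≤ t × 0< h × h * # t ≈ # 1 × All (λ X → X * h ≤ # 1) Xs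
  reciprocal {Xs} ps =
    case upper-bound (total Xs) of λ { (t , 1≤t , q) →
    case pos-inverse (1≤⇒0< (1≤# 1≤t)) of λ { (h , 0<h , th≈1) →
      t , h , 1≤t , 0<h , trans (*-comm _ _) th≈1 , scale q 0<h th≈1 (each≤total ps) } }
    where
    scale : ∀ {t h Ys} → total Xs ≤ # t → 0< h → # t * h ≈ # 1 → All (_≤ total Xs) Ys → All (λ X → X * h ≤ # 1) Ys
    scale q 0<h th []ᵃ = []ᵃ
    scale q 0<h th (r ∷ᵃ rs) = ≤-trans (*-monoʳ-≤ (0<⇒0≤ 0<h) (≤-trans r q)) (≤-reflexive th) ∷ᵃ scale q 0<h th rs

  far-cong : ∀ {μ b₀ y y′} → y ≈ y′ → FarFrom μ b₀ y → FarFrom μ b₀ y′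
  far-cong eq far a b i p q = ≤-trans (far a b i p q) (≤-reflexive (*-congʳ (∣∣-cong (+-congʳ (*-congˡ eq)))))

  module Core (U : K → Set) (f : K → K)
    (f-cong : ∀ {x y} → x ≈ y → f x ≈ f y)
    (U-cong : ∀ {x y} → x ≈ y → U x → U y)
    (U-convex : ∀ {x y z} → U x → U y → x ≤ z → z ≤ y → U z)
    (U-open : ∀ {x} → U x → ∃ λ ρ → 0< ρ × (∀ s → ∣ s ∣ ≤ ρ → U (x + s)))
    (germ : ∀ {c} → U c → ∃ λ a → Germ a (λ s → f (c + s)))
    (¬rational : ¬ Continuation.RationalOn U f f-cong U-cong U-convex U-open germ)
    where
    open Continuation U f f-cong U-cong U-convex U-open germ using (independent)

    module _ {c : K} (Uc : U c) {a : ℕ → K} (ga : Germ a (λ s → f (c + s))) where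
      ind : ∀ E D → Independent (E ℕ.+ D) (coefficients E a)
      ind = independent ¬rational Uc ga

      local : LocalOrder (λ s → f (c + s))
      local = local-order ga (ind 1 1)

    module Advancing {c : K} {F : K → K} {b₀ N : ℕ} {ρ₀ : K} (situation : Situation c F b₀ N ρ₀) where
      open Situation situation

      advance : Advance c F b₀ N ρ₀
      advance =
        case halve 0<μ of λ { (m₂ , 0<m₂ , m₂+m₂≈μ) →
        case small (0≤1 ⊹ 0<⇒0≤ 0<μ) 0<m₂ of λ { (ν , 0<ν , ν-small) →
        case reach 0<c₁ (# 2) of λ { (N₁ , 1≤N₁ , N₁c₁≥2) →
        case reach 0<ν (# 5 * # T₀ * (C₁ * # 2 ^ suc p)) of λ { (K₀ , 1≤K₀ , K₀-large) →
        case pos-inverse 0<c₁ of λ { (w , 0<w , c₁w≈1) →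
        case pos-inverse 0<ρ₀ of λ { (ρ₀⁻¹ , 0<ρ₀⁻¹ , ρρ≈1) →
        case reciprocal {Cg ∷ˡ # 4 * (# B + # 2) ∷ˡ # 2 * C₂ ∷ˡ # 4 ^ p * w ∷ˡ # 2 * C₁ ∷ˡ # (20 ℕ.* N₁ ℕ.* K₀ ℕ.* K₀) ∷ˡ
            # 10 * # N₁ * # K₀ * (C₁ * (# B + # 2)) ∷ˡ # N ∷ˡ # 2 * ρ₀⁻¹ ∷ˡ # 10 ∷ˡ []ˡ}
            (0≤Cg ∷ᵃ 0≤# 4 · (0≤# B ⊹ 0≤# 2) ∷ᵃ 0≤# 2 · 0≤C₂ ∷ᵃ 0≤-^ p (0≤# 4) · 0<⇒0≤ 0<w ∷ᵃ 0≤# 2 · 0≤C₁ ∷ᵃ 0≤# _ ∷ᵃ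
              0≤# 10 · 0≤# N₁ · 0≤# K₀ · (0≤C₁ · (0≤# B ⊹ 0≤# 2)) ∷ᵃ 0≤# N ∷ᵃ 0≤# 2 · 0<⇒0≤ 0<ρ₀⁻¹ ∷ᵃ 0≤# 10 ∷ᵃ []ᵃ)
        of λ { (t , h , 1≤t , 0<h , ht≈1 , x₁ ∷ᵃ x₂ ∷ᵃ x₃ ∷ᵃ x₄ ∷ᵃ x₅ ∷ᵃ x₆ ∷ᵃ x₇ ∷ᵃ x₈ ∷ᵃ x₉ ∷ᵃ x₁₀ ∷ᵃ []ᵃ) →
          StepAt.step situation record
            { m₂ = m₂ ; ν = ν ; 0<m₂ = 0<m₂ ; m₂+m₂≈μ = m₂+m₂≈μ ; 0<ν = 0<ν ; ν-small = ν-small ; N₁ = N₁ ; K₀ = K₀ ; 1≤N₁ = 1≤N₁ ; 1≤K₀ = 1≤K₀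
            ; N₁c₁≥2 = N₁c₁≥2 ; K₀-large = K₀-large ; w = w ; ρ₀⁻¹ = ρ₀⁻¹ ; h = h ; c₁w≈1 = c₁w≈1 ; ρ₀ρ₀⁻¹≈1 = ρρ≈1 ; t = t ; 1≤t = 1≤t ; 0<h = 0<h ; ht≈1 = ht≈1
            ; Cg-h = x₁ ; B-h = x₂ ; C₂-h = x₃ ; 4w-h = x₄ ; C₁-h = x₅ ; NK-h = x₆ ; NKC-h = x₇ ; N-h = x₈ ; ρ-h = x₉ ; 10-h = x₁₀ } } } } } } } }

    -- T may grow and μ shrink from stage to stage, but b₀ is a parameter: the threshold for
    -- denominators is fixed by the first stage and survives in the limit.
    record Stage (b₀ : ℕ) : Set where
      field
        c ρ : K
        0<ρ : 0< ρ
        Uc : U c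
        Uc+ρ : U (c + ρ)
        T : ℕ
        nice : Nice T (f c)
        μ : K
        0<μ : 0< μ
        μ≤1 : μ ≤ # 1
        far : FarFrom μ b₀ (f c)

    open Stage

    record Link {b₀ : ℕ} (N : ℕ) (S S′ : Stage b₀) : Set where
      field
        -- Strictness puts the limit above every later centre, hence above every fraction num/den,
        -- so the approximations of the limit are never exact.
        increase : c S < c S′
        nested : c S′ + ρ S′ ≤ c S + ρ S
        halved : # 2 * ρ S′ ≤ ρ S
        num : K
        num-int : IsInt num
        den : ℕ
        N≤den : N ℕ.≤ den
        2≤den : 2 ℕ.≤ den
        above : num ≤ # den * c S′
        near : # 2 * ((# den * c S′ - num) * # den ^ suc N) ≤ # 1
        ρ-small : # 2 * (# den * ρ S′ * # den ^ suc N) ≤ # 1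

    next : ∀ {b₀} N (S : Stage b₀) → Σ (Stage b₀) (Link N S)
    next {b₀} N S =
      case germ (Uc S) of λ { (a , ga) →
      case good-sample ga (ind (Uc S) ga) (suc N) of λ { (J₀ , gs) →
      -- The sum satisfies both demands on J: J₀ ≤ J for the good samples and p < J for the
      -- comparison of r with t^(p+1).
      case gs (J₀ ℕ.+ suc (LocalOrder.p (local (Uc S) ga))) (ℕₚ.m≤m+n J₀ _) of λ { (B , Cg , 0≤Cg , good) →
      case halve (0<ρ S) of λ { (ρ₂ , 0<ρ₂ , ρ₂+ρ₂≈ρ) →
        move ρ₂ 0<ρ₂ ρ₂+ρ₂≈ρ (Advancing.advance record
          { lo = local (Uc S) ga ; T₀ = T S ; nice₀ = nice-cong f-c+0 (nice S) ; μ = μ S ; 0<μ = 0<μ S ; μ≤1 = μ≤1 S ; far₀ = far-cong f-c+0 (far S)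
          ; J = J₀ ℕ.+ suc (LocalOrder.p (local (Uc S) ga)) ; B = B ; p<J = ℕₚ.m≤n+m _ J₀ ; Cg = Cg ; 0≤Cg = 0≤Cg ; good = good ; 0<ρ₀ = 0<ρ₂ }) } } } }
      where
      f-c+0 : f (c S) ≈ f (c S + # 0)
      f-c+0 = f-cong (sym (+0≈ (c S)))
      module _ (ρ₂ : K) (0<ρ₂ : 0< ρ₂) (ρ₂+ρ₂≈ρ : ρ₂ + ρ₂ ≈ ρ S) (adv : Advance (c S) (λ s → f (c S + s)) b₀ N ρ₂) where
        private module A = Advance adv
        finish : (∃ λ η → 0< η × # 2 * (# A.den * # A.den ^ suc N) * η ≤ # 1) → Σ (Stage b₀) (Link N S)
        finish (η , 0<η , η-small) = case min-pos 0<ρ₂ 0<η of λ { (ρ′ , 0<ρ′ , ρ′≤ρ₂ , ρ′≤η) →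
            let bound = ≤-trans (by (c S ∷ A.s ∷ ρ′ ∷ ρ₂ ∷ []) (λ c s r q → (q :- s) :+ (q :- r) ⊢ c :+ s :+ r :≤ c :+ (q :+ q)) (A.s≤ρ₀ ⊹ ρ′≤ρ₂)) (≤-reflexive (+-congˡ ρ₂+ρ₂≈ρ)) in
            record { c = c S + A.s ; ρ = ρ′ ; 0<ρ = 0<ρ′
                   ; Uc = U-convex (Uc S) (Uc+ρ S) c≤ (≤-trans (by (c S + A.s ∷ ρ′ ∷ []) (λ c r → r ⊢ c :≤ c :+ r) (0<⇒0≤ 0<ρ′)) bound)
                   ; Uc+ρ = U-convex (Uc S) (Uc+ρ S) (≤-trans c≤ (by (c S + A.s ∷ ρ′ ∷ []) (λ c r → r ⊢ c :≤ c :+ r) (0<⇒0≤ 0<ρ′))) bound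
                   ; T = A.T ; nice = A.nice ; μ = A.μ ; 0<μ = A.0<μ ; μ≤1 = A.μ≤1 ; far = A.far }
          , record { increase = by< (c S ∷ A.s ∷ []) (λ c s → s ⊢ c :≤ c :+ s) A.0<s
                   ; nested = bound
                   ; halved = ≤-trans (by (ρ′ ∷ ρ₂ ∷ []) (λ r q → (q :- r) :+ (q :- r) ⊢ κ# 2 :* r :≤ q :+ q) (ρ′≤ρ₂ ⊹ ρ′≤ρ₂)) (≤-reflexive ρ₂+ρ₂≈ρ)
                   ; num = A.num ; num-int = A.num-int ; den = A.den ; N≤den = A.N≤den ; 2≤den = A.2≤den
                   ; above = A.above ; near = A.near
                   ; ρ-small = ≤-trans (≤-reflexive (ring! (# A.den ∷ ρ′ ∷ # A.den ^ suc N ∷ []) λ d r D → κ# 2 :* (d :* r :* D) := κ# 2 :* (d :* D) :* r))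
                       (≤-trans (*-monoˡ-≤ 0≤D ρ′≤η) η-small) } }
          where
          0≤D : 0≤ # 2 * (# A.den * # A.den ^ suc N)
          0≤D = 0≤# 2 · (0≤# A.den · 0≤-^ (suc N) (0≤# A.den))
          c≤ : c S ≤ c S + A.s
          c≤ = by (c S ∷ A.s ∷ []) (λ c s → s ⊢ c :≤ c :+ s) (0<⇒0≤ A.0<s)
        move : Σ (Stage b₀) (Link N S)
        move = finish (small (0≤# 2 · (0≤# A.den · 0≤-^ (suc N) (0≤# A.den))) 0<1)

    initial : ∀ {c ρ} → U c → 0< ρ → U (c + ρ) → ∃ λ b₀ → Σ (Stage b₀) λ S → c ≤ Stage.c S × Stage.c S + Stage.ρ S ≤ c + ρ
    initial {c} {ρ} Uc 0<ρ Uc+ρ = case germ Uc of λ { (a , ga) → start (local Uc ga) }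
      where
      F : K → K
      F s = f (c + s)
      start : LocalOrder F → ∃ λ b₀ → Σ (Stage b₀) λ S → c ≤ Stage.c S × Stage.c S + Stage.ρ S ≤ c + ρ
      start lo =
        case halve 0<ρ of λ { (ρ₂ , 0<ρ₂ , ρ₂+ρ₂≈ρ) →
        case small 0≤C₂ 0<1 of λ { (h₁ , 0<h₁ , C₂h₁≤1) →
        case min-pos 0<h₁ 0<1 of λ { (h₂ , 0<h₂ , h₂≤h₁ , h₂≤1) →
        case min-pos 0<h₂ 0<ρ₂ of λ { (h , 0<h , h≤h₂ , h≤ρ₂) →
        case halve 0<h of λ { (g , 0<g , g+g≈h) →
          inner ρ₂ 0<ρ₂ ρ₂+ρ₂≈ρ h 0<h (≤-trans h≤h₂ h₂≤1) (≤-trans (*-monoˡ-≤ 0≤C₂ (≤-trans h≤h₂ h₂≤h₁)) C₂h₁≤1) h≤ρ₂ g 0<g g+g≈h } } } } }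
        where
        open LocalOrder lo
        module _ (ρ₂ : K) (0<ρ₂ : 0< ρ₂) (ρ₂+ρ₂≈ρ : ρ₂ + ρ₂ ≈ ρ) (h : K) (0<h : 0< h) (h≤1 : h ≤ # 1) (C₂h≤1 : C₂ * h ≤ # 1) (h≤ρ₂ : h ≤ ρ₂)
          (g : K) (0<g : 0< g) (g+g≈h : g + g ≈ h) where
          g≤h : g ≤ h
          g≤h = ≤-trans (by (g ∷ []) (λ g → g ⊢ g :≤ g :+ g) (0<⇒0≤ 0<g)) (≤-reflexive g+g≈h)
          gap : 0< ∣ F h - F g ∣
          gap = 0<-≤ (0<c₁ <· (0<-resp (trans (ring! (g ∷ []) λ g → g := g :+ g :- g) (+-congʳ g+g≈h)) 0<g <· 0<-^ p 0<h))
            (lower g h (0<⇒0≤ 0<g) g≤h C₂h≤1)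
          inner : ∃ λ b₀ → Σ (Stage b₀) λ S → c ≤ Stage.c S × Stage.c S + Stage.ρ S ≤ c + ρ
          inner = case reach gap (# 1) of λ { (T , 1≤T , T-gap) →
            case nice-value F T 1≤T g≤h 0≤C₁ (local-lipschitz lo h≤1 C₂h≤1 g h (0<⇒0≤ 0<g) ≤-refl) T-gap of λ { (s , g≤s , s≤h , nice) →
              10 ℕ.* T , stage T s g≤s s≤h nice , c≤ s g≤s , bound s s≤h } }
            where
            c≤ : ∀ s → g ≤ s → c ≤ c + s
            c≤ s g≤s = by (c ∷ s ∷ []) (λ c s → s ⊢ c :≤ c :+ s) (≤⇒0≤ (≤-trans (0≤⇒≤ (0<⇒0≤ 0<g)) g≤s))
            bound : ∀ s → s ≤ h → c + s + ρ₂ ≤ c + ρ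
            bound s s≤h = ≤-trans (by (c ∷ s ∷ h ∷ ρ₂ ∷ []) (λ c s h r → (h :- s) :+ (r :- h) ⊢ c :+ s :+ r :≤ c :+ (r :+ r)) (s≤h ⊹ h≤ρ₂)) (≤-reflexive (+-congˡ ρ₂+ρ₂≈ρ))
            up : ∀ s → c + s ≤ c + s + ρ₂
            up s = by (c ∷ s ∷ ρ₂ ∷ []) (λ c s r → r ⊢ c :+ s :≤ c :+ s :+ r) (0<⇒0≤ 0<ρ₂)
            stage : ∀ T s → g ≤ s → s ≤ h → Nice T (F s) → Stage (10 ℕ.* T)
            stage T s g≤s s≤h nice = record
              { c = c + s ; ρ = ρ₂ ; 0<ρ = 0<ρ₂
              ; Uc = U-convex Uc Uc+ρ (c≤ s g≤s) (≤-trans (up s) (bound s s≤h))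
              ; Uc+ρ = U-convex Uc Uc+ρ (≤-trans (c≤ s g≤s) (up s)) (bound s s≤h)
              ; T = T ; nice = nice ; μ = # 1 ; 0<μ = 0<1 ; μ≤1 = ≤-refl
              -- The initial margin is μ = 1. From 5 T b |b F(s) - a| ≥ 1 and b ≥ 10 T the product
              -- of |b F(s) - a| with b² is at least 2, and b² ≤ b⁹⁸.
              ; far = λ a b i 1≤b 10T≤b → ≤-trans
                  (by (# b ∷ # T ∷ ∣ # b * F s - a ∣ ∷ []) (λ b T x → κ# 2 :* (κ# 5 :* T :* b :* x :- κ# 1) :+ (b :- κ# 10 :* T) :* (b :* x) ⊢ κ# 1 :+ κ# 1 :≤ x :* b :^ 2)
                    (0≤# 2 · nice a b i 1≤b ⊹ ≤-trans (≤-reflexive (sym (#-* 10 T))) (#-mono 10T≤b) · (0≤# b · 0≤∣∣ _)))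
                  (*-monoˡ-≤ (0≤∣∣ _) (^-monoʳ-≤ {m = 2} {98} (1≤# 1≤b) (ℕₚ.m≤m+n 2 96))) }

    module Iterate {b₀ : ℕ} (next : ∀ N (S : Stage b₀) → Σ (Stage b₀) (Link N S)) (S₀ : Stage b₀) where
      stages : ℕ → Stage b₀
      stages zero = S₀
      stages (suc n) = proj₁ (next n (stages n))

      links : ∀ n → Link n (stages n) (stages (suc n))
      links n = proj₂ (next n (stages n))

    module Sequence {b₀ : ℕ} where
      module _ (S : ℕ → Stage b₀) (link : ∀ n → Link n (S n) (S (suc n))) where
        width : ∀ n → # 2 ^ n * ρ (S n) ≤ ρ (S 0)
        width zero = ≤-reflexive (1*≈ _)
        width (suc n) = ≤-trans (≤-reflexive (ring! (# 2 ^ n ∷ ρ (S (suc n)) ∷ []) λ t r → κ# 2 :* t :* r := t :* (κ# 2 :* r)))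
          (≤-trans (*-monoˡ-≤ (0≤-^ n (0≤# 2)) (Link.halved (link n))) (width n))

        c+ρ-c : ∀ n → c (S n) + ρ (S n) - c (S n) ≈ ρ (S n)
        c+ρ-c n = ring! (c (S n) ∷ ρ (S n) ∷ []) λ c r → c :+ r :- c := r

        limit : ∃ λ ξ → ∀ n → c (S n) ≤ ξ × ξ ≤ c (S n) + ρ (S n)
        limit = complete (λ n → c (S n)) (λ n → c (S n) + ρ (S n)) (λ n → <⇒≤ (Link.increase (link n))) (λ n → Link.nested (link n))
          (λ n → by (c (S n) ∷ ρ (S n) ∷ []) (λ c r → r ⊢ c :≤ c :+ r) (0<⇒0≤ (0<ρ (S n))))
          (λ n → ≤-trans (≤-reflexive (*-cong (trans (sym (#≈fromℕ (2 ℕ.^ n))) (#-^ 2 n)) (c+ρ-c n))) (≤-trans (width n) (≤-reflexive (sym (c+ρ-c 0)))))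

        module _ (ξ : K) (inside : ∀ n → c (S n) ≤ ξ × ξ ≤ c (S n) + ρ (S n)) where

          approximations : ∀ N → ∃₂ λ num den → IsInt num × N ℕ.≤ den × 2 ℕ.≤ den × num < # den * ξ × (# den * ξ - num) * # den ^ suc N ≤ # 1
          approximations N = L.num , L.den , L.num-int , L.N≤den , L.2≤den
            , ≤-<-trans L.above (by< (# L.den ∷ c (S (suc N)) ∷ ξ ∷ []) (λ d c x → d :* (x :- c) ⊢ d :* c :≤ d :* x)
                (1≤⇒0< (1≤# (ℕₚ.≤-trans (s≤s z≤n) L.2≤den)) <· <-≤-trans (Link.increase (link (suc N))) (proj₁ (inside (suc (suc N))))))
            , *-cancelˡ-≤ (0<# 1) (by (# L.den ∷ c (S (suc N)) ∷ ρ (S (suc N)) ∷ ξ ∷ L.num ∷ # L.den ^ suc N ∷ []) (λ d c r x n D →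
                  (κ# 1 :- κ# 2 :* ((d :* c :- n) :* D)) :+ (κ# 1 :- κ# 2 :* (d :* r :* D)) :+ κ# 2 :* (d :* (c :+ r :- x) :* D) ⊢ κ# 2 :* ((d :* x :- n) :* D) :≤ κ# 2 :* κ# 1)
                (L.near ⊹ L.ρ-small ⊹ 0≤# 2 · (0≤# L.den · proj₂ (inside (suc N)) · 0≤-^ (suc N) (0≤# L.den))))
            where
            module L = Link (link N)

          -- For fixed a and b the bound passes to the limit, because f is Lipschitz near ξ. Each
          -- stage gives more than 1, and the vanishing margins leave exactly 1.
          far-limit : ∀ a b → IsInt a → 1 ℕ.≤ b → b₀ ℕ.≤ b → # 1 ≤ ∣ # b * f ξ - a ∣ * # b ^ 98
          far-limit a b i 1≤b b₀≤b = case germ Uξ of λ { (e , A , R , g) → ε-≤ λ ε 0<ε → bound A R g ε 0<ε }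
            where
            Uξ : U ξ
            Uξ = U-convex (Uc (S 0)) (Uc+ρ (S 0)) (proj₁ (inside 0)) (proj₂ (inside 0))
            X : K
            X = ∣ # b * f ξ - a ∣
            module _ {e : ℕ → K} (A R : K) (g : GermWith A R e (λ s → f (ξ + s))) (ε : K) (0<ε : 0< ε) where
              C D : K
              C = (# 2 * # 0 + # 3) * (A * R ^ 1)
              D = # b * C * # b ^ 98
              0≤C : 0≤ C
              0≤C = (0≤# 2 · 0≤0 ⊹ 0≤# 3) · (GermWith.0≤A g · 0≤-^ 1 (GermWith.0≤R g))
              module _ (n : ℕ) (4Rρ≤1 : # 4 * R * ρ (S n) ≤ # 1) where
                s : K
                s = c (S n) - ξ
                ∣s∣≤ : ∣ s ∣ ≤ ρ (S n)
                ∣s∣≤ = ∣∣-≤ (by (c (S n) ∷ ξ ∷ ρ (S n) ∷ []) (λ c x r → (x :- c) :+ r ⊢ c :- x :≤ r) (proj₁ (inside n) ⊹ 0<⇒0≤ (0<ρ (S n))))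
                  (by (c (S n) ∷ ξ ∷ ρ (S n) ∷ []) (λ c x r → c :+ r :- x ⊢ :- (c :- x) :≤ r) (proj₂ (inside n)))
                close : ∣ f (c (S n)) - f ξ ∣ ≤ C * ρ (S n)
                close = ≤-trans (∣∣-cong-≤ (trans (+-cong (f-cong (ring! (c (S n) ∷ ξ ∷ []) λ c x → c := x :+ (c :- x))) (-‿cong (f-cong (sym (+0≈ ξ)))))
                    (ring! (f (ξ + s) ∷ f (ξ + # 0) ∷ e 0 ∷ s ∷ []) λ p q e s → p :- q := (p :- q) :- ((e :+ s :* κ# 0) :- (e :+ κ# 0 :* κ# 0)))))
                  (≤-trans (germ-difference g 0 {ρ (S n)} {# 0} {s} (≤-trans (≤-reflexive (sym (*-assoc _ _ _))) 4Rρ≤1)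
                      (≤-trans (≤-reflexive (∣#∣ 0)) (0≤⇒≤ (0<⇒0≤ (0<ρ (S n))))) ∣s∣≤)
                    (*-monoˡ-≤ 0≤C (≤-trans (≤-reflexive (*1≈ _)) (≤-trans (∣∣-cong-≤ (ring! (s ∷ []) λ s → s :- κ# 0 := s)) ∣s∣≤))))
                at-stage : # 1 ≤ X * # b ^ 98 + D * ρ (S n)
                at-stage = by (∣ # b * f (c (S n)) - a ∣ ∷ X ∷ # b ∷ # b ^ 98 ∷ C ∷ ρ (S n) ∷ μ (S n) ∷ []) (λ Y X b P C r m →
                    (Y :* P :- (κ# 1 :+ m)) :+ (X :+ b :* (C :* r) :- Y) :* P :+ m ⊢ κ# 1 :≤ X :* P :+ b :* C :* P :* r)
                  (far (S n) a b i 1≤b b₀≤b ⊹ perturb · 0≤-^ 98 (0≤# b) ⊹ 0<⇒0≤ (0<μ (S n)))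
                  where
                  perturb : ∣ # b * f (c (S n)) - a ∣ ≤ X + # b * (C * ρ (S n))
                  perturb = ≤-trans (∣∣-cong-≤ (ring! (# b ∷ f (c (S n)) ∷ f ξ ∷ a ∷ []) λ b y f a → b :* y :- a := (b :* f :- a) :+ b :* (y :- f)))
                    (∣+∣-≤ ≤-refl (≤-trans (≤-reflexive (trans (∣*∣ _ _) (*-congʳ (∣#∣ b)))) (*-monoˡ-≤ (0≤# b) close)))
              bound : # 1 ≤ X * # b ^ 98 + ε
              bound =
                case small (0≤# b · 0≤C · 0≤-^ 98 (0≤# b)) 0<ε of λ { (η₁ , 0<η₁ , Dη₁≤ε) →
                case small (0≤# 4 · GermWith.0≤R g) 0<1 of λ { (η₂ , 0<η₂ , 4Rη₂≤1) →
                case min-pos 0<η₁ 0<η₂ of λ { (η , 0<η , η≤η₁ , η≤η₂) →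
                case reach 0<η (ρ (S 0)) of λ { (n , _ , q) →
                  let ρ≤η = *-cancelˡ-≤ (0<-^ n (0<# 1)) (≤-trans (width n) (≤-trans q (*-monoʳ-≤ (0<⇒0≤ 0<η) (≤-trans (#-mono (n≤2^n n)) (≤-reflexive (#-^ 2 n)))))) in
                  ≤-trans (at-stage n (≤-trans (*-monoˡ-≤ (0≤# 4 · GermWith.0≤R g) (≤-trans ρ≤η η≤η₂)) 4Rη₂≤1))
                    (+-monoˡ-≤ (≤-trans (*-monoˡ-≤ (0≤# b · 0≤C · 0≤-^ 98 (0≤# b)) (≤-trans ρ≤η η≤η₁)) Dη₁≤ε)) } } } }

    record Solution (c ρ : K) : Set where
      field
        ξ : K
        c≤ξ : c ≤ ξ
        ξ≤c+ρ : ξ ≤ c + ρ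
        liouville : ∀ N → ∃₂ λ num den → IsInt num × N ℕ.≤ den × 2 ℕ.≤ den × num < # den * ξ × (# den * ξ - num) * # den ^ suc N ≤ # 1
        b₀ : ℕ
        far-from : ∀ a b → IsInt a → 1 ℕ.≤ b → b₀ ℕ.≤ b → # 1 ≤ ∣ # b * f ξ - a ∣ * # b ^ 98

    solution : ∀ {c ρ} → U c → 0< ρ → U (c + ρ) → Solution c ρ
    solution {c₀} {ρ₀} Uc 0<ρ Uc+ρ = case initial Uc 0<ρ Uc+ρ of λ { (b₀ , S₀ , c≤ , ≤c+ρ) → iterate next S₀ c≤ ≤c+ρ }
      where
      assemble : ∀ {b₀} (S : ℕ → Stage b₀) → c₀ ≤ c (S 0) → c (S 0) + ρ (S 0) ≤ c₀ + ρ₀ → (∀ n → Link n (S n) (S (suc n))) → Solution c₀ ρ₀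
      assemble {b₀} S c≤ ≤c+ρ link = case Sequence.limit S link of λ { (ξ , inside) → record
        { ξ = ξ ; c≤ξ = ≤-trans c≤ (proj₁ (inside 0)) ; ξ≤c+ρ = ≤-trans (proj₂ (inside 0)) ≤c+ρ
        ; liouville = Sequence.approximations S link ξ inside ; b₀ = b₀ ; far-from = Sequence.far-limit S link ξ inside } }
      iterate : ∀ {b₀} → (∀ N (S : Stage b₀) → Σ (Stage b₀) (Link N S)) → (S₀ : Stage b₀) → c₀ ≤ c S₀ → c S₀ + ρ S₀ ≤ c₀ + ρ₀ → Solution c₀ ρ₀
      iterate next S₀ c≤ ≤c+ρ = assemble (Iterate.stages next S₀) c≤ ≤c+ρ (Iterate.links next S₀)

  -- Estimates for quotients, suprema and rational powers

  0<-cancel : ∀ {c x} → 0< c → 0< c * x → 0< x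
  0<-cancel {c} 0<c p = 0≤∧≉0⇒0< (0≤-cancel 0<c (0<⇒0≤ p)) λ eq → 0<⇒≉0 p (trans (*-congˡ eq) (*0≈ c))

  -- The hypothesis bounds ξ - x by den^(-N-2). The two spare powers of den, at least 4 together,
  -- make the inequality with exponent N strict.
  quotient-close : ∀ {ξ num x z} den N → 2 ℕ.≤ den → # den * x ≈ num → num < # den * ξ →
    (# den * ξ - num) * # den ^ suc N ≤ # 1 → z * # den ^ N ≈ # 1 → x < ξ × ξ - x < z
  quotient-close {ξ} {num} {x} {z} den N 2≤den qx≈num num< near zP≈1 = x<ξ
    , 0<-cancel 0<P (0<-cancel (0<# 3) (0<-resp (trans (ring! (D ∷ []) λ D → κ# 3 :+ (κ# 1 :- κ# 4 :* D) := κ# 4 :* (κ# 1 :- D))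
        (*-congˡ (trans (+-congʳ (sym zP≈1)) (ring! (z ∷ ξ - x ∷ P ∷ []) λ z d P → z :* P :- d :* P := P :* (z :- d)))))
      (0<# 2 <⊹ by (q ∷ D ∷ []) (λ q D → (κ# 1 :- q :* q :* D) :+ (q :- κ# 2) :* (q :+ κ# 2) :* D ⊢ κ# 4 :* D :≤ κ# 1)
        (≤-trans (≤-reflexive (trans (ring! (q ∷ ξ - x ∷ P ∷ []) λ q d P → q :* q :* (d :* P) := q :* d :* (q :* P)) (*-congʳ (sym e≈)))) near
          ⊹ 2≤q · (0≤# den ⊹ 0≤# 2) · (0<⇒0≤ x<ξ · 0<⇒0≤ 0<P)))))
    where
    q P D : K
    q = # den
    P = q ^ N
    D = (ξ - x) * P
    2≤q : # 2 ≤ q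
    2≤q = #-mono 2≤den
    0<q : 0< q
    0<q = 0<-≤ (0<# 1) 2≤q
    0<P : 0< P
    0<P = 0<-^ N 0<q
    e≈ : q * ξ - num ≈ q * (ξ - x)
    e≈ = trans (+-congˡ (-‿cong (sym qx≈num))) (ring! (q ∷ ξ ∷ x ∷ []) λ q a b → q :* a :- q :* b := q :* (a :- b))
    x<ξ : x < ξ
    x<ξ = 0<-cancel 0<q (0<-resp e≈ num<)

  quotient-far : ∀ {y x a z} b → 2 ℕ.≤ b → # b * x ≈ a → # 1 ≤ ∣ # b * y - a ∣ * # b ^ 98 → z * # b ^ 100 ≈ # 1 → z < ∣ y - x ∣
  quotient-far {y} {x} {a} {z} b 2≤b bx≈a far zP≈1 = 0<-cancel (0<-^ 100 0<b) (0<-resp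
      (trans (+-congˡ (-‿cong (sym zP≈1))) (ring! (β ∷ ∣ y - x ∣ ∷ β ^ 98 ∷ z ∷ []) λ b d p z → b :* (b :* d :* p) :- z :* (b :* (b :* p)) := b :* (b :* p) :* (d :- z)))
      (<-≤-trans (by< (β ∷ []) (λ b → κ# 1 :+ (b :- κ# 2) ⊢ κ# 1 :≤ b) (0<1 <⊹ 2≤β))
        (≤-trans (≤-reflexive (sym (*1≈ β))) (*-monoˡ-≤ (0≤# b) (≤-trans far (≤-reflexive (*-congʳ (trans (∣∣-cong (trans (+-congˡ (-‿cong (sym bx≈a)))
          (ring! (β ∷ y ∷ x ∷ []) λ b y x → b :* y :- b :* x := b :* (y :- x)))) (trans (∣*∣ _ _) (*-congʳ (∣#∣ b)))))))))))
    where
    β : K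
    β = # b
    2≤β : # 2 ≤ β
    2≤β = #-mono 2≤b
    0<b : 0< β
    0<b = 0<-≤ (0<# 1) 2≤β

  -- Bisection on the property of lying below some element of P, between one element and just above
  -- one upper bound.
  supremum : ∀ {P : K → Set} {p b} → P p → (∀ x → P x → x ≤ b) → ∃ λ s → (∀ x → P x → x ≤ s) × (∀ u → (∀ x → P x → x ≤ u) → s ≤ u)
  supremum {P} {p} {b} Pp bounded =
    case bisect {Below} {p} {b + # 1} (≤-trans (bounded p Pp) (by (b ∷ []) (λ b → κ# 1 ⊢ b :≤ b :+ κ# 1) 0≤1)) (p , Pp , ≤-refl) not-below of λ { (s , _ , _ , cut) →
      s , (λ x Px → ε-≤ λ ε 0<ε → case cut ε 0<ε of λ { (c , lo≤s , s≤hi , w) →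
            by (x ∷ s ∷ ε ∷ lo c ∷ hi c ∷ []) (λ x s e l h → (h :- x) :+ (s :- l) :+ (e :- (h :- l)) ⊢ x :≤ s :+ e)
              (<⇒≤ (≰⇒> (λ q → ¬P-hi c (x , Px , q))) ⊹ lo≤s ⊹ w) })
        , λ u upper → ε-≤ λ ε 0<ε → case cut ε 0<ε of λ { (c , lo≤s , s≤hi , w) → case P-lo c of λ { (y , Py , lo≤y) →
            by (y ∷ s ∷ ε ∷ lo c ∷ hi c ∷ u ∷ []) (λ y s e l h u → (u :- y) :+ (y :- l) :+ (h :- s) :+ (e :- (h :- l)) ⊢ s :≤ u :+ e)
              (upper y Py ⊹ lo≤y ⊹ s≤hi ⊹ w) } } }
    where
    open Cut
    Below : K → Set
    Below x = ∃ λ y → P y × x ≤ y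
    not-below : ¬ Below (b + # 1)
    not-below (y , Py , q) = 0<1 (0≤-resp (ring! (b ∷ y ∷ []) λ b y → (y :- (b :+ κ# 1)) :+ (b :- y) := :- κ# 1) (q ⊹ bounded y Py))

  power-cancel-≤ : ∀ {x y} d → 0≤ y → x ^ suc d ≤ y ^ suc d → x ≤ y
  power-cancel-≤ {x} {y} d 0≤y p = <-or-≤-elim (λ q → q) λ y<x →
    ⊥-elim (<⇒≱ (by< (x ∷ y ∷ x ^ d ∷ y ^ d ∷ []) (λ x y a b → (x :- y) :* a :+ y :* (a :- b) ⊢ y :* b :≤ x :* a)
      (y<x <· 0<-^ d (0<-resp (ring! (x ∷ y ∷ []) λ x y → (x :- y) :+ y := x) (y<x <⊹ 0≤y)) <⊹ 0≤y · ^-mono-≤ d 0≤y (<⇒≤ y<x))) p)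

  -- z is a rational power of b with exponent -k/(d+1) ≤ -m, and c = b^(-m).
  power-compare : ∀ {z c} b d k m → 1 ℕ.≤ b → 0≤ z → 0≤ c → z ^ suc d * # b ^ k ≈ # 1 → c * # b ^ m ≈ # 1 → m ℕ.* suc d ℕ.≤ k → z ≤ c
  power-compare {z} {c} b d k m 1≤b 0≤z 0≤c zb≈1 cb≈1 le = power-cancel-≤ d 0≤c (≤-trans
    (≤-reflexive (trans (sym (*1≈ _)) (trans (*-congˡ (trans (sym (1^ (suc d))) (trans (^-congˡ (suc d) (sym cb≈1)) (trans (^-* c (# b ^ m) (suc d)) (*-congˡ (^-^ (# b) m (suc d)))))))
      (ring! (z ^ suc d ∷ c ^ suc d ∷ # b ^ (m ℕ.* suc d) ∷ []) λ z c p → z :* (c :* p) := c :* (z :* p)))))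
    (≤-trans (*-monoˡ-≤ (0≤-^ (suc d) 0≤c) (*-monoˡ-≤ (0≤-^ (suc d) 0≤z) (^-monoʳ-≤ (1≤# 1≤b) le)))
      (≤-reflexive (trans (*-congˡ zb≈1) (*1≈ _)))))

-- The Cauchy reals as a complete ordered field

module RealInstance (em : ExcludedMiddle 0ℓ) where
  open import Defs using (ℝ; mkℝ; approx; cauchy; _≈_; mk≈; _<_; mk<; _≤_; mk≤; ≈-setoid; 0ℝ; 1ℝ; _+_; _*_; -_; _-_)
  import Defs
  open import Algebra.Definitions.RawMonoid using (_×′_)
  open import Relation.Binary.Bundles using (Setoid)
  open import Data.Integer.Base as ℤ using (ℤ; +_; -[1+_])
  import Data.Integer.Properties as ℤₚ
  open import Data.Nat.Base as ℕ using (ℕ; zero; suc; z≤n; s≤s)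
  import Data.Nat.Properties as ℕₚ
  open import Data.Product.Base using (∃; _×_; _,_)
  open import Data.Rational.Base as ℚ using (ℚ; mkℚ; 0ℚ; 1ℚ; toℚᵘ; ↥_)
  import Data.Rational.Properties as ℚₚ
  import Data.Rational.Unnormalised.Base as ℚᵘ
  import Data.Rational.Unnormalised.Properties as ℚᵘₚ
  open import Data.Sum.Base using (_⊎_; inj₁; inj₂; [_,_]′)
  open import Data.Vec.Base using (_∷_; [])
  open import Function.Base using (case_of_)
  open import Relation.Binary.PropositionalEquality as ≡ using (_≡_)
  open import Relation.Nullary.Negation.Core using (¬_)

  ℚ-0≤-total : ∀ x → 0ℚ ℚ.≤ x ⊎ 0ℚ ℚ.≤ ℚ.- x
  ℚ-0≤-total x = [ inj₁ , (λ p → inj₂ (ℚₚ.neg-antimono-≤ p)) ]′ (ℚₚ.≤-total 0ℚ x)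

  ℚ-0≤-antisym : ∀ {x} → 0ℚ ℚ.≤ x → 0ℚ ℚ.≤ ℚ.- x → x ≡ 0ℚ
  ℚ-0≤-antisym {x} p q = ℚₚ.≤-antisym (≡.subst (ℚ._≤ 0ℚ) (neg-neg x) (ℚₚ.neg-antimono-≤ q)) p
    where
    neg-neg : ∀ x → ℚ.- (ℚ.- x) ≡ x
    neg-neg (mkℚ (+ zero) _ _) = ≡.refl
    neg-neg (mkℚ (+ suc _) _ _) = ≡.refl
    neg-neg (mkℚ -[1+ _ ] _ _) = ≡.refl

  ℚ-0≤-* : ∀ {x y} → 0ℚ ℚ.≤ x → 0ℚ ℚ.≤ y → 0ℚ ℚ.≤ x ℚ.* y
  ℚ-0≤-* {x} {y} p q = ℚₚ.nonNegative⁻¹ (x ℚ.* y) {{ℚₚ.nonNeg*nonNeg⇒nonNeg x {{ℚ.nonNegative p}} y {{ℚ.nonNegative q}}}}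

  nat : ℕ → ℚ
  nat n = + n ℚ./ 1

  toℚᵘ-nat : ∀ n → toℚᵘ (nat n) ℚᵘ.≃ ℚᵘ.mkℚᵘ (+ n) 0
  toℚᵘ-nat n = ℚₚ.toℚᵘ-fromℚᵘ (ℚᵘ.mkℚᵘ (+ n) 0)

  nat-suc : ∀ n → nat (suc n) ≡ nat n ℚ.+ 1ℚ
  nat-suc n = ℚₚ.toℚᵘ-injective (ℚᵘₚ.≃-trans (toℚᵘ-nat (suc n)) (ℚᵘₚ.≃-sym (ℚᵘₚ.≃-trans (ℚₚ.toℚᵘ-homo-+ (nat n) 1ℚ)
    (ℚᵘₚ.≃-trans (ℚᵘₚ.+-congˡ (toℚᵘ 1ℚ) (toℚᵘ-nat n)) (ℚᵘ.*≡* (≡.cong (ℤ._* + 1) (≡.trans (≡.cong₂ ℤ._+_ (ℤₚ.*-identityʳ (+ n)) ≡.refl) (≡.cong +_ (ℕₚ.+-comm n 1)))))))))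

  _×1 : ℕ → ℚ
  n ×1 = _×′_ (record { _≈_ = _≡_ ; _∙_ = ℚ._+_ ; ε = 0ℚ }) n 1ℚ

  ×1≡nat : ∀ n → n ×1 ≡ nat n
  ×1≡nat zero = ≡.refl
  ×1≡nat (suc zero) = ≡.refl
  ×1≡nat (suc (suc n)) = ≡.trans (≡.cong (ℚ._+ 1ℚ) (×1≡nat (suc n))) (≡.sym (nat-suc (suc n)))

  x≤nat : ∀ x → x ℚ.≤ nat ℤ.∣ ↥ x ∣
  x≤nat x = ℚₚ.toℚᵘ-cancel-≤ (ℚᵘₚ.≤-trans (below x) (ℚᵘₚ.≤-reflexive (ℚᵘₚ.≃-sym (toℚᵘ-nat ℤ.∣ ↥ x ∣))))
    where
    below : ∀ x → toℚᵘ x ℚᵘ.≤ ℚᵘ.mkℚᵘ (+ ℤ.∣ ↥ x ∣) 0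
    below (mkℚ (+ k) d _) = ℚᵘ.*≤* (≡.subst₂ ℤ._≤_ (≡.sym (ℤₚ.*-identityʳ (+ k))) (ℤₚ.pos-* k (suc d)) (ℤ.+≤+ (ℕₚ.m≤m*n k (suc d))))
    below (mkℚ -[1+ k ] d _) = ℚᵘ.*≤* ℤ.-≤+

  ℚ-field : OrderedField
  ℚ-field = record
    { K = ℚ ; _≈_ = _≡_ ; _+_ = ℚ._+_ ; _*_ = ℚ._*_ ; -_ = ℚ.-_ ; 0# = 0ℚ ; 1# = 1ℚ
    ; isCommutativeRing = ℚₚ.+-*-isCommutativeRing
    ; 0≤_ = 0ℚ ℚ.≤_
    ; 0≤-resp = ≡.subst (0ℚ ℚ.≤_)
    ; 0≤-+ = ℚₚ.+-mono-≤
    ; 0≤-* = ℚ-0≤-*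
    ; 0≤-total = ℚ-0≤-total
    ; 0≤-antisym = ℚ-0≤-antisym
    ; 0≰-1 = λ { (ℚ.*≤* ()) }
    ; inverse = λ x x≢0 → let instance _ = ℚ.≢-nonZero x≢0 in ℚ.1/ x , ℚₚ.*-inverseʳ x
    ; archimedean = λ x → ℤ.∣ ↥ x ∣ , ≡.subst₂ ℚ._≤_ (ℚₚ.+-inverseʳ x) (≡.cong (ℚ._- x) (≡.sym (×1≡nat ℤ.∣ ↥ x ∣))) (ℚₚ.+-monoˡ-≤ (ℚ.- x) (x≤nat x))
    }

  open Basics ℚ-field em using (0<_; 0<⇒0≤; ring!; _:=_; _:+_; _:*_; _:-_; :-_; ≤-trans; halve; 0≤⇒∣x∣≈x; ∣-∣; _⊹_; #_; #≈fromℕ; #-^; _^_; #0; #1)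
    renaming (∣_∣ to ∣_∣ᶠ; _≤_ to _≤ᶠ_)
  open CauchySequences ℚ-field em

  ∣∣-agree : ∀ p → ∣ p ∣ᶠ ≡ ℚ.∣ p ∣
  ∣∣-agree p = [ (λ q → ≡.trans (0≤⇒∣x∣≈x q) (≡.sym (ℚₚ.0≤p⇒∣p∣≡p q)))
               , (λ q → ≡.trans (≡.sym (∣-∣ p)) (≡.trans (≡.trans (0≤⇒∣x∣≈x q) (≡.sym (ℚₚ.0≤p⇒∣p∣≡p q))) (ℚₚ.∣-p∣≡∣p∣ p))) ]′ (ℚ-0≤-total p)

  ≤⇒≤ᶠ : ∀ {p q} → p ℚ.≤ q → p ≤ᶠ q
  ≤⇒≤ᶠ {p} {q} r = ≡.subst (ℚ._≤ q ℚ.- p) (ℚₚ.+-inverseʳ p) (ℚₚ.+-monoˡ-≤ (ℚ.- p) r)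

  ≤ᶠ⇒≤ : ∀ {p q} → p ≤ᶠ q → p ℚ.≤ q
  ≤ᶠ⇒≤ {p} {q} r = ≡.subst₂ ℚ._≤_ (ℚₚ.+-identityˡ p) (ring! (p ∷ q ∷ []) λ p q → q :- p :+ p := q) (ℚₚ.+-monoˡ-≤ p r)

  0<⇒0<ℚ : ∀ {p} → 0< p → 0ℚ ℚ.< p
  0<⇒0<ℚ {p} h = ℚₚ.≰⇒> λ p≤0 → h (ℚₚ.neg-antimono-≤ p≤0)

  0<ℚ⇒0< : ∀ {p} → 0ℚ ℚ.< p → 0< p
  0<ℚ⇒0< {p} h 0≤-p = ℚₚ.<-irrefl (≡.sym (ℚ-0≤-antisym (ℚₚ.<⇒≤ h) 0≤-p)) h

  half< : ∀ {δ ε} → 0< δ → δ ℚ.+ δ ≡ ε → δ ℚ.< ε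
  half< {δ} 0<δ eq = ≡.subst₂ ℚ._<_ (ℚₚ.+-identityˡ δ) eq (ℚₚ.+-monoˡ-< δ (0<⇒0<ℚ 0<δ))

  cauchyᶠ : ∀ {u} → Defs.Cauchy u → Cauchy u
  cauchyᶠ {u} cu ε 0<ε = case cu ε (0<⇒0<ℚ 0<ε) of λ { (N , h) → N , λ m n p q →
    ≤⇒≤ᶠ (≡.subst (ℚ._≤ ε) (≡.sym (∣∣-agree _)) (ℚₚ.<⇒≤ (h m n p q))) }

  cauchyᵈ : ∀ {u} → Cauchy u → Defs.Cauchy u
  cauchyᵈ {u} cu ε 0<ε = case halve (0<ℚ⇒0< 0<ε) of λ { (δ , 0<δ , eq) → case cu δ 0<δ of λ { (N , h) → N , λ m n p q →
    ℚₚ.≤-<-trans (≡.subst (ℚ._≤ δ) (∣∣-agree _) (≤ᶠ⇒≤ (h m n p q))) (half< 0<δ eq) } }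

  cauchy-of : ∀ x → Cauchy (approx x)
  cauchy-of x = cauchyᶠ {approx x} (cauchy x)

  ≈⇒null : ∀ {x y} → x ≈ y → Null (λ n → approx x n ℚ.- approx y n)
  ≈⇒null (mk≈ h) ε 0<ε = case h ε (0<⇒0<ℚ 0<ε) of λ { (N , c) → N , λ n p →
    ≤⇒≤ᶠ (≡.subst (ℚ._≤ ε) (≡.sym (∣∣-agree _)) (ℚₚ.<⇒≤ (c n p))) }

  null⇒≈ : ∀ {x y} → Null (λ n → approx x n ℚ.- approx y n) → x ≈ y
  null⇒≈ h = mk≈ λ ε 0<ε → case halve (0<ℚ⇒0< 0<ε) of λ { (δ , 0<δ , eq) → case h δ 0<δ of λ { (N , c) → N , λ n p →
    ℚₚ.≤-<-trans (≡.subst (ℚ._≤ δ) (∣∣-agree _) (≤ᶠ⇒≤ (c n p))) (half< 0<δ eq) } }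

  pointwise : ∀ {x y} → (∀ n → approx x n ≡ approx y n) → x ≈ y
  pointwise {x} {y} h = null⇒≈ (null-0 λ n → ≡.trans (≡.cong (ℚ._- approx y n) (h n)) (≡.trans (ℚₚ.+-inverseʳ (approx y n)) (≡.sym #0)))

  difference : ℝ → ℝ → ℕ → ℚ
  difference x y n = approx x n ℚ.- approx y n

  +-cong : ∀ {x x′ y y′} → x ≈ x′ → y ≈ y′ → x + y ≈ x′ + y′
  +-cong {x} {x′} {y} {y′} p q = null⇒≈ (null-≈ {λ n → difference x x′ n ℚ.+ difference y y′ n} {difference (x + y) (x′ + y′)}
    (λ n → ring! (approx x n ∷ approx x′ n ∷ approx y n ∷ approx y′ n ∷ []) λ a a′ b b′ → (a :- a′) :+ (b :- b′) := (a :+ b) :- (a′ :+ b′))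
    (null-+ {difference x x′} {difference y y′} (≈⇒null p) (≈⇒null q)))

  neg-cong : ∀ {x x′} → x ≈ x′ → - x ≈ - x′
  neg-cong {x} {x′} p = null⇒≈ (null-≈ {λ n → ℚ.- difference x x′ n} {difference (- x) (- x′)}
    (λ n → ring! (approx x n ∷ approx x′ n ∷ []) λ a a′ → :- (a :- a′) := :- a :- :- a′) (null-neg {difference x x′} (≈⇒null p)))

  *-cong : ∀ {x x′ y y′} → x ≈ x′ → y ≈ y′ → x * y ≈ x′ * y′
  *-cong {x} {x′} {y} {y′} p q = null⇒≈ (null-≈ {λ n → u n ℚ.+ v n} {difference (x * y) (x′ * y′)}
      (λ n → ring! (approx x n ∷ approx x′ n ∷ approx y n ∷ approx y′ n ∷ []) λ a a′ b b′ → a :* (b :- b′) :+ b′ :* (a :- a′) := a :* b :- a′ :* b′)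
    (null-+ {u} {v} (null-* {approx x} {difference y y′} (cauchy-bounded {approx x} (cauchy-of x)) (≈⇒null q))
      (null-* {approx y′} {difference x x′} (cauchy-bounded {approx y′} (cauchy-of y′)) (≈⇒null p))))
    where
    u v : ℕ → ℚ
    u n = approx x n ℚ.* difference y y′ n
    v n = approx y′ n ℚ.* difference x x′ n

  abstract
    ℝ-isCommutativeRing : IsCommutativeRing _≈_ _+_ _*_ -_ 0ℝ 1ℝ
    ℝ-isCommutativeRing = record
      { isRing = record
        { +-isAbelianGroup = record
          { isGroup = record
            { isMonoid = record
              { isSemigroup = record
                { isMagma = record { isEquivalence = Setoid.isEquivalence ≈-setoid ; ∙-cong = λ {x} {x′} {y} {y′} → +-cong {x} {x′} {y} {y′} }
                ; assoc = λ x y z → pointwise λ n → ℚₚ.+-assoc (approx x n) (approx y n) (approx z n) }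
              ; identity = (λ x → pointwise λ n → ℚₚ.+-identityˡ (approx x n)) , λ x → pointwise λ n → ℚₚ.+-identityʳ (approx x n) }
            ; inverse = (λ x → pointwise λ n → ℚₚ.+-inverseˡ (approx x n)) , λ x → pointwise λ n → ℚₚ.+-inverseʳ (approx x n)
            ; ⁻¹-cong = λ {x} {x′} → neg-cong {x} {x′} }
          ; comm = λ x y → pointwise λ n → ℚₚ.+-comm (approx x n) (approx y n) }
        ; *-cong = λ {x} {x′} {y} {y′} → *-cong {x} {x′} {y} {y′}
        ; *-assoc = λ x y z → pointwise λ n → ℚₚ.*-assoc (approx x n) (approx y n) (approx z n)
        ; *-identity = (λ x → pointwise λ n → ℚₚ.*-identityˡ (approx x n)) , λ x → pointwise λ n → ℚₚ.*-identityʳ (approx x n)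
        ; distrib = (λ x y z → pointwise λ n → ℚₚ.*-distribˡ-+ (approx x n) (approx y n) (approx z n))
                  , λ x y z → pointwise λ n → ℚₚ.*-distribʳ-+ (approx x n) (approx y n) (approx z n) }
      ; *-comm = λ x y → pointwise λ n → ℚₚ.*-comm (approx x n) (approx y n) }

  -- A record, so that unification recovers x from the type; the bare condition mentions only the
  -- approximating sequence.
  record 0≤ℝ_ (x : ℝ) : Set where
    constructor nonneg
    field
      sequence : NonNegative (approx x)

  open 0≤ℝ_

  _×1ℝ : ℕ → ℝ
  n ×1ℝ = _×′_ (record { _≈_ = _≈_ ; _∙_ = _+_ ; ε = 0ℝ }) n 1ℝ

  ×1ℝ≡ : ∀ n i → approx (n ×1ℝ) i ≡ n ×1
  ×1ℝ≡ zero i = ≡.refl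
  ×1ℝ≡ (suc zero) i = ≡.refl
  ×1ℝ≡ (suc (suc n)) i = ≡.cong (ℚ._+ 1ℚ) (×1ℝ≡ (suc n) i)

  abstract
    ℝ-inverse : ∀ x → ¬ x ≈ 0ℝ → ∃ λ y → x * y ≈ 1ℝ
    ℝ-inverse x ne = case away-from-0 {approx x} (cauchy-of x) (λ nx → ne (null⇒≈ (null-≈ {approx x} (λ n → ≡.sym (ℚₚ.+-identityʳ (approx x n))) nx))) of λ { (δ , 0<δ , away) →
      mkℝ (λ n → reciprocal-of (approx x n)) (cauchyᵈ {λ n → reciprocal-of (approx x n)} (reciprocal-cauchy {approx x} (cauchy-of x) 0<δ away))
      , null⇒≈ (null-≈ {λ n → approx x n ℚ.* reciprocal-of (approx x n) ℚ.- # 1} (λ n → ≡.cong (λ z → approx x n ℚ.* reciprocal-of (approx x n) ℚ.- z) #1) (reciprocal-null {approx x} (cauchy-of x) 0<δ away)) }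

    ℝ-archimedean : ∀ x → ∃ λ n → 0≤ℝ (n ×1ℝ - x)
    ℝ-archimedean x = case cauchy-bounded {approx x} (cauchy-of x) of λ { (B , _ , N , h) → ℤ.∣ ↥ B ∣ , nonneg λ ε 0<ε → N , λ n p →
      ≡.subst (λ z → 0ℚ ℚ.≤ z ℚ.- approx x n ℚ.+ ε) (≡.sym (≡.trans (×1ℝ≡ ℤ.∣ ↥ B ∣ n) (×1≡nat ℤ.∣ ↥ B ∣))) (bound B n ε (h n p) (0<⇒0≤ {ε} 0<ε)) }
      where
      bound : ∀ B n ε → ∣ approx x n ∣ᶠ ≤ᶠ B → 0ℚ ℚ.≤ ε → 0ℚ ℚ.≤ nat ℤ.∣ ↥ B ∣ ℚ.- approx x n ℚ.+ ε
      bound B n ε p q = _⊹_ {nat ℤ.∣ ↥ B ∣ ℚ.- approx x n} {ε} (≤-trans {approx x n} {∣ approx x n ∣ᶠ} {nat ℤ.∣ ↥ B ∣} (Basics.x≤∣x∣ ℚ-field em (approx x n))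
        (≤-trans {∣ approx x n ∣ᶠ} {B} {nat ℤ.∣ ↥ B ∣} p (≤⇒≤ᶠ {B} {nat ℤ.∣ ↥ B ∣} (x≤nat B)))) q

    0≤ℝ-resp : ∀ {x y} → x ≈ y → 0≤ℝ x → 0≤ℝ y
    0≤ℝ-resp {x} {y} p (nonneg q) = nonneg (nonNegative-cong {approx x} {approx y} (≈⇒null p) q)

    0≤ℝ-+ : ∀ {x y} → 0≤ℝ x → 0≤ℝ y → 0≤ℝ (x + y)
    0≤ℝ-+ {x} {y} (nonneg p) (nonneg q) = nonneg (nonNegative-+ {approx x} {approx y} p q)

    0≤ℝ-* : ∀ {x y} → 0≤ℝ x → 0≤ℝ y → 0≤ℝ (x * y)
    0≤ℝ-* {x} {y} (nonneg p) (nonneg q) = nonneg (nonNegative-* {approx x} {approx y} (cauchy-bounded {approx x} (cauchy-of x)) (cauchy-bounded {approx y} (cauchy-of y)) p q)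

    0≤ℝ-total : ∀ x → 0≤ℝ x ⊎ 0≤ℝ (- x)
    0≤ℝ-total x = [ (λ p → inj₁ (nonneg p)) , (λ p → inj₂ (nonneg p)) ]′ (nonNegative-total {approx x} (cauchy-of x))

    0≤ℝ-antisym : ∀ {x} → 0≤ℝ x → 0≤ℝ (- x) → x ≈ 0ℝ
    0≤ℝ-antisym {x} (nonneg p) (nonneg q) = null⇒≈ (null-≈ {approx x} (λ n → ≡.sym (ℚₚ.+-identityʳ (approx x n))) (nonNegative-antisym {approx x} p q))

    0≰ℝ-1 : ¬ 0≤ℝ (- 1ℝ)
    0≰ℝ-1 (nonneg p) = case p ℚ.½ (0<ℚ⇒0< {ℚ.½} (ℚ.*<* (ℤ.+<+ (s≤s z≤n)))) of λ { (N , h) → case h N ℕₚ.≤-refl of λ { (ℚ.*≤* ()) } }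

  ℝ-ordered : OrderedField
  ℝ-ordered = record
    { K = ℝ ; _≈_ = _≈_ ; _+_ = _+_ ; _*_ = _*_ ; -_ = -_ ; 0# = 0ℝ ; 1# = 1ℝ
    ; isCommutativeRing = ℝ-isCommutativeRing
    ; 0≤_ = 0≤ℝ_
    ; 0≤-resp = 0≤ℝ-resp
    ; 0≤-+ = 0≤ℝ-+
    ; 0≤-* = 0≤ℝ-*
    ; 0≤-total = 0≤ℝ-total
    ; 0≤-antisym = 0≤ℝ-antisym
    ; 0≰-1 = 0≰ℝ-1
    ; inverse = ℝ-inverse
    ; archimedean = ℝ-archimedean
    }

  abstract
    ℝ-complete : (l u : ℕ → ℝ) → (∀ n → 0≤ℝ (l (suc n) - l n)) → (∀ n → 0≤ℝ (u n - u (suc n))) → (∀ n → 0≤ℝ (u n - l n)) →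
      (∀ n → 0≤ℝ ((u 0 - l 0) - (2 ℕ.^ n) ×1ℝ * (u n - l n))) → ∃ λ x → ∀ n → 0≤ℝ (x - l n) × 0≤ℝ (u n - x)
    ℝ-complete l u up down l≤u width = mkℝ N.x (cauchyᵈ {N.x} N.x-cauchy) , λ n → nonneg (N.x-lower n) , nonneg (N.x-upper n)
      where
      scale : ∀ n i → approx ((2 ℕ.^ n) ×1ℝ) i ≡ # 2 ^ n
      scale n i = ≡.trans (×1ℝ≡ (2 ℕ.^ n) i) (≡.trans (≡.sym (#≈fromℕ (2 ℕ.^ n))) (#-^ 2 n))
      width′ : ∀ n → NonNegative (λ i → (approx (u 0) i ℚ.- approx (l 0) i) ℚ.- # 2 ^ n ℚ.* (approx (u n) i ℚ.- approx (l n) i))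
      width′ n ε 0<ε = eventually-map (λ i → ≡.subst (λ z → 0ℚ ℚ.≤ (approx (u 0) i ℚ.- approx (l 0) i) ℚ.- z ℚ.* (approx (u n) i ℚ.- approx (l n) i) ℚ.+ ε) (scale n i))
        (sequence (width n) ε 0<ε)
      module N = Nested (λ n → approx (l n)) (λ n → approx (u n)) (λ n → cauchy-of (l n)) (λ n → cauchy-of (u n))
        (λ n → sequence (up n)) (λ n → sequence (down n)) (λ n → sequence (l≤u n)) width′

  ℝ-field : RealField
  ℝ-field = record { ordered = ℝ-ordered ; complete = ℝ-complete }

  ≤⇒0≤ℝ : ∀ {x y} → x ≤ y → 0≤ℝ (y - x)
  ≤⇒0≤ℝ {x} {y} (mk≤ h) = nonneg λ ε 0<ε → case h ε (0<⇒0<ℚ 0<ε) of λ { (N , p) → N , λ n q →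
    ≡.subst (0ℚ ℚ.≤_) (ring! (approx x n ∷ approx y n ∷ ε ∷ []) λ x y e → y :+ e :- x := y :- x :+ e) (≤⇒≤ᶠ (ℚₚ.<⇒≤ (p n q))) }

  0≤ℝ⇒≤ : ∀ {x y} → 0≤ℝ (y - x) → x ≤ y
  0≤ℝ⇒≤ {x} {y} (nonneg h) = mk≤ λ ε 0<ε → case halve (0<ℚ⇒0< 0<ε) of λ { (δ , 0<δ , eq) → case h δ 0<δ of λ { (N , p) → N , λ n q →
    ℚₚ.≤-<-trans (≤ᶠ⇒≤ (≡.subst (0ℚ ℚ.≤_) (ring! (approx x n ∷ approx y n ∷ δ ∷ []) λ x y e → y :- x :+ e := y :+ e :- x) (p n q)))
      (ℚₚ.+-monoʳ-< (approx y n) (half< 0<δ eq)) } }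

  <⇒≰ℝ : ∀ {x y} → x < y → ¬ 0≤ℝ (- (y - x))
  <⇒≰ℝ {x} {y} (mk< g 0<g (M , h)) (nonneg p) = case p g (0<ℚ⇒0< 0<g) of λ { (N , q) →
    let n = M ℕ.⊔ N in ℚₚ.<-irrefl ≡.refl (ℚₚ.<-≤-trans (h n (ℕₚ.m≤m⊔n M N)) (≤ᶠ⇒≤ (≡.subst (0ℚ ℚ.≤_)
      (ring! (approx x n ∷ approx y n ∷ g ∷ []) λ x y g → :- (y :- x) :+ g := x :+ g :- y) (q n (ℕₚ.m≤n⊔m M N))))) }

  ≰ℝ⇒< : ∀ {x y} → ¬ 0≤ℝ (- (y - x)) → x < y
  ≰ℝ⇒< {x} {y} h = case positive-gap {approx (y - x)} (cauchy-of (y - x)) (λ p → h (nonneg p)) of λ { (δ , 0<δ , N , p) →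
    case halve 0<δ of λ { (g , 0<g , eq) → mk< g (0<⇒0<ℚ 0<g) (N , λ n q →
      ℚₚ.<-≤-trans (ℚₚ.+-monoʳ-< (approx x n) (half< 0<g eq))
        (≤ᶠ⇒≤ (≡.subst (0ℚ ℚ.≤_) (ring! (approx x n ∷ approx y n ∷ δ ∷ []) λ x y d → y :- x :- d := y :- (x :+ d)) (p n q)))) } }

-- Back to the definitions of the theorem

module Interface (em : ExcludedMiddle 0ℓ) where
  open RealInstance em using (ℝ-ordered; ℝ-field; 0≤ℝ-total; ℚ-field; 0≤ℝ_; nonneg; ×1ℝ≡; ×1≡nat; nat; toℚᵘ-nat; pointwise; null⇒≈; ≤⇒0≤ℝ; 0≤ℝ⇒≤; <⇒≰ℝ; ≰ℝ⇒<; ≤ᶠ⇒≤)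
  open Analytic ℝ-field em using (∑; ∑-cong; ev; ev-congʳ; ev-∑^; Germ; germ-convergent; module Continuation; module Core; quotient-close; quotient-far; supremum; power-compare)
  open Basics ℝ-ordered em using (0<-resp; #_; #≈fromℕ; #0; #1; #-^; #-mono; IsInt; int-cong; int-neg; int-#; 0<_; 0<⇒0≤; <⇒≤; ≤-refl; ≤-trans; ≤-reflexive; ≤-total; <-≤-trans; ≤-<-trans; <⇒≱; 0≤#; 0<1; 0<-^; 0≤⇒∣x∣≈x; ∣-∣; ∣∣-cong; x≤∣x∣; -x≤∣x∣; 0≤∣∣; ^-monoʳ-≤; 1≤#; *-monoˡ-≤; upper-bound; halve; _⊹_; _<⊹_; by; by<; ring!; _:=_; _⊢_:≤_; _:+_; _:-_; :-_; refl; sym; trans; +-cong; +-congˡ; +-congʳ; *-cong; *-congˡ; *-congʳ; -‿cong; *-comm; *1≈; 1≤-^; ∣*∣; ∣#∣)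
    renaming (∣_∣ to ∣_∣ᶠ; _≤_ to _≤ᶠ_; _<_ to _<ᶠ_; _^_ to _^ᶠ_)
  open import Defs
  open import Data.Empty using (⊥-elim)
  open import Data.Fin.Base using (toℕ)
  open import Data.Integer.Base as ℤ using (ℤ; +_; -[1+_])
  import Data.Integer.Properties as ℤₚ
  open import Data.List.Base using (List; upTo; cartesianProduct) renaming (_∷_ to _∷ˡ_; [] to []ˡ; _++_ to _++ˡ_; map to mapˡ)
  open import Data.List.Membership.Propositional using (_∈_)
  open import Data.List.Membership.Propositional.Properties using (∈-map⁺; ∈-++⁺ˡ; ∈-++⁺ʳ; ∈-upTo⁺; ∈-cartesianProduct⁺)
  open import Data.List.Relation.Unary.Any using (here; there)
  open import Data.Nat.Base as ℕ using (ℕ; zero; suc; z≤n; s≤s)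
  import Data.Nat.Properties as ℕₚ
  open import Data.Product.Base using (∃; ∃₂; _×_; _,_; proj₁; proj₂; ∃-syntax; Σ-syntax)
  open import Data.Rational.Base as ℚ using (ℚ; mkℚ; 0ℚ; toℚᵘ; ↥_; ↧ₙ_)
  import Data.Rational.Properties as ℚₚ
  import Data.Rational.Unnormalised.Base as ℚᵘ
  import Data.Rational.Unnormalised.Properties as ℚᵘₚ
  open import Data.Sum.Base using (_⊎_; inj₁; inj₂; [_,_]′)
  open import Data.Vec.Base using (_∷_; [])
  open import Function.Base using (case_of_)
  open import Function.Bundles using (Func)
  open import Relation.Binary.Construct.Add.Extrema.NonStrict _≤_ using (⊥±≤_; [_]≤⊤±) renaming ([_] to [_]≤)
  open import Relation.Binary.Construct.Add.Extrema.Strict _<_ using (⊥±<[_]; [_]<⊤±) renaming ([_] to [_]<)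
  open import Relation.Binary.PropositionalEquality as ≡ using (_≡_)
  open import Relation.Nullary.Construct.Add.Extrema using ([_]; ⊥±; ⊤±)
  open import Relation.Nullary.Decidable.Core using (Dec; yes; no)
  open import Relation.Nullary.Negation.Core using (¬_)
  open import Relation.Unary using (_⊆_; Satisfiable)
  import Relation.Binary.Construct.Add.Supremum.NonStrict as Supremum

  -- Real numbers as an ordered field

  ≤-from : ∀ {x y} → x ≤ᶠ y → x ≤ y
  ≤-from = 0≤ℝ⇒≤

  ≤-to : ∀ {x y} → x ≤ y → x ≤ᶠ y
  ≤-to = ≤⇒0≤ℝ

  <-from : ∀ {x y} → x <ᶠ y → x < y
  <-from = ≰ℝ⇒<

  <-to : ∀ {x y} → x < y → x <ᶠ y
  <-to = <⇒≰ℝ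

  x-0≈x : ∀ x → x - 0ℝ ≈ x
  x-0≈x x = pointwise λ n → ℚₚ.+-identityʳ (approx x n)

  0<-from : ∀ {x} → 0< x → 0ℝ < x
  0<-from {x} p = <-from {0ℝ} {x} (0<-resp {x} {x - 0ℝ} (sym (x-0≈x x)) p)

  0<-to : ∀ {x} → 0ℝ < x → 0< x
  0<-to {x} p = 0<-resp {x - 0ℝ} {x} (x-0≈x x) (<-to {0ℝ} {x} p)

  ∣∣-agree : ∀ x → ∣ x ∣ ≈ ∣ x ∣ᶠ
  ∣∣-agree x = [ (λ p → trans (nonneg-abs x p) (sym (0≤⇒∣x∣≈x p)))
               , (λ p → trans (pointwise λ n → ≡.sym (ℚₚ.∣-p∣≡∣p∣ (approx x n))) (trans (nonneg-abs (- x) p) (trans (sym (0≤⇒∣x∣≈x p)) (∣-∣ x)))) ]′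
    (0≤ℝ-total x)
    where
    nonneg-abs : ∀ x → 0≤ℝ x → ∣ x ∣ ≈ x
    nonneg-abs x (nonneg p) = null⇒≈ (CauchySequences.null-≈ ℚ-field em {λ n → Basics.∣_∣ ℚ-field em (approx x n) ℚ.- approx x n} {λ n → ℚ.∣ approx x n ∣ ℚ.- approx x n}
      (λ n → ≡.cong (ℚ._- approx x n) (RealInstance.∣∣-agree em (approx x n)))
      (CauchySequences.nonNegative-abs ℚ-field em {approx x} p))

  ^-agree : ∀ x n → x ^ n ≈ x ^ᶠ n
  ^-agree x zero = sym #1
  ^-agree x (suc n) = *-congˡ (^-agree x n)

  #≈ι : ∀ n → # n ≈ ι (nat n)
  #≈ι n = trans (#≈fromℕ n) (pointwise λ i → ≡.trans (×1ℝ≡ n i) (×1≡nat n))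

  ι-reflect : ∀ {p q} → ι p ≤ᶠ ι q → p ℚ.≤ q
  ι-reflect {p} {q} (nonneg h) = ≤ᶠ⇒≤ (Basics.ε-≤ ℚ-field em {p} {q} λ ε 0<ε → case h ε 0<ε of λ { (N , r) →
    ≡.subst (0ℚ ℚ.≤_) (rearrange p q ε) (r N ℕₚ.≤-refl) })
    where
    rearrange : ∀ p q ε → q ℚ.- p ℚ.+ ε ≡ q ℚ.+ ε ℚ.- p
    rearrange p q ε = ≡.trans (ℚₚ.+-assoc q (ℚ.- p) ε) (≡.trans (≡.cong (q ℚ.+_) (ℚₚ.+-comm (ℚ.- p) ε)) (≡.sym (ℚₚ.+-assoc q ε (ℚ.- p))))

  toℚᵘ-/ : ∀ a b → toℚᵘ (a ℚ./ suc b) ℚᵘ.≃ ℚᵘ.mkℚᵘ a b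
  toℚᵘ-/ a b = ℚₚ.toℚᵘ-fromℚᵘ (ℚᵘ.mkℚᵘ a b)

  fraction : ∀ a b .{{_ : ℕ.NonZero b}} → nat b ℚ.* (a ℚ./ b) ≡ a ℚ./ 1
  fraction a (suc b) = ℚₚ.toℚᵘ-injective (ℚᵘₚ.≃-trans (ℚₚ.toℚᵘ-homo-* (nat (suc b)) (a ℚ./ suc b))
    (ℚᵘₚ.≃-trans (ℚᵘₚ.*-cong (toℚᵘ-nat (suc b)) (toℚᵘ-/ a b)) (ℚᵘₚ.≃-trans (ℚᵘ.*≡* equal) (ℚᵘₚ.≃-sym (toℚᵘ-/ a 0)))))
    where
    equal : (+ suc b ℤ.* a) ℤ.* + 1 ≡ a ℤ.* + (1 ℕ.* suc b)
    equal = ≡.trans (ℤₚ.*-identityʳ _) (≡.trans (ℤₚ.*-comm (+ suc b) a) (≡.cong (λ z → a ℤ.* + z) (≡.sym (ℕₚ.+-identityʳ (suc b)))))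

  #-fraction : ∀ a b .{{_ : ℕ.NonZero b}} → # b * ι (a ℚ./ b) ≈ ι (a ℚ./ 1)
  #-fraction a b = trans (*-congʳ (#≈ι b)) (pointwise λ _ → fraction a b)

  /1-difference : ∀ p q → (p ℤ.- q) ℚ./ 1 ≡ p ℚ./ 1 ℚ.- q ℚ./ 1
  /1-difference p q = ℚₚ.toℚᵘ-injective (ℚᵘₚ.≃-trans (toℚᵘ-/ (p ℤ.- q) 0) (ℚᵘₚ.≃-sym (ℚᵘₚ.≃-trans (ℚₚ.toℚᵘ-homo-+ (p ℚ./ 1) (ℚ.- (q ℚ./ 1)))
    (ℚᵘₚ.≃-trans (ℚᵘₚ.+-cong (toℚᵘ-/ p 0) (ℚᵘₚ.≃-trans (ℚₚ.toℚᵘ-homo‿- (q ℚ./ 1)) (ℚᵘₚ.-‿cong (toℚᵘ-/ q 0))))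
      (ℚᵘ.*≡* (≡.cong (ℤ._* + 1) (≡.cong₂ ℤ._+_ (ℤₚ.*-identityʳ p) (ℤₚ.*-identityʳ (ℤ.- q)))))))))

  int→ℤ : ∀ {x} → IsInt x → ∃ λ p → x ≈ ι (p ℚ./ 1)
  int→ℤ (m , n , eq) = + m ℤ.- + n , trans eq (trans (+-cong (#≈ι m) (-‿cong (#≈ι n))) (pointwise λ _ → ≡.sym (/1-difference (+ m) (+ n))))

  ℤ→int : ∀ p → IsInt (ι (p ℚ./ 1))
  ℤ→int (+ n) = int-cong (#≈ι n) (int-# n)
  ℤ→int -[1+ n ] = int-cong (trans (-‿cong (#≈ι (suc n))) (pointwise λ _ → ≡.refl)) (int-neg (int-# (suc n)))

  #-power : ∀ b .{{_ : ℕ.NonZero b}} k → ι (b ^ᶻ -[1+ k ]) * # b ^ᶠ suc k ≈ # 1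
  #-power b k = trans (*-comm _ _) (trans (*-congʳ (sym (#-^ b (suc k)))) (trans (#-fraction (+ 1) (b ℕ.^ suc k) {{ℕₚ.m^n≢0 b (suc k)}}) (sym (trans (#≈ι 1) refl))))

  -- Shifted by one: `power-of b k` is b^(-k-1), so `power-of b 99` is b⁻¹⁰⁰.
  power-of : ∀ b .{{_ : ℕ.NonZero b}} → ℕ → ℝ
  power-of b k = ι (b ^ᶻ -[1+ k ])

  0<-invert : ∀ {z P} → 0< P → z * P ≈ # 1 → 0< z
  0<-invert {z} {P} 0<P eq = Basics.0≤∧≉0⇒0< ℝ-ordered em (Basics.0≤-cancel ℝ-ordered em 0<P (OrderedField.0≤-resp ℝ-ordered (trans (sym eq) (*-comm z P)) (0<⇒0≤ 0<1)))
    λ z≈0 → Basics.0<⇒≉0 ℝ-ordered em 0<1 (trans (sym eq) (trans (*-congʳ z≈0) (trans (*-comm _ _) (Basics.*0≈ ℝ-ordered em _))))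

  nonZero⇒1≤ : ∀ b .{{_ : ℕ.NonZero b}} → 1 ℕ.≤ b
  nonZero⇒1≤ (suc b) = s≤s z≤n

  0<power : ∀ b .{{_ : ℕ.NonZero b}} k → 0< power-of b k
  0<power b k = 0<-invert (0<-^ (suc k) (Basics.1≤⇒0< ℝ-ordered em (1≤# (nonZero⇒1≤ b)))) (#-power b k)

  -- Powers with real exponents

  -100ℝ : ℝ
  -100ℝ = - ι (+ 100 ℚ./ 1)

  exponent-bound : ∀ t → ι t ≤ -100ℝ → ∃ λ k → ↥ t ≡ -[1+ k ] × 100 ℕ.* ↧ₙ t ℕ.≤ suc k
  exponent-bound t h = from t (ι-reflect {t} {ℚ.- (+ 100 ℚ./ 1)} (case ≤-to h of λ { (nonneg p) → nonneg p }))
    where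
    from : ∀ t → t ℚ.≤ ℚ.- (+ 100 ℚ./ 1) → ∃ λ k → ↥ t ≡ -[1+ k ] × 100 ℕ.* ↧ₙ t ℕ.≤ suc k
    from (mkℚ (+ m) d _) (ℚ.*≤* p) = ⊥-elim (absurd (≡.subst (ℤ._≤ -[1+ 99 ] ℤ.* + suc d) (ℤₚ.*-identityʳ (+ m)) p))
      where
      absurd : ¬ (+ m ℤ.≤ -[1+ 99 ] ℤ.* + suc d)
      absurd ()
    from (mkℚ -[1+ k ] d _) (ℚ.*≤* p) = k , ≡.refl , bound (≡.subst (ℤ._≤ -[1+ 99 ] ℤ.* + suc d) (ℤₚ.*-identityʳ -[1+ k ]) p)
      where
      bound : -[1+ k ] ℤ.≤ -[1+ 99 ] ℤ.* + suc d → 100 ℕ.* suc d ℕ.≤ suc k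
      bound (ℤ.-≤- q) = s≤s q

  rational-power-bound : ∀ b .{{_ : ℕ.NonZero b}} t z → ι t ≤ -100ℝ → IsRationalPower b t z → z ≤ power-of b 99
  rational-power-bound b t z h (0<z , eq) = case exponent-bound t h of λ { (k , num≡ , le) → compare k num≡ le (ℕₚ.suc-pred (↧ₙ t)) }
    where
    compare : ∀ k → ↥ t ≡ -[1+ k ] → 100 ℕ.* ↧ₙ t ℕ.≤ suc k → suc (ℕ.pred (↧ₙ t)) ≡ ↧ₙ t → z ≤ power-of b 99
    compare k num≡ le den≡ = ≤-from (power-compare b (ℕ.pred (↧ₙ t)) (suc k) 100 (nonZero⇒1≤ b) (0<⇒0≤ (0<-to 0<z)) (0<⇒0≤ (0<power b 99))
      (trans (*-congʳ (trans (Basics.^-≈ ℝ-ordered em z den≡) (trans (sym (^-agree z (↧ₙ t))) (trans eq (pointwise λ _ → ≡.cong (b ^ᶻ_) num≡))))) (#-power b k))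
      (#-power b 99) (≡.subst (λ d → 100 ℕ.* d ℕ.≤ suc k) (≡.sym den≡) le))

  -- The supremum that defines b⁻¹⁰⁰ is attained, as the exponent -100 is itself rational. Smaller
  -- rational exponents give smaller powers because b ≥ 1.
  power-100 : ∀ b .{{_ : ℕ.NonZero b}} → IsPower b -100ℝ (power-of b 99)
  power-100 b = (λ { z (t , h , p) → [ rational-power-bound b t z h p ]≤ })
    , λ u upper → upper (power-of b 99) (ℚ.- (+ 100 ℚ./ 1) , ≤-from (≤-reflexive (pointwise λ _ → ≡.refl)) , 0<-from (0<power b 99)
        , trans (^-agree (power-of b 99) 1) (trans (*1≈ _) refl))

  power-beyond-100 : ∀ b .{{_ : ℕ.NonZero b}} {l c} → ι (+ 100 ℚ./ 1) ≤ᶠ l → IsPower b (- l) c → c ≤ power-of b 99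
  power-beyond-100 b {l} {c} 100≤l (_ , least) = unwrap (least [ power-of b 99 ] λ { z (t , t≤ , p) →
      [ rational-power-bound b t z (≤-from (≤-trans (≤-to t≤) (by (ι (+ 100 ℚ./ 1) ∷ l ∷ []) (λ h l → l :- h ⊢ :- l :≤ :- h) 100≤l))) p ]≤ })
    where
    unwrap : ∀ {x y} → [ x ] ≤± [ y ] → x ≤ y
    unwrap [ p ]≤ = p

  -- Liouville numbers

  denominators : List (ℤ × ℕ) → ℕ
  denominators []ˡ = 0
  denominators ((_ , q) ∷ˡ xs) = q ℕ.⊔ denominators xs

  ∈⇒≤denominators : ∀ {p q} xs → (p , q) ∈ xs → q ℕ.≤ denominators xs
  ∈⇒≤denominators (_ ∷ˡ xs) (here ≡.refl) = ℕₚ.m≤m⊔n _ _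
  ∈⇒≤denominators ((_ , q′) ∷ˡ xs) (there r) = ℕₚ.≤-trans (∈⇒≤denominators xs r) (ℕₚ.m≤n⊔m q′ _)

  Approximable : ℝ → Set
  Approximable ξ = ∀ N → ∃₂ λ num den → IsInt num × N ℕ.≤ den × 2 ℕ.≤ den × num <ᶠ # den * ξ × (# den * ξ - num) * # den ^ᶠ suc N ≤ᶠ # 1

  liouville-from : ∀ {ξ} → Approximable ξ → Liouville ξ
  -- The index serves twice: it makes the order of approximation at least `suc N`, and it makes the
  -- denominator exceed all denominators in `xs`, so that the pair is not in the list.
  liouville-from {ξ} approximable (suc N) _ xs = case approximable (suc N ℕ.+ suc (denominators xs)) of λ { (num , den , num-int , M≤den , 2≤den , above , near) →
      case int→ℤ num-int of λ { (p , num≈p) → (p , den) , (λ r → ℕₚ.<⇒≱ (ℕₚ.≤-trans (ℕₚ.m≤n+m (suc (denominators xs)) (suc N)) M≤den) (∈⇒≤denominators xs r))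
        , witness num den p num≈p 2≤den above near } }
    where
    witness : ∀ num den p → num ≈ ι (p ℚ./ 1) → 2 ℕ.≤ den → num <ᶠ # den * ξ → (# den * ξ - num) * # den ^ᶠ suc (suc N ℕ.+ suc (denominators xs)) ≤ᶠ # 1 →
      Σ[ nz ∈ ℕ.NonZero den ] let instance _ = nz; d = ∣ ξ - ι (p ℚ./ den) ∣ in 2 ℕ.≤ den × 0ℝ < d × d < ι (den ^ᶻ (ℤ.- + suc N))
    witness num (suc den) p num≈p 2≤den above near = _ , 2≤den , 0<-from (0<-resp (sym d≈) (proj₁ close))
      , <-from (≤-<-trans (≤-reflexive d≈) (proj₂ close))
      where
      x : ℝ
      x = ι (p ℚ./ suc den)
      close : x <ᶠ ξ × ξ - x <ᶠ power-of (suc den) N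
      close = quotient-close (suc den) (suc N) 2≤den (trans (#-fraction p (suc den)) (sym num≈p)) above
        (≤-trans (*-monoˡ-≤ (0<⇒0≤ above) (^-monoʳ-≤ (1≤# (s≤s z≤n)) (s≤s (ℕₚ.m≤m+n (suc N) _)))) near) (#-power (suc den) N)
      d≈ : ∣ ξ - x ∣ ≈ ξ - x
      d≈ = trans (∣∣-agree (ξ - x)) (0≤⇒∣x∣≈x (0<⇒0≤ (proj₁ close)))

  -- Irrationality exponents

  Far : ℝ → ℕ → Set
  Far y B = ∀ a b → IsInt a → 1 ℕ.≤ b → B ℕ.≤ b → # 1 ≤ᶠ ∣ # b * y - a ∣ᶠ * # b ^ᶠ 98

  module _ {y : ℝ} {B : ℕ} (far : Far y B) where

    far-fraction : ∀ a b .{{_ : ℕ.NonZero b}} → 2 ℕ.≤ b → B ℕ.≤ b → power-of b 99 <ᶠ ∣ y - ι (a ℚ./ b) ∣ᶠ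
    far-fraction a b 2≤b B≤b = quotient-far b 2≤b (#-fraction a b) (far (ι (a ℚ./ 1)) b (ℤ→int a) (nonZero⇒1≤ b) B≤b) (#-power b 99)

    eventually-far : EventuallyFarFromRationals (ι (+ 100 ℚ./ 1)) y
    eventually-far = 2 ℕ.⊔ B , λ a b le → power-of b 99 , power-100 b
      , <-from (<-≤-trans (far-fraction a b (ℕₚ.m⊔n≤o⇒m≤o 2 B le) (ℕₚ.m⊔n≤o⇒n≤o 2 B le)) (≤-reflexive (sym (∣∣-agree _))))

    private
      Y : ℕ
      Y = proj₁ (upper-bound (∣ y ∣ᶠ + # 1))
      y<Y : ∣ y ∣ᶠ + # 1 ≤ᶠ # Y
      y<Y = proj₂ (proj₂ (upper-bound (∣ y ∣ᶠ + # 1)))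
      B′ : ℕ
      B′ = 2 ℕ.⊔ B

      integers : ℕ → List ℤ
      integers n = mapˡ +_ (upTo (suc n)) ++ˡ mapˡ -[1+_] (upTo n)

      ∈-integers : ∀ n p → ℤ.∣ p ∣ ℕ.≤ n → p ∈ integers n
      ∈-integers n (+ m) le = ∈-++⁺ˡ (∈-map⁺ +_ (∈-upTo⁺ (s≤s le)))
      ∈-integers n -[1+ m ] le = ∈-++⁺ʳ (mapˡ +_ (upTo (suc n))) (∈-map⁺ -[1+_] (∈-upTo⁺ le))

      -- A fraction that approximates y with exponent at least 100 has denominator below B′, and its
      -- numerator is bounded because it lies within 1 of y. This finite list therefore contradicts
      -- the infinitude that such an exponent demands.
      small-fractions : List (ℤ × ℕ)
      small-fractions = cartesianProduct (integers (B′ ℕ.* Y)) (upTo B′)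

      ∣ℤ∣ : ∀ p → ∣ ι (p ℚ./ 1) ∣ᶠ ≈ # ℤ.∣ p ∣
      ∣ℤ∣ (+ n) = trans (∣∣-cong (sym (#≈ι n))) (∣#∣ n)
      ∣ℤ∣ -[1+ n ] = trans (∣∣-cong (sym (trans (-‿cong (#≈ι (suc n))) (pointwise λ _ → ≡.refl)))) (trans (∣-∣ _) (∣#∣ (suc n)))

      numerator-bound : ∀ a b .{{_ : ℕ.NonZero b}} → b ℕ.< B′ → ∣ y - ι (a ℚ./ b) ∣ᶠ ≤ᶠ # 1 → ℤ.∣ a ∣ ℕ.≤ B′ ℕ.* Y
      numerator-bound a b b<B′ close = Basics.#-mono⁻¹ ℝ-ordered em (≤-trans (≤-reflexive (trans (sym (∣ℤ∣ a)) (trans (∣∣-cong (sym (#-fraction a b))) (∣*∣ _ _))))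
        (≤-trans (Basics.*-mono-≤ ℝ-ordered em (0≤∣∣ _) (0≤# B′) (≤-trans (≤-reflexive (∣#∣ b)) (#-mono (ℕₚ.<⇒≤ b<B′)))
          (≤-trans (∣∣-cong-≤′ (ring! (y ∷ ι (a ℚ./ b) ∷ []) λ y x → x := y :- (y :- x))) (≤-trans (Basics.∣-∣-≤ ℝ-ordered em ≤-refl close) y<Y)))
        (≤-reflexive (sym (Basics.#-* ℝ-ordered em B′ Y)))))
        where
        ∣∣-cong-≤′ : ∀ {u v} → u ≈ v → ∣ u ∣ᶠ ≤ᶠ ∣ v ∣ᶠ
        ∣∣-cong-≤′ eq = ≤-reflexive (∣∣-cong eq)

      power≤1 : ∀ b .{{_ : ℕ.NonZero b}} → power-of b 99 ≤ᶠ # 1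
      power≤1 b = ≤-trans (≤-trans (≤-reflexive (sym (*1≈ _))) (*-monoˡ-≤ (0<⇒0≤ (0<power b 99)) (1≤-^ 100 (1≤# (nonZero⇒1≤ b))))) (≤-reflexive (#-power b 99))

      Approximated : ℝ → ℤ × ℕ → Set
      Approximated l (a , b) = Σ[ nz ∈ ℕ.NonZero b ] let instance _ = nz; d = ∣ y - ι (a ℚ./ b) ∣ in 0ℝ < d × ∃[ c ] IsPower b (- l) c × d < c

      Exponent : ℝ → Set
      Exponent l = 0ℝ < l × Infinitely {ℤ × ℕ} (Approximated l)

      finitely-many : ∀ {l} → ι (+ 100 ℚ./ 1) ≤ᶠ l → ∀ ab → Approximated l ab → ab ∈ small-fractions
      finitely-many {l} 100≤l (a , b) (nz , 0<d , c , is-power , d<c) = cases (ℕₚ.<-≤-connex b B′)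
        where
        instance _ = nz
        d≤ : ∣ y - ι (a ℚ./ b) ∣ᶠ ≤ᶠ power-of b 99
        d≤ = ≤-trans (≤-reflexive (sym (∣∣-agree _))) (≤-trans (<⇒≤ (<-to d<c)) (≤-to (power-beyond-100 b 100≤l is-power)))
        cases : b ℕ.< B′ ⊎ B′ ℕ.≤ b → (a , b) ∈ small-fractions
        cases (inj₁ b<B′) = ∈-cartesianProduct⁺ (∈-integers (B′ ℕ.* Y) a (numerator-bound a b b<B′ (≤-trans d≤ (power≤1 b)))) (∈-upTo⁺ b<B′)
        cases (inj₂ B′≤b) = ⊥-elim (<⇒≱ (far-fraction a b (ℕₚ.m⊔n≤o⇒m≤o 2 B B′≤b) (ℕₚ.m⊔n≤o⇒n≤o 2 B B′≤b)) d≤)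

      exponents≤100 : ∀ l → Exponent l → l ≤ᶠ ι (+ 100 ℚ./ 1)
      exponents≤100 l (_ , infinitely) = [ (λ p → p) , (λ 100≤l → case infinitely small-fractions of λ { (ab , ∉ , app) → ⊥-elim (∉ (finitely-many 100≤l ab app)) }) ]′
        (≤-total l (ι (+ 100 ℚ./ 1)))

    irrationality-exponent : ∃[ m ] IsIrrationalityExponent y m × m ≤± [ ι (+ 100 ℚ./ 1) ]
    irrationality-exponent = from em
      where
      from : Dec (∃ Exponent) → ∃[ m ] IsIrrationalityExponent y m × m ≤± [ ι (+ 100 ℚ./ 1) ]
      -- If there is no exponent at all, the supremum of the empty set in the extended reals is the
      -- bottom element.
      from (no none) = ⊥± , ((λ l e → ⊥-elim (none (l , e))) , λ u _ → ⊥±≤ u) , ⊥±≤ [ ι (+ 100 ℚ./ 1) ]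
      from (yes (l , e)) = case supremum {Exponent} e exponents≤100 of λ { (s , upper , least) →
        [ s ] , ((λ x ex → [ ≤-from (upper x ex) ]≤) , λ u above → bound s least u above (above l e)) , [ ≤-from (least _ exponents≤100) ]≤ }
        where
        bound : ∀ s → (∀ u → (∀ x → Exponent x → x ≤ᶠ u) → s ≤ᶠ u) → ∀ u → (∀ x → Exponent x → [ x ] ≤± u) → [ l ] ≤± u → [ s ] ≤± u
        bound s least ⊥± above Supremum.[ () ]
        bound s least [ u ] above _ = [ ≤-from (least u λ x ex → ≤-to (unwrap (above x ex))) ]≤
          where
          unwrap : ∀ {x y} → [ x ] ≤± [ y ] → x ≤ y
          unwrap [ p ]≤ = p
        bound s least ⊤± above _ = [ s ]≤⊤±

  -- Open intervals

  below-up : ∀ a {x y} → a <± [ x ] → x ≤ᶠ y → a <± [ y ]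
  below-up ⊥± {y = y} p q = ⊥±<[ y ]
  below-up [ a ] [ p ]< q = [ <-from (<-≤-trans (<-to p) q) ]<
  below-up ⊤± ()

  above-down : ∀ b {x y} → [ y ] <± b → x ≤ᶠ y → [ x ] <± b
  above-down [ b ] [ p ]< q = [ <-from (≤-<-trans q (<-to p)) ]<
  above-down ⊤± {x = x} p q = [ x ]<⊤±

  below-open : ∀ a {x} → a <± [ x ] → ∃ λ ρ → 0< ρ × (∀ y → x - ρ ≤ᶠ y → a <± [ y ])
  below-open ⊥± p = # 1 , 0<1 , λ y _ → ⊥±<[ y ]
  below-open [ a ] {x} [ p ]< = case halve (<-to p) of λ { (ρ , 0<ρ , eq) → ρ , 0<ρ , λ y q →
    [ <-from (<-≤-trans (by< (a ∷ x ∷ ρ ∷ []) (λ a x r → r :+ (x :- a :- (r :+ r)) ⊢ a :≤ x :- r) (0<ρ <⊹ ≤-reflexive eq)) q) ]< }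
  below-open ⊤± ()

  above-open : ∀ b {x} → [ x ] <± b → ∃ λ ρ → 0< ρ × (∀ y → y ≤ᶠ x + ρ → [ y ] <± b)
  above-open [ b ] {x} [ p ]< = case halve (<-to p) of λ { (ρ , 0<ρ , eq) → ρ , 0<ρ , λ y q →
    [ <-from (≤-<-trans q (by< (b ∷ x ∷ ρ ∷ []) (λ b x r → r :+ (b :- x :- (r :+ r)) ⊢ x :+ r :≤ b) (0<ρ <⊹ ≤-reflexive eq))) ]< }
  above-open ⊤± p = # 1 , 0<1 , λ y _ → [ y ]<⊤±

  points-cong : ∀ I {x y} → x ≈ y → Points I x → Points I y
  points-cong ⟨ a , b ⟩ eq (p , q) = below-up a p (≤-reflexive eq) , above-down b q (≤-reflexive (sym eq))

  points-convex : ∀ I {x y z} → Points I x → Points I y → x ≤ᶠ z → z ≤ᶠ y → Points I z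
  points-convex ⟨ a , b ⟩ (p , _) (_ , q) r s = below-up a p r , above-down b q s

  points-open : ∀ I {x} → Points I x → ∃ λ ρ → 0< ρ × (∀ s → ∣ s ∣ᶠ ≤ᶠ ρ → Points I (x + s))
  points-open ⟨ a , b ⟩ {x} (p , q) = case below-open a p of λ { (ρ₁ , 0<ρ₁ , f) → case above-open b q of λ { (ρ₂ , 0<ρ₂ , g) →
    case Basics.≤-total ℝ-ordered em ρ₁ ρ₂ of λ
      { (inj₁ r) → ρ₁ , 0<ρ₁ , λ s t → f (x + s) (left ρ₁ s t) , g (x + s) (≤-trans (right ρ₁ s t) (Basics.+-monoˡ-≤ ℝ-ordered em r))
      ; (inj₂ r) → ρ₂ , 0<ρ₂ , λ s t → f (x + s) (≤-trans (by (x ∷ ρ₁ ∷ ρ₂ ∷ []) (λ x a b → a :- b ⊢ x :- a :≤ x :- b) r) (left ρ₂ s t)) , g (x + s) (right ρ₂ s t) } } }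
    where
    left : ∀ ρ s → ∣ s ∣ᶠ ≤ᶠ ρ → x - ρ ≤ᶠ x + s
    left ρ s t = by (x ∷ ρ ∷ s ∷ ∣ s ∣ᶠ ∷ []) (λ x r s a → (r :- a) :+ (a :- :- s) ⊢ x :- r :≤ x :+ s) (t ⊹ -x≤∣x∣ s)
    right : ∀ ρ s → ∣ s ∣ᶠ ≤ᶠ ρ → x + s ≤ᶠ x + ρ
    right ρ s t = Basics.+-monoˡ-≤ ℝ-ordered em (≤-trans (x≤∣x∣ s) t)

  -- The theorem for an analytic function on an interval

  sum≈∑ : ∀ n (f : ℕ → ℝ) → sum {n} (λ i → f (toℕ i)) ≈ ∑ n f
  sum≈∑ zero f = sym #0
  sum≈∑ (suc n) f = +-congˡ (sum≈∑ n (λ i → f (suc i)))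

  eval≈ev : ∀ n (a : ℕ → ℝ) x → eval {n} (λ i → a (toℕ i)) x ≈ ev n a x
  eval≈ev n a x = trans (sum≈∑ n (λ i → a i * x ^ i)) (trans (∑-cong n λ i _ → *-congˡ (^-agree x i)) (sym (ev-∑^ n a x)))

  module _ (I : OpenInterval) (f : RealFunction I) (analytic : RealAnalytic I f) (¬rational : ¬ RationalWithoutPoles I f) where

    private
      U : ℝ → Set
      U = Points I

      -- The construction works with a function on the whole field, so f is extended by 0. The
      -- choice of the membership proof is immaterial, since f respects equality of points.
      extend : ∀ x → Dec (U x) → ℝ
      extend x (yes p) = Func.to f (x , p)
      extend x (no _) = # 0

      f̂ : ℝ → ℝ
      f̂ x = extend x em

      extend-cong : ∀ {x y} → x ≈ y → ∀ (d : Dec (U x)) (e : Dec (U y)) → extend x d ≈ extend y e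
      extend-cong eq (yes p) (yes q) = Func.cong f eq
      extend-cong eq (yes p) (no q) = ⊥-elim (q (points-cong I eq p))
      extend-cong eq (no p) (yes q) = ⊥-elim (p (points-cong I (sym eq) q))
      extend-cong eq (no p) (no q) = refl

      f̂-cong : ∀ {x y} → x ≈ y → f̂ x ≈ f̂ y
      f̂-cong eq = extend-cong eq em em

      f̂-value : ∀ x (p : U x) → f̂ x ≈ Func.to f (x , p)
      f̂-value x p = extend-cong (refl {x}) em (yes p)

      germ : ∀ {c} → U c → ∃ λ a → Germ a (λ s → f̂ (c + s))
      -- Convergence is given strictly inside r, whereas a germ needs a closed disc; hence the half
      -- of r, reduced further to a radius on which c + s stays in the interval.
      germ {c} Uc = case analytic c Uc of λ { (a , r , 0<r , conv) → case points-open I Uc of λ { (ρ₁ , 0<ρ₁ , inside) → case halve (0<-to 0<r) of λ { (r₂ , 0<r₂ , eq) →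
        case Basics.≤-total ℝ-ordered em ρ₁ r₂ of λ
          { (inj₁ le) → a , germ-convergent 0<ρ₁ (converge a r conv r₂ 0<r₂ eq ρ₁ inside ρ₁ ≤-refl le)
          ; (inj₂ ge) → a , germ-convergent 0<r₂ (converge a r conv r₂ 0<r₂ eq ρ₁ inside r₂ ge ≤-refl) } } } }
        where
        converge : ∀ a r → (∀ x (x∈U : U x) → ∣ x - c ∣ < r → (λ n → eval {n} (λ i → a (toℕ i)) (x - c)) converges-to Func.to f (x , x∈U)) →
          ∀ r₂ → 0< r₂ → r₂ + r₂ ≈ r → ∀ ρ₁ → (∀ s → ∣ s ∣ᶠ ≤ᶠ ρ₁ → U (c + s)) → ∀ ρ → ρ ≤ᶠ ρ₁ → ρ ≤ᶠ r₂ →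
          ∀ s → ∣ s ∣ᶠ ≤ᶠ ρ → ∀ ε → 0< ε → ∃ λ N → ∀ n → N ℕ.≤ n → ∣ f̂ (c + s) - ev n a s ∣ᶠ ≤ᶠ ε
        converge a r conv r₂ 0<r₂ eq ρ₁ inside ρ ρ≤ρ₁ ρ≤r₂ s s≤ρ ε 0<ε =
          case conv (c + s) Ux (<-from (≤-<-trans (≤-reflexive (trans (∣∣-agree _) (∣∣-cong x-c≈s))) (≤-<-trans (≤-trans s≤ρ ρ≤r₂)
              (<-≤-trans (by< (r₂ ∷ []) (λ r → r ⊢ r :≤ r :+ r) 0<r₂) (≤-reflexive eq))))) ε (0<-from 0<ε) of λ { (N , close) → N , λ n N≤n →
            ≤-trans (≤-reflexive (trans (∣∣-cong (trans (ring! (f̂ (c + s) ∷ ev n a s ∷ []) λ f e → f :- e := :- (e :- f))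
                (-‿cong (+-cong (trans (ev-congʳ n a (sym x-c≈s)) (sym (eval≈ev n a (c + s - c)))) (-‿cong (f̂-value (c + s) Ux))))))
              (trans (∣-∣ _) (sym (∣∣-agree _))))) (<⇒≤ (<-to (close n N≤n))) }
          where
          Ux : U (c + s)
          Ux = inside s (≤-trans s≤ρ ρ≤ρ₁)
          x-c≈s : c + s - c ≈ s
          x-c≈s = ring! (c ∷ s ∷ []) λ c s → c :+ s :- c := s

      not-rational : ¬ Continuation.RationalOn U f̂ f̂-cong (points-cong I) (points-convex I) (points-open I) germ
      not-rational (D , E , q , p , h) = ¬rational (E , D , (λ i → p (toℕ i)) , (λ i → q (toℕ i)) , λ x x∈U →
        (λ z → proj₁ (h x x∈U) (trans (sym (eval≈ev D q x)) (trans z (sym #0))))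
        , trans (*-cong (sym (f̂-value x x∈U)) (eval≈ev D q x)) (trans (proj₂ (h x x∈U)) (sym (eval≈ev E p x))))

      module C = Core U f̂ f̂-cong (points-cong I) (points-convex I) (points-open I) germ not-rational

    Conclusion : (V : OpenInterval) → Points V ⊆ Points I → Set
    Conclusion V V⊆U = Σ[ ξ ∈ ℝ ] Σ[ ξ∈V ∈ Points V ξ ] let y = Func.to f (ξ , V⊆U {ξ} ξ∈V) in
      Liouville ξ × (∃[ m ] IsIrrationalityExponent y m × m ≤± [ ι (+ 100 ℚ./ 1) ]) × EventuallyFarFromRationals (ι (+ 100 ℚ./ 1)) y

    approximation : (V : OpenInterval) → Satisfiable (Points V) → (V⊆U : Points V ⊆ Points I) → Conclusion V V⊆U
    approximation V (x , x∈V) V⊆U = case points-open V x∈V of λ { (ρ , 0<ρ , inside) →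
        conclude ρ (x+ρ∈V ρ 0<ρ inside) (C.solution (V⊆U x∈V) 0<ρ (V⊆U (x+ρ∈V ρ 0<ρ inside))) }
      where
      x+ρ∈V : ∀ ρ → 0< ρ → (∀ s → ∣ s ∣ᶠ ≤ᶠ ρ → Points V (x + s)) → Points V (x + ρ)
      x+ρ∈V ρ 0<ρ inside = inside ρ (≤-reflexive (0≤⇒∣x∣≈x (0<⇒0≤ 0<ρ)))
      conclude : ∀ ρ → Points V (x + ρ) → C.Solution x ρ → Conclusion V V⊆U
      conclude ρ x+ρ∈V solution = ξ , ξ∈V , liouville-from liouville , irrationality-exponent far , eventually-far far
        where
        open C.Solution solution
        ξ∈V : Points V ξ
        ξ∈V = points-convex V x∈V x+ρ∈V c≤ξ ξ≤c+ρ
        far : Far (Func.to f (ξ , V⊆U {ξ} ξ∈V)) b₀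
        far a b i p q = ≤-trans (far-from a b i p q) (≤-reflexive (*-congʳ (∣∣-cong (+-congʳ (*-congˡ (f̂-value ξ (V⊆U {ξ} ξ∈V)))))))

open import Defs
open import Data.Integer.Base using (+_)
open import Data.Product.Base using (∃-syntax; _,_)
open import Data.Rational.Base using (_/_; 0ℚ; 1ℚ)
import Data.Rational.Properties as ℚₚ
open import Relation.Nullary.Decidable.Core using (from-yes)

theorem1p2 :
  ExcludedMiddle 0ℓ →
  (∃[ τ ] ι (+ 2 / 1) < τ × ApproximationProperty τ) ×
  ApproximationProperty (ι (+ 100 / 1))
theorem1p2 em = (ι (+ 100 / 1) , 2<100 , approximation-100) , approximation-100
  where
  approximation-100 : ApproximationProperty (ι (+ 100 / 1))
  approximation-100 U f analytic ¬rational V nonempty V⊆U = Interface.approximation em U f analytic ¬rational V nonempty V⊆U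

  2<100 : ι (+ 2 / 1) < ι (+ 100 / 1)
  2<100 = mk< 1ℚ (from-yes (0ℚ ℚₚ.<? 1ℚ)) (0 , λ _ _ → from-yes ((+ 3 / 1) ℚₚ.<? (+ 100 / 1)))
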